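{- Let $\ell\ge 3$ be a prime and write the $\ell$-th classical modular polynomial as $$\Phi_\ell(X,Y)=X^{\ell+1}+Y^{\ell+1}+\sum_{0\le m,n\le \ell}a_{m,n}X^mY^n,\qquad a_{m,n}\in\mathbb{Z}.$$ Let $j(z)=\sum_{i=-1}^\infty c_iq^i=q^{ -1}+744+196884q+\cdots$ (with $q=e^{2\pi i z}$) be the Fourier expansion of the modular invariant $j$. For an integer $0<m\le \ell$, let $\mathcal{P}(m)$ denote the set of tuples $(\lambda; r_1,\dots,r_\lambda; t_1,\dots,t_\lambda)$ with $\lambda\ge 1$, integers $0<r_1<\cdots<r_\lambda$ and integers $t_i\ge 1$ such that $t_1r_1+\cdots+t_\lambda r_\lambda=m$; for such a tuple put $u:=t_1+\cdots+t_\lambda-1$. Then: \begin{enumerate} \item[(i)] If $0<m<\ell$, then $$a_{\ell,\ell-m}=\sum_{\mathcal{P}(m)}(-1)^u\frac{u!}{t_1!\cdots t_\lambda!}\,\ell\binom{\ell-m+u}{u}c_{r_1-1}^{t_1}\cdots c_{r_\lambda-1}^{t_\lambda}.$$ \item[(ii)] If $m=\ell$, then $$a_{\ell,0}=-(\ell+1)c_0+\sum_{\mathcal{P}(\ell)}(-1)^u\frac{u!}{t_1!\cdots t_\lambda!}\,\ell\, c_{r_1-1}^{t_1}\cdots c_{r_\lambda-1}^{t_\lambda}.$$ \item[(iii)] For every $0<m\le \ell$ and every tuple in $\mathcal{P}(m)$, the number $\frac{u!}{t_1!\cdots t_\lambda!}\,\ell\binom{\ell-m+u}{u}$ is an integer.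 \end{enumerate}
   Context: The classical modular polynomial $\Phi_\ell(X,Y)\in\mathbb{Z}[X,Y]$ is the polynomial satisfying $\Phi_\ell(j(\ell z),j(z))=0$, giving a plane model of $X_0(\ell)$; it is symmetric ($a_{m,n}=a_{n,m}$) and has the stated shape with monic terms $X^{\ell+1}$, $Y^{\ell+1}$. -}

module Defs where

open import Data.Bool.Base using (Bool; true; false; if_then_else_; _∧_)
open import Data.Nat.Base as ℕ using (ℕ; zero; suc; _∸_; _<ᵇ_; _≡ᵇ_; _!; NonZero)
open import Data.Nat.Properties using (_!≢0; m*n≢0)
open import Data.Nat.Divisibility using (_∣?_)
open import Data.Integer.Base as ℤ using (ℤ; +_; -_)
open import Data.List.Base using (List; []; _∷_; map; concatMap; upTo; filterᵇ; foldr)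
open import Data.Vec.Base as Vec using (Vec; []; _∷_)
open import Data.Product.Base using (Σ; _×_; _,_)
open import Relation.Binary.PropositionalEquality using (_≡_)
open import Relation.Nullary.Decidable.Core using (does)
open import Data.Rational.Base as ℚ using (ℚ)

-- Formal power series with integer coefficients: ℕ → ℤ
-- (f k = coefficient of q^k).

PS : Set
PS = ℕ → ℤ

sumBelow : ℕ → (ℕ → ℤ) → ℤ
sumBelow zero    f = + 0
sumBelow (suc n) f = sumBelow n f ℤ.+ f n

onePS : PS
onePS zero    = + 1
onePS (suc _) = + 0

mulPS : PS → PS → PS
mulPS f g k = sumBelow (suc k) (λ i → f i ℤ.* g (k ∸ i))

powPS : PS → ℕ → PS
powPS f zero    = onePS
powPS f (suc n) = mulPS f (powPS f n)

shiftPS : ℕ → PS → PS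
shiftPS s f k = if k <ᵇ s then + 0 else f (k ∸ s)

-- substitution q ↦ q^ℓ   (for ℓ ≥ 1): coefficient k is f (k/ℓ) if ℓ ∣ k, else 0
dilPS : ℕ → PS → PS
dilPS ℓ f k = sumBelow (suc k) (λ i → if (i ℕ.* ℓ) ≡ᵇ k then f i else + 0)

-- The q-expansion of j.
-- E₄ = 1 + 240 Σ σ₃(n) qⁿ,  Δ = q ∏_{n≥1} (1 - qⁿ)²⁴,  j = E₄³ / Δ.
-- Hence q·j = E₄³ · (∏_{n≥1} 1/(1 - qⁿ))²⁴.

σ₃ : ℕ → ℤ
σ₃ n = sumBelow (suc n) (λ d → if does (d ∣? n) ∧ (0 <ᵇ d) then + (d ℕ.* d ℕ.* d) else + 0)

E₄ : PS
E₄ zero    = + 1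
E₄ (suc k) = + 240 ℤ.* σ₃ (suc k)

-- 1/(1 - qⁿ) = Σ_j q^{n j}   (n ≥ 1)
geomPS : ℕ → PS
geomPS n k = if does (n ∣? k) then + 1 else + 0

finPartProd : ℕ → PS
finPartProd zero    = onePS
finPartProd (suc N) = mulPS (geomPS (suc N)) (finPartProd N)

-- ∏_{n≥1} 1/(1 - qⁿ): the coefficient of q^k only involves the factors n ≤ k
partPS : PS
partPS k = finPartProd k k

-- Jq k = coefficient of q^k in q·j(q), i.e.  Jq k = c_{k-1}  in the
-- notation j = Σ_{i ≥ -1} c_i q^i   (so Jq 0 = c_{-1} = 1, Jq 1 = c_0 = 744).
Jq : PS
Jq = mulPS (powPS E₄ 3) (powPS partPS 24)

c′ : ℕ → ℤ
c′ = Jq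

-- Modular polynomial, via its defining property.
-- a m n (for m, n ≤ ℓ) are the coefficients a_{m,n}; the polynomial is
--   Φ(X,Y) = X^{ℓ+1} + Y^{ℓ+1} + Σ_{0≤m,n≤ℓ} a_{m,n} X^m Y^n.
-- Φ(j(ℓz), j(z)) = 0 as a q-expansion.  Since j(q) = q⁻¹·Jq(q) and
-- j(q^ℓ) = q^{-ℓ}·Jq(q^ℓ), multiplying by q^{ℓ(ℓ+1)} the monomial X^m Y^n
-- becomes q^{ℓ(ℓ+1) - (ℓ m + n)} · Jq(q^ℓ)^m · Jq(q)^n  (a power series).

monoPS : ℕ → ℕ → ℕ → PS
monoPS ℓ m n = shiftPS (ℓ ℕ.* suc ℓ ∸ (ℓ ℕ.* m ℕ.+ n))
                       (mulPS (powPS (dilPS ℓ Jq) m) (powPS Jq n))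

evalΦ : ℕ → (ℕ → ℕ → ℤ) → PS
evalΦ ℓ a k =
  monoPS ℓ (suc ℓ) 0 k ℤ.+ monoPS ℓ 0 (suc ℓ) k ℤ.+
  sumBelow (suc ℓ) (λ m → sumBelow (suc ℓ) (λ n → a m n ℤ.* monoPS ℓ m n k))

IsModularPolynomial : ℕ → (ℕ → ℕ → ℤ) → Set
IsModularPolynomial ℓ a = ∀ k → evalΦ ℓ a k ≡ + 0

Tuple : Set
Tuple = Σ ℕ (λ n → Vec ℕ n × Vec ℕ n)

incFrom : ∀ {n} → ℕ → Vec ℕ n → Bool
incFrom p []       = true
incFrom p (x ∷ xs) = (p <ᵇ x) ∧ incFrom x xs

allPos : ∀ {n} → Vec ℕ n → Bool
allPos []       = true
allPos (x ∷ xs) = (0 <ᵇ x) ∧ allPos xs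

weight : ∀ {n} → Vec ℕ n → Vec ℕ n → ℕ
weight r t = Vec.sum (Vec.zipWith ℕ._*_ t r)

inP : ℕ → Tuple → Bool
inP m (n , r , t) = (0 <ᵇ n) ∧ incFrom 0 r ∧ allPos t ∧ (weight r t ≡ᵇ m)

boxVecs : (n b : ℕ) → List (Vec ℕ n)
boxVecs zero    b = [] ∷ []
boxVecs (suc n) b = concatMap (λ x → map (x ∷_) (boxVecs n b)) (map suc (upTo b))

-- every tuple of 𝒫(m) has λ ≤ m, rᵢ ≤ m, tᵢ ≤ m; so 𝒫(m) (listed once each)
-- is the filter of this finite box by inP m.
𝒫 : ℕ → List Tuple
𝒫 m = filterᵇ (inP m)
  (concatMap (λ n → concatMap (λ r → map (λ t → (n , r , t)) (boxVecs n m)) (boxVecs n m))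
             (map suc (upTo m)))

uOf : Tuple → ℕ
uOf (n , r , t) = Vec.sum t ∸ 1

factProd : ∀ {n} → Vec ℕ n → ℕ
factProd []       = 1
factProd (x ∷ xs) = x ! ℕ.* factProd xs

factProd≢0 : ∀ {n} (t : Vec ℕ n) → NonZero (factProd t)
factProd≢0 []       = _
factProd≢0 (x ∷ xs) = m*n≢0 (x !) (factProd xs) {{x !≢0}} {{factProd≢0 xs}}

tFact : Tuple → ℕ
tFact (n , r , t) = factProd t

tFact≢0 : (τ : Tuple) → NonZero (tFact τ)
tFact≢0 (n , r , t) = factProd≢0 t

_/tFact_ : ℤ → Tuple → ℚ
z /tFact τ = ℚ._/_ z (tFact τ) {{tFact≢0 τ}}

cProd : Tuple → ℤ
cProd (n , r , t) = Vec.foldr _ ℤ._*_ (+ 1) (Vec.zipWith (λ rᵢ tᵢ → c′ rᵢ ℤ.^ tᵢ) r t)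

sgn : ℕ → ℤ
sgn u = ℤ.-1ℤ ℤ.^ u

sumℚ : {A : Set} → List A → (A → ℚ) → ℚ
sumℚ xs f = foldr (λ x acc → f x ℚ.+ acc) ℚ.0ℚ xs

{-# OPTIONS --safe #-}
module Submission where

open import Algebra.Bundles using (CommutativeRing)
import Algebra.Properties.CommutativeSemiring.Exp
import Algebra.Properties.Ring
import Algebra.Properties.Semiring.Exp
import Algebra.Solver.Ring
import Algebra.Solver.Ring.AlmostCommutativeRing as ACR
open import Algebra.Structures using (IsCommutativeRing)
open import Data.Bool.Base using (Bool; true; false; if_then_else_; _∧_) renaming (T to IsTrue)
open import Data.Bool.Properties using (∧-zeroʳ)
open import Data.Integer.Base as ℤ using (ℤ; +_)
import Data.Integer.Properties as ℤP
open import Data.List.Base using (List; []; _∷_; _++_; map; concatMap; applyUpTo; upTo; foldr; filterᵇ)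
open import Data.List.Membership.Propositional using (_∈_)
open import Data.List.Membership.Propositional.Properties using (∈-filter⁻)
open import Data.List.Relation.Unary.Any using (here; there)
open import Data.Maybe.Base using (Maybe; just; nothing)
open import Data.Nat.Base as ℕ using (ℕ; zero; suc; _∸_; _≤_; _<_; _!; z≤n; s≤s)
open import Data.Nat.Combinatorics using (_C_; nCn≡1; nCk≡nC[n∸k]; nCk+nC[k+1]≡[n+1]C[k+1]; k>n⇒nCk≡0; nCk≡n!/k![n-k]!; k![n∸k]!∣n!)
open import Data.Nat.Divisibility using (_∣_; _∣?_; divides; quotient; _∣0; ∣⇒≤; ∣-refl; ∣-reflexive; ∣-trans; ∣m+n∣m⇒∣n; ∣m∣n⇒∣m+n; ∣m⇒∣m*n; m∣m*n; *-monoˡ-∣; *-cancelˡ-∣; m∣n⇒n≡quotient*m; n/m≡quotient; m≤n⇒m!∣n!)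
open import Data.Nat.DivMod using (m/n*n≡m)
open import Data.Nat.Primality using (Prime)
import Data.Nat.Properties as ℕP
open import Data.Nat.Properties using (_!≢0)
import Data.Nat.Solver
open import Data.Product.Base using (_×_; _,_; proj₁; proj₂; ∃)
open import Data.Rational.Base as ℚ using (ℚ)
import Data.Rational.Properties as ℚP
import Data.Rational.Unnormalised.Base as ℚᵘ
import Data.Rational.Unnormalised.Properties as ℚᵘP
open import Data.Sum.Base using (_⊎_; inj₁; inj₂)
open import Data.Unit.Base using (tt)
open import Data.Vec.Base as Vec using (Vec; []; _∷_)
open import Defs
open import Function.Base using (_∘_; id; case_of_; _⟨_⟩_)
open import Function.Bundles using (mk⇔)
open import Level using (0ℓ)
open import Relation.Binary.Definitions using (tri<; tri≈; tri>)
open import Relation.Binary.PropositionalEquality as ≡ using (_≡_; _≢_)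
import Relation.Binary.Reasoning.Setoid
open import Relation.Nullary using (Dec; yes; no; ¬_; contradiction)
open import Relation.Nullary.Decidable using (T?; does; dec-true; dec-false; does-⇔; decidable-stable)

-- Write K = j(ℓz) and J = j(z), with j = h/q.  Modulo q^{ℓ+1}, the equation Φ(K, J) = 0 divided by K^ℓ involves only
-- the coefficients a_{ℓ,n} and A = a_{ℓ-1,ℓ}.  Pairing it with the residues against powers of J (Lagrange inversion)
-- gives N a_{ℓ,N} = -ℓ [q^{ℓ-N}] h^{-N} for N > 0 and a_{ℓ,0} = -c₀ - A + [q^ℓ] θh/h, where θ = q d/dq; the negative
-- binomial series in h - 1 and the multinomial theorem turn these into the sums over 𝒫.
--
-- It remains to see that A = 744 ℓ, although Φ is not assumed symmetric.  By Ramanujan's equations j satisfies a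
-- third-order differential equation, invariant under z ↦ ℓz.  Differentiating along the curve, this is the vanishing at
-- (K, J) of a polynomial Σ in the two coordinates.  The curve has a second place over X = ∞, with X = q⁻¹ and
-- Y = q^{-ℓ}(1 - A q + ⋯), and a polynomial that vanishes at one place vanishes at the other, because K is not a
-- polynomial in J.  At the second place the leading coefficient of Σ is 72 ℓ (744 ℓ - A).

-- Only the vanishing of Φ at (K, J) is given, so irreducibility of the curve cannot be quoted when
-- passing to the second place. What replaces it: a polynomial is reduced by Φ = 0 to degree at most
-- ℓ in Y, and then the pole orders iℓ + n of X^i Y^n at (K, J) collide only for X^(i+1) and X^i
-- Y^ℓ. The second place, with orders i + nℓ, separates these pairs, so a polynomial that vanishes
-- at (K, J) and has no pole at the second place reduces to zero. Any other polynomial is first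
-- multiplied by a power of W = Y - ζ(X), where ζ makes W vanish to positive order at the second
-- place. That W is not identically zero there is where K must not be a polynomial in J.
--
-- The detour through a differential equation is needed because A enters row ℓ only at the order
-- q^ℓ, together with the unknown a_{ℓ,0}. Under a change of parameter the equation acquires a
-- defect N² times a factor that depends on the parameters alone. The defects of the two functions
-- cancel in Σ, so Σ can be computed with a derivation on polynomials in X and Y.

record ℤAlgebra : Set₁ where
  field
    commutativeRing : CommutativeRing 0ℓ 0ℓ
  open CommutativeRing commutativeRing public
    hiding (zero)
  field
    con   : ℤ → Carrier
    con-+ : ∀ i j → con (i ℤ.+ j) ≈ con i + con j
    con-* : ∀ i j → con (i ℤ.* j) ≈ con i * con j
    con-- : ∀ i → con (ℤ.- i) ≈ - con i
    con-0 : con (+ 0) ≈ 0#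
    con-1 : con (+ 1) ≈ 1#

  almostCommutativeRing : ACR.AlmostCommutativeRing 0ℓ 0ℓ
  almostCommutativeRing = ACR.fromCommutativeRing commutativeRing

  con-morphism : CommutativeRing.rawRing ℤP.+-*-commutativeRing ACR.-Raw-AlmostCommutative⟶ almostCommutativeRing
  con-morphism = record
    { ⟦_⟧ = con ; +-homo = con-+ ; *-homo = con-* ; -‿homo = con-- ; 0-homo = con-0 ; 1-homo = con-1 }

  con-≟ : (i j : ℤ) → Maybe (con i ≈ con j)
  con-≟ i j with i ℤP.≟ j
  ... | yes eq = just (reflexive (≡.cong con eq))
  ... | no  _  = nothing

  module Solver = Algebra.Solver.Ring (CommutativeRing.rawRing ℤP.+-*-commutativeRing)
    almostCommutativeRing con-morphism con-≟

  module ≈-Reasoning = Relation.Binary.Reasoning.Setoid setoid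

  open Algebra.Properties.Ring ring public using (+-cancelʳ; -‿distribˡ-*; -‿distribʳ-*)
  open Algebra.Properties.Semiring.Exp semiring public
  open Algebra.Properties.CommutativeSemiring.Exp commutativeSemiring public using (^-distrib-*)

ℤ-algebra : ℤAlgebra
ℤ-algebra = record
  { commutativeRing = ℤP.+-*-commutativeRing
  ; con = id ; con-+ = λ _ _ → ≡.refl ; con-* = λ _ _ → ≡.refl ; con-- = λ _ → ≡.refl
  ; con-0 = ≡.refl ; con-1 = ≡.refl }

-- Finite sums and the ring of power series over ℤ.

module Sums (A : ℤAlgebra) where
  open ℤAlgebra A
  open ≈-Reasoning
  open Solver using (solve; _:=_; _:+_)

  ∑ : ℕ → (ℕ → Carrier) → Carrier
  ∑ zero    f = 0#
  ∑ (suc n) f = ∑ n f + f n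

  ∑-cong : ∀ n {f g} → (∀ i → i < n → f i ≈ g i) → ∑ n f ≈ ∑ n g
  ∑-cong zero    eq = refl
  ∑-cong (suc n) eq = +-cong (∑-cong n (λ i i<n → eq i (ℕP.m<n⇒m<1+n i<n))) (eq n ℕP.≤-refl)

  ∑-0 : ∀ n {f} → (∀ i → i < n → f i ≈ 0#) → ∑ n f ≈ 0#
  ∑-0 zero    eq = refl
  ∑-0 (suc n) eq = trans (+-cong (∑-0 n (λ i i<n → eq i (ℕP.m<n⇒m<1+n i<n))) (eq n ℕP.≤-refl)) (+-identityˡ _)

  ∑-+ : ∀ n f g → ∑ n (λ i → f i + g i) ≈ ∑ n f + ∑ n g
  ∑-+ zero    f g = sym (+-identityˡ _)
  ∑-+ (suc n) f g = trans (+-congʳ (∑-+ n f g))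
    (solve 4 (λ a b c d → (a :+ b) :+ (c :+ d) := (a :+ c) :+ (b :+ d)) (refl) _ _ _ _)

  *-∑ : ∀ n c f → c * ∑ n f ≈ ∑ n (λ i → c * f i)
  *-∑ zero    c f = zeroʳ c
  *-∑ (suc n) c f = trans (distribˡ c _ _) (+-congʳ (*-∑ n c f))

  ∑-* : ∀ n c f → ∑ n f * c ≈ ∑ n (λ i → f i * c)
  ∑-* zero    c f = zeroˡ c
  ∑-* (suc n) c f = trans (distribʳ c _ _) (+-congʳ (∑-* n c f))

  ∑-swap : ∀ m n (f : ℕ → ℕ → Carrier) → ∑ m (λ i → ∑ n (f i)) ≈ ∑ n (λ j → ∑ m (λ i → f i j))
  ∑-swap zero    n f = sym (∑-0 n {λ _ → 0#} (λ _ _ → refl))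
  ∑-swap (suc m) n f = trans (+-congʳ (∑-swap m n f)) (sym (∑-+ n (λ j → ∑ m (λ i → f i j)) (f m)))

  ∑-head : ∀ n f → ∑ (suc n) f ≈ f 0 + ∑ n (λ i → f (suc i))
  ∑-head zero    f = +-comm _ _
  ∑-head (suc n) f = trans (+-congʳ (∑-head n f)) (+-assoc _ _ _)

  ∑-single : ∀ n j {f} → j < n → (∀ i → i < n → i ≢ j → f i ≈ 0#) → ∑ n f ≈ f j
  ∑-single (suc n) j {f} (s≤s j≤n) eq with j ℕP.≟ n
  ... | yes ≡.refl = trans (+-congʳ (∑-0 n (λ i i<n → eq i (ℕP.m<n⇒m<1+n i<n) (ℕP.<⇒≢ i<n)))) (+-identityˡ _)
  ... | no j≢n = trans (+-cong (∑-single n j (ℕP.≤∧≢⇒< j≤n j≢n) (λ i i<n → eq i (ℕP.m<n⇒m<1+n i<n)))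
                               (eq n ℕP.≤-refl (j≢n ∘ ≡.sym))) (+-identityʳ _)

  ∑-extend : ∀ n k {f} → (∀ i → n ≤ i → f i ≈ 0#) → ∑ (n ℕ.+ k) f ≈ ∑ n f
  ∑-extend n zero    {f} eq = reflexive (≡.cong (λ m → ∑ m f) (ℕP.+-identityʳ n))
  ∑-extend n (suc k) {f} eq = trans (reflexive (≡.cong (λ m → ∑ m f) (ℕP.+-suc n k)))
    (trans (+-cong (∑-extend n k eq) (eq _ (ℕP.m≤m+n n k))) (+-identityʳ _))

module ℤA = ℤAlgebra ℤ-algebra
open ℤAlgebra ℤ-algebra using () renaming (module Solver to ℤ-solver) public
open Sums ℤ-algebra using () renaming (∑ to ∑ℤ) public
module ∑ℤ = Sums ℤ-algebra

sumBelow≡∑ : ∀ n f → sumBelow n f ≡ ∑ℤ n f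
sumBelow≡∑ zero    f = ≡.refl
sumBelow≡∑ (suc n) f = ≡.cong (ℤ._+ f n) (sumBelow≡∑ n f)

tail : PS → PS
tail f k = f (suc k)

infix 4 _≋_
record _≋_ (f g : PS) : Set where
  constructor mk≋
  field at : ∀ k → f k ≡ g k
open _≋_ public

conPS : ℤ → PS
conPS c zero    = c
conPS c (suc _) = + 0

q : PS
q (suc zero) = + 1
q _          = + 0

-- Opaque, so that unification treats series arithmetic as injective.
infixl 7 _⊠_
infixl 6 _⊞_
infix  8 ⊟_
opaque
  _⊠_ : PS → PS → PS
  (f ⊠ g) k = ∑ℤ (suc k) (λ i → f i ℤ.* g (k ∸ i))

  _⊞_ : PS → PS → PS
  (f ⊞ g) k = f k ℤ.+ g k

  ⊟_ : PS → PS
  (⊟ f) k = ℤ.- f k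

  0PS : PS
  0PS _ = + 0

  θ : PS → PS
  θ f k = + k ℤ.* f k

  mulPS≡⊠ : ∀ f g k → mulPS f g k ≡ (f ⊠ g) k
  mulPS≡⊠ f g k = sumBelow≡∑ (suc k) (λ i → f i ℤ.* g (k ∸ i))

  ⊠-coefficient : ∀ f g k → (f ⊠ g) k ≡ ∑ℤ (suc k) (λ i → f i ℤ.* g (k ∸ i))
  ⊠-coefficient f g k = ≡.refl

  ⊞-coefficient : ∀ f g k → (f ⊞ g) k ≡ f k ℤ.+ g k
  ⊞-coefficient f g k = ≡.refl

  ⊟-coefficient : ∀ f k → (⊟ f) k ≡ ℤ.- f k
  ⊟-coefficient f k = ≡.refl

  0PS-coefficient : ∀ k → 0PS k ≡ + 0
  0PS-coefficient k = ≡.refl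

  θ-coefficient : ∀ f k → θ f k ≡ + k ℤ.* f k
  θ-coefficient f k = ≡.refl

  ⊠-0 : ∀ f g → (f ⊠ g) 0 ≡ f 0 ℤ.* g 0
  ⊠-0 f g = ℤP.+-identityˡ _

  ⊠-1 : ∀ f g → (f ⊠ g) 1 ≡ f 0 ℤ.* g 1 ℤ.+ f 1 ℤ.* g 0
  ⊠-1 f g = ≡.cong (ℤ._+ f 1 ℤ.* g 0) (ℤP.+-identityˡ (f 0 ℤ.* g 1))

  -- The decomposition f = f(0) + q · `tail f` on the level of coefficients. It reduces index
  -- `suc k` to index `k` for other series, so the ring laws follow by induction on the index with
  -- the series universally quantified.
  ⊠-suc : ∀ f g k → (f ⊠ g) (suc k) ≡ f 0 ℤ.* g (suc k) ℤ.+ (tail f ⊠ g) k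
  ⊠-suc f g k = ∑ℤ.∑-head (suc k) (λ i → f i ℤ.* g (suc k ∸ i))

  ⊠-sucʳ : ∀ f g k → (f ⊠ g) (suc k) ≡ (f ⊠ tail g) k ℤ.+ f (suc k) ℤ.* g 0
  ⊠-sucʳ f g k = ≡.cong₂ ℤ._+_
    (∑ℤ.∑-cong (suc k) (λ { i (s≤s i≤k) → ≡.cong (λ j → f i ℤ.* g j) (ℕP.+-∸-assoc 1 i≤k) }))
    (≡.cong (λ j → f (suc k) ℤ.* g j) (ℕP.n∸n≡0 k))

  ⊠-congˡ-below : ∀ k {f g g′} → (∀ i → i ≤ k → g i ≡ g′ i) → (f ⊠ g) k ≡ (f ⊠ g′) k
  ⊠-congˡ-below k {f} eq = ∑ℤ.∑-cong (suc k) (λ i _ → ≡.cong (f i ℤ.*_) (eq _ (ℕP.m∸n≤m k i)))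

  ⊠-congʳ-below : ∀ k {f f′ g} → (∀ i → i ≤ k → f i ≡ f′ i) → (f ⊠ g) k ≡ (f′ ⊠ g) k
  ⊠-congʳ-below k {g = g} eq = ∑ℤ.∑-cong (suc k) (λ { i (s≤s i≤k) → ≡.cong (ℤ._* g (k ∸ i)) (eq i i≤k) })

  scale : ℤ → PS → PS
  scale c f k = c ℤ.* f k

  private
    ⊠-comm′ : ∀ k f g → (f ⊠ g) k ≡ (g ⊠ f) k
    ⊠-comm′ zero    f g = ≡.cong (λ z → + 0 ℤ.+ z) (ℤP.*-comm (f 0) (g 0))
    ⊠-comm′ (suc k) f g = ≡.trans (⊠-suc f g k) (≡.trans
      (≡.cong₂ ℤ._+_ (ℤP.*-comm (f 0) (g (suc k))) (⊠-comm′ k (tail f) g))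
      (≡.trans (ℤP.+-comm _ ((g ⊠ tail f) k)) (≡.sym (⊠-sucʳ g f k))))

    ⊠-distribʳ′ : ∀ k f g h → ((g ⊞ h) ⊠ f) k ≡ (g ⊠ f) k ℤ.+ (h ⊠ f) k
    ⊠-distribʳ′ k f g h = ≡.trans (∑ℤ.∑-cong (suc k) (λ i _ → ℤP.*-distribʳ-+ (f (k ∸ i)) (g i) (h i)))
      (∑ℤ.∑-+ (suc k) (λ i → g i ℤ.* f (k ∸ i)) (λ i → h i ℤ.* f (k ∸ i)))

    ⊠-scale : ∀ k c f g → (scale c f ⊠ g) k ≡ c ℤ.* (f ⊠ g) k
    ⊠-scale k c f g = ≡.trans (∑ℤ.∑-cong (suc k) (λ i _ → ℤP.*-assoc c (f i) (g (k ∸ i))))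
      (≡.sym (∑ℤ.*-∑ (suc k) c (λ i → f i ℤ.* g (k ∸ i))))

    ⊠-assoc′ : ∀ k f g h → (f ⊠ g ⊠ h) k ≡ (f ⊠ (g ⊠ h)) k
    ⊠-assoc′ zero    f g h = solve 3 (λ f g h → con (+ 0) :+ (con (+ 0) :+ f :* g) :* h := con (+ 0) :+ f :* (con (+ 0) :+ g :* h))
      ≡.refl (f 0) (g 0) (h 0)
      where open ℤ-solver using (solve; _:=_; _:+_; _:*_; con)
    ⊠-assoc′ (suc k) f g h = begin
      (f ⊠ g ⊠ h) (suc k)
        ≡⟨ ⊠-suc (f ⊠ g) h k ⟩
      (f ⊠ g) 0 ℤ.* h (suc k) ℤ.+ (tail (f ⊠ g) ⊠ h) k
        ≡⟨ ≡.cong₂ (λ x y → x ℤ.* h (suc k) ℤ.+ y) (⊠-0 f g)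
            (⊠-congʳ-below k {tail (f ⊠ g)} {scale (f 0) (tail g) ⊞ tail f ⊠ g} {h} (λ i _ → ⊠-suc f g i)) ⟩
      f 0 ℤ.* g 0 ℤ.* h (suc k) ℤ.+ ((scale (f 0) (tail g) ⊞ tail f ⊠ g) ⊠ h) k
        ≡⟨ ≡.cong (λ y → f 0 ℤ.* g 0 ℤ.* h (suc k) ℤ.+ y)
            (≡.trans (⊠-distribʳ′ k h (scale (f 0) (tail g)) (tail f ⊠ g))
                     (≡.cong₂ ℤ._+_ (⊠-scale k (f 0) (tail g) h) (⊠-assoc′ k (tail f) g h))) ⟩
      f 0 ℤ.* g 0 ℤ.* h (suc k) ℤ.+ (f 0 ℤ.* (tail g ⊠ h) k ℤ.+ (tail f ⊠ (g ⊠ h)) k)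
        ≡⟨ solve 5 (λ a b c d e → a :* b :* c :+ (a :* d :+ e) := a :* (b :* c :+ d) :+ e) ≡.refl
            (f 0) (g 0) (h (suc k)) ((tail g ⊠ h) k) ((tail f ⊠ (g ⊠ h)) k) ⟩
      f 0 ℤ.* (g 0 ℤ.* h (suc k) ℤ.+ (tail g ⊠ h) k) ℤ.+ (tail f ⊠ (g ⊠ h)) k
        ≡⟨ ≡.cong (λ y → f 0 ℤ.* y ℤ.+ (tail f ⊠ (g ⊠ h)) k) (⊠-suc g h k) ⟨
      f 0 ℤ.* (g ⊠ h) (suc k) ℤ.+ (tail f ⊠ (g ⊠ h)) k
        ≡⟨ ⊠-suc f (g ⊠ h) k ⟨
      (f ⊠ (g ⊠ h)) (suc k) ∎
      where
      open ≡.≡-Reasoning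
      open ℤ-solver using (solve; _:=_; _:+_; _:*_)

    ⊠-zeroˡ′ : ∀ k f → (0PS ⊠ f) k ≡ + 0
    ⊠-zeroˡ′ k f = ∑ℤ.∑-0 (suc k) {λ i → + 0 ℤ.* f (k ∸ i)} (λ i _ → ℤP.*-zeroˡ (f (k ∸ i)))

  con-⊠ : ∀ c f k → (conPS c ⊠ f) k ≡ c ℤ.* f k
  con-⊠ c f zero    = ⊠-0 (conPS c) f
  con-⊠ c f (suc k) = ≡.trans (⊠-suc (conPS c) f k)
    (≡.trans (≡.cong (λ z → c ℤ.* f (suc k) ℤ.+ z) (⊠-zeroˡ′ k f)) (ℤP.+-identityʳ (c ℤ.* f (suc k))))

  onePS≋con : onePS ≋ conPS (+ 1)
  onePS≋con = mk≋ λ { zero → ≡.refl ; (suc _) → ≡.refl }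

  private
    ≋-trans : ∀ {f g h} → f ≋ g → g ≋ h → f ≋ h
    ≋-trans p q = mk≋ λ k → ≡.trans (at p k) (at q k)

    ⊠-cong : ∀ {f f′ g g′} → f ≋ f′ → g ≋ g′ → f ⊠ g ≋ f′ ⊠ g′
    ⊠-cong {f} {f′} {g} {g′} eq eq′ = mk≋ λ k → ≡.trans (⊠-congʳ-below k {f} {f′} {g} (λ i _ → at eq i))
      (⊠-congˡ-below k {f′} {g} {g′} (λ i _ → at eq′ i))

    ⊠-identityˡ : ∀ f → onePS ⊠ f ≋ f
    ⊠-identityˡ f = mk≋ λ k → ≡.trans (⊠-congʳ-below k {onePS} {conPS (+ 1)} {f} (λ i _ → at onePS≋con i))
      (≡.trans (con-⊠ (+ 1) f k) (ℤP.*-identityˡ (f k)))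

    ⊠-comm : ∀ f g → f ⊠ g ≋ g ⊠ f
    ⊠-comm f g = mk≋ λ k → ⊠-comm′ k f g

  PS-isCommutativeRing : IsCommutativeRing _≋_ _⊞_ _⊠_ ⊟_ 0PS onePS
  PS-isCommutativeRing = record
    { isRing = record
      { +-isAbelianGroup = record
        { isGroup = record
          { isMonoid = record
            { isSemigroup = record
              { isMagma = record
                { isEquivalence = record
                  { refl = mk≋ λ _ → ≡.refl ; sym = λ p → mk≋ λ k → ≡.sym (at p k) ; trans = ≋-trans }
                ; ∙-cong = λ p q → mk≋ λ k → ≡.cong₂ ℤ._+_ (at p k) (at q k) }
              ; assoc = λ f g h → mk≋ λ k → ℤP.+-assoc (f k) (g k) (h k) }
            ; identity = (λ f → mk≋ λ k → ℤP.+-identityˡ (f k)) , (λ f → mk≋ λ k → ℤP.+-identityʳ (f k)) }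
          ; inverse = (λ f → mk≋ λ k → ℤP.+-inverseˡ (f k)) , (λ f → mk≋ λ k → ℤP.+-inverseʳ (f k))
          ; ⁻¹-cong = λ p → mk≋ λ k → ≡.cong ℤ.-_ (at p k) }
        ; comm = λ f g → mk≋ λ k → ℤP.+-comm (f k) (g k) }
      ; *-cong = ⊠-cong
      ; *-assoc = λ f g h → mk≋ λ k → ⊠-assoc′ k f g h
      ; *-identity = ⊠-identityˡ , (λ f → ≋-trans (⊠-comm f onePS) (⊠-identityˡ f))
      ; distrib = (λ f g h → ≋-trans (⊠-comm f (g ⊞ h)) (≋-trans (mk≋ λ k → ⊠-distribʳ′ k f g h)
                    (mk≋ λ k → ≡.cong₂ ℤ._+_ (⊠-comm′ k g f) (⊠-comm′ k h f))))
                , (λ f g h → mk≋ λ k → ⊠-distribʳ′ k f g h) }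
    ; *-comm = ⊠-comm }

  conPS-⊞ : ∀ i j → conPS (i ℤ.+ j) ≋ conPS i ⊞ conPS j
  conPS-⊞ i j = mk≋ λ { zero → ≡.refl ; (suc _) → ≡.refl }

  conPS-⊟ : ∀ i → conPS (ℤ.- i) ≋ ⊟ conPS i
  conPS-⊟ i = mk≋ λ { zero → ≡.refl ; (suc _) → ≡.refl }

  conPS-0 : conPS (+ 0) ≋ 0PS
  conPS-0 = mk≋ λ { zero → ≡.refl ; (suc _) → ≡.refl }

PS-algebra : ℤAlgebra
PS-algebra = record
  { commutativeRing = record { isCommutativeRing = PS-isCommutativeRing }
  ; con   = conPS
  ; con-+ = conPS-⊞
  ; con-* = λ { i j → mk≋ λ { zero → ≡.sym (con-⊠ i (conPS j) 0)
                           ; (suc k) → ≡.sym (≡.trans (con-⊠ i (conPS j) (suc k)) (ℤP.*-zeroʳ i)) } }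
  ; con-- = conPS-⊟
  ; con-0 = conPS-0
  ; con-1 = mk≋ λ { zero → ≡.refl ; (suc _) → ≡.refl }
  }

module 𝕊 = ℤAlgebra PS-algebra
module ∑𝕊 = Sums PS-algebra

mulPS≋⊠ : ∀ {f g f′ g′} → f ≋ f′ → g ≋ g′ → mulPS f g ≋ f′ ⊠ g′
mulPS≋⊠ {f} {g} p r = 𝕊.trans (mk≋ (mulPS≡⊠ f g)) (𝕊.*-cong p r)

powPS≋^ : ∀ f n → powPS f n ≋ f 𝕊.^ n
powPS≋^ f zero    = 𝕊.refl
powPS≋^ f (suc n) = mulPS≋⊠ 𝕊.refl (powPS≋^ f n)

∑𝕊-coefficient : ∀ n F k → ∑𝕊.∑ n F k ≡ ∑ℤ n (λ i → F i k)
∑𝕊-coefficient zero    F k = 0PS-coefficient k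
∑𝕊-coefficient (suc n) F k = ≡.trans (⊞-coefficient (∑𝕊.∑ n F) (F n) k) (≡.cong (ℤ._+ F n k) (∑𝕊-coefficient n F k))

q⊠-suc : ∀ f k → (q ⊠ f) (suc k) ≡ f k
q⊠-suc f k = ≡.trans (⊠-suc q f k) (≡.trans
  (≡.cong₂ ℤ._+_ (ℤP.*-zeroˡ (f (suc k)))
    (≡.trans (⊠-congʳ-below k {tail q} {onePS} {f} (λ { zero _ → ≡.refl ; (suc _) _ → ≡.refl })) (at (𝕊.*-identityˡ f) k)))
  (ℤP.+-identityˡ (f k)))

q⊠-0 : ∀ f → (q ⊠ f) 0 ≡ + 0
q⊠-0 f = ≡.trans (⊠-0 q f) (ℤP.*-zeroˡ (f 0))

shift≋ : ∀ n f → shiftPS n f ≋ q 𝕊.^ n ⊠ f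
shift≋ zero    f = 𝕊.sym (𝕊.*-identityˡ f)
shift≋ (suc n) f = 𝕊.trans shift-suc (𝕊.trans (𝕊.*-congˡ (shift≋ n f)) (𝕊.sym (𝕊.*-assoc q _ f)))
  where
  shift-suc : shiftPS (suc n) f ≋ q ⊠ shiftPS n f
  shift-suc = mk≋ λ { zero → ≡.sym (q⊠-0 (shiftPS n f)) ; (suc k) → ≡.sym (q⊠-suc (shiftPS n f) k) }

q^⊠-high : ∀ n f k → (q 𝕊.^ n ⊠ f) (n ℕ.+ k) ≡ f k
q^⊠-high n f k = ≡.trans (≡.sym (at (shift≋ n f) (n ℕ.+ k))) (go n)
  where
  go : ∀ n → shiftPS n f (n ℕ.+ k) ≡ f k
  go zero    = ≡.refl
  go (suc n) = go n

q^⊠-low : ∀ n f k → k < n → (q 𝕊.^ n ⊠ f) k ≡ + 0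
q^⊠-low n f k k<n = ≡.trans (≡.sym (at (shift≋ n f) k)) (go n k k<n)
  where
  go : ∀ n k → k < n → shiftPS n f k ≡ + 0
  go (suc n) zero    _         = ≡.refl
  go (suc n) (suc k) (s≤s k<n) = go n k k<n

q^-cancel : ∀ n {f g} → q 𝕊.^ n ⊠ f ≋ q 𝕊.^ n ⊠ g → f ≋ g
q^-cancel n {f} {g} eq = mk≋ λ k → ≡.trans (≡.sym (q^⊠-high n f k)) (≡.trans (at eq (n ℕ.+ k)) (q^⊠-high n g k))

opaque
  unfolding _⊠_

  θ-cong : ∀ {f g} → f ≋ g → θ f ≋ θ g
  θ-cong eq = mk≋ λ k → ≡.cong (+ k ℤ.*_) (at eq k)

  θ-⊞ : ∀ f g → θ (f ⊞ g) ≋ θ f ⊞ θ g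
  θ-⊞ f g = mk≋ λ k → ℤP.*-distribˡ-+ (+ k) (f k) (g k)

  θ-con : ∀ c → θ (conPS c) ≋ 0PS
  θ-con c = mk≋ λ { zero → ≡.refl ; (suc k) → ℤP.*-zeroʳ (+ suc k) }

  θ-⊟ : ∀ f → θ (⊟ f) ≋ ⊟ θ f
  θ-⊟ f = mk≋ λ k → ≡.sym (ℤP.neg-distribʳ-* (+ k) (f k))

  θ-⊠ : ∀ f g → θ (f ⊠ g) ≋ θ f ⊠ g ⊞ f ⊠ θ g
  θ-⊠ f g = mk≋ λ k → begin
    + k ℤ.* ∑ℤ (suc k) (λ i → f i ℤ.* g (k ∸ i))
      ≡⟨ ∑ℤ.*-∑ (suc k) (+ k) (λ i → f i ℤ.* g (k ∸ i)) ⟩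
    ∑ℤ (suc k) (λ i → + k ℤ.* (f i ℤ.* g (k ∸ i)))
      ≡⟨ ∑ℤ.∑-cong (suc k) (λ { i (s≤s i≤k) → step k i i≤k }) ⟩
    ∑ℤ (suc k) (λ i → (+ i ℤ.* f i) ℤ.* g (k ∸ i) ℤ.+ f i ℤ.* (+ (k ∸ i) ℤ.* g (k ∸ i)))
      ≡⟨ ∑ℤ.∑-+ (suc k) (λ i → (+ i ℤ.* f i) ℤ.* g (k ∸ i)) (λ i → f i ℤ.* (+ (k ∸ i) ℤ.* g (k ∸ i))) ⟩
    ∑ℤ (suc k) (λ i → θ f i ℤ.* g (k ∸ i)) ℤ.+ ∑ℤ (suc k) (λ i → f i ℤ.* θ g (k ∸ i)) ∎
    where
    open ≡.≡-Reasoning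
    open ℤ-solver using (solve; _:=_; _:+_; _:*_)
    step : ∀ k i → i ≤ k → + k ℤ.* (f i ℤ.* g (k ∸ i)) ≡ (+ i ℤ.* f i) ℤ.* g (k ∸ i) ℤ.+ f i ℤ.* (+ (k ∸ i) ℤ.* g (k ∸ i))
    step k i i≤k = ≡.trans (≡.cong (ℤ._* (f i ℤ.* g (k ∸ i))) (≡.trans (≡.cong +_ (≡.sym (ℕP.m+[n∸m]≡n i≤k))) (ℤP.pos-+ i (k ∸ i))))
      (solve 4 (λ i j x y → (i :+ j) :* (x :* y) := (i :* x) :* y :+ x :* (j :* y)) ≡.refl (+ i) (+ (k ∸ i)) (f i) (g (k ∸ i)))

θ-q^ : ∀ n → θ (q 𝕊.^ n) ≋ conPS (+ n) ⊠ q 𝕊.^ n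
θ-q^ zero    = 𝕊.trans (θ-cong (𝕊.sym 𝕊.con-1)) (𝕊.trans (θ-con (+ 1)) (𝕊.sym (𝕊.trans (𝕊.*-congʳ 𝕊.con-0) (𝕊.zeroˡ _))))
θ-q^ (suc n) = begin
  θ (q ⊠ q 𝕊.^ n)                                     ≈⟨ θ-⊠ q (q 𝕊.^ n) ⟩
  θ q ⊠ q 𝕊.^ n ⊞ q ⊠ θ (q 𝕊.^ n)                     ≈⟨ 𝕊.+-cong (𝕊.*-congʳ θq) (𝕊.*-congˡ (θ-q^ n)) ⟩
  q ⊠ q 𝕊.^ n ⊞ q ⊠ (conPS (+ n) ⊠ q 𝕊.^ n)           ≈⟨ S.solve 3 (λ q r c → q S.:* r S.:+ q S.:* (c S.:* r) S.:= (S.con (+ 1) S.:+ c) S.:* (q S.:* r)) 𝕊.refl q (q 𝕊.^ n) (conPS (+ n)) ⟩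
  (conPS (+ 1) ⊞ conPS (+ n)) ⊠ (q ⊠ q 𝕊.^ n)         ≈⟨ 𝕊.*-congʳ (𝕊.con-+ (+ 1) (+ n)) ⟨
  conPS (+ suc n) ⊠ (q ⊠ q 𝕊.^ n)                     ∎
  where
  open 𝕊.≈-Reasoning
  module S = 𝕊.Solver
  θq : θ q ≋ q
  θq = mk≋ λ { zero → θ-coefficient q 0 ; (suc zero) → θ-coefficient q 1
             ; (suc (suc k)) → ≡.trans (θ-coefficient q (suc (suc k))) (ℤP.*-zeroʳ (+ suc (suc k))) }

-- The ring solver proves identities but takes no hypotheses. A consequence of equations l = r is
-- therefore certified as ideal membership: a equals b plus multiples of the differences l - r,
-- which is again an identity. The cofactors `c` are the whole content of each use.
module LinearCombination (A : ℤAlgebra) where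
  open ℤAlgebra A

  vanish : ∀ {l r} c → l ≈ r → c * (l - r) ≈ 0#
  vanish {l} {r} c eq = trans (*-congˡ (trans (+-congʳ eq) (-‿inverseʳ r))) (zeroʳ c)

  modulo₁ : ∀ {a b l r} c → l ≈ r → a ≈ b + c * (l - r) → a ≈ b
  modulo₁ c eq p = trans p (trans (+-congˡ (vanish c eq)) (+-identityʳ _))

  modulo₂ : ∀ {a b l r l′ r′} c c′ → l ≈ r → l′ ≈ r′ → a ≈ b + c * (l - r) + c′ * (l′ - r′) → a ≈ b
  modulo₂ c c′ eq eq′ p = modulo₁ c eq (modulo₁ c′ eq′ p)

  modulo₃ : ∀ {a b l r l′ r′ l″ r″} c c′ c″ → l ≈ r → l′ ≈ r′ → l″ ≈ r″ →
            a ≈ b + c * (l - r) + c′ * (l′ - r′) + c″ * (l″ - r″) → a ≈ b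
  modulo₃ c c′ c″ eq eq′ eq″ p = modulo₂ c c′ eq eq′ (modulo₁ c″ eq″ p)

-- Derivations, and convolution identities for divisor sums.

record DifferentialAlgebra : Set₁ where
  field
    algebra : ℤAlgebra
  open ℤAlgebra algebra public
  field
    ∂      : Carrier → Carrier
    ∂-cong : ∀ {x y} → x ≈ y → ∂ x ≈ ∂ y
    ∂-+    : ∀ x y → ∂ (x + y) ≈ ∂ x + ∂ y
    ∂-*    : ∀ x y → ∂ (x * y) ≈ ∂ x * y + x * ∂ y
    ∂-neg  : ∀ x → ∂ (- x) ≈ - ∂ x
    ∂-con  : ∀ c → ∂ (con c) ≈ 0#

  ∂-sub : ∀ x y → ∂ (x - y) ≈ ∂ x - ∂ y
  ∂-sub x y = trans (∂-+ x (- y)) (+-congˡ (∂-neg y))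

  ∂-1 : ∂ 1# ≈ 0#
  ∂-1 = trans (∂-cong (sym con-1)) (∂-con (+ 1))

  ∂-con* : ∀ c x → ∂ (con c * x) ≈ con c * ∂ x
  ∂-con* c x = trans (∂-* (con c) x) (trans (+-congʳ (trans (*-congʳ (∂-con c)) (zeroˡ x))) (+-identityˡ _))

PS-differential : DifferentialAlgebra
PS-differential = record
  { algebra = PS-algebra ; ∂ = θ ; ∂-cong = θ-cong ; ∂-+ = θ-⊞ ; ∂-* = θ-⊠ ; ∂-neg = θ-⊟ ; ∂-con = θ-con }

module θ𝕊 = DifferentialAlgebra PS-differential

-- Divisor sums.  With uₘ = qᵐ/(1 - qᵐ) one has uₐu_b = u_{a+b}(1 + uₐ + u_b), which turns a sum of
-- p(a,b)uₐu_b along the antidiagonals into one over a triangle a < m.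

module _ (U : ℕ → ℕ → ℤ) (V : ℕ → ℤ) (n : ℕ)
         (U-split : ∀ a b → U (suc a) (suc b) ≡ V (suc a ℕ.+ suc b) ℤ.+ U (suc a) (suc a ℕ.+ suc b) ℤ.+ U (suc b) (suc a ℕ.+ suc b))
         (U-sym : ∀ a b → U a b ≡ U b a)
         (U-high : ∀ a b → n < a ℕ.+ b → U a b ≡ + 0) where
  open ∑ℤ using (∑-cong; ∑-+; ∑-0; ∑-extend; ∑-head)
  open ℤ-solver using (solve; _:=_; _:+_; _:*_; con)
  open ≡.≡-Reasoning

  square : ℕ → (ℕ → ℕ → ℤ) → ℤ
  square N f = ∑ℤ N (λ i → ∑ℤ N (λ j → f (suc i) (suc j)))

  antidiagonals : ℕ → (ℕ → ℕ → ℤ) → ℤ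
  antidiagonals N f = ∑ℤ N (λ k → ∑ℤ (suc k) (λ i → f i (k ∸ i)))

  antidiagonals-rows : ∀ N f → antidiagonals N f ≡ ∑ℤ N (λ i → ∑ℤ (N ∸ i) (f i))
  antidiagonals-rows zero    f = ≡.refl
  antidiagonals-rows (suc N) f = begin
    antidiagonals N f ℤ.+ (∑ℤ N (λ i → f i (N ∸ i)) ℤ.+ f N (N ∸ N))
      ≡⟨ ≡.cong (ℤ._+ (∑ℤ N (λ i → f i (N ∸ i)) ℤ.+ f N (N ∸ N))) (antidiagonals-rows N f) ⟩
    ∑ℤ N (λ i → ∑ℤ (N ∸ i) (f i)) ℤ.+ (∑ℤ N (λ i → f i (N ∸ i)) ℤ.+ f N (N ∸ N))
      ≡⟨ ℤP.+-assoc (∑ℤ N (λ i → ∑ℤ (N ∸ i) (f i))) _ _ ⟨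
    ∑ℤ N (λ i → ∑ℤ (N ∸ i) (f i)) ℤ.+ ∑ℤ N (λ i → f i (N ∸ i)) ℤ.+ f N (N ∸ N)
      ≡⟨ ≡.cong₂ ℤ._+_ (≡.sym (∑-+ N (λ i → ∑ℤ (N ∸ i) (f i)) (λ i → f i (N ∸ i)))) (diagonal N) ⟩
    ∑ℤ N (λ i → ∑ℤ (suc (N ∸ i)) (f i)) ℤ.+ ∑ℤ (suc N ∸ N) (f N)
      ≡⟨ ≡.cong (ℤ._+ ∑ℤ (suc N ∸ N) (f N))
          (∑-cong N (λ i i<N → ≡.cong (λ m → ∑ℤ m (f i)) (≡.sym (ℕP.+-∸-assoc 1 (ℕP.<⇒≤ i<N))))) ⟩
    ∑ℤ N (λ i → ∑ℤ (suc N ∸ i) (f i)) ℤ.+ ∑ℤ (suc N ∸ N) (f N) ∎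
    where
    diagonal : ∀ N → f N (N ∸ N) ≡ ∑ℤ (suc N ∸ N) (f N)
    diagonal N = ≡.trans (≡.sym (ℤP.+-identityˡ _)) (≡.trans
      (≡.cong₂ ℤ._+_ (≡.cong (λ m → ∑ℤ m (f N)) (≡.sym (ℕP.n∸n≡0 N))) ≡.refl)
      (≡.cong (λ m → ∑ℤ m (f N)) (≡.sym (ℕP.+-∸-assoc 1 (ℕP.≤-refl {N})))))

  -- The pairs (a, m) with 1 ≤ a < m, where m = k + 2 and a = i + 1; the value m = 1 has no a below
  -- it.
  triangle : ℕ → (ℕ → ℕ → ℤ) → ℤ
  triangle N f = ∑ℤ N (λ k → ∑ℤ (suc k) (λ i → f (suc i) (suc (suc k))))

  square-symmetric : ∀ N f → (∀ a b → f a b ≡ f b a) →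
    square (suc N) f ≡ ∑ℤ (suc N) (λ i → f (suc i) (suc i)) ℤ.+ + 2 ℤ.* triangle N f
  square-symmetric zero    f f-sym = solve 1 (λ x → con (+ 0) :+ (con (+ 0) :+ x) := con (+ 0) :+ x :+ con (+ 2) :* con (+ 0)) ≡.refl (f 1 1)
  square-symmetric (suc N) f f-sym = begin
    ∑ℤ (suc N) (λ i → ∑ℤ (suc N) (λ j → f (suc i) (suc j)) ℤ.+ f (suc i) (suc (suc N))) ℤ.+ (∑ℤ (suc N) (λ j → f (suc (suc N)) (suc j)) ℤ.+ d)
      ≡⟨ ≡.cong₂ ℤ._+_ (∑-+ (suc N) (λ i → ∑ℤ (suc N) (λ j → f (suc i) (suc j))) (λ i → f (suc i) (suc (suc N))))
          (≡.cong (ℤ._+ d) (∑-cong (suc N) (λ j _ → f-sym (suc (suc N)) (suc j)))) ⟩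
    square (suc N) f ℤ.+ x ℤ.+ (x ℤ.+ d)
      ≡⟨ ≡.cong (λ z → z ℤ.+ x ℤ.+ (x ℤ.+ d)) (square-symmetric N f f-sym) ⟩
    y ℤ.+ + 2 ℤ.* triangle N f ℤ.+ x ℤ.+ (x ℤ.+ d)
      ≡⟨ solve 4 (λ y t x d → y :+ con (+ 2) :* t :+ x :+ (x :+ d) := y :+ d :+ con (+ 2) :* (t :+ x)) ≡.refl y (triangle N f) x d ⟩
    y ℤ.+ d ℤ.+ + 2 ℤ.* (triangle N f ℤ.+ x) ∎
    where
    d = f (suc (suc N)) (suc (suc N))
    x = ∑ℤ (suc N) (λ i → f (suc i) (suc (suc N)))
    y = ∑ℤ (suc N) (λ i → f (suc i) (suc i))

  module _ (p g : ℕ → ℕ → ℤ) (p-g : ∀ a d → p a d ≡ g a (a ℕ.+ d)) (p-sym : ∀ a b → p a b ≡ p b a)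
           (g-sym : ∀ a b → g a b ≡ g b a) where
    private
      pU gU pV : ℕ → ℕ → ℤ
      pU a b = p a b ℤ.* U a b
      gU a b = g a b ℤ.* U a b
      pV a b = g a b ℤ.* V b

      reverse : ∀ k f → ∑ℤ (suc k) f ≡ ∑ℤ (suc k) (λ i → f (k ∸ i))
      reverse zero    f = ≡.refl
      reverse (suc k) f = begin
        ∑ℤ (suc k) f ℤ.+ f (suc k)                           ≡⟨ ≡.cong (ℤ._+ f (suc k)) (reverse k f) ⟩
        ∑ℤ (suc k) (λ i → f (k ∸ i)) ℤ.+ f (suc k)           ≡⟨ ℤP.+-comm (∑ℤ (suc k) (λ i → f (k ∸ i))) _ ⟩
        f (suc k) ℤ.+ ∑ℤ (suc k) (λ i → f (suc k ∸ suc i))   ≡⟨ ∑-head (suc k) (λ i → f (suc k ∸ i)) ⟨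
        ∑ℤ (suc (suc k)) (λ i → f (suc k ∸ i))               ∎

      row : ∀ k → ∑ℤ (suc k) (λ i → pU (suc i) (suc (k ∸ i)))
          ≡ ∑ℤ (suc k) (λ i → pV (suc i) (suc (suc k))) ℤ.+ + 2 ℤ.* ∑ℤ (suc k) (λ i → gU (suc i) (suc (suc k)))
      row k = begin
        ∑ℤ (suc k) (λ i → pU (suc i) (suc (k ∸ i)))
          ≡⟨ ∑-cong (suc k) (λ { i (s≤s i≤k) → cell i (k ∸ i) (ℕP.m+[n∸m]≡n i≤k) }) ⟩
        ∑ℤ (suc k) (λ i → pV (suc i) (suc (suc k)) ℤ.+ gU (suc i) (suc (suc k)) ℤ.+ gU (suc (k ∸ i)) (suc (suc k)))
          ≡⟨ ∑-+ (suc k) (λ i → pV (suc i) (suc (suc k)) ℤ.+ gU (suc i) (suc (suc k))) _ ⟩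
        ∑ℤ (suc k) (λ i → pV (suc i) (suc (suc k)) ℤ.+ gU (suc i) (suc (suc k))) ℤ.+ ∑ℤ (suc k) (λ i → gU (suc (k ∸ i)) (suc (suc k)))
          ≡⟨ ≡.cong₂ ℤ._+_ (∑-+ (suc k) (λ i → pV (suc i) (suc (suc k))) _) (≡.sym (reverse k (λ i → gU (suc i) (suc (suc k))))) ⟩
        P ℤ.+ G ℤ.+ G
          ≡⟨ solve 2 (λ x y → x :+ y :+ y := x :+ con (+ 2) :* y) ≡.refl P G ⟩
        P ℤ.+ + 2 ℤ.* G ∎
        where
        P = ∑ℤ (suc k) (λ i → pV (suc i) (suc (suc k)))
        G = ∑ℤ (suc k) (λ i → gU (suc i) (suc (suc k)))
        cell : ∀ i j → i ℕ.+ j ≡ k → pU (suc i) (suc j)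
          ≡ pV (suc i) (suc (suc k)) ℤ.+ gU (suc i) (suc (suc k)) ℤ.+ gU (suc j) (suc (suc k))
        cell i j ≡.refl = begin
          p a b ℤ.* U a b                                              ≡⟨ ≡.cong (p a b ℤ.*_) (U-split i j) ⟩
          p a b ℤ.* (V (a ℕ.+ b) ℤ.+ U a (a ℕ.+ b) ℤ.+ U b (a ℕ.+ b))  ≡⟨ solve 4 (λ p v x y → p :* (v :+ x :+ y) := p :* v :+ p :* x :+ p :* y) ≡.refl (p a b) (V (a ℕ.+ b)) (U a (a ℕ.+ b)) (U b (a ℕ.+ b)) ⟩
          p a b ℤ.* V (a ℕ.+ b) ℤ.+ p a b ℤ.* U a (a ℕ.+ b) ℤ.+ p a b ℤ.* U b (a ℕ.+ b)
            ≡⟨ ≡.cong₂ ℤ._+_ (≡.cong₂ ℤ._+_ (≡.cong (ℤ._* V (a ℕ.+ b)) (p-g a b)) (≡.cong (ℤ._* U a (a ℕ.+ b)) (p-g a b)))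
                (≡.cong (ℤ._* U b (a ℕ.+ b)) (≡.trans (p-sym a b) (≡.trans (p-g b a) (≡.cong (g b) (ℕP.+-comm b a))))) ⟩
          g a (a ℕ.+ b) ℤ.* V (a ℕ.+ b) ℤ.+ g a (a ℕ.+ b) ℤ.* U a (a ℕ.+ b) ℤ.+ g b (a ℕ.+ b) ℤ.* U b (a ℕ.+ b)
            ≡⟨ ≡.cong (λ m → g a m ℤ.* V m ℤ.+ g a m ℤ.* U a m ℤ.+ g b m ℤ.* U b m) (≡.cong suc (ℕP.+-suc i j)) ⟩
          pV a (suc (suc (i ℕ.+ j))) ℤ.+ gU a (suc (suc (i ℕ.+ j))) ℤ.+ gU b (suc (suc (i ℕ.+ j))) ∎
          where
          a = suc i
          b = suc j

      pU-high : ∀ i j → n ≤ suc (i ℕ.+ j) → pU (suc i) (suc j) ≡ + 0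
      pU-high i j n≤ = ≡.trans (≡.cong (p (suc i) (suc j) ℤ.*_) (U-high (suc i) (suc j) (s≤s (≡.subst (n ≤_) (≡.sym (ℕP.+-suc i j)) n≤))))
        (ℤP.*-zeroʳ (p (suc i) (suc j)))

      square-antidiagonals : ∀ N → n ≤ suc N → square (suc N) pU ≡ antidiagonals N (λ i j → pU (suc i) (suc j))
      square-antidiagonals N n≤ = begin
        square (suc N) pU
          ≡⟨ ∑-cong (suc N) (λ i i≤N → ≡.trans (≡.cong (λ m → ∑ℤ m (λ j → pU (suc i) (suc j))) (≡.sym (ℕP.m∸n+n≡m (ℕP.<⇒≤ i≤N))))
              (∑-extend (suc N ∸ i) i {λ j → pU (suc i) (suc j)} (λ j N-i≤j → pU-high i j (ℕP.≤-trans n≤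
                 (ℕP.≤-trans (ℕP.m≤n+m∸n (suc N) i) (ℕP.≤-trans (ℕP.+-monoʳ-≤ i N-i≤j) (ℕP.n≤1+n _))))))) ⟩
        ∑ℤ (suc N) (λ i → ∑ℤ (suc N ∸ i) (λ j → pU (suc i) (suc j)))
          ≡⟨ antidiagonals-rows (suc N) (λ i j → pU (suc i) (suc j)) ⟨
        antidiagonals N (λ i j → pU (suc i) (suc j)) ℤ.+ ∑ℤ (suc N) (λ i → pU (suc i) (suc (N ∸ i)))
          ≡⟨ ≡.cong (λ z → antidiagonals N (λ i j → pU (suc i) (suc j)) ℤ.+ z)
              (∑-0 (suc N) (λ { i (s≤s i≤N) → pU-high i (N ∸ i) (≡.subst (λ m → n ≤ suc m) (≡.sym (ℕP.m+[n∸m]≡n i≤N)) n≤) })) ⟩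
        antidiagonals N (λ i j → pU (suc i) (suc j)) ℤ.+ + 0
          ≡⟨ ℤP.+-identityʳ _ ⟩
        antidiagonals N (λ i j → pU (suc i) (suc j)) ∎

    -- On the antidiagonal a + b = m, the hypothesis `U-split` and p(a, b) = g(a, m) give g(a, m) (v
    -- + uₐuₘ) + g(b, m) u_b uₘ, and reversing the antidiagonal makes the last two sums equal. Twice
    -- the sum of g(a, m) uₐuₘ over a < m is the full square of g without its diagonal, which is why
    -- the diagonal appears on the left.
    divisor-sum-identity : ∀ N → n ≤ suc N →
      square (suc N) pU ℤ.+ ∑ℤ (suc N) (λ i → gU (suc i) (suc i)) ≡ square (suc N) gU ℤ.+ triangle N pV
    divisor-sum-identity N n≤ = begin
      square (suc N) pU ℤ.+ D
        ≡⟨ ≡.cong (ℤ._+ D) (≡.trans (square-antidiagonals N n≤) (∑-cong N (λ k _ → row k))) ⟩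
      ∑ℤ N (λ k → ∑ℤ (suc k) (λ i → pV (suc i) (suc (suc k))) ℤ.+ + 2 ℤ.* ∑ℤ (suc k) (λ i → gU (suc i) (suc (suc k)))) ℤ.+ D
        ≡⟨ ≡.cong (ℤ._+ D) (≡.trans (∑-+ N (λ k → ∑ℤ (suc k) (λ i → pV (suc i) (suc (suc k)))) _)
            (≡.cong (λ z → triangle N pV ℤ.+ z) (≡.sym (∑ℤ.*-∑ N (+ 2) (λ k → ∑ℤ (suc k) (λ i → gU (suc i) (suc (suc k)))))))) ⟩
      triangle N pV ℤ.+ + 2 ℤ.* triangle N gU ℤ.+ D
        ≡⟨ solve 3 (λ x y z → x :+ con (+ 2) :* y :+ z := z :+ con (+ 2) :* y :+ x) ≡.refl (triangle N pV) (triangle N gU) D ⟩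
      D ℤ.+ + 2 ℤ.* triangle N gU ℤ.+ triangle N pV
        ≡⟨ ≡.cong (ℤ._+ triangle N pV) (square-symmetric N gU (λ a b → ≡.cong₂ ℤ._*_ (g-sym a b) (U-sym a b))) ⟨
      square (suc N) gU ℤ.+ triangle N pV ∎
      where D = ∑ℤ (suc N) (λ i → gU (suc i) (suc i))

-- uₘ = qᵐ/(1 - qᵐ)
u : ℕ → PS
u m = q 𝕊.^ m ⊠ geomPS m

u-low : ∀ m k → k < m → u m k ≡ + 0
u-low m k = q^⊠-low m (geomPS m) k

geom≋1+u : ∀ m → geomPS (suc m) ≋ onePS ⊞ u (suc m)
geom≋1+u m = mk≋ λ k → ≡.trans (split k (k ℕP.<? suc m)) (≡.sym (⊞-coefficient onePS (u (suc m)) k))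
  where
  indicator = λ b → if b then + 1 else + 0
  split : ∀ k → Dec (k < suc m) → geomPS (suc m) k ≡ onePS k ℤ.+ u (suc m) k
  split zero    _ = ≡.trans (≡.cong indicator (dec-true (suc m ∣? 0) (suc m ∣0)))
    (≡.cong (λ z → + 1 ℤ.+ z) (≡.sym (u-low (suc m) 0 (s≤s z≤n))))
  split (suc k) (yes k<m) = ≡.trans
    (≡.cong indicator (dec-false (suc m ∣? suc k) (λ m∣k → ℕP.<⇒≱ k<m (∣⇒≤ m∣k))))
    (≡.cong (λ z → + 0 ℤ.+ z) (≡.sym (u-low (suc m) (suc k) k<m)))
  split (suc k) (no k≮m) = ≡.trans (≡.cong indicator (≡.trans
    (≡.cong (λ j → does (suc m ∣? j)) (≡.sym eq))
    (does-⇔ (mk⇔ (λ d → ∣m+n∣m⇒∣n d ∣-refl) (∣m∣n⇒∣m+n ∣-refl)) (suc m ∣? (suc m ℕ.+ (suc k ∸ suc m))) (suc m ∣? (suc k ∸ suc m)))))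
    (≡.trans (≡.sym (≡.trans (≡.cong (u (suc m)) (≡.sym eq)) (q^⊠-high (suc m) (geomPS (suc m)) (suc k ∸ suc m)))) (≡.sym (ℤP.+-identityˡ (u (suc m) (suc k)))))
    where eq = ℕP.m+[n∸m]≡n (ℕP.≮⇒≥ k≮m)

module _ where
  open 𝕊
  open 𝕊.Solver using (solve; _:=_; _:+_; _:*_; :-_; _:-_; _:^_)
  open LinearCombination PS-algebra

  u-recursive : ∀ m → u (suc m) ≋ q ^ suc m ⊠ (onePS ⊞ u (suc m))
  u-recursive m = *-congˡ (geom≋1+u m)

  u-product : ∀ a b → u (suc a) ⊠ u (suc b) ≋ u (suc a ℕ.+ suc b) ⊞ u (suc a ℕ.+ suc b) ⊠ u (suc a) ⊞ u (suc a ℕ.+ suc b) ⊠ u (suc b)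
  u-product a b = modulo₃ ((1# + W) * (1# + B) * y) ((1# + W) * (1# + A) - (1# + W)) (- ((1# + A) * (1# + B)))
    (u-recursive a) (u-recursive b) (trans (u-recursive (a ℕ.+ suc b)) (*-congʳ (^-homo-* q (suc a) (suc b))))
    (solve 5 (λ A B W x y → A :* B := W :+ W :* A :+ W :* B
        :+ (A :^ 0 :+ W) :* (A :^ 0 :+ B) :* y :* (A :- x :* (A :^ 0 :+ A))
        :+ ((A :^ 0 :+ W) :* (A :^ 0 :+ A) :- (A :^ 0 :+ W)) :* (B :- y :* (A :^ 0 :+ B))
        :+ (:- ((A :^ 0 :+ A) :* (A :^ 0 :+ B))) :* (W :- x :* y :* (A :^ 0 :+ W))) refl A B W x y)
    where
    A = u (suc a)
    B = u (suc b)
    W = u (suc a ℕ.+ suc b)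
    x = q ^ suc a
    y = q ^ suc b

  θ-u : ∀ m → θ (u (suc m)) ≋ conPS (+ suc m) ⊠ (u (suc m) ⊞ u (suc m) ⊠ u (suc m))
  θ-u m = modulo₂ (1# + A) (- (θ A + c * (1# + A))) θ-eq (u-recursive m)
    (solve 4 (λ A A′ c x → A′ := c :* (A :+ A :* A)
        :+ (A :^ 0 :+ A) :* (A′ :- (c :* x :* (A :^ 0 :+ A) :+ x :* A′))
        :+ (:- (A′ :+ c :* (A :^ 0 :+ A))) :* (A :- x :* (A :^ 0 :+ A))) refl A (θ A) c x)
    where
    A = u (suc m)
    c = conPS (+ suc m)
    x = q ^ suc m
    θ-eq : θ A ≋ c ⊠ x ⊠ (onePS ⊞ A) ⊞ x ⊠ θ A
    θ-eq = trans (θ-cong (u-recursive m)) (trans (θ-⊠ x (onePS ⊞ A)) (+-cong (*-congʳ (θ-q^ (suc m)))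
      (*-congˡ (trans (θ-⊞ onePS A) (trans (+-congʳ θ𝕊.∂-1) (+-identityˡ _))))))

-- powerSum N k = Σ_{m ≤ N} mᵏ uₘ, and S k = Σ_m mᵏ uₘ = Σ_n σₖ(n) qⁿ.
powerSum : ℕ → ℕ → PS
powerSum N k = ∑𝕊.∑ N (λ i → conPS ((+ suc i) ℤ.^ k) ⊠ u (suc i))

powerSum-coefficient : ∀ N k n → powerSum N k n ≡ ∑ℤ N (λ i → (+ suc i) ℤ.^ k ℤ.* u (suc i) n)
powerSum-coefficient N k n = ≡.trans (∑𝕊-coefficient N (λ i → conPS ((+ suc i) ℤ.^ k) ⊠ u (suc i)) n)
  (∑ℤ.∑-cong N (λ i _ → con-⊠ ((+ suc i) ℤ.^ k) (u (suc i)) n))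

S : ℕ → PS
S k n = powerSum n k n

powerSum-stable : ∀ N k n → n ≤ N → powerSum N k n ≡ S k n
powerSum-stable N k n n≤N = ≡.trans (powerSum-coefficient N k n) (≡.trans
  (≡.trans (≡.cong (λ m → ∑ℤ m f) (≡.sym (ℕP.m+[n∸m]≡n n≤N)))
    (∑ℤ.∑-extend n (N ∸ n) {f} (λ i n≤i → ≡.trans (≡.cong ((+ suc i) ℤ.^ k ℤ.*_) (u-low (suc i) n (s≤s n≤i))) (ℤP.*-zeroʳ ((+ suc i) ℤ.^ k)))))
  (≡.sym (powerSum-coefficient n k n)))
  where
  f : ℕ → ℤ
  f i = (+ suc i) ℤ.^ k ℤ.* u (suc i) n

∑∑ : ℕ → (ℕ → ℕ → ℤ) → ℤ
∑∑ N f = ∑ℤ N (λ i → ∑ℤ N (λ j → f (suc i) (suc j)))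

∑∑-cong : ∀ N {f g} → (∀ a b → f a b ≡ g a b) → ∑∑ N f ≡ ∑∑ N g
∑∑-cong N eq = ∑ℤ.∑-cong N (λ i _ → ∑ℤ.∑-cong N (λ j _ → eq (suc i) (suc j)))

∑∑-+* : ∀ N c f g → ∑∑ N (λ a b → f a b ℤ.+ c ℤ.* g a b) ≡ ∑∑ N f ℤ.+ c ℤ.* ∑∑ N g
∑∑-+* N c f g = ≡.trans
  (∑ℤ.∑-cong N (λ i _ → ≡.trans (∑ℤ.∑-+ N (f (suc i) ∘ suc) _) (≡.cong (λ z → ∑ℤ N (f (suc i) ∘ suc) ℤ.+ z) (≡.sym (∑ℤ.*-∑ N c (g (suc i) ∘ suc))))))
  (≡.trans (∑ℤ.∑-+ N (λ i → ∑ℤ N (f (suc i) ∘ suc)) _)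
    (≡.cong (λ z → ∑∑ N f ℤ.+ z) (≡.sym (∑ℤ.*-∑ N c (λ i → ∑ℤ N (g (suc i) ∘ suc))))))

powerSum-product : ∀ N i j n → ∑∑ N (λ a b → (+ a) ℤ.^ i ℤ.* (+ b) ℤ.^ j ℤ.* (u a ⊠ u b) n) ≡ (powerSum N i ⊠ powerSum N j) n
powerSum-product N i j n = ≡.sym (begin
  (powerSum N i ⊠ powerSum N j) n
    ≡⟨ at (𝕊.trans (∑𝕊.∑-* N (powerSum N j) (λ a → conPS ((+ suc a) ℤ.^ i) ⊠ u (suc a)))
          (∑𝕊.∑-cong N (λ a _ → ∑𝕊.*-∑ N (conPS ((+ suc a) ℤ.^ i) ⊠ u (suc a)) (λ b → conPS ((+ suc b) ℤ.^ j) ⊠ u (suc b))))) n ⟩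
  ∑𝕊.∑ N (λ a → ∑𝕊.∑ N (λ b → conPS ((+ suc a) ℤ.^ i) ⊠ u (suc a) ⊠ (conPS ((+ suc b) ℤ.^ j) ⊠ u (suc b)))) n
    ≡⟨ ≡.trans (∑𝕊-coefficient N (λ a → ∑𝕊.∑ N (λ b → conPS ((+ suc a) ℤ.^ i) ⊠ u (suc a) ⊠ (conPS ((+ suc b) ℤ.^ j) ⊠ u (suc b)))) n)
        (∑ℤ.∑-cong N (λ a _ → ≡.trans (∑𝕊-coefficient N (λ b → conPS ((+ suc a) ℤ.^ i) ⊠ u (suc a) ⊠ (conPS ((+ suc b) ℤ.^ j) ⊠ u (suc b))) n)
          (∑ℤ.∑-cong N (λ b _ → cell (suc a) (suc b))))) ⟩
  ∑∑ N (λ a b → (+ a) ℤ.^ i ℤ.* (+ b) ℤ.^ j ℤ.* (u a ⊠ u b) n) ∎)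
  where
  open ≡.≡-Reasoning
  cell : ∀ a b → (conPS ((+ a) ℤ.^ i) ⊠ u a ⊠ (conPS ((+ b) ℤ.^ j) ⊠ u b)) n ≡ (+ a) ℤ.^ i ℤ.* (+ b) ℤ.^ j ℤ.* (u a ⊠ u b) n
  cell a b = ≡.trans (at (𝕊.trans
      (𝕊.Solver.solve 4 (λ c x d y → c 𝕊.Solver.:* x 𝕊.Solver.:* (d 𝕊.Solver.:* y) 𝕊.Solver.:= c 𝕊.Solver.:* d 𝕊.Solver.:* (x 𝕊.Solver.:* y)) 𝕊.refl
        (conPS ((+ a) ℤ.^ i)) (u a) (conPS ((+ b) ℤ.^ j)) (u b))
      (𝕊.*-congʳ (𝕊.sym (𝕊.con-* ((+ a) ℤ.^ i) ((+ b) ℤ.^ j))))) n)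
    (con-⊠ ((+ a) ℤ.^ i ℤ.* (+ b) ℤ.^ j) (u a ⊠ u b) n)

S-product : ∀ i j n → ∑∑ (suc n) (λ a b → (+ a) ℤ.^ i ℤ.* (+ b) ℤ.^ j ℤ.* (u a ⊠ u b) n) ≡ (S i ⊠ S j) n
S-product i j n = ≡.trans (powerSum-product (suc n) i j n) (≡.trans
  (⊠-congʳ-below n {powerSum (suc n) i} {S i} {powerSum (suc n) j} (λ k k≤n → powerSum-stable (suc n) i k (ℕP.m≤n⇒m≤1+n k≤n)))
  (⊠-congˡ-below n {S i} {powerSum (suc n) j} {S j} (λ k k≤n → powerSum-stable (suc n) j k (ℕP.m≤n⇒m≤1+n k≤n))))

S-sum : ∀ k n → ∑ℤ (suc n) (λ i → (+ suc i) ℤ.^ k ℤ.* u (suc i) n) ≡ S k n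
S-sum k n = ≡.trans (≡.sym (powerSum-coefficient (suc n) k n)) (powerSum-stable (suc n) k n (ℕP.n≤1+n n))

S-sum-* : ∀ c k n → ∑ℤ (suc n) (λ i → c ℤ.* ((+ suc i) ℤ.^ k ℤ.* u (suc i) n)) ≡ c ℤ.* S k n
S-sum-* c k n = ≡.trans (≡.sym (∑ℤ.*-∑ (suc n) c (λ i → (+ suc i) ℤ.^ k ℤ.* u (suc i) n))) (≡.cong (c ℤ.*_) (S-sum k n))

S-sum₂ : ∀ c k c′ k′ n → ∑ℤ (suc n) (λ i → c ℤ.* ((+ suc i) ℤ.^ k ℤ.* u (suc i) n) ℤ.+ c′ ℤ.* ((+ suc i) ℤ.^ k′ ℤ.* u (suc i) n))
  ≡ c ℤ.* S k n ℤ.+ c′ ℤ.* S k′ n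
S-sum₂ c k c′ k′ n = ≡.trans (∑ℤ.∑-+ (suc n) (λ i → c ℤ.* ((+ suc i) ℤ.^ k ℤ.* u (suc i) n)) (λ i → c′ ℤ.* ((+ suc i) ℤ.^ k′ ℤ.* u (suc i) n)))
  (≡.cong₂ ℤ._+_ (S-sum-* c k n) (S-sum-* c′ k′ n))

S-product₂ : ∀ c i j c′ i′ j′ n {f : ℕ → ℕ → ℤ} →
  (∀ a b → f a b ≡ c ℤ.* ((+ a) ℤ.^ i ℤ.* (+ b) ℤ.^ j ℤ.* (u a ⊠ u b) n) ℤ.+ c′ ℤ.* ((+ a) ℤ.^ i′ ℤ.* (+ b) ℤ.^ j′ ℤ.* (u a ⊠ u b) n)) →
  ∑∑ (suc n) f ≡ c ℤ.* (S i ⊠ S j) n ℤ.+ c′ ℤ.* (S i′ ⊠ S j′) n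
S-product₂ c i j c′ i′ j′ n {f} eq = begin
  ∑∑ (suc n) f
    ≡⟨ ∑∑-cong (suc n) (λ a b → ≡.trans (eq a b) (solve 2 (λ x y → x :+ y := con (+ 0) :+ x :+ y) ≡.refl (c ℤ.* h a b) (c′ ℤ.* h′ a b))) ⟩
  ∑∑ (suc n) (λ a b → + 0 ℤ.+ c ℤ.* h a b ℤ.+ c′ ℤ.* h′ a b)
    ≡⟨ ≡.trans (∑∑-+* (suc n) c′ (λ a b → + 0 ℤ.+ c ℤ.* h a b) h′) (≡.cong (ℤ._+ c′ ℤ.* ∑∑ (suc n) h′) (∑∑-+* (suc n) c (λ _ _ → + 0) h)) ⟩
  ∑∑ (suc n) (λ _ _ → + 0) ℤ.+ c ℤ.* ∑∑ (suc n) h ℤ.+ c′ ℤ.* ∑∑ (suc n) h′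
    ≡⟨ ≡.cong₂ ℤ._+_ (≡.cong₂ ℤ._+_ (∑ℤ.∑-0 (suc n) (λ i _ → ∑ℤ.∑-0 (suc n) (λ _ _ → ≡.refl))) (≡.cong (c ℤ.*_) (S-product i j n)))
        (≡.cong (c′ ℤ.*_) (S-product i′ j′ n)) ⟩
  + 0 ℤ.+ c ℤ.* (S i ⊠ S j) n ℤ.+ c′ ℤ.* (S i′ ⊠ S j′) n
    ≡⟨ ≡.cong (ℤ._+ c′ ℤ.* (S i′ ⊠ S j′) n) (ℤP.+-identityˡ (c ℤ.* (S i ⊠ S j) n)) ⟩
  c ℤ.* (S i ⊠ S j) n ℤ.+ c′ ℤ.* (S i′ ⊠ S j′) n ∎
  where
  open ≡.≡-Reasoning
  open ℤ-solver using (solve; _:=_; _:+_; con)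
  h h′ : ℕ → ℕ → ℤ
  h  a b = (+ a) ℤ.^ i ℤ.* (+ b) ℤ.^ j ℤ.* (u a ⊠ u b) n
  h′ a b = (+ a) ℤ.^ i′ ℤ.* (+ b) ℤ.^ j′ ℤ.* (u a ⊠ u b) n

module _ (p g : ℤ → ℤ → ℤ) (c : ℤ) (F : ℤ → ℤ) (L : ℤ → ℤ → ℤ)
         (p-g : ∀ a d → p a d ≡ g a (a ℤ.+ d)) (p-sym : ∀ a b → p a b ≡ p b a) (g-sym : ∀ a b → g a b ≡ g b a)
         (F-sum : ∀ k → c ℤ.* ∑ℤ (suc k) (λ i → g (+ suc i) (+ suc (suc k))) ≡ F (+ suc (suc k)))
         (F-1 : F (+ 1) ≡ + 0)
         (diagonal : ∀ n m x v → m ℤ.* x ≡ n ℤ.* v ℤ.- m ℤ.* v → F m ℤ.* v ≡ c ℤ.* (g m m ℤ.* x) ℤ.+ L n m ℤ.* v) (n : ℕ) where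
  private
    U : ℕ → ℕ → ℤ
    U a b = (u a ⊠ u b) n
    V : ℕ → ℤ
    V m = u m n

    U-sym : ∀ a b → U a b ≡ U b a
    U-sym a b = at (𝕊.*-comm (u a) (u b)) n

    U-split : ∀ a b → U (suc a) (suc b) ≡ V (suc a ℕ.+ suc b) ℤ.+ U (suc a) (suc a ℕ.+ suc b) ℤ.+ U (suc b) (suc a ℕ.+ suc b)
    U-split a b = ≡.trans (at (u-product a b) n) (≡.trans (⊞-coefficient (u m ⊞ u m ⊠ u (suc a)) (u m ⊠ u (suc b)) n)
      (≡.cong₂ ℤ._+_ (≡.trans (⊞-coefficient (u m) (u m ⊠ u (suc a)) n) (≡.cong (λ z → V m ℤ.+ z) (U-sym m (suc a)))) (U-sym m (suc b))))
      where m = suc a ℕ.+ suc b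

    U-high : ∀ a b → n < a ℕ.+ b → U a b ≡ + 0
    U-high a b n<a+b = ≡.trans (at (𝕊.trans
      (solve 4 (λ x y z w → x :* y :* (z :* w) := x :* z :* (y :* w)) 𝕊.refl (q 𝕊.^ a) (geomPS a) (q 𝕊.^ b) (geomPS b))
      (𝕊.*-congʳ (𝕊.sym (𝕊.^-homo-* q a b)))) n) (q^⊠-low (a ℕ.+ b) (geomPS a ⊠ geomPS b) n n<a+b)
      where open 𝕊.Solver using (solve; _:=_; _:*_)

    U-diagonal : ∀ m → + suc m ℤ.* U (suc m) (suc m) ≡ + n ℤ.* V (suc m) ℤ.- + suc m ℤ.* V (suc m)
    U-diagonal m = ≡.trans (solve 3 (λ m x v → m :* x := m :* (v :+ x) :- m :* v) ≡.refl (+ suc m) (U (suc m) (suc m)) (V (suc m)))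
      (≡.cong (ℤ._- + suc m ℤ.* V (suc m)) (≡.trans
        (≡.cong (+ suc m ℤ.*_) (≡.sym (⊞-coefficient (u (suc m)) (u (suc m) ⊠ u (suc m)) n)))
        (≡.trans (≡.sym (con-⊠ (+ suc m) (u (suc m) ⊞ u (suc m) ⊠ u (suc m)) n)) (≡.trans (≡.sym (at (θ-u m) n)) (θ-coefficient (u (suc m)) n)))))
      where open ℤ-solver using (solve; _:=_; _:+_; _:*_; :-_; _:-_)

    p′ g′ : ℕ → ℕ → ℤ
    p′ a b = p (+ a) (+ b)
    g′ a b = g (+ a) (+ b)
    M = suc n

  -- `F`/c is the power sum of g(a, m) over a < m, and `c` clears its denominators. The diagonal
  -- squares uₘ² are removed by θuₘ = m(uₘ + uₘ²): in degree n this reads m[uₘ²] = (n - m)[uₘ], and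
  -- it turns `F` into `L`, the polynomial in which n occurs.
  divisor-sums : c ℤ.* ∑∑ M (λ a b → (p (+ a) (+ b) ℤ.- g (+ a) (+ b)) ℤ.* (u a ⊠ u b) n) ≡ ∑ℤ M (λ i → L (+ n) (+ suc i) ℤ.* u (suc i) n)
  divisor-sums = ℤA.+-cancelʳ (c ℤ.* G ℤ.+ c ℤ.* D) _ _ (begin
    c ℤ.* X ℤ.+ (c ℤ.* G ℤ.+ c ℤ.* D)
      ≡⟨ solve 4 (λ c x g d → c :* x :+ (c :* g :+ c :* d) := c :* (g :+ con (+ 1) :* x :+ d)) ≡.refl c X G D ⟩
    c ℤ.* (G ℤ.+ + 1 ℤ.* X ℤ.+ D)
      ≡⟨ ≡.cong (λ z → c ℤ.* (z ℤ.+ D)) (≡.trans (≡.sym (∑∑-+* M (+ 1) (λ a b → g′ a b ℤ.* U a b) (λ a b → (p′ a b ℤ.- g′ a b) ℤ.* U a b)))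
          (∑∑-cong M (λ a b → solve 3 (λ p g u → g :* u :+ con (+ 1) :* ((p :- g) :* u) := p :* u) ≡.refl (p′ a b) (g′ a b) (U a b)))) ⟩
    c ℤ.* (∑∑ M (λ a b → p′ a b ℤ.* U a b) ℤ.+ D)
      ≡⟨ ≡.cong (c ℤ.*_) (divisor-sum-identity U V n U-split U-sym U-high p′ g′ (λ a d → p-g (+ a) (+ d)) (λ a b → p-sym (+ a) (+ b))
          (λ a b → g-sym (+ a) (+ b)) n (ℕP.n≤1+n n)) ⟩
    c ℤ.* (G ℤ.+ ∑ℤ n (λ k → ∑ℤ (suc k) (λ i → g′ (suc i) (suc (suc k)) ℤ.* V (suc (suc k)))))
      ≡⟨ ℤP.*-distribˡ-+ c G _ ⟩
    c ℤ.* G ℤ.+ c ℤ.* ∑ℤ n (λ k → ∑ℤ (suc k) (λ i → g′ (suc i) (suc (suc k)) ℤ.* V (suc (suc k))))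
      ≡⟨ ≡.cong (λ z → c ℤ.* G ℤ.+ z) triangle-sum ⟩
    c ℤ.* G ℤ.+ (c ℤ.* D ℤ.+ ∑ℤ M (λ i → L (+ n) (+ suc i) ℤ.* V (suc i)))
      ≡⟨ solve 3 (λ x y z → x :+ (y :+ z) := z :+ (x :+ y)) ≡.refl (c ℤ.* G) (c ℤ.* D) (∑ℤ M (λ i → L (+ n) (+ suc i) ℤ.* V (suc i))) ⟩
    ∑ℤ M (λ i → L (+ n) (+ suc i) ℤ.* V (suc i)) ℤ.+ (c ℤ.* G ℤ.+ c ℤ.* D) ∎)
    where
    open ≡.≡-Reasoning
    open ℤ-solver using (solve; _:=_; _:+_; _:*_; :-_; _:-_; con)
    X G D : ℤ
    X = ∑∑ M (λ a b → (p′ a b ℤ.- g′ a b) ℤ.* U a b)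
    G = ∑∑ M (λ a b → g′ a b ℤ.* U a b)
    D = ∑ℤ M (λ i → g′ (suc i) (suc i) ℤ.* U (suc i) (suc i))
    triangle-sum : c ℤ.* ∑ℤ n (λ k → ∑ℤ (suc k) (λ i → g′ (suc i) (suc (suc k)) ℤ.* V (suc (suc k))))
      ≡ c ℤ.* D ℤ.+ ∑ℤ M (λ i → L (+ n) (+ suc i) ℤ.* V (suc i))
    triangle-sum = begin
      c ℤ.* ∑ℤ n (λ k → ∑ℤ (suc k) (λ i → g′ (suc i) (suc (suc k)) ℤ.* V (suc (suc k))))
        ≡⟨ ∑ℤ.*-∑ n c (λ k → ∑ℤ (suc k) (λ i → g′ (suc i) (suc (suc k)) ℤ.* V (suc (suc k)))) ⟩
      ∑ℤ n (λ k → c ℤ.* ∑ℤ (suc k) (λ i → g′ (suc i) (suc (suc k)) ℤ.* V (suc (suc k))))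
        ≡⟨ ∑ℤ.∑-cong n (λ k _ → ≡.trans (≡.cong (c ℤ.*_) (≡.sym (∑ℤ.∑-* (suc k) (V (suc (suc k))) (λ i → g′ (suc i) (suc (suc k))))))
            (≡.trans (≡.sym (ℤP.*-assoc c _ (V (suc (suc k))))) (≡.cong (ℤ._* V (suc (suc k))) (F-sum k)))) ⟩
      ∑ℤ n (λ k → F (+ suc (suc k)) ℤ.* V (suc (suc k)))
        ≡⟨ ℤP.+-identityˡ _ ⟨
      + 0 ℤ.+ ∑ℤ n (λ k → F (+ suc (suc k)) ℤ.* V (suc (suc k)))
        ≡⟨ ≡.cong (ℤ._+ ∑ℤ n (λ k → F (+ suc (suc k)) ℤ.* V (suc (suc k)))) (≡.sym (≡.trans (≡.cong (ℤ._* V 1) F-1) (ℤP.*-zeroˡ (V 1)))) ⟩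
      F (+ 1) ℤ.* V 1 ℤ.+ ∑ℤ n (λ k → F (+ suc (suc k)) ℤ.* V (suc (suc k)))
        ≡⟨ ∑ℤ.∑-head n (λ i → F (+ suc i) ℤ.* V (suc i)) ⟨
      ∑ℤ M (λ i → F (+ suc i) ℤ.* V (suc i))
        ≡⟨ ∑ℤ.∑-cong M (λ i _ → diagonal (+ n) (+ suc i) (U (suc i) (suc i)) (V (suc i)) (U-diagonal i)) ⟩
      ∑ℤ M (λ i → c ℤ.* (g′ (suc i) (suc i) ℤ.* U (suc i) (suc i)) ℤ.+ L (+ n) (+ suc i) ℤ.* V (suc i))
        ≡⟨ ∑ℤ.∑-+ M (λ i → c ℤ.* (g′ (suc i) (suc i) ℤ.* U (suc i) (suc i))) _ ⟩
      ∑ℤ M (λ i → c ℤ.* (g′ (suc i) (suc i) ℤ.* U (suc i) (suc i))) ℤ.+ ∑ℤ M (λ i → L (+ n) (+ suc i) ℤ.* V (suc i))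
        ≡⟨ ≡.cong (ℤ._+ ∑ℤ M (λ i → L (+ n) (+ suc i) ℤ.* V (suc i))) (∑ℤ.*-∑ M c (λ i → g′ (suc i) (suc i) ℤ.* U (suc i) (suc i))) ⟨
      c ℤ.* D ℤ.+ ∑ℤ M (λ i → L (+ n) (+ suc i) ℤ.* V (suc i)) ∎

S-product₃ : ∀ c i j c′ i′ j′ c″ i″ j″ n {f : ℕ → ℕ → ℤ} →
  (∀ a b → f a b ≡ c ℤ.* ((+ a) ℤ.^ i ℤ.* (+ b) ℤ.^ j ℤ.* (u a ⊠ u b) n) ℤ.+ c′ ℤ.* ((+ a) ℤ.^ i′ ℤ.* (+ b) ℤ.^ j′ ℤ.* (u a ⊠ u b) n)
    ℤ.+ c″ ℤ.* ((+ a) ℤ.^ i″ ℤ.* (+ b) ℤ.^ j″ ℤ.* (u a ⊠ u b) n)) →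
  ∑∑ (suc n) f ≡ c ℤ.* (S i ⊠ S j) n ℤ.+ c′ ℤ.* (S i′ ⊠ S j′) n ℤ.+ c″ ℤ.* (S i″ ⊠ S j″) n
S-product₃ c i j c′ i′ j′ c″ i″ j″ n eq = ≡.trans (∑∑-cong (suc n) eq) (≡.trans (∑∑-+* (suc n) c″ (λ a b → c ℤ.* h i j a b ℤ.+ c′ ℤ.* h i′ j′ a b) (h i″ j″))
  (≡.cong₂ ℤ._+_ (S-product₂ c i j c′ i′ j′ n (λ _ _ → ≡.refl)) (≡.cong (c″ ℤ.*_) (S-product i″ j″ n))))
  where
  h : ℕ → ℕ → ℕ → ℕ → ℤ
  h i j a b = (+ a) ℤ.^ i ℤ.* (+ b) ℤ.^ j ℤ.* (u a ⊠ u b) n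

-- The form a² - ab + b² becomes a² + ab + b² under b ↦ a + b, as `p-g` demands, and the difference
-- 2ab of the two forms produces the square of `S 1`. `G` is the closed form of 6 times the sum of
-- g(i, m) over 1 ≤ i ≤ r.
module Identity₂ where
  open ℤ-solver using (solve; _:=_; _:+_; _:*_; :-_; _:-_; con; Polynomial)
  :p :g : ∀ {k} → Polynomial k → Polynomial k → Polynomial k
  :p a b = (a :* a :+ a :* b :+ b :* b)
  :g a b = (a :* a :- a :* b :+ b :* b)
  :F : ∀ {k} → Polynomial k → Polynomial k
  :F m = con (+ 5) :* (m :* m :* m) :- con (+ 6) :* (m :* m) :+ con (+ 1) :* (m)
  :L : ∀ {k} → Polynomial k → Polynomial k → Polynomial k
  :L n m = con (+ 5) :* (m :* m :* m) :+ con (+ 1) :* (m) :- con (+ 6) :* (n :* m)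
  :Σ : ∀ {k} → Polynomial k → Polynomial k → Polynomial k
  :Σ m r = con (+ 2) :* (r :* r :* r) :+ con (+ 3) :* (r :* r) :+ con (+ 1) :* (r) :- con (+ 3) :* (m :* r :* r) :- con (+ 3) :* (m :* r) :+ con (+ 6) :* (m :* m :* r)
  p g : ℤ → ℤ → ℤ
  p a b = (a ℤ.* a ℤ.+ a ℤ.* b ℤ.+ b ℤ.* b)
  g a b = (a ℤ.* a ℤ.- a ℤ.* b ℤ.+ b ℤ.* b)
  F : ℤ → ℤ
  F m = + 5 ℤ.* (m ℤ.* m ℤ.* m) ℤ.- + 6 ℤ.* (m ℤ.* m) ℤ.+ + 1 ℤ.* (m)
  L : ℤ → ℤ → ℤ
  L n m = + 5 ℤ.* (m ℤ.* m ℤ.* m) ℤ.+ + 1 ℤ.* (m) ℤ.- + 6 ℤ.* (n ℤ.* m)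
  G : ℤ → ℤ → ℤ
  G m r = + 2 ℤ.* (r ℤ.* r ℤ.* r) ℤ.+ + 3 ℤ.* (r ℤ.* r) ℤ.+ + 1 ℤ.* (r) ℤ.- + 3 ℤ.* (m ℤ.* r ℤ.* r) ℤ.- + 3 ℤ.* (m ℤ.* r) ℤ.+ + 6 ℤ.* (m ℤ.* m ℤ.* r)

  partial : ∀ m r → + 6 ℤ.* ∑ℤ r (λ i → g (+ suc i) m) ≡ G m (+ r)
  partial m zero    = solve 1 (λ m → con (+ 0) := :Σ m (con (+ 0))) ≡.refl m
  partial m (suc r) = ≡.trans (ℤP.*-distribˡ-+ (+ 6) (∑ℤ r (λ i → g (+ suc i) m)) (g (+ suc r) m))
    (≡.trans (≡.cong (ℤ._+ + 6 ℤ.* g (+ suc r) m) (partial m r))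
    (solve 2 (λ m r → :Σ m r :+ con (+ 6) :* :g (con (+ 1) :+ r) m := :Σ m (con (+ 1) :+ r)) ≡.refl m (+ r)))

  products : ∀ n → ∑∑ (suc n) (λ a b → (p (+ a) (+ b) ℤ.- g (+ a) (+ b)) ℤ.* (u a ⊠ u b) n)
    ≡ + 2 ℤ.* (S 1 ⊠ S 1) n ℤ.+ + 0 ℤ.* (S 1 ⊠ S 1) n
  products n = S-product₂ (+ 2) 1 1 (+ 0) 1 1 n (λ a b → solve 3 (λ a b x → (:p a b :- :g a b) :* x
    := con (+ 2) :* ((a :* con (+ 1)) :* (b :* con (+ 1)) :* x) :+ con (+ 0) :* ((a :* con (+ 1)) :* (b :* con (+ 1)) :* x)) ≡.refl (+ a) (+ b) ((u a ⊠ u b) n))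

  coefficients : ∀ n → + 6 ℤ.* ∑∑ (suc n) (λ a b → (p (+ a) (+ b) ℤ.- g (+ a) (+ b)) ℤ.* (u a ⊠ u b) n)
    ≡ ∑ℤ (suc n) (λ i → L (+ n) (+ suc i) ℤ.* u (suc i) n)
  coefficients = divisor-sums p g (+ 6) F L
    (solve 2 (λ a d → :p a d := :g a (a :+ d)) ≡.refl)
    (solve 2 (λ a b → :p a b := :p b a) ≡.refl)
    (solve 2 (λ a b → :g a b := :g b a) ≡.refl)
    (λ k → ≡.trans (partial (+ suc (suc k)) (suc k))
      (solve 1 (λ k → :Σ (con (+ 2) :+ k) (con (+ 1) :+ k) := :F (con (+ 2) :+ k)) ≡.refl (+ k)))
    ≡.refl
    (λ n m x v eq → LinearCombination.modulo₁ ℤ-algebra (ℤ.- (+ 6 ℤ.* (m))) eq (solve 4 (λ n m x v → :F m :* v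
      := con (+ 6) :* (:g m m :* x) :+ :L n m :* v :+ (:- (con (+ 6) :* (m))) :* (m :* x :- (n :* v :- m :* v))) ≡.refl n m x v))

-- The squares of the two quadratic forms of `Identity₂` differ by 4ab³ + 4a³b, hence the product of
-- `S 1` and `S 3`.
module Identity₄ where
  open ℤ-solver using (solve; _:=_; _:+_; _:*_; :-_; _:-_; con; Polynomial)
  :p :g : ∀ {k} → Polynomial k → Polynomial k → Polynomial k
  :p a b = (a :* a :+ a :* b :+ b :* b) :* (a :* a :+ a :* b :+ b :* b)
  :g a b = (a :* a :- a :* b :+ b :* b) :* (a :* a :- a :* b :+ b :* b)
  :F : ∀ {k} → Polynomial k → Polynomial k
  :F m = con (+ 21) :* (m :* m :* m :* m :* m) :- con (+ 30) :* (m :* m :* m :* m) :+ con (+ 10) :* (m :* m :* m) :- con (+ 1) :* (m)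
  :L : ∀ {k} → Polynomial k → Polynomial k → Polynomial k
  :L n m = con (+ 21) :* (m :* m :* m :* m :* m) :+ con (+ 10) :* (m :* m :* m) :- con (+ 1) :* (m) :- con (+ 30) :* (n :* m :* m :* m)
  :Σ : ∀ {k} → Polynomial k → Polynomial k → Polynomial k
  :Σ m r = con (+ 6) :* (r :* r :* r :* r :* r) :+ con (+ 15) :* (r :* r :* r :* r) :+ con (+ 10) :* (r :* r :* r) :- con (+ 1) :* (r) :- con (+ 15) :* (r :* r :* r :* r :* m) :- con (+ 30) :* (r :* r :* r :* m) :- con (+ 15) :* (r :* r :* m) :+ con (+ 30) :* (r :* r :* r :* m :* m) :+ con (+ 45) :* (r :* r :* m :* m) :+ con (+ 15) :* (r :* m :* m) :- con (+ 30) :* (r :* r :* m :* m :* m) :- con (+ 30) :* (r :* m :* m :* m) :+ con (+ 30) :* (r :* m :* m :* m :* m)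
  p g : ℤ → ℤ → ℤ
  p a b = (a ℤ.* a ℤ.+ a ℤ.* b ℤ.+ b ℤ.* b) ℤ.* (a ℤ.* a ℤ.+ a ℤ.* b ℤ.+ b ℤ.* b)
  g a b = (a ℤ.* a ℤ.- a ℤ.* b ℤ.+ b ℤ.* b) ℤ.* (a ℤ.* a ℤ.- a ℤ.* b ℤ.+ b ℤ.* b)
  F : ℤ → ℤ
  F m = + 21 ℤ.* (m ℤ.* m ℤ.* m ℤ.* m ℤ.* m) ℤ.- + 30 ℤ.* (m ℤ.* m ℤ.* m ℤ.* m) ℤ.+ + 10 ℤ.* (m ℤ.* m ℤ.* m) ℤ.- + 1 ℤ.* (m)
  L : ℤ → ℤ → ℤ
  L n m = + 21 ℤ.* (m ℤ.* m ℤ.* m ℤ.* m ℤ.* m) ℤ.+ + 10 ℤ.* (m ℤ.* m ℤ.* m) ℤ.- + 1 ℤ.* (m) ℤ.- + 30 ℤ.* (n ℤ.* m ℤ.* m ℤ.* m)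
  G : ℤ → ℤ → ℤ
  G m r = + 6 ℤ.* (r ℤ.* r ℤ.* r ℤ.* r ℤ.* r) ℤ.+ + 15 ℤ.* (r ℤ.* r ℤ.* r ℤ.* r) ℤ.+ + 10 ℤ.* (r ℤ.* r ℤ.* r) ℤ.- + 1 ℤ.* (r) ℤ.- + 15 ℤ.* (r ℤ.* r ℤ.* r ℤ.* r ℤ.* m) ℤ.- + 30 ℤ.* (r ℤ.* r ℤ.* r ℤ.* m) ℤ.- + 15 ℤ.* (r ℤ.* r ℤ.* m) ℤ.+ + 30 ℤ.* (r ℤ.* r ℤ.* r ℤ.* m ℤ.* m) ℤ.+ + 45 ℤ.* (r ℤ.* r ℤ.* m ℤ.* m) ℤ.+ + 15 ℤ.* (r ℤ.* m ℤ.* m) ℤ.- + 30 ℤ.* (r ℤ.* r ℤ.* m ℤ.* m ℤ.* m) ℤ.- + 30 ℤ.* (r ℤ.* m ℤ.* m ℤ.* m) ℤ.+ + 30 ℤ.* (r ℤ.* m ℤ.* m ℤ.* m ℤ.* m)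

  partial : ∀ m r → + 30 ℤ.* ∑ℤ r (λ i → g (+ suc i) m) ≡ G m (+ r)
  partial m zero    = solve 1 (λ m → con (+ 0) := :Σ m (con (+ 0))) ≡.refl m
  partial m (suc r) = ≡.trans (ℤP.*-distribˡ-+ (+ 30) (∑ℤ r (λ i → g (+ suc i) m)) (g (+ suc r) m))
    (≡.trans (≡.cong (ℤ._+ + 30 ℤ.* g (+ suc r) m) (partial m r))
    (solve 2 (λ m r → :Σ m r :+ con (+ 30) :* :g (con (+ 1) :+ r) m := :Σ m (con (+ 1) :+ r)) ≡.refl m (+ r)))

  products : ∀ n → ∑∑ (suc n) (λ a b → (p (+ a) (+ b) ℤ.- g (+ a) (+ b)) ℤ.* (u a ⊠ u b) n)
    ≡ + 4 ℤ.* (S 1 ⊠ S 3) n ℤ.+ + 4 ℤ.* (S 3 ⊠ S 1) n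
  products n = S-product₂ (+ 4) 1 3 (+ 4) 3 1 n (λ a b → solve 3 (λ a b x → (:p a b :- :g a b) :* x
    := con (+ 4) :* ((a :* con (+ 1)) :* (b :* (b :* (b :* con (+ 1)))) :* x) :+ con (+ 4) :* ((a :* (a :* (a :* con (+ 1)))) :* (b :* con (+ 1)) :* x)) ≡.refl (+ a) (+ b) ((u a ⊠ u b) n))

  coefficients : ∀ n → + 30 ℤ.* ∑∑ (suc n) (λ a b → (p (+ a) (+ b) ℤ.- g (+ a) (+ b)) ℤ.* (u a ⊠ u b) n)
    ≡ ∑ℤ (suc n) (λ i → L (+ n) (+ suc i) ℤ.* u (suc i) n)
  coefficients = divisor-sums p g (+ 30) F L
    (solve 2 (λ a d → :p a d := :g a (a :+ d)) ≡.refl)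
    (solve 2 (λ a b → :p a b := :p b a) ≡.refl)
    (solve 2 (λ a b → :g a b := :g b a) ≡.refl)
    (λ k → ≡.trans (partial (+ suc (suc k)) (suc k))
      (solve 1 (λ k → :Σ (con (+ 2) :+ k) (con (+ 1) :+ k) := :F (con (+ 2) :+ k)) ≡.refl (+ k)))
    ≡.refl
    (λ n m x v eq → LinearCombination.modulo₁ ℤ-algebra (ℤ.- (+ 30 ℤ.* (m ℤ.* m ℤ.* m))) eq (solve 4 (λ n m x v → :F m :* v
      := con (+ 30) :* (:g m m :* x) :+ :L n m :* v :+ (:- (con (+ 30) :* (m :* m :* m))) :* (m :* x :- (n :* v :- m :* v))) ≡.refl n m x v))

-- Over an abstract ring, where the solver's terms do not unfold to integer arithmetic.
module Sextic (A : ℤAlgebra) where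
  open ℤAlgebra A
  private module P = Solver
  open Solver using (solve; _:=_; _:+_; _:*_; :-_; _:-_; Polynomial)

  -- Both the cubes of the quadratic forms and the squares of ab(a + b), ab(a - b) are admissible
  -- pairs. Each alone brings in m⁷, that is `S 7`; the leading parts of the sums over a < m are
  -- 83/140 and 1/30 of m⁷, and 42 · 83/140 = 747/30, so this combination has no m⁷ in `F`.
  p g L G : Carrier → Carrier → Carrier
  p a b = con (+ 42) * ((a * a + a * b + b * b) * (a * a + a * b + b * b) * (a * a + a * b + b * b)) - con (+ 747) * (a * b * (a + b) * (a * b * (a + b)))
  g a b = con (+ 42) * ((a * a - a * b + b * b) * (a * a - a * b + b * b) * (a * a - a * b + b * b)) - con (+ 747) * (a * b * (a - b) * (a * b * (a - b)))
  L n m = con (+ 42) * (m * m * m * m * m) + con (+ 40) * (m * m * m) + con (+ 2) * (m) - con (+ 84) * (n * m * m * m * m * m)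
  G m r = con (+ 12) * (r * r * r * r * r * r * r) + con (+ 42) * (r * r * r * r * r * r) + con (+ 42) * (r * r * r * r * r) - con (+ 14) * (r * r * r) + con (+ 2) * (r) - con (+ 42) * (r * r * r * r * r * r * m) - con (+ 126) * (r * r * r * r * r * m) - con (+ 105) * (r * r * r * r * m) + con (+ 21) * (r * r * m) - con (+ 198) * (r * r * r * r * r * m * m) - con (+ 495) * (r * r * r * r * m * m) - con (+ 330) * (r * r * r * m * m) + con (+ 33) * (r * m * m) + con (+ 600) * (r * r * r * r * m * m * m) + con (+ 1200) * (r * r * r * m * m * m) + con (+ 600) * (r * r * m * m * m) - con (+ 330) * (r * r * r * m * m * m * m) - con (+ 495) * (r * r * m * m * m * m) - con (+ 165) * (r * m * m * m * m) - con (+ 126) * (r * r * m * m * m * m * m) - con (+ 126) * (r * m * m * m * m * m) + con (+ 84) * (r * m * m * m * m * m * m)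
  F : Carrier → Carrier
  F m = con (+ 42) * (m * m * m * m * m) + con (+ 40) * (m * m * m) + con (+ 2) * (m) - con (+ 84) * (m * m * m * m * m * m)

  private
    :p :g :L :G : ∀ {k} → Polynomial k → Polynomial k → Polynomial k
    :p a b = P.con (+ 42) :* ((a :* a :+ a :* b :+ b :* b) :* (a :* a :+ a :* b :+ b :* b) :* (a :* a :+ a :* b :+ b :* b)) :- P.con (+ 747) :* (a :* b :* (a :+ b) :* (a :* b :* (a :+ b)))
    :g a b = P.con (+ 42) :* ((a :* a :- a :* b :+ b :* b) :* (a :* a :- a :* b :+ b :* b) :* (a :* a :- a :* b :+ b :* b)) :- P.con (+ 747) :* (a :* b :* (a :- b) :* (a :* b :* (a :- b)))
    :L n m = P.con (+ 42) :* (m :* m :* m :* m :* m) :+ P.con (+ 40) :* (m :* m :* m) :+ P.con (+ 2) :* (m) :- P.con (+ 84) :* (n :* m :* m :* m :* m :* m)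
    :G m r = P.con (+ 12) :* (r :* r :* r :* r :* r :* r :* r) :+ P.con (+ 42) :* (r :* r :* r :* r :* r :* r) :+ P.con (+ 42) :* (r :* r :* r :* r :* r) :- P.con (+ 14) :* (r :* r :* r) :+ P.con (+ 2) :* (r) :- P.con (+ 42) :* (r :* r :* r :* r :* r :* r :* m) :- P.con (+ 126) :* (r :* r :* r :* r :* r :* m) :- P.con (+ 105) :* (r :* r :* r :* r :* m) :+ P.con (+ 21) :* (r :* r :* m) :- P.con (+ 198) :* (r :* r :* r :* r :* r :* m :* m) :- P.con (+ 495) :* (r :* r :* r :* r :* m :* m) :- P.con (+ 330) :* (r :* r :* r :* m :* m) :+ P.con (+ 33) :* (r :* m :* m) :+ P.con (+ 600) :* (r :* r :* r :* r :* m :* m :* m) :+ P.con (+ 1200) :* (r :* r :* r :* m :* m :* m) :+ P.con (+ 600) :* (r :* r :* m :* m :* m) :- P.con (+ 330) :* (r :* r :* r :* m :* m :* m :* m) :- P.con (+ 495) :* (r :* r :* m :* m :* m :* m) :- P.con (+ 165) :* (r :* m :* m :* m :* m) :- P.con (+ 126) :* (r :* r :* m :* m :* m :* m :* m) :- P.con (+ 126) :* (r :* m :* m :* m :* m :* m) :+ P.con (+ 84) :* (r :* m :* m :* m :* m :* m :* m)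
    :F : ∀ {k} → Polynomial k → Polynomial k
    :F m = P.con (+ 42) :* (m :* m :* m :* m :* m) :+ P.con (+ 40) :* (m :* m :* m) :+ P.con (+ 2) :* (m) :- P.con (+ 84) :* (m :* m :* m :* m :* m :* m)

  G-zero : ∀ m → con (+ 0) ≈ G m (con (+ 0))
  G-zero = solve 1 (λ m → P.con (+ 0) := :G m (P.con (+ 0))) refl

  G-suc : ∀ m r → G m r + con (+ 2) * g (con (+ 1) + r) m ≈ G m (con (+ 1) + r)
  G-suc = solve 2 (λ m r → :G m r :+ P.con (+ 2) :* :g (P.con (+ 1) :+ r) m := :G m (P.con (+ 1) :+ r)) refl

  p-g : ∀ a d → p a d ≈ g a (a + d)
  p-g = solve 2 (λ a d → :p a d := :g a (a :+ d)) refl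

  p-sym : ∀ a b → p a b ≈ p b a
  p-sym = solve 2 (λ a b → :p a b := :p b a) refl

  g-sym : ∀ a b → g a b ≈ g b a
  g-sym = solve 2 (λ a b → :g a b := :g b a) refl

  G-F : ∀ k → G (con (+ 2) + k) (con (+ 1) + k) ≈ F (con (+ 2) + k)
  G-F = solve 1 (λ k → :G (P.con (+ 2) :+ k) (P.con (+ 1) :+ k) := :F (P.con (+ 2) :+ k)) refl

  difference : ∀ a b x → (p a b - g a b) * x ≈ con (+ 252) * ((a * con (+ 1)) * (b * (b * (b * (b * (b * con (+ 1)))))) * x) + con (+ 252) * ((a * (a * (a * (a * (a * con (+ 1)))))) * (b * con (+ 1)) * x) + (- con (+ 2400)) * ((a * (a * (a * con (+ 1)))) * (b * (b * (b * con (+ 1)))) * x)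
  difference = solve 3 (λ a b x → (:p a b :- :g a b) :* x := P.con (+ 252) :* ((a :* P.con (+ 1)) :* (b :* (b :* (b :* (b :* (b :* P.con (+ 1)))))) :* x) :+ P.con (+ 252) :* ((a :* (a :* (a :* (a :* (a :* P.con (+ 1)))))) :* (b :* P.con (+ 1)) :* x) :+ (:- P.con (+ 2400)) :* ((a :* (a :* (a :* P.con (+ 1)))) :* (b :* (b :* (b :* P.con (+ 1)))) :* x)) refl

  diagonal : ∀ n m x v → m * x ≈ n * v - m * v → F m * v ≈ con (+ 2) * (g m m * x) + L n m * v
  diagonal n m x v eq = LinearCombination.modulo₁ A (- (con (+ 84) * (m * m * m * m * m))) eq
    (solve 4 (λ n m x v → :F m :* v := P.con (+ 2) :* (:g m m :* x) :+ :L n m :* v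
      :+ (:- (P.con (+ 84) :* (m :* m :* m :* m :* m))) :* (m :* x :- (n :* v :- m :* v))) refl n m x v)

module Identity₆ where
  open Sextic ℤ-algebra

  partial : ∀ m r → + 2 ℤ.* ∑ℤ r (λ i → g (+ suc i) m) ≡ G m (+ r)
  partial m zero    = G-zero m
  partial m (suc r) = ≡.trans (ℤP.*-distribˡ-+ (+ 2) (∑ℤ r (λ i → g (+ suc i) m)) (g (+ suc r) m))
    (≡.trans (≡.cong (ℤ._+ + 2 ℤ.* g (+ suc r) m) (partial m r)) (G-suc m (+ r)))

  products : ∀ n → ∑∑ (suc n) (λ a b → (p (+ a) (+ b) ℤ.- g (+ a) (+ b)) ℤ.* (u a ⊠ u b) n)
    ≡ + 252 ℤ.* (S 1 ⊠ S 5) n ℤ.+ + 252 ℤ.* (S 5 ⊠ S 1) n ℤ.+ (ℤ.- + 2400) ℤ.* (S 3 ⊠ S 3) n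
  products n = S-product₃ (+ 252) 1 5 (+ 252) 5 1 (ℤ.- + 2400) 3 3 n (λ a b → difference (+ a) (+ b) ((u a ⊠ u b) n))

  coefficients : ∀ n → + 2 ℤ.* ∑∑ (suc n) (λ a b → (p (+ a) (+ b) ℤ.- g (+ a) (+ b)) ℤ.* (u a ⊠ u b) n)
    ≡ ∑ℤ (suc n) (λ i → L (+ n) (+ suc i) ℤ.* u (suc i) n)
  coefficients = divisor-sums p g (+ 2) F L (λ a d → p-g a d) p-sym g-sym
    (λ k → ≡.trans (partial (+ suc (suc k)) (suc k)) (G-F (+ k))) ≡.refl diagonal

-- Eisenstein series and Ramanujan's differential equations.

module Powers (D : DifferentialAlgebra) where
  open DifferentialAlgebra D
  open Solver using (solve; _:=_; _:+_; _:*_) renaming (con to :con)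

  ∂-^ : ∀ x n → ∂ (x ^ suc n) ≈ con (+ suc n) * (x ^ n * ∂ x)
  ∂-^ x zero    = trans (∂-* x 1#) (trans (+-congˡ (trans (*-congˡ ∂-1) (zeroʳ x)))
    (trans (+-identityʳ _) (trans (*-comm _ _) (trans (sym (*-identityˡ _)) (*-congʳ (sym con-1))))))
  ∂-^ x (suc n) = trans (∂-* x (x ^ suc n)) (trans (+-congˡ (*-congˡ (∂-^ x n)))
    (trans (solve 4 (λ x y z c → z :* (x :* y) :+ x :* (c :* (y :* z)) := (:con (+ 1) :+ c) :* (x :* y :* z)) refl x (x ^ n) (∂ x) (con (+ suc n)))
      (*-congʳ (sym (con-+ (+ 1) (+ suc n))))))

  ∂-^-logarithmic : ∀ x s n → ∂ x ≈ s * x → ∂ (x ^ n) ≈ con (+ n) * s * x ^ n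
  ∂-^-logarithmic x s zero    eq = trans ∂-1 (sym (trans (*-congʳ (trans (*-congʳ con-0) (zeroˡ s))) (zeroˡ 1#)))
  ∂-^-logarithmic x s (suc n) eq = trans (∂-^ x n) (trans (*-congˡ (*-congˡ eq))
    (solve 4 (λ c y s x → c :* (y :* (s :* x)) := c :* s :* (x :* y)) refl (con (+ suc n)) (x ^ n) s x))

⊞-at : ∀ {f g n a b} → f n ≡ a → g n ≡ b → (f ⊞ g) n ≡ a ℤ.+ b
⊞-at {f} {g} {n} p q = ≡.trans (⊞-coefficient f g n) (≡.cong₂ ℤ._+_ p q)

con-at : ∀ c {f n a} → f n ≡ a → (conPS c ⊠ f) n ≡ c ℤ.* a
con-at c {f} {n} p = ≡.trans (con-⊠ c f n) (≡.cong (c ℤ.*_) p)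

θ-at : ∀ {f n} → θ f n ≡ + n ℤ.* f n
θ-at {f} {n} = θ-coefficient f n

-- In degree n this is the classical 12 Σ σ₁(k)σ₁(n-k) = 5σ₃(n) + (1 - 6n)σ₁(n); the factor n
-- becomes θ. The two identities after it arise in the same way from the quartic and sextic forms.
S1²-identity : conPS (+ 12) ⊠ (S 1 ⊠ S 1) ⊞ conPS (+ 6) ⊠ θ (S 1) ≋ conPS (+ 5) ⊠ S 3 ⊞ S 1
S1²-identity = mk≋ λ n → ≡.trans (⊞-at (con-at (+ 12) ≡.refl) (con-at (+ 6) θ-at)) (≡.trans
  (LinearCombination.modulo₁ ℤ-algebra (+ 1) (eq n) (solve 4 (λ x s t n →
     con (+ 12) :* x :+ con (+ 6) :* (n :* s) := con (+ 5) :* t :+ s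
       :+ con (+ 1) :* (con (+ 6) :* (con (+ 2) :* x :+ con (+ 0) :* x) :- (con (+ 5) :* t :+ (con (+ 1) :- con (+ 6) :* n) :* s))) ≡.refl ((S 1 ⊠ S 1) n) (S 1 n) (S 3 n) (+ n)))
  (≡.sym (⊞-at (con-at (+ 5) ≡.refl) ≡.refl)))
  where
  open ℤ-solver using (solve; _:=_; _:+_; _:*_; _:-_; con)
  eq : ∀ n → + 6 ℤ.* (+ 2 ℤ.* (S 1 ⊠ S 1) n ℤ.+ + 0 ℤ.* (S 1 ⊠ S 1) n) ≡ + 5 ℤ.* S 3 n ℤ.+ (+ 1 ℤ.- + 6 ℤ.* + n) ℤ.* S 1 n
  eq n = ≡.trans (≡.cong (+ 6 ℤ.*_) (≡.sym (Identity₂.products n))) (≡.trans (Identity₂.coefficients n) (≡.trans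
    (∑ℤ.∑-cong (suc n) (λ i _ → solve 3 (λ m n v →
      (con (+ 5) :* (m :* m :* m) :+ con (+ 1) :* m :- con (+ 6) :* (n :* m)) :* v
      := con (+ 5) :* (m :* (m :* (m :* con (+ 1))) :* v) :+ (con (+ 1) :- con (+ 6) :* n) :* (m :* con (+ 1) :* v)) ≡.refl (+ suc i) (+ n) (u (suc i) n)))
    (S-sum₂ (+ 5) 3 (+ 1 ℤ.- + 6 ℤ.* + n) 1 n)))

S1S3-identity : conPS (+ 240) ⊠ (S 1 ⊠ S 3) ⊞ conPS (+ 30) ⊠ θ (S 3) ⊞ S 1 ≋ conPS (+ 21) ⊠ S 5 ⊞ conPS (+ 10) ⊠ S 3
S1S3-identity = mk≋ λ n → ≡.trans (⊞-at (⊞-at (con-at (+ 240) ≡.refl) (con-at (+ 30) θ-at)) ≡.refl) (≡.trans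
  (LinearCombination.modulo₁ ℤ-algebra (+ 1) (eq n) (solve 5 (λ x r s t n →
     con (+ 240) :* x :+ con (+ 30) :* (n :* s) :+ r := con (+ 21) :* t :+ con (+ 10) :* s
       :+ con (+ 1) :* (con (+ 30) :* (con (+ 4) :* x :+ con (+ 4) :* x)
         :- (con (+ 21) :* t :+ (con (+ 10) :- con (+ 30) :* n) :* s :- r))) ≡.refl ((S 1 ⊠ S 3) n) (S 1 n) (S 3 n) (S 5 n) (+ n)))
  (≡.sym (⊞-at (con-at (+ 21) ≡.refl) (con-at (+ 10) ≡.refl))))
  where
  open ℤ-solver using (solve; _:=_; _:+_; _:*_; _:-_; :-_; con)
  eq : ∀ n → + 30 ℤ.* (+ 4 ℤ.* (S 1 ⊠ S 3) n ℤ.+ + 4 ℤ.* (S 1 ⊠ S 3) n)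
    ≡ + 21 ℤ.* S 5 n ℤ.+ (+ 10 ℤ.- + 30 ℤ.* + n) ℤ.* S 3 n ℤ.- S 1 n
  eq n = ≡.trans (≡.cong (λ z → + 30 ℤ.* (+ 4 ℤ.* (S 1 ⊠ S 3) n ℤ.+ + 4 ℤ.* z)) (at (𝕊.*-comm (S 1) (S 3)) n))
    (≡.trans (≡.cong (+ 30 ℤ.*_) (≡.sym (Identity₄.products n))) (≡.trans (Identity₄.coefficients n) (≡.trans
    (∑ℤ.∑-cong (suc n) (λ i _ → solve 3 (λ m n v →
      (con (+ 21) :* (m :* m :* m :* m :* m) :+ con (+ 10) :* (m :* m :* m) :- con (+ 1) :* m :- con (+ 30) :* (n :* m :* m :* m)) :* v
      := con (+ 21) :* (m :* (m :* (m :* (m :* (m :* con (+ 1))))) :* v) :+ (con (+ 10) :- con (+ 30) :* n) :* (m :* (m :* (m :* con (+ 1))) :* v)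
         :+ (:- con (+ 1)) :* (m :* con (+ 1) :* v)) ≡.refl (+ suc i) (+ n) (u (suc i) n)))
    (≡.trans (∑ℤ.∑-+ (suc n) (λ i → + 21 ℤ.* ((+ suc i) ℤ.^ 5 ℤ.* u (suc i) n) ℤ.+ (+ 10 ℤ.- + 30 ℤ.* + n) ℤ.* ((+ suc i) ℤ.^ 3 ℤ.* u (suc i) n)) (λ i → ℤ.- + 1 ℤ.* ((+ suc i) ℤ.^ 1 ℤ.* u (suc i) n)))
      (≡.cong₂ ℤ._+_ (S-sum₂ (+ 21) 5 (+ 10 ℤ.- + 30 ℤ.* + n) 3 n) (≡.trans (S-sum-* (ℤ.- + 1) 1 n) (ℤP.-1*i≡-i (S 1 n))))))))

S1S5-identity : conPS (+ 1008) ⊠ (S 1 ⊠ S 5) ⊞ conPS (+ 84) ⊠ θ (S 5)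
  ≋ conPS (+ 4800) ⊠ (S 3 ⊠ S 3) ⊞ conPS (+ 2) ⊠ S 1 ⊞ conPS (+ 42) ⊠ S 5 ⊞ conPS (+ 40) ⊠ S 3
S1S5-identity = mk≋ λ n → ≡.trans (⊞-at (con-at (+ 1008) ≡.refl) (con-at (+ 84) θ-at)) (≡.trans
  (LinearCombination.modulo₁ ℤ-algebra (+ 1) (eq n) (solve 6 (λ x y r s t n →
     con (+ 1008) :* x :+ con (+ 84) :* (n :* t) := con (+ 4800) :* y :+ con (+ 2) :* r :+ con (+ 42) :* t :+ con (+ 40) :* s
       :+ con (+ 1) :* (con (+ 2) :* (con (+ 252) :* x :+ con (+ 252) :* x :+ (:- con (+ 2400)) :* y)
         :- ((con (+ 42) :- con (+ 84) :* n) :* t :+ con (+ 40) :* s :+ con (+ 2) :* r))) ≡.refl ((S 1 ⊠ S 5) n) ((S 3 ⊠ S 3) n) (S 1 n) (S 3 n) (S 5 n) (+ n)))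
  (≡.sym (⊞-at (⊞-at (⊞-at (con-at (+ 4800) ≡.refl) (con-at (+ 2) ≡.refl)) (con-at (+ 42) ≡.refl)) (con-at (+ 40) ≡.refl))))
  where
  open ℤ-solver using (solve; _:=_; _:+_; _:*_; _:-_; :-_; con)
  eq : ∀ n → + 2 ℤ.* (+ 252 ℤ.* (S 1 ⊠ S 5) n ℤ.+ + 252 ℤ.* (S 1 ⊠ S 5) n ℤ.+ (ℤ.- + 2400) ℤ.* (S 3 ⊠ S 3) n)
    ≡ (+ 42 ℤ.- + 84 ℤ.* + n) ℤ.* S 5 n ℤ.+ + 40 ℤ.* S 3 n ℤ.+ + 2 ℤ.* S 1 n
  eq n = ≡.trans (≡.cong (λ z → + 2 ℤ.* (+ 252 ℤ.* (S 1 ⊠ S 5) n ℤ.+ + 252 ℤ.* z ℤ.+ (ℤ.- + 2400) ℤ.* (S 3 ⊠ S 3) n)) (at (𝕊.*-comm (S 1) (S 5)) n))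
    (≡.trans (≡.cong (+ 2 ℤ.*_) (≡.sym (Identity₆.products n))) (≡.trans (Identity₆.coefficients n) (≡.trans
    (∑ℤ.∑-cong (suc n) (λ i _ → solve 3 (λ m n v →
      (con (+ 42) :* (m :* m :* m :* m :* m) :+ con (+ 40) :* (m :* m :* m) :+ con (+ 2) :* m :- con (+ 84) :* (n :* m :* m :* m :* m :* m)) :* v
      := (con (+ 42) :- con (+ 84) :* n) :* (m :* (m :* (m :* (m :* (m :* con (+ 1))))) :* v) :+ con (+ 40) :* (m :* (m :* (m :* con (+ 1))) :* v)
         :+ con (+ 2) :* (m :* con (+ 1) :* v)) ≡.refl (+ suc i) (+ n) (u (suc i) n)))
    (≡.trans (∑ℤ.∑-+ (suc n) (λ i → (+ 42 ℤ.- + 84 ℤ.* + n) ℤ.* ((+ suc i) ℤ.^ 5 ℤ.* u (suc i) n) ℤ.+ + 40 ℤ.* ((+ suc i) ℤ.^ 3 ℤ.* u (suc i) n)) (λ i → + 2 ℤ.* ((+ suc i) ℤ.^ 1 ℤ.* u (suc i) n)))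
      (≡.cong₂ ℤ._+_ (S-sum₂ (+ 42 ℤ.- + 84 ℤ.* + n) 5 (+ 40) 3 n) (S-sum-* (+ 2) 1 n))))))

-- The Eisenstein series E₂, E₄, E₆ in Ramanujan's notation.
P Q R : PS
P = conPS (+ 1) ⊞ conPS (ℤ.- + 24) ⊠ S 1
Q = conPS (+ 1) ⊞ conPS (+ 240) ⊠ S 3
R = conPS (+ 1) ⊞ conPS (ℤ.- + 504) ⊠ S 5

private
  θ-affine : ∀ c f → θ (conPS (+ 1) ⊞ conPS c ⊠ f) ≋ conPS c ⊠ θ f
  θ-affine c f = 𝕊.trans (θ-⊞ (conPS (+ 1)) (conPS c ⊠ f)) (𝕊.trans (𝕊.+-cong (θ-con (+ 1)) (θ𝕊.∂-con* c f)) (𝕊.+-identityˡ _))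

module _ where
  open 𝕊.Solver using (solve; _:=_; _:+_; _:*_; _:-_; :-_; con)
  open LinearCombination PS-algebra

  θP : conPS (+ 12) ⊠ θ P ≋ P ⊠ P 𝕊.- Q
  θP = modulo₂ (conPS (+ 12)) (conPS (ℤ.- + 48)) (θ-affine (ℤ.- + 24) (S 1)) S1²-identity
    (solve 4 (λ s s′ t p → con (+ 12) :* p := let P = con (+ 1) :+ con (ℤ.- + 24) :* s in
      P :* P :- (con (+ 1) :+ con (+ 240) :* t) :+ con (+ 12) :* (p :- con (ℤ.- + 24) :* s′)
      :+ con (ℤ.- + 48) :* (con (+ 12) :* (s :* s) :+ con (+ 6) :* s′ :- (con (+ 5) :* t :+ s))) 𝕊.refl (S 1) (θ (S 1)) (S 3) (θ P))

  θQ : conPS (+ 3) ⊠ θ Q ≋ P ⊠ Q 𝕊.- R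
  θQ = modulo₂ (conPS (+ 3)) (conPS (+ 24)) (θ-affine (+ 240) (S 3)) S1S3-identity
    (solve 5 (λ s t t′ w Q′ → con (+ 3) :* Q′ := let P = con (+ 1) :+ con (ℤ.- + 24) :* s in
      P :* (con (+ 1) :+ con (+ 240) :* t) :- (con (+ 1) :+ con (ℤ.- + 504) :* w) :+ con (+ 3) :* (Q′ :- con (+ 240) :* t′)
      :+ con (+ 24) :* (con (+ 240) :* (s :* t) :+ con (+ 30) :* t′ :+ s :- (con (+ 21) :* w :+ con (+ 10) :* t))) 𝕊.refl (S 1) (S 3) (θ (S 3)) (S 5) (θ Q))

  θR : conPS (+ 2) ⊠ θ R ≋ P ⊠ R 𝕊.- Q ⊠ Q
  θR = modulo₂ (conPS (+ 2)) (conPS (ℤ.- + 12)) (θ-affine (ℤ.- + 504) (S 5)) S1S5-identity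
    (solve 5 (λ s t w w′ R′ → con (+ 2) :* R′ := let P = con (+ 1) :+ con (ℤ.- + 24) :* s in let Q = con (+ 1) :+ con (+ 240) :* t in
      P :* (con (+ 1) :+ con (ℤ.- + 504) :* w) :- Q :* Q :+ con (+ 2) :* (R′ :- con (ℤ.- + 504) :* w′)
      :+ con (ℤ.- + 12) :* (con (+ 1008) :* (s :* w) :+ con (+ 84) :* w′
        :- (con (+ 4800) :* (t :* t) :+ con (+ 2) :* s :+ con (+ 42) :* w :+ con (+ 40) :* t))) 𝕊.refl (S 1) (S 3) (S 5) (θ (S 5)) (θ R))

-- The infinite product, the discriminant and the q-expansion of j.

private
  u-coefficient : ∀ m n → u (suc m) (suc n) ≡ geomPS (suc m) (suc n)
  u-coefficient m n = ≡.sym (≡.trans (at (geom≋1+u m) (suc n)) (≡.trans (⊞-coefficient onePS (u (suc m)) (suc n)) (ℤP.+-identityˡ _)))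

  σ₃≡S : ∀ n → σ₃ (suc n) ≡ S 3 (suc n)
  σ₃≡S n = ≡.trans (sumBelow≡∑ (suc (suc n)) f) (≡.trans (∑ℤ.∑-head (suc n) f) (≡.trans
    (≡.cong₂ ℤ._+_ (≡.cong (λ b → if b then + 0 else + 0) (∧-zeroʳ (does (0 ∣? suc n))))
      (∑ℤ.∑-cong (suc n) (λ i _ → term i)))
    (≡.trans (ℤP.+-identityˡ _) (≡.sym (powerSum-coefficient (suc n) 3 (suc n))))))
    where
    f : ℕ → ℤ
    f d = if does (d ∣? suc n) ∧ (0 ℕ.<ᵇ d) then + (d ℕ.* d ℕ.* d) else + 0
    cube : ∀ i (b : Bool) → (if b ∧ true then + (suc i ℕ.* suc i ℕ.* suc i) else + 0) ≡ (+ suc i) ℤ.^ 3 ℤ.* (if b then + 1 else + 0)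
    cube i true  = ≡.trans (≡.trans (ℤP.pos-* (suc i ℕ.* suc i) (suc i)) (≡.cong (ℤ._* + suc i) (ℤP.pos-* (suc i) (suc i))))
      (ℤ-solver.solve 1 (λ x → x ℤ-solver.:* x ℤ-solver.:* x ℤ-solver.:= x ℤ-solver.:* (x ℤ-solver.:* (x ℤ-solver.:* ℤ-solver.con (+ 1))) ℤ-solver.:* ℤ-solver.con (+ 1)) ≡.refl (+ suc i))
    cube i false = ≡.sym (ℤP.*-zeroʳ ((+ suc i) ℤ.^ 3))
    term : ∀ i → f (suc i) ≡ (+ suc i) ℤ.^ 3 ℤ.* u (suc i) (suc n)
    term i = ≡.trans (cube i (does (suc i ∣? suc n))) (≡.cong ((+ suc i) ℤ.^ 3 ℤ.*_) (≡.sym (u-coefficient i n)))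

E₄≋Q : E₄ ≋ Q
E₄≋Q = mk≋ λ { zero    → ≡.sym (⊞-at ≡.refl (con-at (+ 240) (0PS-coefficient 0)))
             ; (suc n) → ≡.trans (≡.cong (+ 240 ℤ.*_) (σ₃≡S n))
                 (≡.sym (≡.trans (⊞-at ≡.refl (con-at (+ 240) ≡.refl)) (ℤP.+-identityˡ _))) }

private
  π : ℕ → PS
  π zero    = onePS
  π (suc N) = geomPS (suc N) ⊠ π N

  finPartProd≋π : ∀ N → finPartProd N ≋ π N
  finPartProd≋π zero    = 𝕊.refl
  finPartProd≋π (suc N) = mulPS≋⊠ 𝕊.refl (finPartProd≋π N)

  π-suc : ∀ N → π (suc N) ≋ π N ⊞ q 𝕊.^ suc N ⊠ (geomPS (suc N) ⊠ π N)
  π-suc N = 𝕊.trans (𝕊.*-congʳ (geom≋1+u N)) (solve 4 (λ a x g p → (a :^ 0 :+ x :* g) :* p := p :+ x :* (g :* p)) 𝕊.refl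
    onePS (q 𝕊.^ suc N) (geomPS (suc N)) (π N))
    where open 𝕊.Solver using (solve; _:=_; _:+_; _:*_; _:^_)

  π-stable : ∀ N k → k ≤ N → π N k ≡ π k k
  π-stable N k k≤N with ℕP.m≤n⇒m<n∨m≡n k≤N
  ... | inj₂ ≡.refl = ≡.refl
  π-stable (suc N) k _ | inj₁ (s≤s k≤N) = ≡.trans (at (π-suc N) k) (≡.trans (⊞-coefficient (π N) (q 𝕊.^ suc N ⊠ (geomPS (suc N) ⊠ π N)) k)
    (≡.trans (≡.cong₂ ℤ._+_ (π-stable N k k≤N) (q^⊠-low (suc N) (geomPS (suc N) ⊠ π N) k (s≤s k≤N))) (ℤP.+-identityʳ _)))

  θ-π : ∀ N → θ (π N) ≋ powerSum N 1 ⊠ π N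
  θ-π zero    = 𝕊.trans θ𝕊.∂-1 (𝕊.sym (𝕊.zeroˡ _))
  θ-π (suc N) = 𝕊.trans (θ-⊠ (geomPS (suc N)) (π N)) (LinearCombination.modulo₃ PS-algebra
      (π N) (geomPS (suc N)) (⊟ (c ⊠ U ⊠ π N)) θ-geom (θ-π N) (geom≋1+u N)
      (solve 7 (λ g g′ p p′ s c u → g′ :* p :+ g :* p′ := (s :+ c :* u) :* (g :* p)
        :+ p :* (g′ :- c :* (u :+ u :* u)) :+ g :* (p′ :- s :* p)
        :+ (:- (c :* u :* p)) :* (g :- (g :^ 0 :+ u))) 𝕊.refl (geomPS (suc N)) (θ (geomPS (suc N))) (π N) (θ (π N)) (powerSum N 1) c U)
    ⟨ 𝕊.trans ⟩ 𝕊.*-congʳ (𝕊.+-congˡ (𝕊.*-congʳ (mk≋ λ { zero → ≡.sym (ℤP.*-identityʳ (+ suc N)) ; (suc _) → ≡.refl }))))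
    where
    open 𝕊.Solver using (solve; _:=_; _:+_; _:*_; _:^_; _:-_; :-_)
    U c : PS
    U = u (suc N)
    c = conPS (+ suc N)
    θ-geom : θ (geomPS (suc N)) ≋ c ⊠ (U ⊞ U ⊠ U)
    θ-geom = 𝕊.trans (θ-cong (geom≋1+u N)) (𝕊.trans (θ-⊞ onePS U) (𝕊.trans (𝕊.+-cong θ𝕊.∂-1 (θ-u N)) (𝕊.+-identityˡ _)))

  partPS≡π : ∀ k N → k ≤ N → partPS k ≡ π N k
  partPS≡π k N k≤N = ≡.trans (at (finPartProd≋π k) k) (≡.sym (π-stable N k k≤N))

-- The factor 1/(1 - qⁿ) has logarithmic derivative n uₙ, and these add up to `S 1`. The infinite
-- product is read off finite products: in degree k those with at least k factors agree.
θ-partPS : θ partPS ≋ S 1 ⊠ partPS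
θ-partPS = mk≋ λ k → ≡.trans (θ-coefficient partPS k) (≡.trans (≡.cong (+ k ℤ.*_) (partPS≡π k k ℕP.≤-refl))
  (≡.trans (≡.sym (θ-coefficient (π k) k)) (≡.trans (at (θ-π k) k) (≡.trans
    (⊠-congʳ-below k {powerSum k 1} {S 1} {π k} (λ i i≤k → powerSum-stable k 1 i i≤k))
    (⊠-congˡ-below k {S 1} {π k} {partPS} (λ i i≤k → ≡.sym (partPS≡π i k i≤k)))))))

-- This is q/Δ.
D : PS
D = partPS 𝕊.^ 24

θD : θ D ≋ (conPS (+ 1) 𝕊.- P) ⊠ D
θD = 𝕊.trans (Powers.∂-^-logarithmic PS-differential partPS (S 1) 24 θ-partPS)
  (𝕊.*-congʳ (solve 1 (λ s → con (+ 24) :* s := con (+ 1) :- (con (+ 1) :+ con (ℤ.- + 24) :* s)) 𝕊.refl (S 1)))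
  where open 𝕊.Solver using (solve; _:=_; _:+_; _:*_; _:-_; con)

Jq≋ : Jq ≋ Q ⊠ Q ⊠ Q ⊠ D
Jq≋ = mulPS≋⊠ (𝕊.trans (powPS≋^ E₄ 3) (𝕊.trans (𝕊.*-cong E₄≋Q (𝕊.*-cong E₄≋Q (𝕊.*-congʳ E₄≋Q)))
  (solve 1 (λ x → x :* (x :* (x :* x :^ 0)) := x :* x :* x) 𝕊.refl Q))) (powPS≋^ partPS 24)
  where open 𝕊.Solver using (solve; _:=_; _:*_; _:^_)

private
  -- E₄³ - E₆² satisfies the same first-order equation as 1/D, up to a factor q.
  cusp : PS
  cusp = (Q ⊠ Q ⊠ Q 𝕊.- R ⊠ R) ⊠ D

  θ-cusp : θ cusp ≋ cusp
  θ-cusp = 𝕊.trans derivative (LinearCombination.modulo₃ PS-algebra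
    (Q ⊠ Q ⊠ D) (⊟ (R ⊠ D)) (Q ⊠ Q ⊠ Q 𝕊.- R ⊠ R) θQ θR θD
    (solve 7 (λ q r d q′ r′ d′ p →
      (con (+ 3) :* (q :* q :* q′) :- con (+ 2) :* (r :* r′)) :* d :+ (q :* q :* q :- r :* r) :* d′
      := (q :* q :* q :- r :* r) :* d :+ q :* q :* d :* (con (+ 3) :* q′ :- (p :* q :- r))
        :+ (:- (r :* d)) :* (con (+ 2) :* r′ :- (p :* r :- q :* q))
        :+ (q :* q :* q :- r :* r) :* (d′ :- (con (+ 1) :- p) :* d)
      ) 𝕊.refl Q R D (θ Q) (θ R) (θ D) P))
    where
    open 𝕊.Solver using (solve; _:=_; _:+_; _:*_; _:-_; :-_; con)
    derivative : θ cusp ≋ (conPS (+ 3) ⊠ (Q ⊠ Q ⊠ θ Q) 𝕊.- conPS (+ 2) ⊠ (R ⊠ θ R)) ⊠ D ⊞ (Q ⊠ Q ⊠ Q 𝕊.- R ⊠ R) ⊠ θ D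
    derivative = 𝕊.trans (θ-⊠ (Q ⊠ Q ⊠ Q 𝕊.- R ⊠ R) D) (𝕊.+-congʳ (𝕊.*-congʳ (𝕊.trans (θ𝕊.∂-sub (Q ⊠ Q ⊠ Q) (R ⊠ R)) (𝕊.trans
      (𝕊.+-cong (𝕊.trans (θ-⊠ (Q ⊠ Q) Q) (𝕊.+-congʳ (𝕊.*-congʳ (θ-⊠ Q Q)))) (𝕊.-‿cong (θ-⊠ R R)))
      (solve 4 (λ q q′ r r′ → (q′ :* q :+ q :* q′) :* q :+ q :* q :* q′ :- (r′ :* r :+ r :* r′)
        := con (+ 3) :* (q :* q :* q′) :- con (+ 2) :* (r :* r′)) 𝕊.refl Q (θ Q) R (θ R))))))

  -- θf = f says k f(k) = f(k), so only the coefficient of q survives.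
  cusp-coefficient : ∀ k → k ≢ 1 → cusp k ≡ + 0
  cusp-coefficient zero    _   = ≡.trans (≡.sym (at θ-cusp 0)) (θ-coefficient cusp 0)
  cusp-coefficient (suc zero) k≢1 = contradiction ≡.refl k≢1
  cusp-coefficient (suc (suc k)) _ = ℤP.*-cancelˡ-≡ (+ suc k) (cusp (suc (suc k))) (+ 0)
    (ℤA.+-cancelʳ (cusp (suc (suc k))) (+ suc k ℤ.* cusp (suc (suc k))) (+ suc k ℤ.* + 0) (≡.trans
      (ℤ-solver.solve 2 (λ k w → k ℤ-solver.:* w ℤ-solver.:+ w ℤ-solver.:= (ℤ-solver.con (+ 1) ℤ-solver.:+ k) ℤ-solver.:* w) ≡.refl (+ suc k) (cusp (suc (suc k))))
      (≡.trans (≡.sym (θ-coefficient cusp (suc (suc k)))) (≡.trans (at θ-cusp (suc (suc k)))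
        (≡.sym (≡.trans (≡.cong (ℤ._+ cusp (suc (suc k))) (ℤP.*-zeroʳ (+ suc k))) (ℤP.+-identityˡ _)))))))

  S-1 : ∀ k → S k 1 ≡ + 1
  S-1 k = ≡.trans (powerSum-coefficient 1 k 1) (≡.trans (ℤP.+-identityˡ _)
    (≡.cong₂ ℤ._*_ (ℤP.^-zeroˡ k) (u-coefficient 0 0)))

  affine-1 : ∀ c k → (conPS (+ 1) ⊞ conPS c ⊠ S k) 1 ≡ c
  affine-1 c k = ≡.trans (⊞-at ≡.refl (con-at c (S-1 k))) (≡.trans (ℤP.+-identityˡ _) (ℤP.*-identityʳ c))

  affine-0 : ∀ c k → (conPS (+ 1) ⊞ conPS c ⊠ S k) 0 ≡ + 1
  affine-0 c k = ≡.trans (⊞-at ≡.refl (con-at c (0PS-coefficient 0))) (≡.cong (λ z → + 1 ℤ.+ z) (ℤP.*-zeroʳ c))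

  ⊠-at-0 : ∀ {f g a b} → f 0 ≡ a → g 0 ≡ b → (f ⊠ g) 0 ≡ a ℤ.* b
  ⊠-at-0 {f} {g} p q = ≡.trans (⊠-0 f g) (≡.cong₂ ℤ._*_ p q)

  ⊠-at-1 : ∀ {f g a b a′ b′} → f 0 ≡ a → f 1 ≡ a′ → g 0 ≡ b → g 1 ≡ b′ → (f ⊠ g) 1 ≡ a ℤ.* b′ ℤ.+ a′ ℤ.* b
  ⊠-at-1 {f} {g} p p′ q q′ = ≡.trans (⊠-1 f g) (≡.cong₂ ℤ._+_ (≡.cong₂ ℤ._*_ p q′) (≡.cong₂ ℤ._*_ p′ q))

^-at-0 : ∀ f n → f 0 ≡ + 1 → (f 𝕊.^ n) 0 ≡ + 1
^-at-0 f zero    eq = ≡.refl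
^-at-0 f (suc n) eq = ≡.trans (⊠-0 f (f 𝕊.^ n)) (≡.cong₂ ℤ._*_ eq (^-at-0 f n eq))

D-0 : D 0 ≡ + 1
D-0 = ^-at-0 partPS 24 ≡.refl

-- E₄³ - E₆² = 1728 Δ, multiplied by q/Δ. Since the left side is a multiple of q, one coefficient
-- decides: 3 · 240 + 2 · 504 = 1728.
discriminant : (Q ⊠ Q ⊠ Q 𝕊.- R ⊠ R) ⊠ D ≋ conPS (+ 1728) ⊠ q
discriminant = mk≋ λ
  { zero → ≡.trans (cusp-coefficient 0 (λ ())) (≡.sym (con-⊠ (+ 1728) q 0))
  ; (suc zero) → ≡.trans cusp-1 (≡.sym (con-⊠ (+ 1728) q 1))
  ; (suc (suc k)) → ≡.trans (cusp-coefficient (suc (suc k)) (λ ())) (≡.sym (≡.trans (con-⊠ (+ 1728) q (suc (suc k))) (ℤP.*-zeroʳ (+ 1728)))) }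
  where
  Q0 = affine-0 (+ 240) 3
  Q1 = affine-1 (+ 240) 3
  R0 = affine-0 (ℤ.- + 504) 5
  R1 = affine-1 (ℤ.- + 504) 5
  cusp-1 : cusp 1 ≡ + 1728
  cusp-1 = ≡.trans (⊠-1 (Q ⊠ Q ⊠ Q 𝕊.- R ⊠ R) D) (≡.trans (≡.cong₂ ℤ._+_
    (≡.cong (ℤ._* D 1) (⊞-at (⊠-at-0 (⊠-at-0 Q0 Q0) Q0) (≡.trans (⊟-coefficient (R ⊠ R) 0) (≡.cong ℤ.-_ (⊠-at-0 R0 R0)))))
    (≡.cong₂ ℤ._*_ (⊞-at (⊠-at-1 (⊠-at-0 Q0 Q0) (⊠-at-1 Q0 Q1 Q0 Q1) Q0 Q1)
      (≡.trans (⊟-coefficient (R ⊠ R) 1) (≡.cong ℤ.-_ (⊠-at-1 R0 R1 R0 R1)))) D-0)) (≡.cong (ℤ._+ + 1728) (ℤP.*-zeroˡ (D 1))))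

-- Laurent series as a differential ring with constant terms.

-- Laurent series, as fractions f/qⁿ.  The denominator is kept as a series, so that the ring laws are polynomial identities.
record Laurent : Set where
  no-eta-equality
  field
    num  : PS
    den  : PS
    pole : ℕ
    den≋ : den ≋ q 𝕊.^ pole
open Laurent public

infix 4 _≅_
record _≅_ (x y : Laurent) : Set where
  constructor mk≅
  field cross : num x ⊠ den y ≋ num y ⊠ den x
open _≅_ public

module LaurentRing where
  open 𝕊 hiding (isCommutativeRing)
  open 𝕊.Solver using (solve; _:=_; _:+_; _:*_; _:-_; :-_) renaming (con to :con)
  open LinearCombination PS-algebra

  den-cancel : ∀ x {f g} → den x ⊠ f ≋ den x ⊠ g → f ≋ g
  den-cancel x eq = q^-cancel (pole x) (trans (*-congʳ (sym (den≋ x))) (trans eq (*-congʳ (den≋ x))))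

  ≅-refl : ∀ {x} → x ≅ x
  ≅-refl = mk≅ refl

  ≅-sym : ∀ {x y} → x ≅ y → y ≅ x
  ≅-sym p = mk≅ (sym (cross p))

  ≅-trans : ∀ {x y z} → x ≅ y → y ≅ z → x ≅ z
  ≅-trans {x} {y} {z} p r = mk≅ (den-cancel y (modulo₂ (den z) (den x) (cross p) (cross r)
    (solve 6 (λ f d g e h k → e :* (f :* k) := e :* (h :* d) :+ k :* (f :* e :- g :* d) :+ d :* (g :* k :- h :* e)) refl
      (num x) (den x) (num y) (den y) (num z) (den z))))

  infixl 7 _*ᴸ_
  infixl 6 _+ᴸ_
  opaque
    conᴸ : ℤ → Laurent
    conᴸ c = record { num = conPS c ; den = conPS (+ 1) ; pole = 0 ; den≋ = sym onePS≋con }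

    ι : PS → Laurent
    ι f = record { num = f ; den = conPS (+ 1) ; pole = 0 ; den≋ = sym onePS≋con }

    _/q^_ : PS → ℕ → Laurent
    f /q^ n = record { num = f ; den = q ^ n ; pole = n ; den≋ = refl }

    _*ᴸ_ : Laurent → Laurent → Laurent
    x *ᴸ y = record { num = num x ⊠ num y ; den = den x ⊠ den y ; pole = pole x ℕ.+ pole y
                    ; den≋ = trans (*-cong (den≋ x) (den≋ y)) (sym (^-homo-* q (pole x) (pole y))) }

    _+ᴸ_ : Laurent → Laurent → Laurent
    x +ᴸ y = record { num = num x ⊠ den y ⊞ num y ⊠ den x ; den = den x ⊠ den y ; pole = pole x ℕ.+ pole y
                    ; den≋ = trans (*-cong (den≋ x) (den≋ y)) (sym (^-homo-* q (pole x) (pole y))) }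

    -ᴸ_ : Laurent → Laurent
    -ᴸ x = record { num = ⊟ num x ; den = den x ; pole = pole x ; den≋ = den≋ x }

    θᴸ : Laurent → Laurent
    θᴸ x = record { num = θ (num x) ⊠ den x - num x ⊠ θ (den x) ; den = den x ⊠ den x ; pole = pole x ℕ.+ pole x
                  ; den≋ = trans (*-cong (den≋ x) (den≋ x)) (sym (^-homo-* q (pole x) (pole x))) }

    -- The coefficient of q⁰. Since θt · dq/q = dt, the constant term of x · θt is the residue of
    -- the differential x dt, and `CT-θ` says that exact differentials have no residue.
    CT : Laurent → ℤ
    CT x = num x (pole x)

  opaque
    unfolding _*ᴸ_

    Laurent-isCommutativeRing : IsCommutativeRing _≅_ _+ᴸ_ _*ᴸ_ -ᴸ_ (conᴸ (+ 0)) (conᴸ (+ 1))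
    Laurent-isCommutativeRing = record
      { isRing = record
        { +-isAbelianGroup = record
          { isGroup = record
            { isMonoid = record
              { isSemigroup = record
                { isMagma = record
                  { isEquivalence = record { refl = ≅-refl ; sym = ≅-sym ; trans = ≅-trans }
                  ; ∙-cong = λ {x} {x′} {y} {y′} p r → mk≅ (modulo₂ (den y ⊠ den y′) (den x ⊠ den x′) (cross p) (cross r)
                      (solve 8 (λ f d f′ d′ g e g′ e′ → (f :* e :+ g :* d) :* (d′ :* e′) := (f′ :* e′ :+ g′ :* d′) :* (d :* e)
                         :+ e :* e′ :* (f :* d′ :- f′ :* d) :+ d :* d′ :* (g :* e′ :- g′ :* e)) refl
                        (num x) (den x) (num x′) (den x′) (num y) (den y) (num y′) (den y′))) }
                ; assoc = λ x y z → mk≅ (solve 6 (λ f d g e h k → ((f :* e :+ g :* d) :* k :+ h :* (d :* e)) :* (d :* (e :* k))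
                    := (f :* (e :* k) :+ (g :* k :+ h :* e) :* d) :* (d :* e :* k)) refl (num x) (den x) (num y) (den y) (num z) (den z)) }
              ; identity = (λ x → mk≅ (solve 2 (λ f d → (:con (+ 0) :* d :+ f :* :con (+ 1)) :* d := f :* (:con (+ 1) :* d)) refl (num x) (den x)))
                         , (λ x → mk≅ (solve 2 (λ f d → (f :* :con (+ 1) :+ :con (+ 0) :* d) :* d := f :* (d :* :con (+ 1))) refl (num x) (den x))) }
            ; inverse = (λ x → mk≅ (solve 2 (λ f d → ((:- f) :* d :+ f :* d) :* :con (+ 1) := :con (+ 0) :* (d :* d)) refl (num x) (den x)))
                      , (λ x → mk≅ (solve 2 (λ f d → (f :* d :+ (:- f) :* d) :* :con (+ 1) := :con (+ 0) :* (d :* d)) refl (num x) (den x)))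
            ; ⁻¹-cong = λ {x} {y} p → mk≅ (trans (sym (-‿distribˡ-* (num x) (den y))) (trans (-‿cong (cross p)) (-‿distribˡ-* (num y) (den x)))) }
          ; comm = λ x y → mk≅ (solve 4 (λ f d g e → (f :* e :+ g :* d) :* (e :* d) := (g :* d :+ f :* e) :* (d :* e)) refl (num x) (den x) (num y) (den y)) }
        ; *-cong = λ {x} {x′} {y} {y′} p r → mk≅ (trans
            (solve 4 (λ f d g e → f :* g :* (d :* e) := f :* d :* (g :* e)) refl (num x) (den x′) (num y) (den y′)) (trans (*-cong (cross p) (cross r))
            (solve 4 (λ f d g e → f :* d :* (g :* e) := f :* g :* (d :* e)) refl (num x′) (den x) (num y′) (den y))))
        ; *-assoc = λ x y z → mk≅ (solve 6 (λ f d g e h k → f :* g :* h :* (d :* (e :* k)) := f :* (g :* h) :* (d :* e :* k)) refl (num x) (den x) (num y) (den y) (num z) (den z))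
        ; *-identity = (λ x → mk≅ (solve 2 (λ f d → :con (+ 1) :* f :* d := f :* (:con (+ 1) :* d)) refl (num x) (den x)))
                     , (λ x → mk≅ (solve 2 (λ f d → f :* :con (+ 1) :* d := f :* (d :* :con (+ 1))) refl (num x) (den x)))
        ; distrib = (λ x y z → mk≅ (solve 6 (λ f d g e h k → f :* (g :* k :+ h :* e) :* (d :* e :* (d :* k))
                       := (f :* g :* (d :* k) :+ f :* h :* (d :* e)) :* (d :* (e :* k))) refl (num x) (den x) (num y) (den y) (num z) (den z)))
                  , (λ x y z → mk≅ (solve 6 (λ f d g e h k → (g :* k :+ h :* e) :* f :* (e :* d :* (k :* d))
                       := (g :* f :* (k :* d) :+ h :* f :* (e :* d)) :* (e :* k :* d)) refl (num x) (den x) (num y) (den y) (num z) (den z))) }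
      ; *-comm = λ x y → mk≅ (solve 4 (λ f d g e → f :* g :* (e :* d) := g :* f :* (d :* e)) refl (num x) (den x) (num y) (den y)) }

    conᴸ-+ : ∀ i j → conᴸ (i ℤ.+ j) ≅ conᴸ i +ᴸ conᴸ j
    conᴸ-+ i j = mk≅ (trans (*-congʳ (con-+ i j)) (solve 2 (λ x y → (x :+ y) :* (:con (+ 1) :* :con (+ 1))
      := (x :* :con (+ 1) :+ y :* :con (+ 1)) :* :con (+ 1)) refl (conPS i) (conPS j)))

    conᴸ-* : ∀ i j → conᴸ (i ℤ.* j) ≅ conᴸ i *ᴸ conᴸ j
    conᴸ-* i j = mk≅ (trans (*-congʳ (con-* i j)) (solve 2 (λ x y → x :* y :* (:con (+ 1) :* :con (+ 1)) := x :* y :* :con (+ 1)) refl (conPS i) (conPS j)))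

    conᴸ-neg : ∀ i → conᴸ (ℤ.- i) ≅ -ᴸ conᴸ i
    conᴸ-neg i = mk≅ (*-congʳ (con-- i))

    θᴸ-cong : ∀ {x y} → x ≅ y → θᴸ x ≅ θᴸ y
    θᴸ-cong {x} {y} p = mk≅ (modulo₂ (den x ⊠ den y) (⊟ (θ (den x) ⊠ den y ⊞ θ (den y) ⊠ den x)) derivative (cross p)
      (solve 8 (λ f f′ d d′ g g′ e e′ → (f′ :* d :- f :* d′) :* (e :* e) := (g′ :* e :- g :* e′) :* (d :* d)
        :+ d :* e :* (f′ :* e :+ f :* e′ :- (g′ :* d :+ g :* d′)) :+ (:- (d′ :* e :+ e′ :* d)) :* (f :* e :- g :* d)) refl
        (num x) (θ (num x)) (den x) (θ (den x)) (num y) (θ (num y)) (den y) (θ (den y))))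
      where
      derivative : θ (num x) ⊠ den y ⊞ num x ⊠ θ (den y) ≋ θ (num y) ⊠ den x ⊞ num y ⊠ θ (den x)
      derivative = trans (sym (θ-⊠ (num x) (den y))) (trans (θ-cong (cross p)) (θ-⊠ (num y) (den x)))

    θᴸ-+ : ∀ x y → θᴸ (x +ᴸ y) ≅ θᴸ x +ᴸ θᴸ y
    θᴸ-+ x y = mk≅ (trans (*-congʳ (+-cong
        (*-congʳ (trans (θ-⊞ (num x ⊠ den y) (num y ⊠ den x)) (+-cong (θ-⊠ (num x) (den y)) (θ-⊠ (num y) (den x)))))
        (-‿cong (*-congˡ (θ-⊠ (den x) (den y))))))
      (solve 8 (λ f f′ d d′ g g′ e e′ →
        ((f′ :* e :+ f :* e′ :+ (g′ :* d :+ g :* d′)) :* (d :* e) :- (f :* e :+ g :* d) :* (d′ :* e :+ d :* e′)) :* (d :* d :* (e :* e))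
        := ((f′ :* d :- f :* d′) :* (e :* e) :+ (g′ :* e :- g :* e′) :* (d :* d)) :* (d :* e :* (d :* e))) refl
        (num x) (θ (num x)) (den x) (θ (den x)) (num y) (θ (num y)) (den y) (θ (den y))))

    θᴸ-* : ∀ x y → θᴸ (x *ᴸ y) ≅ θᴸ x *ᴸ y +ᴸ x *ᴸ θᴸ y
    θᴸ-* x y = mk≅ (trans (*-congʳ (+-cong (*-congʳ (θ-⊠ (num x) (num y))) (-‿cong (*-congˡ (θ-⊠ (den x) (den y))))))
      (solve 8 (λ f f′ d d′ g g′ e e′ →
        ((f′ :* g :+ f :* g′) :* (d :* e) :- f :* g :* (d′ :* e :+ d :* e′)) :* (d :* d :* e :* (d :* (e :* e)))
        := ((f′ :* d :- f :* d′) :* g :* (d :* (e :* e)) :+ f :* (g′ :* e :- g :* e′) :* (d :* d :* e)) :* (d :* e :* (d :* e))) refl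
        (num x) (θ (num x)) (den x) (θ (den x)) (num y) (θ (num y)) (den y) (θ (den y))))

    θᴸ-neg : ∀ x → θᴸ (-ᴸ x) ≅ -ᴸ θᴸ x
    θᴸ-neg x = mk≅ (*-congʳ (trans (+-congʳ (*-congʳ (θ-⊟ (num x))))
      (solve 4 (λ f f′ d d′ → (:- f′) :* d :- (:- f) :* d′ := :- (f′ :* d :- f :* d′)) refl (num x) (θ (num x)) (den x) (θ (den x)))))

    θᴸ-con : ∀ c → θᴸ (conᴸ c) ≅ conᴸ (+ 0)
    θᴸ-con c = mk≅ (trans (*-congʳ (+-cong (*-congʳ (trans (θ-con c) (sym con-0))) (-‿cong (*-congˡ (trans (θ-con (+ 1)) (sym con-0))))))
      (solve 1 (λ x → (:con (+ 0) :* :con (+ 1) :- x :* :con (+ 0)) :* :con (+ 1) := :con (+ 0) :* (:con (+ 1) :* :con (+ 1))) refl (conPS c)))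

    ι-cong : ∀ {f g} → f ≋ g → ι f ≅ ι g
    ι-cong eq = mk≅ (*-congʳ eq)

    ι-injective : ∀ {f g} → ι f ≅ ι g → f ≋ g
    ι-injective {f} {g} p = trans (sym (*1 f)) (trans (cross p) (*1 g))
      where
      *1 : ∀ f → f ⊠ conPS (+ 1) ≋ f
      *1 f = trans (*-congˡ con-1) (*-identityʳ f)

    ι-+ : ∀ f g → ι (f ⊞ g) ≅ ι f +ᴸ ι g
    ι-+ f g = mk≅ (solve 2 (λ x y → (x :+ y) :* (:con (+ 1) :* :con (+ 1)) := (x :* :con (+ 1) :+ y :* :con (+ 1)) :* :con (+ 1)) refl f g)

    ι-* : ∀ f g → ι (f ⊠ g) ≅ ι f *ᴸ ι g
    ι-* f g = mk≅ (solve 2 (λ x y → x :* y :* (:con (+ 1) :* :con (+ 1)) := x :* y :* :con (+ 1)) refl f g)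

    ι-neg : ∀ f → ι (⊟ f) ≅ -ᴸ ι f
    ι-neg f = mk≅ refl

    ι-con : ∀ c → ι (conPS c) ≅ conᴸ c
    ι-con c = mk≅ refl

    θᴸ-ι : ∀ f → θᴸ (ι f) ≅ ι (θ f)
    θᴸ-ι f = mk≅ (trans (*-congʳ (+-congˡ (-‿cong (*-congˡ (trans (θ-con (+ 1)) (sym con-0))))))
      (solve 2 (λ f f′ → (f′ :* :con (+ 1) :- f :* :con (+ 0)) :* :con (+ 1) := f′ :* (:con (+ 1) :* :con (+ 1))) refl f (θ f)))

    clear : ∀ x → ι (q ^ pole x) *ᴸ x ≅ ι (num x)
    clear x = mk≅ (trans (*-congʳ (*-congʳ (sym (den≋ x)))) (solve 2 (λ f d → d :* f :* :con (+ 1) := f :* (:con (+ 1) :* d)) refl (num x) (den x)))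

    clear-/ : ∀ f n → ι (q ^ n) *ᴸ (f /q^ n) ≅ ι f
    clear-/ f n = mk≅ (solve 2 (λ f d → d :* f :* :con (+ 1) := f :* (:con (+ 1) :* d)) refl f (q ^ n))

    CT-cong : ∀ {x y} → x ≅ y → CT x ≡ CT y
    CT-cong {x} {y} p = ≡.trans (≡.sym (q^⊠-high (pole y) (num x) (pole x))) (≡.trans
      (at (trans (trans (*-congʳ (sym (den≋ y))) (*-comm (den y) (num x))) (trans (cross p) (trans (*-comm (num y) (den x)) (*-congʳ (den≋ x))))) (pole y ℕ.+ pole x))
      (≡.trans (≡.cong (q ^ pole x ⊠ num y) (ℕP.+-comm (pole y) (pole x))) (q^⊠-high (pole x) (num y) (pole y))))

    CT-+ : ∀ x y → CT (x +ᴸ y) ≡ CT x ℤ.+ CT y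
    CT-+ x y = ≡.trans (⊞-coefficient (num x ⊠ den y) (num y ⊠ den x) (pole x ℕ.+ pole y)) (≡.cong₂ ℤ._+_
      (≡.trans (at (trans (*-comm (num x) (den y)) (*-congʳ (den≋ y))) (pole x ℕ.+ pole y))
        (≡.trans (≡.cong (q ^ pole y ⊠ num x) (ℕP.+-comm (pole x) (pole y))) (q^⊠-high (pole y) (num x) (pole x))))
      (≡.trans (at (trans (*-comm (num y) (den x)) (*-congʳ (den≋ x))) (pole x ℕ.+ pole y)) (q^⊠-high (pole x) (num y) (pole y))))

    CT-con* : ∀ c x → CT (conᴸ c *ᴸ x) ≡ c ℤ.* CT x
    CT-con* c x = con-⊠ c (num x) (pole x)

    CT-/ : ∀ f n → CT (f /q^ n) ≡ f n
    CT-/ f n = ≡.refl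

    CT-θ : ∀ x → CT (θᴸ x) ≡ + 0
    CT-θ x = let n = pole x in ≡.trans (at (trans (+-cong (*-congˡ (den≋ x)) (-‿cong (*-congˡ (trans (θ-cong (den≋ x)) (θ-q^ n)))))
        (solve 4 (λ f f′ d c → f′ :* d :- f :* (c :* d) := d :* (f′ :- c :* f)) refl (num x) (θ (num x)) (q ^ n) (conPS (+ n)))) (n ℕ.+ n))
      (≡.trans (q^⊠-high n (θ (num x) - conPS (+ n) ⊠ num x) n) (≡.trans (⊞-at (θ-coefficient (num x) n)
        (≡.trans (⊟-coefficient (conPS (+ n) ⊠ num x) n) (≡.cong ℤ.-_ (con-⊠ (+ n) (num x) n)))) (ℤP.+-inverseʳ (+ n ℤ.* num x n))))

open LaurentRing using (conᴸ; ι; _/q^_; _*ᴸ_; _+ᴸ_; -ᴸ_; θᴸ; CT) public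

Laurent-algebra : ℤAlgebra
Laurent-algebra = record
  { commutativeRing = record { isCommutativeRing = LaurentRing.Laurent-isCommutativeRing }
  ; con = conᴸ ; con-+ = LaurentRing.conᴸ-+ ; con-* = LaurentRing.conᴸ-* ; con-- = LaurentRing.conᴸ-neg
  ; con-0 = LaurentRing.≅-refl ; con-1 = LaurentRing.≅-refl }

Laurent-differential : DifferentialAlgebra
Laurent-differential = record
  { algebra = Laurent-algebra ; ∂ = θᴸ ; ∂-cong = LaurentRing.θᴸ-cong ; ∂-+ = LaurentRing.θᴸ-+ ; ∂-* = LaurentRing.θᴸ-*
  ; ∂-neg = LaurentRing.θᴸ-neg ; ∂-con = LaurentRing.θᴸ-con }

module 𝕃 = ℤAlgebra Laurent-algebra
module ∑𝕃 = Sums Laurent-algebra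
module θ𝕃 = DifferentialAlgebra Laurent-differential

-- The third-order differential equation and its behaviour under change of parameter.

record Operations (A : Set) : Set where
  infixl 7 _⊙_
  infixl 6 _⊕_ _⊖_
  field
    _⊕_ _⊙_ : A → A → A
    κ       : ℤ → A
  _⊖_ : A → A → A
  x ⊖ y = x ⊕ κ (ℤ.- + 1) ⊙ y

-- With z′ = dz/dt and c = 1728, the series E₂(τ) equals M/N for z = j(τ), and Ramanujan's equation 12 E₂′ = E₂² - E₄
-- becomes F = 0, a third-order equation for j which every modular substitution preserves.  The combination Σ compares
-- it for two functions x and y, and is homogeneous under a change of the parameter t.
module Schwarzian {A : Set} (O : Operations A) where
  open Operations O

  c : A
  c = κ (+ 1728)

  -- w stands for z ⊖ c
  Nʷ : A → A → A → A
  Nʷ w z z₁ = z ⊙ z₁ ⊙ w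

  Mʷ : A → A → A → A → A
  Mʷ w z z₁ z₂ = κ (+ 6) ⊙ (z ⊙ z₂ ⊙ w) ⊖ κ (+ 4) ⊙ (z₁ ⊙ z₁ ⊙ w) ⊖ κ (+ 3) ⊙ (z₁ ⊙ z₁ ⊙ z)

  N′ʷ : A → A → A → A → A
  N′ʷ w z z₁ z₂ = z₁ ⊙ z₁ ⊙ w ⊕ z ⊙ z₂ ⊙ w ⊕ z ⊙ z₁ ⊙ z₁

  M′ʷ : A → A → A → A → A → A
  M′ʷ w z z₁ z₂ z₃ = κ (+ 6) ⊙ (z ⊙ z₃ ⊙ w) ⊖ κ (+ 2) ⊙ (z₁ ⊙ z₂ ⊙ w) ⊖ κ (+ 7) ⊙ (z₁ ⊙ z₁ ⊙ z₁)

  Fʷ : A → A → A → A → A → A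
  Fʷ w z z₁ z₂ z₃ = κ (+ 12) ⊙ (M′ʷ w z z₁ z₂ z₃ ⊙ Nʷ w z z₁ ⊖ Mʷ w z z₁ z₂ ⊙ N′ʷ w z z₁ z₂) ⊖ Mʷ w z z₁ z₂ ⊙ Mʷ w z z₁ z₂
    ⊕ z₁ ⊙ z₁ ⊙ z₁ ⊙ z₁ ⊙ (z ⊙ w)

  N : A → A → A
  N z = Nʷ (z ⊖ c) z

  M : A → A → A → A
  M z = Mʷ (z ⊖ c) z

  N′ : A → A → A → A
  N′ z = N′ʷ (z ⊖ c) z

  M′ : A → A → A → A → A
  M′ z = M′ʷ (z ⊖ c) z

  F : A → A → A → A → A
  F z = Fʷ (z ⊖ c) z

  Σ₂ : A → A → A → A → A → A → A → A → A
  Σ₂ x x₁ x₂ x₃ y y₁ y₂ y₃ = F x x₁ x₂ x₃ ⊙ (N y y₁ ⊙ N y y₁) ⊖ F y y₁ y₂ y₃ ⊙ (N x x₁ ⊙ N x x₁)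

-- The Schwarzian formulas are written once over bare operations and read in several ways: in a
-- ring, in the syntax of the ring solver, in dual numbers for first-order expansions, and in formal
-- polynomials in X and Y.
module AlgebraOperations (A : ℤAlgebra) where
  open ℤAlgebra A

  operations : Operations Carrier
  operations = record { _⊕_ = _+_ ; _⊙_ = _*_ ; κ = con }

  polynomials : ∀ {n} → Operations (Solver.Polynomial n)
  polynomials = record { _⊕_ = Solver._:+_ ; _⊙_ = Solver._:*_ ; κ = Solver.con }

-- Pairs (a, b) stand for a + bε with ε² = 0.
dual : ∀ {A} → Operations A → Operations (A × A)
dual O = record
  { _⊕_ = λ x y → proj₁ x ⊕′ proj₁ y , proj₂ x ⊕′ proj₂ y
  ; _⊙_ = λ x y → proj₁ x ⊙′ proj₁ y , proj₁ x ⊙′ proj₂ y ⊕′ proj₂ x ⊙′ proj₁ y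
  ; κ = λ c → κ′ c , κ′ (+ 0) }
  where open Operations O renaming (_⊕_ to infixl 6 _⊕′_; _⊙_ to infixl 7 _⊙′_; κ to κ′)

module Leading {A : Set} (O : Operations A) where
  open Operations O
  open Schwarzian (dual O) using (Fʷ; Nʷ)
  module D = Operations (dual O)

  -- Σ₂ at x = q⁻¹ and y = q^{-ℓ}(1 + bq + ⋯), for the derivation q d/dq, to first order
  Fˣ Fʸ Nˣ Nʸ leadingΣ : A → A → A × A
  -- The entry -1728 comes from x - 1728 = q⁻¹(1 - 1728q). For y the shift by 1728 has relative
  -- order q^ℓ, beyond first order when ℓ ≥ 2, so `Fʸ` uses the data (1, b) of y also for y - 1728.
  Fˣ l b = Fʷ (κ (+ 1) , κ (ℤ.- + 1728)) (κ (+ 1) , κ (+ 0)) (κ (ℤ.- + 1) , κ (+ 0)) (κ (+ 1) , κ (+ 0)) (κ (ℤ.- + 1) , κ (+ 0))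
  Nˣ l b = Nʷ (κ (+ 1) , κ (ℤ.- + 1728)) (κ (+ 1) , κ (+ 0)) (κ (ℤ.- + 1) , κ (+ 0))
  Fʸ l b = Fʷ (κ (+ 1) , b) (κ (+ 1) , b) (d (κ (+ 1)) , e b) (d (d (κ (+ 1))) , e (e b)) (d (d (d (κ (+ 1)))) , e (e (e b)))
    where
    d e : A → A
    d a = κ (ℤ.- + 1) ⊙ (l ⊙ a)
    e a = (κ (+ 1) ⊖ l) ⊙ a
  Nʸ l b = Nʷ (κ (+ 1) , b) (κ (+ 1) , b) (κ (ℤ.- + 1) ⊙ (l ⊙ κ (+ 1)) , (κ (+ 1) ⊖ l) ⊙ b)
  leadingΣ l b = Fˣ l b D.⊙ (Nʸ l b D.⊙ Nʸ l b) D.⊖ Fʸ l b D.⊙ (Nˣ l b D.⊙ Nˣ l b)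

module LeadingValue (A : ℤAlgebra) where
  open ℤAlgebra A
  open AlgebraOperations A
  open Solver using (solve; _:=_; _:+_; _:*_)

  -- The value to expect: if 1/s = q⁻¹ + 744 + ⋯ is taken as new coordinate, q^(-l) becomes s^(-l)(1
  -- - 744 l s + ⋯), so the linear coefficient compatible with the modular equation is b = -744 l,
  -- the zero of the last factor.
  leadingΣ≈ : ∀ l b → proj₂ (Leading.leadingΣ operations l b) ≈ con (+ 72) * l * (con (+ 744) * l + b)
  leadingΣ≈ = solve 2 (λ l b → proj₂ (Leading.leadingΣ polynomials l b) := Solver.con (+ 72) :* l :* (Solver.con (+ 744) :* l :+ b)) refl

module Reparametrisation (A : ℤAlgebra) where
  open ℤAlgebra A
  open AlgebraOperations A
  open Schwarzian operations public
  open Solver using (solve; _:=_; _:+_; _:*_; _:-_; Polynomial)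
  private
    module S {n} = Schwarzian (polynomials {n})
    :F̂ : ∀ {n} → (z z₁ z₂ z₃ ν α β : Polynomial n) → Polynomial n
    :F̂ z z₁ z₂ z₃ ν α β = S.F z (ν :* z₁) (α :* z₁ :+ ν :* ν :* z₂) (β :* z₁ :+ Solver.con (+ 3) :* ν :* α :* z₂ :+ ν :* ν :* ν :* z₃)

  F̂ : (z z₁ z₂ z₃ ν α β : Carrier) → Carrier
  F̂ z z₁ z₂ z₃ ν α β = F z (ν * z₁) (α * z₁ + ν * ν * z₂) (β * z₁ + con (+ 3) * ν * α * z₂ + ν * ν * ν * z₃)

  -- The arguments of `F̂` are the derivatives of z under ν d/dt, with α = νν′ and β = να′. Then
  -- 72νβ - 108α² = 72ν²(νν″ - ν′²/2) is a Schwarzian derivative of the parameter change, and z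
  -- enters the correction only through N².
  F-reparametrise : ∀ z z₁ z₂ z₃ ν α β → F̂ z z₁ z₂ z₃ ν α β
    ≈ ν * ν * ν * ν * F z z₁ z₂ z₃ + (con (+ 72) * (ν * β) - con (+ 108) * (α * α)) * (N z z₁ * N z z₁)
  F-reparametrise = solve 7 (λ z z₁ z₂ z₃ ν α β → :F̂ z z₁ z₂ z₃ ν α β
    := ν :* ν :* ν :* ν :* S.F z z₁ z₂ z₃ :+ (Solver.con (+ 72) :* (ν :* β) :- Solver.con (+ 108) :* (α :* α)) :* (S.N z z₁ :* S.N z z₁)) refl

  N-reparametrise : ∀ z z₁ ν → N z (ν * z₁) ≈ ν * N z z₁
  N-reparametrise = solve 3 (λ z z₁ ν → S.N z (ν :* z₁) := ν :* S.N z z₁) refl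

  -- Cross-multiplication by the squares of `N` cancels the Schwarzian corrections of x and y. What
  -- remains has weight 4 from `F` and weight 2 from N².
  Σ₂-reparametrise : ∀ x x₁ x₂ x₃ y y₁ y₂ y₃ ν α β →
    Σ₂ x (ν * x₁) (α * x₁ + ν * ν * x₂) (β * x₁ + con (+ 3) * ν * α * x₂ + ν * ν * ν * x₃)
       y (ν * y₁) (α * y₁ + ν * ν * y₂) (β * y₁ + con (+ 3) * ν * α * y₂ + ν * ν * ν * y₃)
    ≈ ν * ν * ν * ν * ν * ν * Σ₂ x x₁ x₂ x₃ y y₁ y₂ y₃
  Σ₂-reparametrise x x₁ x₂ x₃ y y₁ y₂ y₃ ν α β = trans
    (+-cong (*-cong (F-reparametrise x x₁ x₂ x₃ ν α β) (*-cong (N-reparametrise y y₁ ν) (N-reparametrise y y₁ ν)))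
      (*-congˡ (*-cong (F-reparametrise y y₁ y₂ y₃ ν α β) (*-cong (N-reparametrise x x₁ ν) (N-reparametrise x x₁ ν)))))
    (solve 6 (λ f g m n ν ψ →
      (ν :* ν :* ν :* ν :* f :+ ψ :* (m :* m)) :* (ν :* n :* (ν :* n)) :+ Solver.con (ℤ.- + 1) :* ((ν :* ν :* ν :* ν :* g :+ ψ :* (n :* n)) :* (ν :* m :* (ν :* m)))
      := ν :* ν :* ν :* ν :* ν :* ν :* (f :* (n :* n) :+ Solver.con (ℤ.- + 1) :* (g :* (m :* m)))) refl
      (F x x₁ x₂ x₃) (F y y₁ y₂ y₃) (N x x₁) (N y y₁) ν (con (+ 72) * (ν * β) - con (+ 108) * (α * α)))

  Σ₂-cong : ∀ {x x₁ x₂ x₃ y y₁ y₂ y₃ x₁′ x₂′ x₃′ y₁′ y₂′ y₃′} → x₁ ≈ x₁′ → x₂ ≈ x₂′ → x₃ ≈ x₃′ → y₁ ≈ y₁′ → y₂ ≈ y₂′ → y₃ ≈ y₃′ →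
    Σ₂ x x₁ x₂ x₃ y y₁ y₂ y₃ ≈ Σ₂ x x₁′ x₂′ x₃′ y y₁′ y₂′ y₃′
  Σ₂-cong p₁ p₂ p₃ r₁ r₂ r₃ = +-cong (*-cong (F-cong p₁ p₂ p₃) (*-cong (N-cong r₁) (N-cong r₁)))
    (*-congˡ (*-cong (F-cong r₁ r₂ r₃) (*-cong (N-cong p₁) (N-cong p₁))))
    where
    N-cong : ∀ {z z₁ z₁′} → z₁ ≈ z₁′ → N z z₁ ≈ N z z₁′
    N-cong p = *-congʳ (*-congˡ p)
    M-cong : ∀ {z z₁ z₂ z₁′ z₂′} → z₁ ≈ z₁′ → z₂ ≈ z₂′ → M z z₁ z₂ ≈ M z z₁′ z₂′
    M-cong p₁ p₂ = +-cong (+-cong (*-congˡ (*-congʳ (*-congˡ p₂))) (*-congˡ (*-congˡ (*-congʳ (*-cong p₁ p₁))))) (*-congˡ (*-congˡ (*-congʳ (*-cong p₁ p₁))))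
    F-cong : ∀ {z z₁ z₂ z₃ z₁′ z₂′ z₃′} → z₁ ≈ z₁′ → z₂ ≈ z₂′ → z₃ ≈ z₃′ → F z z₁ z₂ z₃ ≈ F z z₁′ z₂′ z₃′
    F-cong p₁ p₂ p₃ = +-cong (+-cong (*-congˡ (+-cong
      (*-cong (+-cong (+-cong (*-congˡ (*-congʳ (*-congˡ p₃))) (*-congˡ (*-congˡ (*-congʳ (*-cong p₁ p₂))))) (*-congˡ (*-congˡ (*-cong (*-cong p₁ p₁) p₁)))) (N-cong p₁))
      (*-congˡ (*-cong (M-cong p₁ p₂) (+-cong (+-cong (*-congʳ (*-cong p₁ p₁)) (*-congʳ (*-congˡ p₂))) (*-cong (*-congˡ p₁) p₁))))))
      (*-congˡ (*-cong (M-cong p₁ p₂) (M-cong p₁ p₂)))) (*-congʳ (*-cong (*-cong (*-cong p₁ p₁) p₁) p₁))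

-- Polynomials in two variables and derivations along a curve.

infixl 7 _⊗_
infixl 6 _⊕_
-- Formal expressions rather than functions: one polynomial has to be differentiated in X and Y and
-- then evaluated at different places of the curve.
data Term : Set where
  κ       : ℤ → Term
  X Y     : Term
  _⊕_ _⊗_ : Term → Term → Term

Term-operations : Operations Term
Term-operations = record { _⊕_ = _⊕_ ; _⊙_ = _⊗_ ; κ = κ }

∂X ∂Y : Term → Term
∂X (κ _)   = κ (+ 0)
∂X X       = κ (+ 1)
∂X Y       = κ (+ 0)
∂X (e ⊕ f) = ∂X e ⊕ ∂X f
∂X (e ⊗ f) = ∂X e ⊗ f ⊕ e ⊗ ∂X f
∂Y (κ _)   = κ (+ 0)
∂Y X       = κ (+ 0)
∂Y Y       = κ (+ 1)
∂Y (e ⊕ f) = ∂Y e ⊕ ∂Y f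
∂Y (e ⊗ f) = ∂Y e ⊗ f ⊕ e ⊗ ∂Y f

-- the Hamiltonian derivation, tangent to the curve Φ = 0
tangent : Term → Term → Term
tangent Φ e = ∂X e ⊗ ∂Y Φ ⊕ κ (ℤ.- + 1) ⊗ (∂Y e ⊗ ∂X Φ)

opaque
  -- The combination Σ for the two coordinate functions, with the derivation taken along the curve.
  -- It is a polynomial in X and Y with integer coefficients, hence something whose vanishing can be
  -- moved from one place to another.
  invariant : Term → Term
  invariant Φ = Schwarzian.Σ₂ Term-operations X (T X) (T (T X)) (T (T (T X))) Y (T Y) (T (T Y)) (T (T (T Y)))
    where
    T : Term → Term
    T = tangent Φ

module Evaluation (A : ℤAlgebra) where
  open ℤAlgebra A

  eval : Carrier → Carrier → Term → Carrier
  eval x y (κ c)   = con c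
  eval x y X       = x
  eval x y Y       = y
  eval x y (e ⊕ f) = eval x y e + eval x y f
  eval x y (e ⊗ f) = eval x y e * eval x y f

module CurveDerivation (𝔇 : DifferentialAlgebra) (x y : DifferentialAlgebra.Carrier 𝔇) (Φ : Term) where
  open DifferentialAlgebra 𝔇
  open Evaluation algebra
  open Reparametrisation algebra using (Σ₂; Σ₂-cong; Σ₂-reparametrise)
  open Solver using (solve; _:=_; _:+_; _:*_; _:-_) renaming (con to :con)
  open LinearCombination algebra

  ⟦_⟧ : Term → Carrier
  ⟦_⟧ = eval x y

  chain-rule : ∀ e → ∂ ⟦ e ⟧ ≈ ⟦ ∂X e ⟧ * ∂ x + ⟦ ∂Y e ⟧ * ∂ y
  chain-rule (κ c)   = trans (∂-con c) (sym (trans (+-cong (trans (*-congʳ con-0) (zeroˡ _)) (trans (*-congʳ con-0) (zeroˡ _))) (+-identityˡ _)))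
  chain-rule X       = sym (trans (+-cong (trans (*-congʳ con-1) (*-identityˡ _)) (trans (*-congʳ con-0) (zeroˡ _))) (+-identityʳ _))
  chain-rule Y       = sym (trans (+-cong (trans (*-congʳ con-0) (zeroˡ _)) (trans (*-congʳ con-1) (*-identityˡ _))) (+-identityˡ _))
  chain-rule (e ⊕ f) = trans (∂-+ _ _) (trans (+-cong (chain-rule e) (chain-rule f))
    (solve 6 (λ a b c d p r → a :* p :+ b :* r :+ (c :* p :+ d :* r) := (a :+ c) :* p :+ (b :+ d) :* r) refl _ _ _ _ (∂ x) (∂ y)))
  chain-rule (e ⊗ f) = trans (∂-* _ _) (trans (+-cong (*-congʳ (chain-rule e)) (*-congˡ (chain-rule f)))
    (solve 8 (λ a b c d p r e f → (a :* p :+ b :* r) :* f :+ e :* (c :* p :+ d :* r) := (a :* f :+ e :* c) :* p :+ (b :* f :+ e :* d) :* r) refl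
      ⟦ ∂X e ⟧ ⟦ ∂Y e ⟧ ⟦ ∂X f ⟧ ⟦ ∂Y f ⟧ (∂ x) (∂ y) ⟦ e ⟧ ⟦ f ⟧))

  module _ (on-curve : ⟦ Φ ⟧ ≈ con (+ 0)) where
    μ ν : Carrier
    μ = ⟦ ∂Y Φ ⟧
    ν = ∂ x

    -- On the curve Φ_X ∂x + Φ_Y ∂y = 0, so ∂ and the tangent derivation are proportional, with
    -- factors Φ_Y and ∂x.
    tangent-derivative : ∀ e → μ * ∂ ⟦ e ⟧ ≈ ν * ⟦ tangent Φ e ⟧
    tangent-derivative e = modulo₂ μ (⟦ ∂Y e ⟧) (chain-rule e) curve
      (solve 7 (λ μ d ex ey fx p r → μ :* d := p :* (ex :* μ :+ :con (ℤ.- + 1) :* (ey :* fx)) :+ μ :* (d :- (ex :* p :+ ey :* r)) :+ ey :* (fx :* p :+ μ :* r :- :con (+ 0))) refl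
        μ (∂ ⟦ e ⟧) ⟦ ∂X e ⟧ ⟦ ∂Y e ⟧ ⟦ ∂X Φ ⟧ (∂ x) (∂ y))
      where
      curve : ⟦ ∂X Φ ⟧ * ∂ x + μ * ∂ y ≈ con (+ 0)
      curve = trans (sym (chain-rule Φ)) (trans (∂-cong on-curve) (trans (∂-con (+ 0)) (sym con-0)))

    private
      ∂∂ : ∀ a z b w → ∂ (a * z + b * b * w) ≈ ∂ a * z + a * ∂ z + con (+ 2) * (b * ∂ b) * w + b * b * ∂ w
      ∂∂ a z b w = trans (∂-+ _ _) (trans (+-cong (∂-* a z) (trans (∂-* (b * b) w) (+-congʳ (*-congʳ (∂-* b b)))))
        (solve 8 (λ a a′ z z′ b b′ w w′ → a′ :* z :+ a :* z′ :+ ((b′ :* b :+ b :* b′) :* w :+ b :* b :* w′)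
          := a′ :* z :+ a :* z′ :+ :con (+ 2) :* (b :* b′) :* w :+ b :* b :* w′) refl a (∂ a) z (∂ z) b (∂ b) w (∂ w)))

      T : Term → Term
      T = tangent Φ

      α β α̂ β̂ : Carrier
      α = μ * ∂ ν
      β = μ * ∂ α
      α̂ = μ * ∂ μ
      β̂ = μ * ∂ α̂

      -- both sides are the jets of e for the derivation μ∂
      second : ∀ e → α̂ * ∂ ⟦ e ⟧ + μ * μ * ∂ (∂ ⟦ e ⟧) ≈ α * ⟦ T e ⟧ + ν * ν * ⟦ T (T e) ⟧
      second e = modulo₂ μ ν (trans (sym (∂-* μ (∂ ⟦ e ⟧))) (trans (∂-cong (tangent-derivative e)) (∂-* ν ⟦ T e ⟧))) (tangent-derivative (T e))
        (solve 9 (λ μ μ′ d d′ ν ν′ t t′ tt → μ :* μ′ :* d :+ μ :* μ :* d′ := μ :* ν′ :* t :+ ν :* ν :* tt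
          :+ μ :* (μ′ :* d :+ μ :* d′ :- (ν′ :* t :+ ν :* t′)) :+ ν :* (μ :* t′ :- ν :* tt)) refl
          μ (∂ μ) (∂ ⟦ e ⟧) (∂ (∂ ⟦ e ⟧)) ν (∂ ν) ⟦ T e ⟧ (∂ ⟦ T e ⟧) ⟦ T (T e) ⟧)

      third : ∀ e → β̂ * ∂ ⟦ e ⟧ + con (+ 3) * μ * α̂ * ∂ (∂ ⟦ e ⟧) + μ * μ * μ * ∂ (∂ (∂ ⟦ e ⟧))
        ≈ β * ⟦ T e ⟧ + con (+ 3) * ν * α * ⟦ T (T e) ⟧ + ν * ν * ν * ⟦ T (T (T e)) ⟧
      third e = modulo₃ μ α (ν * ν) (trans (sym (∂∂ α̂ (∂ ⟦ e ⟧) μ (∂ (∂ ⟦ e ⟧)))) (trans (∂-cong (second e)) (∂∂ α ⟦ T e ⟧ ν ⟦ T (T e) ⟧)))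
        (tangent-derivative (T e)) (tangent-derivative (T (T e)))
        (solve 15 (λ μ μ′ d d′ d″ ν ν′ t t′ tt tt′ ttt α̂′ α′ α →
          μ :* α̂′ :* d :+ :con (+ 3) :* μ :* (μ :* μ′) :* d′ :+ μ :* μ :* μ :* d″
          := μ :* α′ :* t :+ :con (+ 3) :* ν :* (μ :* ν′) :* tt :+ ν :* ν :* ν :* ttt
            :+ μ :* (α̂′ :* d :+ μ :* μ′ :* d′ :+ :con (+ 2) :* (μ :* μ′) :* d′ :+ μ :* μ :* d″
                  :- (α′ :* t :+ μ :* ν′ :* t′ :+ :con (+ 2) :* (ν :* ν′) :* tt :+ ν :* ν :* tt′))
            :+ μ :* ν′ :* (μ :* t′ :- ν :* tt) :+ ν :* ν :* (μ :* tt′ :- ν :* ttt)) refl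
          μ (∂ μ) (∂ ⟦ e ⟧) (∂ (∂ ⟦ e ⟧)) (∂ (∂ (∂ ⟦ e ⟧))) ν (∂ ν) ⟦ T e ⟧ (∂ ⟦ T e ⟧) ⟦ T (T e) ⟧ (∂ ⟦ T (T e) ⟧) ⟦ T (T (T e)) ⟧ (∂ α̂) (∂ α) α)

    opaque
      unfolding invariant

      -- The derivation μ∂ agrees on the curve with ν times the tangent derivation. Both sides are Σ
      -- for this common derivation, once reparametrised by μ from ∂ and once by ν from the tangent
      -- derivation; the sixth powers are the weight of Σ.
      Σ₂-tangent : μ * μ * μ * μ * μ * μ * Σ₂ x (∂ x) (∂ (∂ x)) (∂ (∂ (∂ x))) y (∂ y) (∂ (∂ y)) (∂ (∂ (∂ y)))
        ≈ ν * ν * ν * ν * ν * ν * ⟦ invariant Φ ⟧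
      Σ₂-tangent = trans (sym (Σ₂-reparametrise x (∂ x) (∂ (∂ x)) (∂ (∂ (∂ x))) y (∂ y) (∂ (∂ y)) (∂ (∂ (∂ y))) μ α̂ β̂))
        (trans (Σ₂-cong (tangent-derivative X) (second X) (third X) (tangent-derivative Y) (second Y) (third Y))
          (Σ₂-reparametrise x ⟦ T X ⟧ ⟦ T (T X) ⟧ ⟦ T (T (T X)) ⟧ y ⟦ T Y ⟧ ⟦ T (T Y) ⟧ ⟦ T (T (T Y)) ⟧ ν α β))

-- The third-order equation deduced from Ramanujan's equations.

module Ramanujan (𝔇 : DifferentialAlgebra) where
  open DifferentialAlgebra 𝔇
  open Reparametrisation algebra using (F; M; N; M′; N′)
  open Solver using (solve; _:=_; _:+_; _:*_; _:-_; :-_) renaming (con to :con)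
  open LinearCombination algebra
  private
    module S {n} = Schwarzian (AlgebraOperations.polynomials algebra {n})

    ∂-product₃ : ∀ c x y w → ∂ (con c * (x * y * w)) ≈ con c * (∂ x * y * w + x * ∂ y * w + x * y * ∂ w)
    ∂-product₃ c x y w = trans (∂-con* c _) (*-congˡ (trans (∂-* (x * y) w) (+-congʳ (trans (*-congʳ (∂-* x y)) (distribʳ w _ _)))))

    ∂-1728 : ∀ z → ∂ (z + con (ℤ.- + 1) * con (+ 1728)) ≈ ∂ z
    ∂-1728 z = trans (∂-+ z _) (trans (+-congˡ (trans (∂-con* (ℤ.- + 1) _) (trans (*-congˡ (∂-con (+ 1728))) (zeroʳ _)))) (+-identityʳ _))

    ∂-sub₃ : ∀ a b d → ∂ (a + con (ℤ.- + 1) * b + con (ℤ.- + 1) * d) ≈ ∂ a + con (ℤ.- + 1) * ∂ b + con (ℤ.- + 1) * ∂ d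
    ∂-sub₃ a b d = trans (∂-+ _ _) (+-cong (trans (∂-+ a _) (+-congˡ (∂-con* _ b))) (∂-con* _ d))

  ∂-N : ∀ z → ∂ (N z (∂ z)) ≈ N′ z (∂ z) (∂ (∂ z))
  ∂-N z = trans (∂-* _ _) (trans (+-cong (*-congʳ (∂-* z (∂ z))) (*-congˡ (∂-1728 z)))
    (solve 3 (λ z z₁ z₂ → (z₁ :* z₁ :+ z :* z₂) :* (z :+ :con (ℤ.- + 1) :* :con (+ 1728)) :+ z :* z₁ :* z₁ := S.N′ z z₁ z₂) refl z (∂ z) (∂ (∂ z))))

  ∂-M : ∀ z → ∂ (M z (∂ z) (∂ (∂ z))) ≈ M′ z (∂ z) (∂ (∂ z)) (∂ (∂ (∂ z)))
  ∂-M z = trans (∂-sub₃ _ _ _) (trans (+-cong (+-cong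
      (trans (∂-product₃ (+ 6) z (∂ (∂ z)) _) (*-congˡ (+-congˡ (*-congˡ (∂-1728 z)))))
      (*-congˡ (trans (∂-product₃ (+ 4) (∂ z) (∂ z) _) (*-congˡ (+-congˡ (*-congˡ (∂-1728 z)))))))
      (*-congˡ (∂-product₃ (+ 3) (∂ z) (∂ z) z)))
    (solve 4 (λ z z₁ z₂ z₃ → let w = z :+ :con (ℤ.- + 1) :* :con (+ 1728) in
      :con (+ 6) :* (z₁ :* z₂ :* w :+ z :* z₃ :* w :+ z :* z₂ :* z₁)
      :+ :con (ℤ.- + 1) :* (:con (+ 4) :* (z₂ :* z₁ :* w :+ z₁ :* z₂ :* w :+ z₁ :* z₁ :* z₁))
      :+ :con (ℤ.- + 1) :* (:con (+ 3) :* (z₂ :* z₁ :* z :+ z₁ :* z₂ :* z :+ z₁ :* z₁ :* z₁)) := S.M′ z z₁ z₂ z₃) refl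
      z (∂ z) (∂ (∂ z)) (∂ (∂ (∂ z)))))

  -- P, Q, R are E₂, E₄, E₆, `Z` is 1/Δ and z = E₄³/Δ is j, all possibly dilated: ℓ is the constant
  -- by which the derivation is multiplied for series in q^ℓ.
  module _ (P Q R Z ℓ z : Carrier) (∂ℓ : ∂ ℓ ≈ con (+ 0))
           (∂P : con (+ 12) * ∂ P ≈ ℓ * (P * P - Q)) (∂Q : con (+ 3) * ∂ Q ≈ ℓ * (P * Q - R)) (∂R : con (+ 2) * ∂ R ≈ ℓ * (P * R - Q * Q))
           (∂Z : ∂ Z ≈ - (ℓ * P * Z)) (disc : (Q * Q * Q - R * R) * Z ≈ con (+ 1728)) (z≈ : z ≈ Q * Q * Q * Z) where
    private
      ∂z : ∂ z ≈ - (ℓ * (Q * Q * R * Z))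
      ∂z = trans (∂-cong z≈) (trans (trans (∂-* _ Z) (+-congʳ (*-congʳ (trans (∂-* (Q * Q) Q) (+-congʳ (*-congʳ (∂-* Q Q)))))))
        (modulo₂ (Q * Q * Z) (Q * Q * Q) ∂Q ∂Z
          (solve 7 (λ p q r z q′ z′ ℓ → ((q′ :* q :+ q :* q′) :* q :+ q :* q :* q′) :* z :+ q :* q :* q :* z′
            := :- (ℓ :* (q :* q :* r :* z)) :+ q :* q :* z :* (:con (+ 3) :* q′ :- ℓ :* (p :* q :- r)) :+ q :* q :* q :* (z′ :- (:- (ℓ :* p :* z)))) refl
            P Q R Z (∂ Q) (∂ Z) ℓ)))

      ∂∂z : con (+ 6) * ∂ (∂ z) ≈ - (ℓ * ℓ * (P * Q * Q * R - con (+ 4) * (Q * R * R) - con (+ 3) * (Q * Q * Q * Q)) * Z)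
      ∂∂z = trans (*-congˡ (trans (∂-cong ∂z) (trans (∂-neg _) (-‿cong (trans (∂-* ℓ _) (trans (+-congʳ (trans (*-congʳ ∂ℓ) (trans (*-congʳ con-0) (zeroˡ _))))
          (trans (+-identityˡ _) (*-congˡ (trans (∂-* _ Z) (+-congʳ (*-congʳ (trans (∂-* (Q * Q) R) (+-congʳ (*-congʳ (∂-* Q Q)))))))))))))))
        (modulo₃ (- (con (+ 4) * (ℓ * Q * R * Z))) (- (con (+ 3) * (ℓ * Q * Q * Z))) (- (con (+ 6) * (ℓ * Q * Q * R))) ∂Q ∂R ∂Z
          (solve 8 (λ p q r z q′ r′ z′ ℓ →
            :con (+ 6) :* (:- (ℓ :* (((q′ :* q :+ q :* q′) :* r :+ q :* q :* r′) :* z :+ q :* q :* r :* z′)))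
            := :- (ℓ :* ℓ :* (p :* q :* q :* r :- :con (+ 4) :* (q :* r :* r) :- :con (+ 3) :* (q :* q :* q :* q)) :* z)
            :+ (:- (:con (+ 4) :* (ℓ :* q :* r :* z))) :* (:con (+ 3) :* q′ :- ℓ :* (p :* q :- r))
            :+ (:- (:con (+ 3) :* (ℓ :* q :* q :* z))) :* (:con (+ 2) :* r′ :- ℓ :* (p :* r :- q :* q))
            :+ (:- (:con (+ 6) :* (ℓ :* q :* q :* r))) :* (z′ :- (:- (ℓ :* p :* z)))) refl
            P Q R Z (∂ Q) (∂ R) (∂ Z) ℓ))

      z-1728 : z + con (ℤ.- + 1) * con (+ 1728) ≈ R * R * Z
      z-1728 = modulo₂ (con (+ 1)) (con (+ 1)) z≈ disc (solve 4 (λ z q r Z → z :+ :con (ℤ.- + 1) :* :con (+ 1728)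
        := r :* r :* Z :+ :con (+ 1) :* (z :- q :* q :* q :* Z) :+ :con (+ 1) :* ((q :* q :* q :- r :* r) :* Z :- :con (+ 1728))) refl z Q R Z)

      w z₁ z₂ : Carrier
      w = z + con (ℤ.- + 1) * con (+ 1728)
      z₁ = ∂ z
      z₂ = ∂ (∂ z)

      -- This expresses E₂ as M/(ℓN) through z and its derivatives, using z′ = -ℓE₄²E₆/Δ and z -
      -- 1728 = E₆²/Δ.
      M≈ : M z z₁ z₂ ≈ ℓ * P * N z z₁
      M≈ = trans (solve 4 (λ z z₁ z₂ w → :con (+ 6) :* (z :* z₂ :* w) :+ :con (ℤ.- + 1) :* (:con (+ 4) :* (z₁ :* z₁ :* w)) :+ :con (ℤ.- + 1) :* (:con (+ 3) :* (z₁ :* z₁ :* z))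
             := z :* (:con (+ 6) :* z₂) :* w :- :con (+ 4) :* (z₁ :* z₁ :* w) :- :con (+ 3) :* (z₁ :* z₁ :* z)) refl z z₁ z₂ w)
        (trans (+-cong (+-cong (*-cong (*-cong z≈ ∂∂z) z-1728) (-‿cong (*-congˡ (*-cong (*-cong ∂z ∂z) z-1728)))) (-‿cong (*-congˡ (*-cong (*-cong ∂z ∂z) z≈))))
        (trans (solve 5 (λ p q r Z ℓ → let z₁ = :- (ℓ :* (q :* q :* r :* Z)) in
             q :* q :* q :* Z :* (:- (ℓ :* ℓ :* (p :* q :* q :* r :- :con (+ 4) :* (q :* r :* r) :- :con (+ 3) :* (q :* q :* q :* q)) :* Z)) :* (r :* r :* Z)
               :- :con (+ 4) :* (z₁ :* z₁ :* (r :* r :* Z)) :- :con (+ 3) :* (z₁ :* z₁ :* (q :* q :* q :* Z))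
             := ℓ :* p :* (q :* q :* q :* Z :* z₁ :* (r :* r :* Z))) refl P Q R Z ℓ)
        (sym (*-congˡ (*-cong (*-cong z≈ ∂z) z-1728)))))

      -- This expresses E₄: from the same formulas, z′² = ℓ²E₄ z(z - 1728).
      Q-relation : z₁ * z₁ * z₁ * z₁ * (z * w) ≈ ℓ * ℓ * Q * (N z z₁ * N z z₁)
      Q-relation = trans (*-cong (*-cong (*-cong (*-cong ∂z ∂z) ∂z) ∂z) (*-cong z≈ z-1728))
        (trans (solve 4 (λ q r Z ℓ → let z₁ = :- (ℓ :* (q :* q :* r :* Z)) in
             z₁ :* z₁ :* z₁ :* z₁ :* (q :* q :* q :* Z :* (r :* r :* Z))
             := ℓ :* ℓ :* q :* (q :* q :* q :* Z :* z₁ :* (r :* r :* Z) :* (q :* q :* q :* Z :* z₁ :* (r :* r :* Z)))) refl Q R Z ℓ)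
        (sym (*-congˡ (*-cong (*-cong (*-cong z≈ ∂z) z-1728) (*-cong (*-cong z≈ ∂z) z-1728)))))

      ∂M≈ : M′ z z₁ z₂ (∂ z₂) ≈ ℓ * ∂ P * N z z₁ + ℓ * P * N′ z z₁ z₂
      ∂M≈ = trans (sym (∂-M z)) (trans (∂-cong M≈) (trans (∂-* (ℓ * P) (N z z₁))
        (+-cong (*-congʳ (trans (∂-* ℓ P) (trans (+-congʳ (trans (*-congʳ ∂ℓ) (trans (*-congʳ con-0) (zeroˡ P)))) (+-identityˡ _)))) (*-congˡ (∂-N z)))))

    -- Differentiating M = ℓPN gives M′N - MN′ = ℓP′N². With 12P′ = ℓ(P² - Q), twelve times this is
    -- M² - ℓ²QN², and the last term is rewritten by `Q-relation`.
    F≈0 : F z (∂ z) (∂ (∂ z)) (∂ (∂ (∂ z))) ≈ con (+ 0)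
    F≈0 = trans (+-cong (+-cong (*-congˡ (+-cong (*-congʳ ∂M≈) (*-congˡ (*-congʳ M≈)))) (*-congˡ (*-cong M≈ M≈))) Q-relation)
      (modulo₁ (ℓ * (N z z₁ * N z z₁)) ∂P
        (solve 6 (λ ℓ p q p′ n n′ → :con (+ 12) :* ((ℓ :* p′ :* n :+ ℓ :* p :* n′) :* n :+ :con (ℤ.- + 1) :* (ℓ :* p :* n :* n′))
            :+ :con (ℤ.- + 1) :* (ℓ :* p :* n :* (ℓ :* p :* n)) :+ ℓ :* ℓ :* q :* (n :* n)
          := :con (+ 0) :+ ℓ :* (n :* n) :* (:con (+ 12) :* p′ :- ℓ :* (p :* p :- q))) refl ℓ P Q (∂ P) (N z z₁) (N′ z z₁ z₂)))

-- The substitution q ↦ q^ℓ.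

module Dilation (ℓ′ : ℕ) where
  ℓ : ℕ
  ℓ = suc ℓ′

  δ : PS → PS
  δ = dilPS ℓ

  private
    choose : Bool → ℤ → ℤ
    choose b z = if b then z else + 0

    choose-+ : ∀ b x y → choose b (x ℤ.+ y) ≡ choose b x ℤ.+ choose b y
    choose-+ true  x y = ≡.refl
    choose-+ false x y = ≡.refl

    choose-* : ∀ b c x → choose b (c ℤ.* x) ≡ c ℤ.* choose b x
    choose-* true  c x = ≡.refl
    choose-* false c x = ≡.sym (ℤP.*-zeroʳ c)

    ≡ᵇ-false : ∀ {m n} → m ≢ n → (m ℕ.≡ᵇ n) ≡ false
    ≡ᵇ-false {zero}  {zero}  ne = contradiction ≡.refl ne
    ≡ᵇ-false {zero}  {suc n} ne = ≡.refl
    ≡ᵇ-false {suc m} {zero}  ne = ≡.refl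
    ≡ᵇ-false {suc m} {suc n} ne = ≡ᵇ-false (ne ∘ ≡.cong suc)

    ≡ᵇ-+ : ∀ k m n → (k ℕ.+ m ℕ.≡ᵇ k ℕ.+ n) ≡ (m ℕ.≡ᵇ n)
    ≡ᵇ-+ zero    m n = ≡.refl
    ≡ᵇ-+ (suc k) m n = ≡ᵇ-+ k m n

    δ∑ : ∀ f k → δ f k ≡ ∑ℤ (suc k) (λ i → choose (i ℕ.* ℓ ℕ.≡ᵇ k) (f i))
    δ∑ f k = sumBelow≡∑ (suc k) (λ i → choose (i ℕ.* ℓ ℕ.≡ᵇ k) (f i))

    con-choose : ∀ c k → conPS c k ≡ choose (0 ℕ.≡ᵇ k) c
    con-choose c zero    = ≡.refl
    con-choose c (suc k) = ≡.refl

  δ-cong : ∀ {f g} → f ≋ g → δ f ≋ δ g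
  δ-cong eq = mk≋ λ k → ≡.trans (δ∑ _ k) (≡.trans (∑ℤ.∑-cong (suc k) (λ i _ → ≡.cong (choose (i ℕ.* ℓ ℕ.≡ᵇ k)) (at eq i))) (≡.sym (δ∑ _ k)))

  δ-⊞ : ∀ f g → δ (f ⊞ g) ≋ δ f ⊞ δ g
  δ-⊞ f g = mk≋ λ k → ≡.trans (δ∑ (f ⊞ g) k) (≡.trans
    (∑ℤ.∑-cong (suc k) (λ i _ → ≡.trans (≡.cong (choose (i ℕ.* ℓ ℕ.≡ᵇ k)) (⊞-coefficient f g i)) (choose-+ (i ℕ.* ℓ ℕ.≡ᵇ k) (f i) (g i))))
    (≡.trans (∑ℤ.∑-+ (suc k) (λ i → choose (i ℕ.* ℓ ℕ.≡ᵇ k) (f i)) (λ i → choose (i ℕ.* ℓ ℕ.≡ᵇ k) (g i))) (≡.sym (⊞-at (δ∑ f k) (δ∑ g k)))))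

  δ-con⊠ : ∀ c f → δ (conPS c ⊠ f) ≋ conPS c ⊠ δ f
  δ-con⊠ c f = mk≋ λ k → ≡.trans (δ∑ (conPS c ⊠ f) k) (≡.trans
    (∑ℤ.∑-cong (suc k) (λ i _ → ≡.trans (≡.cong (choose (i ℕ.* ℓ ℕ.≡ᵇ k)) (con-⊠ c f i)) (choose-* (i ℕ.* ℓ ℕ.≡ᵇ k) c (f i))))
    (≡.trans (≡.sym (∑ℤ.*-∑ (suc k) c (λ i → choose (i ℕ.* ℓ ℕ.≡ᵇ k) (f i)))) (≡.sym (con-at c (δ∑ f k)))))

  -- The recursion that replaces divisibility arguments. Multiplication by q^ℓ reads only smaller
  -- indices, so this equation drives strong inductions on the coefficient, for products as well as
  -- for θ.
  δ-unfold : ∀ f → δ f ≋ conPS (f 0) ⊞ q 𝕊.^ ℓ ⊠ δ (tail f)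
  δ-unfold f = mk≋ λ k → ≡.trans (δ∑ f k) (≡.trans (∑ℤ.∑-head k (λ i → choose (i ℕ.* ℓ ℕ.≡ᵇ k) (f i)))
    (≡.sym (⊞-at (con-choose (f 0) k) (rest k (k ℕP.<? ℓ)))))
    where
    rest : ∀ k → Dec (k < ℓ) → (q 𝕊.^ ℓ ⊠ δ (tail f)) k ≡ ∑ℤ k (λ i → choose (suc i ℕ.* ℓ ℕ.≡ᵇ k) (f (suc i)))
    rest k (yes k<ℓ) = ≡.trans (q^⊠-low ℓ (δ (tail f)) k k<ℓ) (≡.sym (∑ℤ.∑-0 k (λ i _ →
      ≡.cong (λ b → choose b (f (suc i))) (≡ᵇ-false {suc i ℕ.* ℓ} {k} (λ eq → ℕP.<⇒≱ k<ℓ (≡.subst (ℓ ≤_) eq (ℕP.m≤m+n ℓ (i ℕ.* ℓ))))))))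
    rest k (no k≮ℓ) = ≡.subst (λ k → (q 𝕊.^ ℓ ⊠ δ (tail f)) k ≡ ∑ℤ k (λ i → choose (suc i ℕ.* ℓ ℕ.≡ᵇ k) (f (suc i)))) (ℕP.m+[n∸m]≡n (ℕP.≮⇒≥ k≮ℓ)) (high (k ∸ ℓ))
      where
      high : ∀ j → (q 𝕊.^ ℓ ⊠ δ (tail f)) (ℓ ℕ.+ j) ≡ ∑ℤ (ℓ ℕ.+ j) (λ i → choose (suc i ℕ.* ℓ ℕ.≡ᵇ ℓ ℕ.+ j) (f (suc i)))
      high j = ≡.trans (q^⊠-high ℓ (δ (tail f)) j) (≡.trans (δ∑ (tail f) j) (≡.sym (≡.trans
        (∑ℤ.∑-cong (ℓ ℕ.+ j) (λ i _ → ≡.cong (λ b → choose b (f (suc i))) (≡ᵇ-+ ℓ (i ℕ.* ℓ) j)))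
        (≡.trans (≡.cong (λ m → ∑ℤ (suc m) (λ i → choose (i ℕ.* ℓ ℕ.≡ᵇ j) (f (suc i)))) (ℕP.+-comm ℓ′ j))
          (∑ℤ.∑-extend (suc j) ℓ′ (λ i j<i → ≡.cong (λ b → choose b (f (suc i)))
            (≡ᵇ-false {i ℕ.* ℓ} {j} (λ eq → ℕP.<⇒≱ j<i (≡.subst (i ≤_) eq (ℕP.m≤m*n i ℓ))))))))))

  private
    q^ℓ-below : ∀ k {a b} → (∀ i → i < k → a i ≡ b i) → (q 𝕊.^ ℓ ⊠ a) k ≡ (q 𝕊.^ ℓ ⊠ b) k
    q^ℓ-below k {a} {b} eq = case k ℕP.<? ℓ of λ
      { (yes k<ℓ) → ≡.trans (q^⊠-low ℓ a k k<ℓ) (≡.sym (q^⊠-low ℓ b k k<ℓ))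
      ; (no k≮ℓ) → let k≡ = ℕP.m+[n∸m]≡n (ℕP.≮⇒≥ k≮ℓ) in
          ≡.subst (λ k → (q 𝕊.^ ℓ ⊠ a) k ≡ (q 𝕊.^ ℓ ⊠ b) k) k≡ (≡.trans (q^⊠-high ℓ a (k ∸ ℓ))
            (≡.trans (eq (k ∸ ℓ) (≡.subst (k ∸ ℓ <_) k≡ (ℕP.m<n+m (k ∸ ℓ) (s≤s z≤n)))) (≡.sym (q^⊠-high ℓ b (k ∸ ℓ))))) }

    open 𝕊.Solver using (solve; _:=_; _:+_; _:*_)

    δ-⊠-below : ∀ n k → k < n → ∀ f g → δ (f ⊠ g) k ≡ (δ f ⊠ δ g) k
    δ-⊠-below (suc n) k (s≤s k≤n) f g = ≡.trans (at lhs k) (≡.trans (⊞-at ≡.refl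
        (q^ℓ-below k (λ i i<k → δ-⊠-below n i (ℕP.<-≤-trans i<k k≤n) (tail f) g))) (≡.trans (≡.sym (⊞-coefficient _ _ k)) (≡.sym (at rhs k))))
      where
      A : PS
      A = conPS (f 0) ⊠ δ g
      lhs : δ (f ⊠ g) ≋ A ⊞ q 𝕊.^ ℓ ⊠ δ (tail f ⊠ g)
      lhs = 𝕊.trans (δ-unfold (f ⊠ g)) (𝕊.trans (𝕊.+-cong
        (𝕊.trans (𝕊.reflexive (≡.cong conPS (⊠-0 f g))) (𝕊.con-* (f 0) (g 0)))
        (𝕊.*-congˡ (𝕊.trans (δ-cong {tail (f ⊠ g)} {conPS (f 0) ⊠ tail g ⊞ tail f ⊠ g} (mk≋ λ i → ≡.trans (⊠-suc f g i) (≡.sym (⊞-at (con-⊠ (f 0) (tail g) i) ≡.refl))))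
          (𝕊.trans (δ-⊞ (conPS (f 0) ⊠ tail g) (tail f ⊠ g)) (𝕊.+-congʳ (δ-con⊠ (f 0) (tail g)))))))
        (𝕊.trans (solve 5 (λ a b q x y → a :* b :+ q :* (a :* x :+ y) := a :* (b :+ q :* x) :+ q :* y) 𝕊.refl (conPS (f 0)) (conPS (g 0)) (q 𝕊.^ ℓ) (δ (tail g)) (δ (tail f ⊠ g)))
          (𝕊.+-congʳ (𝕊.*-congˡ (𝕊.sym (δ-unfold g))))))
      rhs : δ f ⊠ δ g ≋ A ⊞ q 𝕊.^ ℓ ⊠ (δ (tail f) ⊠ δ g)
      rhs = 𝕊.trans (𝕊.*-congʳ (δ-unfold f)) (solve 4 (λ a q x g → (a :+ q :* x) :* g := a :* g :+ q :* (x :* g)) 𝕊.refl (conPS (f 0)) (q 𝕊.^ ℓ) (δ (tail f)) (δ g))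

    θ-δ-below : ∀ n k → k < n → ∀ f → θ (δ f) k ≡ (conPS (+ ℓ) ⊠ δ (θ f)) k
    θ-δ-below (suc n) k (s≤s k≤n) f = ≡.trans (at lhs k) (≡.trans (⊞-at ≡.refl
        (q^ℓ-below k (λ i i<k → θ-δ-below n i (ℕP.<-≤-trans i<k k≤n) (tail f)))) (≡.trans (≡.sym (⊞-coefficient _ _ k)) (≡.sym (at rhs k))))
      where
      A : PS
      A = conPS (+ ℓ) ⊠ (q 𝕊.^ ℓ ⊠ δ (tail f))
      lhs : θ (δ f) ≋ A ⊞ q 𝕊.^ ℓ ⊠ θ (δ (tail f))
      lhs = 𝕊.trans (θ-cong (δ-unfold f)) (𝕊.trans (θ-⊞ _ _) (𝕊.trans (𝕊.+-cong (θ-con (f 0)) (𝕊.trans (θ-⊠ (q 𝕊.^ ℓ) (δ (tail f))) (𝕊.+-congʳ (𝕊.*-congʳ (θ-q^ ℓ)))))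
        (𝕊.trans (𝕊.+-identityˡ _) (𝕊.+-congʳ (𝕊.*-assoc _ _ _)))))
      tail-θ : tail (θ f) ≋ tail f ⊞ θ (tail f)
      tail-θ = mk≋ λ i → ≡.trans (θ-coefficient f (suc i)) (≡.sym (≡.trans (⊞-at ≡.refl (θ-coefficient (tail f) i)) (ℤ-solver.solve 2
        (λ i x → x ℤ-solver.:+ i ℤ-solver.:* x ℤ-solver.:= (ℤ-solver.con (+ 1) ℤ-solver.:+ i) ℤ-solver.:* x) ≡.refl (+ i) (f (suc i)))))
      rhs : conPS (+ ℓ) ⊠ δ (θ f) ≋ A ⊞ q 𝕊.^ ℓ ⊠ (conPS (+ ℓ) ⊠ δ (θ (tail f)))
      rhs = 𝕊.trans (𝕊.*-congˡ (𝕊.trans (δ-unfold (θ f)) (𝕊.trans (𝕊.+-cong (𝕊.trans (𝕊.reflexive (≡.cong conPS (θ-coefficient f 0))) 𝕊.con-0)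
          (𝕊.*-congˡ (𝕊.trans (δ-cong tail-θ) (δ-⊞ (tail f) (θ (tail f)))))) (𝕊.+-identityˡ _))))
        (solve 4 (λ c q x y → c :* (q :* (x :+ y)) := c :* (q :* x) :+ q :* (c :* y)) 𝕊.refl (conPS (+ ℓ)) (q 𝕊.^ ℓ) (δ (tail f)) (δ (θ (tail f))))

  δ-⊠ : ∀ f g → δ (f ⊠ g) ≋ δ f ⊠ δ g
  δ-⊠ f g = mk≋ λ k → δ-⊠-below (suc k) k ℕP.≤-refl f g

  θ-δ : ∀ f → θ (δ f) ≋ conPS (+ ℓ) ⊠ δ (θ f)
  θ-δ f = mk≋ λ k → θ-δ-below (suc k) k ℕP.≤-refl f

  δ-con : ∀ c → δ (conPS c) ≋ conPS c
  δ-con c = 𝕊.trans (δ-unfold (conPS c)) (𝕊.trans (𝕊.+-congˡ (𝕊.trans (𝕊.*-congˡ δ0) (𝕊.zeroʳ _))) (𝕊.+-identityʳ _))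
    where
    δ0 : δ (tail (conPS c)) ≋ 0PS
    δ0 = mk≋ λ k → ≡.trans (δ∑ (tail (conPS c)) k) (≡.trans (∑ℤ.∑-0 (suc k) {λ i → choose (i ℕ.* ℓ ℕ.≡ᵇ k) (+ 0)} (λ i _ → both (i ℕ.* ℓ ℕ.≡ᵇ k))) (≡.sym (0PS-coefficient k)))
      where
      both : ∀ b → choose b (+ 0) ≡ + 0
      both true  = ≡.refl
      both false = ≡.refl

-- The third-order equation for j(z) and j(ℓz).

ι-1 : ι onePS ≅ 𝕃.1#
ι-1 = 𝕃.trans (LaurentRing.ι-cong onePS≋con) (LaurentRing.ι-con (+ 1))

qᴸ : ℕ → Laurent
qᴸ n = ι (q 𝕊.^ n)

qᴸ-cancel : ∀ n {x y} → qᴸ n 𝕃.* x ≅ qᴸ n 𝕃.* y → x ≅ y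
qᴸ-cancel n {x} {y} eq = 𝕃.trans (𝕃.sym (unit x)) (𝕃.trans (𝕃.*-congˡ eq) (unit y))
  where
  unit : ∀ x → (onePS /q^ n) 𝕃.* (qᴸ n 𝕃.* x) ≅ x
  unit x = 𝕃.trans (𝕃.sym (𝕃.*-assoc _ _ _)) (𝕃.trans (𝕃.*-congʳ (𝕃.trans (𝕃.*-comm _ _) (𝕃.trans (LaurentRing.clear-/ onePS n) ι-1))) (𝕃.*-identityˡ x))

ι-sub : ∀ f g → ι (f 𝕊.- g) ≅ ι f 𝕃.- ι g
ι-sub f g = 𝕃.trans (LaurentRing.ι-+ f (⊟ g)) (𝕃.+-congˡ (LaurentRing.ι-neg g))

module SchwarzianOf = Reparametrisation Laurent-algebra

module _ where
  open 𝕃.Solver using (solve; _:=_; _:+_; _:*_; _:-_; :-_; con)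
  open LinearCombination Laurent-algebra
  open LaurentRing using (ι-cong; ι-*; ι-+; ι-neg; ι-con; θᴸ-ι; clear-/)

  -- One `n` plays two roles, as the factor that dilation puts in front of θ and as the order of the
  -- pole. The case n = 1 is j(z), and n = ℓ is j(ℓz).
  quotient-equation : ∀ p e r d j n →
    conPS (+ 12) ⊠ θ p ≋ conPS (+ n) ⊠ (p ⊠ p 𝕊.- e) →
    conPS (+ 3) ⊠ θ e ≋ conPS (+ n) ⊠ (p ⊠ e 𝕊.- r) →
    conPS (+ 2) ⊠ θ r ≋ conPS (+ n) ⊠ (p ⊠ r 𝕊.- e ⊠ e) →
    θ d ≋ conPS (+ n) ⊠ ((conPS (+ 1) 𝕊.- p) ⊠ d) →
    (e ⊠ e ⊠ e 𝕊.- r ⊠ r) ⊠ d ≋ conPS (+ 1728) ⊠ q 𝕊.^ n →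
    j ≋ e ⊠ e ⊠ e ⊠ d →
    let z = j /q^ n in SchwarzianOf.F z (θᴸ z) (θᴸ (θᴸ z)) (θᴸ (θᴸ (θᴸ z))) ≅ conᴸ (+ 0)
  quotient-equation p e r d j n θp θe θr θd disc j≋ = Ramanujan.F≈0 Laurent-differential (ι p) (ι e) (ι r) Z (conᴸ (+ n)) (j /q^ n)
    (θ𝕃.∂-con (+ n))
    (scaled (+ 12) p (𝕃.trans (ι-cong θp) (𝕃.trans (ι-* _ _) (𝕃.*-cong (ι-con (+ n)) (𝕃.trans (ι-sub _ _) (𝕃.+-congʳ (ι-* p p)))))))
    (scaled (+ 3) e (𝕃.trans (ι-cong θe) (𝕃.trans (ι-* _ _) (𝕃.*-cong (ι-con (+ n)) (𝕃.trans (ι-sub _ _) (𝕃.+-congʳ (ι-* p e)))))))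
    (scaled (+ 2) r (𝕃.trans (ι-cong θr) (𝕃.trans (ι-* _ _) (𝕃.*-cong (ι-con (+ n)) (𝕃.trans (ι-sub _ _) (𝕃.+-cong (ι-* p r) (𝕃.-‿cong (ι-* e e))))))))
    (qᴸ-cancel n (modulo₂ (conᴸ (+ 1)) (𝕃.- (conᴸ (+ n) 𝕃.* (conᴸ (+ 1) 𝕃.- ι p))) derivative qZ
      (solve 6 (λ k z z′ d p n → k :* z′ := k :* (:- (n :* p :* z))
        :+ con (+ 1) :* (n :* k :* z :+ k :* z′ :- n :* ((con (+ 1) :- p) :* d))
        :+ (:- (n :* (con (+ 1) :- p))) :* (k :* z :- d)) 𝕃.refl (qᴸ n) Z (θᴸ Z) (ι d) (ι p) (conᴸ (+ n)))))
    (qᴸ-cancel n (modulo₂ (conᴸ (+ 1)) (ι e 𝕃.* ι e 𝕃.* ι e 𝕃.- ι r 𝕃.* ι r) discᴸ qZ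
      (solve 5 (λ k z d e r → k :* ((e :* e :* e :- r :* r) :* z) := k :* con (+ 1728)
        :+ con (+ 1) :* ((e :* e :* e :- r :* r) :* d :- con (+ 1728) :* k)
        :+ (e :* e :* e :- r :* r) :* (k :* z :- d)) 𝕃.refl (qᴸ n) Z (ι d) (ι e) (ι r))))
    (qᴸ-cancel n (𝕃.trans (clear-/ j n) (𝕃.trans (ι-cong j≋) (𝕃.trans (ι-* _ d) (𝕃.trans (𝕃.*-cong cube (𝕃.sym qZ))
      (solve 3 (λ c k z → c :* (k :* z) := k :* (c :* z)) 𝕃.refl (ι e 𝕃.* ι e 𝕃.* ι e) (qᴸ n) Z))))))
    where
    Z : Laurent
    Z = d /q^ n
    qZ : qᴸ n 𝕃.* Z ≅ ι d
    qZ = clear-/ d n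
    cube : ι (e ⊠ e ⊠ e) ≅ ι e 𝕃.* ι e 𝕃.* ι e
    cube = 𝕃.trans (ι-* (e ⊠ e) e) (𝕃.*-congʳ (ι-* e e))
    scaled : ∀ c f {x} → ι (conPS c ⊠ θ f) ≅ x → conᴸ c 𝕃.* θᴸ (ι f) ≅ x
    scaled c f eq = 𝕃.trans (𝕃.*-cong (𝕃.sym (ι-con c)) (θᴸ-ι f)) (𝕃.trans (𝕃.sym (ι-* (conPS c) (θ f))) eq)
    derivative : conᴸ (+ n) 𝕃.* qᴸ n 𝕃.* Z 𝕃.+ qᴸ n 𝕃.* θᴸ Z ≅ conᴸ (+ n) 𝕃.* ((conᴸ (+ 1) 𝕃.- ι p) 𝕃.* ι d)
    derivative = 𝕃.trans (𝕃.+-congʳ (𝕃.*-congʳ (𝕃.trans (𝕃.*-congʳ (𝕃.sym (ι-con (+ n)))) (𝕃.trans (𝕃.sym (ι-* _ _)) (𝕃.trans (ι-cong (𝕊.sym (θ-q^ n))) (𝕃.sym (θᴸ-ι (q 𝕊.^ n))))))))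
      (𝕃.trans (𝕃.sym (θ𝕃.∂-* (qᴸ n) Z)) (𝕃.trans (θ𝕃.∂-cong qZ) (𝕃.trans (θᴸ-ι d) (𝕃.trans (ι-cong θd) (𝕃.trans (ι-* _ _)
        (𝕃.*-cong (ι-con (+ n)) (𝕃.trans (ι-* _ d) (𝕃.*-congʳ (𝕃.trans (ι-sub _ p) (𝕃.+-congʳ (ι-con (+ 1))))))))))))
    discᴸ : (ι e 𝕃.* ι e 𝕃.* ι e 𝕃.- ι r 𝕃.* ι r) 𝕃.* ι d ≅ conᴸ (+ 1728) 𝕃.* qᴸ n
    discᴸ = 𝕃.trans (𝕃.*-congʳ (𝕃.sym (𝕃.trans (ι-sub (e ⊠ e ⊠ e) (r ⊠ r)) (𝕃.+-cong cube (𝕃.-‿cong (ι-* r r))))))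
      (𝕃.trans (𝕃.sym (ι-* _ d)) (𝕃.trans (ι-cong disc) (𝕃.trans (ι-* _ _) (𝕃.*-congʳ (ι-con (+ 1728))))))

J : Laurent
J = Jq /q^ 1

J-equation : SchwarzianOf.F J (θᴸ J) (θᴸ (θᴸ J)) (θᴸ (θᴸ (θᴸ J))) ≅ conᴸ (+ 0)
J-equation = quotient-equation P Q R D Jq 1 (one* θP) (one* θQ) (one* θR) (𝕊.trans θD (𝕊.sym (one _)))
    (𝕊.trans discriminant (𝕊.*-congˡ (𝕊.sym (𝕊.*-identityʳ q)))) Jq≋
  where
  one : ∀ f → conPS (+ 1) ⊠ f ≋ f
  one f = 𝕊.trans (𝕊.*-congʳ 𝕊.con-1) (𝕊.*-identityˡ f)
  one* : ∀ {f g} → f ≋ g → f ≋ conPS (+ 1) ⊠ g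
  one* eq = 𝕊.trans eq (𝕊.sym (one _))

module _ (ℓ′ : ℕ) where
  open Dilation ℓ′

  K : Laurent
  K = δ Jq /q^ ℓ

  δ-sub : ∀ f g → δ (f 𝕊.- g) ≋ δ f 𝕊.- δ g
  δ-sub f g = 𝕊.trans (δ-⊞ f (⊟ g)) (𝕊.+-congˡ (𝕊.trans (δ-cong (𝕊.trans (𝕊.sym (𝕊.*-identityˡ (⊟ g)))
      (solve 1 (λ g → g :^ 0 :* (:- g) := con (ℤ.- + 1) :* g) 𝕊.refl g)))
    (𝕊.trans (δ-con⊠ (ℤ.- + 1) g) (solve 1 (λ g → con (ℤ.- + 1) :* g := :- g) 𝕊.refl (δ g)))))
    where open 𝕊.Solver using (solve; _:=_; _:*_; :-_; con; _:^_)

  private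
    transport : ∀ c {f g} → conPS c ⊠ θ f ≋ g → conPS c ⊠ θ (δ f) ≋ conPS (+ ℓ) ⊠ δ g
    transport c {f} {g} eq = 𝕊.trans (𝕊.*-congˡ (θ-δ f)) (𝕊.trans
      (solve 3 (λ c l x → c :* (l :* x) := l :* (c :* x)) 𝕊.refl (conPS c) (conPS (+ ℓ)) (δ (θ f)))
      (𝕊.*-congˡ (𝕊.trans (𝕊.sym (δ-con⊠ c (θ f))) (δ-cong eq))))
      where open 𝕊.Solver using (solve; _:=_; _:*_)

    δ-q : δ q ≋ q 𝕊.^ ℓ
    δ-q = 𝕊.trans (δ-unfold q) (𝕊.trans (𝕊.+-cong 𝕊.con-0 (𝕊.*-congˡ (𝕊.trans (δ-cong {tail q} {conPS (+ 1)} (mk≋ λ { zero → ≡.refl ; (suc _) → ≡.refl }))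
      (𝕊.trans (δ-con (+ 1)) 𝕊.con-1)))) (𝕊.trans (𝕊.+-identityˡ _) (𝕊.*-identityʳ _)))

    cube : ∀ f → δ (f ⊠ f ⊠ f) ≋ δ f ⊠ δ f ⊠ δ f
    cube f = 𝕊.trans (δ-⊠ (f ⊠ f) f) (𝕊.*-congʳ (δ-⊠ f f))

  K-equation : SchwarzianOf.F K (θᴸ K) (θᴸ (θᴸ K)) (θᴸ (θᴸ (θᴸ K))) ≅ conᴸ (+ 0)
  K-equation = quotient-equation (δ P) (δ Q) (δ R) (δ D) (δ Jq) ℓ
    (𝕊.trans (transport (+ 12) θP) (𝕊.*-congˡ (𝕊.trans (δ-sub (P ⊠ P) Q) (𝕊.+-congʳ (δ-⊠ P P)))))
    (𝕊.trans (transport (+ 3) θQ) (𝕊.*-congˡ (𝕊.trans (δ-sub (P ⊠ Q) R) (𝕊.+-congʳ (δ-⊠ P Q)))))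
    (𝕊.trans (transport (+ 2) θR) (𝕊.*-congˡ (𝕊.trans (δ-sub (P ⊠ R) (Q ⊠ Q)) (𝕊.+-cong (δ-⊠ P R) (𝕊.-‿cong (δ-⊠ Q Q))))))
    (𝕊.trans (θ-δ D) (𝕊.*-congˡ (𝕊.trans (δ-cong θD) (𝕊.trans (δ-⊠ _ D) (𝕊.*-congʳ (𝕊.trans (δ-sub (conPS (+ 1)) P) (𝕊.+-congʳ (δ-con (+ 1)))))))))
    (𝕊.trans (𝕊.*-congʳ (𝕊.sym (𝕊.trans (δ-sub (Q ⊠ Q ⊠ Q) (R ⊠ R)) (𝕊.+-cong (cube Q) (𝕊.-‿cong (δ-⊠ R R))))))
      (𝕊.trans (𝕊.sym (δ-⊠ _ D)) (𝕊.trans (δ-cong discriminant) (𝕊.trans (δ-con⊠ (+ 1728) q) (𝕊.*-congˡ δ-q)))))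
    (𝕊.trans (δ-cong Jq≋) (𝕊.trans (δ-⊠ _ D) (𝕊.*-congʳ (cube Q))))

-- x = f/qᵖ with f(0) = a
record Lead (p : ℕ) (a : ℤ) (x : Laurent) : Set where
  constructor lead
  field
    series  : PS
    expands : qᴸ p 𝕃.* x ≅ ι series
    initial : series 0 ≡ a

module _ where
  open LaurentRing using (ι-cong; ι-*; ι-+; ι-neg; ι-con; ι-injective; clear)
  open 𝕃.Solver using (solve; _:=_; _:*_)

  qᴸ-+ : ∀ m n → qᴸ (m ℕ.+ n) ≅ qᴸ m 𝕃.* qᴸ n
  qᴸ-+ m n = 𝕃.trans (ι-cong (𝕊.^-homo-* q m n)) (ι-* (q 𝕊.^ m) (q 𝕊.^ n))

  Lead-cong : ∀ {p a x y} → x ≅ y → Lead p a x → Lead p a y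
  Lead-cong eq (lead f e h) = lead f (𝕃.trans (𝕃.*-congˡ (𝕃.sym eq)) e) h

  Lead-* : ∀ {p r a b x y} → Lead p a x → Lead r b y → Lead (p ℕ.+ r) (a ℤ.* b) (x 𝕃.* y)
  Lead-* {p} {r} {x = x} {y} (lead f e h) (lead g e′ h′) = lead (f ⊠ g)
    (𝕃.trans (𝕃.*-congʳ (qᴸ-+ p r)) (𝕃.trans (solve 4 (λ u v x y → u :* v :* (x :* y) := u :* x :* (v :* y)) 𝕃.refl (qᴸ p) (qᴸ r) x y)
        (𝕃.trans (𝕃.*-cong e e′) (𝕃.sym (ι-* f g)))))
    (≡.trans (⊠-0 f g) (≡.cong₂ ℤ._*_ h h′))

  Lead-+ : ∀ {p a b x y} → Lead p a x → Lead p b y → Lead p (a ℤ.+ b) (x 𝕃.+ y)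
  Lead-+ (lead f e h) (lead g e′ h′) = lead (f ⊞ g) (𝕃.trans (𝕃.distribˡ _ _ _) (𝕃.trans (𝕃.+-cong e e′) (𝕃.sym (ι-+ f g)))) (⊞-at h h′)

  Lead-neg : ∀ {p a x} → Lead p a x → Lead p (ℤ.- a) (𝕃.- x)
  Lead-neg (lead f e h) = lead (⊟ f) (𝕃.trans (𝕃.sym (𝕃.-‿distribʳ-* _ _)) (𝕃.trans (𝕃.-‿cong e) (𝕃.sym (ι-neg f))))
    (≡.trans (⊟-coefficient f 0) (≡.cong ℤ.-_ h))

  Lead-con : ∀ c → Lead 0 c (conᴸ c)
  Lead-con c = lead (conPS c) (𝕃.trans (𝕃.*-congʳ ι-1) (𝕃.trans (𝕃.*-identityˡ _) (𝕃.sym (ι-con c)))) ≡.refl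

  Lead-weaken : ∀ {p a x} r → p < r → Lead p a x → Lead r (+ 0) x
  Lead-weaken {p} {a} {x} r p<r (lead f e h) = lead (q 𝕊.^ k ⊠ f)
    (𝕃.trans (𝕃.*-congʳ (𝕃.trans (𝕃.reflexive (≡.cong qᴸ (≡.sym (ℕP.m∸n+n≡m (ℕP.<⇒≤ p<r))))) (qᴸ-+ k p)))
        (𝕃.trans (𝕃.*-assoc _ _ _) (𝕃.trans (𝕃.*-congˡ e) (𝕃.sym (ι-* (q 𝕊.^ k) f)))))
    (q^⊠-low k f 0 (ℕP.m<n⇒0<n∸m p<r))
    where k = r ∸ p

  Lead-0 : ∀ p {x} → x ≅ conᴸ (+ 0) → Lead p (+ 0) x
  Lead-0 p eq = lead 0PS (𝕃.trans (𝕃.*-congˡ eq) (𝕃.trans (𝕃.zeroʳ _) (𝕃.trans (𝕃.sym (ι-con (+ 0))) (ι-cong 𝕊.con-0)))) (0PS-coefficient 0)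

  Lead-unique : ∀ {p a b x} → Lead p a x → Lead p b x → a ≡ b
  Lead-unique (lead f e h) (lead g e′ h′) = ≡.trans (≡.sym h) (≡.trans (at (ι-injective (𝕃.trans (𝕃.sym e) e′)) 0) h′)

  Lead-^ : ∀ {p x} n → Lead p (+ 1) x → Lead (n ℕ.* p) (+ 1) (x 𝕃.^ n)
  Lead-^ zero    l = Lead-con (+ 1)
  Lead-^ (suc n) l = Lead-* l (Lead-^ n l)

  Lead-∑ : ∀ p n a v → (∀ i → i < n → Lead p (a i) (v i)) → Lead p (∑ℤ n a) (∑𝕃.∑ n v)
  Lead-∑ p zero    a v l = Lead-0 p 𝕃.refl
  Lead-∑ p (suc n) a v l = Lead-+ (Lead-∑ p n a v (λ i i<n → l i (ℕP.m<n⇒m<1+n i<n))) (l n ℕP.≤-refl)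

  Lead-pole : ∀ x → Lead (pole x) (num x 0) x
  Lead-pole x = lead (num x) (clear x) ≡.refl

-- Polynomial functions on the curve and their pole orders.

powT : Term → ℕ → Term
powT e zero    = κ (+ 1)
powT e (suc n) = e ⊗ powT e n

∑T : ℕ → (ℕ → Term) → Term
∑T zero    f = κ (+ 0)
∑T (suc n) f = ∑T n f ⊕ f n

open Evaluation Laurent-algebra using (eval) public

eval-pow : ∀ x y e n → eval x y (powT e n) ≡ eval x y e 𝕃.^ n
eval-pow x y e zero    = ≡.refl
eval-pow x y e (suc n) = ≡.cong (eval x y e 𝕃.*_) (eval-pow x y e n)

eval-∑ : ∀ x y n f → eval x y (∑T n f) ≡ ∑𝕃.∑ n (λ i → eval x y (f i))
eval-∑ x y zero    f = ≡.refl
eval-∑ x y (suc n) f = ≡.cong (𝕃._+ eval x y (f n)) (eval-∑ x y n f)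

monomial : ℕ → ℕ → Laurent → Laurent → Laurent
monomial i n x y = x 𝕃.^ i 𝕃.* y 𝕃.^ n

polynomial : ℕ → ℕ → (ℕ → ℕ → ℤ) → Laurent → Laurent → Laurent
polynomial D N ε x y = ∑𝕃.∑ D (λ i → ∑𝕃.∑ N (λ n → conᴸ (ε i n) 𝕃.* monomial i n x y))

OnCurve : ℕ → (ℕ → ℕ → ℤ) → Laurent → Laurent → Set
OnCurve ℓ a x y = x 𝕃.^ suc ℓ 𝕃.+ y 𝕃.^ suc ℓ 𝕃.+ polynomial (suc ℓ) (suc ℓ) a x y ≅ conᴸ (+ 0)

module Reduction (ℓ : ℕ) (a : ℕ → ℕ → ℤ) where
  open 𝕃.Solver using (solve; _:=_; _:+_; _:*_; _:-_; :-_; con)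

  -- v agrees on the curve with a polynomial of degree at most ℓ in y
  Reducible : (Laurent → Laurent → Laurent) → Set
  Reducible v = ∃ λ d → ∃ λ (ε : ℕ → ℕ → ℤ) → ∀ D → d ≤ D → ∀ x y → OnCurve ℓ a x y → v x y ≅ polynomial D (suc ℓ) ε x y

  Reducible-cong : ∀ {v w} → (∀ x y → OnCurve ℓ a x y → w x y ≅ v x y) → Reducible v → Reducible w
  Reducible-cong eq (d , ε , h) = d , ε , λ D d≤D x y c → 𝕃.trans (eq x y c) (h D d≤D x y c)

  -- A reduction is valid for every bound D above its own degree, so two reductions can be added at
  -- a common D.
  Reducible-+ : ∀ {v w} → Reducible v → Reducible w → Reducible (λ x y → v x y 𝕃.+ w x y)
  Reducible-+ (d , ε , h) (d′ , ε′ , h′) = d ℕ.+ d′ , (λ i n → ε i n ℤ.+ ε′ i n) , λ D le x y c → 𝕃.trans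
    (𝕃.+-cong (h D (ℕP.≤-trans (ℕP.m≤m+n d d′) le) x y c) (h′ D (ℕP.≤-trans (ℕP.m≤n+m d′ d) le) x y c))
    (𝕃.sym (𝕃.trans (∑𝕃.∑-cong D (λ i _ → 𝕃.trans
      (∑𝕃.∑-cong (suc ℓ) (λ n _ → 𝕃.trans (𝕃.*-congʳ (𝕃.con-+ (ε i n) (ε′ i n))) (𝕃.distribʳ _ _ _)))
      (∑𝕃.∑-+ (suc ℓ) (λ n → conᴸ (ε i n) 𝕃.* monomial i n x y) (λ n → conᴸ (ε′ i n) 𝕃.* monomial i n x y))))
      (∑𝕃.∑-+ D (λ i → ∑𝕃.∑ (suc ℓ) (λ n → conᴸ (ε i n) 𝕃.* monomial i n x y)) (λ i → ∑𝕃.∑ (suc ℓ) (λ n → conᴸ (ε′ i n) 𝕃.* monomial i n x y)))))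

  Reducible-con* : ∀ k {v} → Reducible v → Reducible (λ x y → conᴸ k 𝕃.* v x y)
  Reducible-con* k (d , ε , h) = d , (λ i n → k ℤ.* ε i n) , λ D le x y c → 𝕃.trans (𝕃.*-congˡ (h D le x y c))
    (𝕃.trans (∑𝕃.*-∑ D (conᴸ k) (λ i → ∑𝕃.∑ (suc ℓ) (λ n → conᴸ (ε i n) 𝕃.* monomial i n x y)))
      (∑𝕃.∑-cong D (λ i _ → 𝕃.trans (∑𝕃.*-∑ (suc ℓ) (conᴸ k) (λ n → conᴸ (ε i n) 𝕃.* monomial i n x y))
        (∑𝕃.∑-cong (suc ℓ) (λ n _ → 𝕃.trans (𝕃.sym (𝕃.*-assoc _ _ _)) (𝕃.*-congʳ (𝕃.sym (𝕃.con-* k (ε i n)))))))))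

  private
    indicator : ℕ → ℕ → ℤ
    indicator i j = if does (i ℕP.≟ j) then + 1 else + 0

    indicator-refl : ∀ i → indicator i i ≡ + 1
    indicator-refl i = ≡.cong (λ b → if b then + 1 else + 0) (dec-true (i ℕP.≟ i) ≡.refl)

    indicator-≢ : ∀ {i j} → j ≢ i → indicator i j ≡ + 0
    indicator-≢ {i} {j} ne = ≡.cong (λ b → if b then + 1 else + 0) (dec-false (i ℕP.≟ j) (ne ∘ ≡.sym))

    con-zero : ∀ {c} z → c ≡ + 0 → conᴸ c 𝕃.* z ≅ 𝕃.0#
    con-zero z ≡.refl = 𝕃.zeroˡ z

  Reducible-monomial : ∀ i n → n ≤ ℓ → Reducible (monomial i n)
  Reducible-monomial i n n≤ℓ = suc i , (λ j m → indicator i j ℤ.* indicator n m) , λ D i<D x y _ → 𝕃.sym (𝕃.trans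
    (∑𝕃.∑-single D i i<D (λ j _ j≢i → ∑𝕃.∑-0 (suc ℓ) (λ m _ → con-zero _ (≡.cong (ℤ._* indicator n m) (indicator-≢ j≢i)))))
    (𝕃.trans (∑𝕃.∑-single (suc ℓ) n (s≤s n≤ℓ) (λ m _ m≢n → con-zero _ (≡.trans (≡.cong (indicator i i ℤ.*_) (indicator-≢ m≢n)) (ℤP.*-zeroʳ (indicator i i)))))
      (𝕃.trans (𝕃.*-congʳ (𝕃.reflexive (≡.cong conᴸ (≡.cong₂ ℤ._*_ (indicator-refl i) (indicator-refl n))))) (𝕃.*-identityˡ _))))

  Reducible-∑ : ∀ N (v : ℕ → Laurent → Laurent → Laurent) → (∀ i → i < N → Reducible (v i)) → Reducible (λ x y → ∑𝕃.∑ N (λ i → v i x y))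
  Reducible-∑ zero    v r = Reducible-cong (λ x y _ → 𝕃.sym (𝕃.zeroˡ _)) (Reducible-con* (+ 0) (Reducible-monomial 0 0 z≤n))
  Reducible-∑ (suc N) v r = Reducible-+ (Reducible-∑ N v (λ i i<N → r i (ℕP.m<n⇒m<1+n i<N))) (r N ℕP.≤-refl)

  -- Φ is monic in Y, so the equation of the curve expresses Y^(ℓ+1) by lower powers of Y, at the
  -- price of higher powers of X.
  Reducible-monomial⁺ : ∀ i → Reducible (monomial i (suc ℓ))
  Reducible-monomial⁺ i = Reducible-cong
    (λ x y c → 𝕃.trans (LinearCombination.modulo₁ Laurent-algebra (x 𝕃.^ i) c
        (solve 4 (λ xi xl yl s → xi :* yl := con (ℤ.- + 1) :* (xi :* xl) :+ con (ℤ.- + 1) :* (xi :* s) :+ xi :* (xl :+ yl :+ s :- con (+ 0))) 𝕃.refl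
          (x 𝕃.^ i) (x 𝕃.^ suc ℓ) (y 𝕃.^ suc ℓ) (polynomial (suc ℓ) (suc ℓ) a x y)))
      (𝕃.+-cong (𝕃.*-congˡ (𝕃.trans (𝕃.sym (𝕃.^-homo-* x i (suc ℓ))) (𝕃.sym (𝕃.*-identityʳ _)))) (𝕃.*-congˡ
        (𝕃.trans (∑𝕃.*-∑ (suc ℓ) (x 𝕃.^ i) (λ m → ∑𝕃.∑ (suc ℓ) (λ n → conᴸ (a m n) 𝕃.* monomial m n x y)))
          (∑𝕃.∑-cong (suc ℓ) (λ m _ → 𝕃.trans (∑𝕃.*-∑ (suc ℓ) (x 𝕃.^ i) (λ n → conᴸ (a m n) 𝕃.* monomial m n x y))
            (∑𝕃.∑-cong (suc ℓ) (λ n _ → 𝕃.trans (solve 4 (λ p c r s → p :* (c :* (r :* s)) := c :* (p :* r :* s)) 𝕃.refl (x 𝕃.^ i) (conᴸ (a m n)) (x 𝕃.^ m) (y 𝕃.^ n))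
              (𝕃.*-congˡ (𝕃.*-congʳ (𝕃.sym (𝕃.^-homo-* x i m)))))))))))) 
    (Reducible-+ (Reducible-con* (ℤ.- + 1) (Reducible-monomial (i ℕ.+ suc ℓ) 0 z≤n))
      (Reducible-con* (ℤ.- + 1) (Reducible-∑ (suc ℓ) _ (λ m _ → Reducible-∑ (suc ℓ) (λ n x y → conᴸ (a m n) 𝕃.* monomial (i ℕ.+ m) n x y)
        (λ { n (s≤s n≤ℓ) → Reducible-con* (a m n) (Reducible-monomial (i ℕ.+ m) n n≤ℓ) })))))

  private
    product : ∀ (z : Laurent → Laurent → Laurent) → (∀ i n → n ≤ ℓ → Reducible (λ x y → z x y 𝕃.* monomial i n x y)) →
      ∀ {v} → Reducible v → Reducible (λ x y → z x y 𝕃.* v x y)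
    product z r (d , ε , h) = Reducible-cong
      (λ x y c → 𝕃.trans (𝕃.*-congˡ (h d ℕP.≤-refl x y c)) (𝕃.trans (∑𝕃.*-∑ d (z x y) (λ i → ∑𝕃.∑ (suc ℓ) (λ n → conᴸ (ε i n) 𝕃.* monomial i n x y)))
        (∑𝕃.∑-cong d (λ i _ → 𝕃.trans (∑𝕃.*-∑ (suc ℓ) (z x y) (λ n → conᴸ (ε i n) 𝕃.* monomial i n x y))
          (∑𝕃.∑-cong (suc ℓ) (λ n _ → solve 3 (λ z c m → z :* (c :* m) := c :* (z :* m)) 𝕃.refl (z x y) (conᴸ (ε i n)) (monomial i n x y)))))))
      (Reducible-∑ d _ (λ i _ → Reducible-∑ (suc ℓ) (λ n x y → conᴸ (ε i n) 𝕃.* (z x y 𝕃.* monomial i n x y))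
        (λ { n (s≤s n≤ℓ) → Reducible-con* (ε i n) (r i n n≤ℓ) })))

  -- Stated as multiplication of a reduced function by a term. The induction then only ever
  -- multiplies by a constant, X or Y, and Y raises the degree by at most one above ℓ.
  Reducible-eval* : ∀ e {v} → Reducible v → Reducible (λ x y → eval x y e 𝕃.* v x y)
  Reducible-eval* (κ k)   r = Reducible-con* k r
  Reducible-eval* X       r = product (λ x y → x) (λ i n n≤ℓ → Reducible-cong (λ x y _ → 𝕃.sym (𝕃.*-assoc _ _ _)) (Reducible-monomial (suc i) n n≤ℓ)) r
  Reducible-eval* Y       r = product (λ x y → y) (λ i n n≤ℓ → Reducible-cong
    (λ x y _ → solve 3 (λ y p r → y :* (p :* r) := p :* (y :* r)) 𝕃.refl y (x 𝕃.^ i) (y 𝕃.^ n)) (y-step i n n≤ℓ)) r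
    where
    y-step : ∀ i n → n ≤ ℓ → Reducible (monomial i (suc n))
    y-step i n n≤ℓ with ℕP.m≤n⇒m<n∨m≡n n≤ℓ
    ... | inj₁ n<ℓ    = Reducible-monomial i (suc n) n<ℓ
    ... | inj₂ ≡.refl = Reducible-monomial⁺ i
  Reducible-eval* (e ⊕ f) r = Reducible-cong (λ x y _ → 𝕃.distribʳ _ _ _) (Reducible-+ (Reducible-eval* e r) (Reducible-eval* f r))
  Reducible-eval* (e ⊗ f) r = Reducible-cong (λ x y _ → 𝕃.*-assoc _ _ _) (Reducible-eval* e (Reducible-eval* f r))

  Reducible-eval : ∀ e → Reducible (λ x y → eval x y e)
  Reducible-eval e = Reducible-cong (λ x y _ → solve 1 (λ z → z := z :* (con (+ 1) :* con (+ 1))) 𝕃.refl (eval x y e)) (Reducible-eval* e (Reducible-monomial 0 0 z≤n))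

cells : ∀ i₀ n₀ → ℤ → (i n : ℕ) → ℤ
cells i₀ n₀ c i n with i ℕP.≟ i₀ | n ℕP.≟ n₀
... | yes _ | yes _ = c
... | yes _ | no  _ = + 0
... | no  _ | _     = + 0

cells-sum : ∀ {D N i₀ n₀} c → i₀ < D → n₀ < N → ∑ℤ D (λ i → ∑ℤ N (cells i₀ n₀ c i)) ≡ c
cells-sum {D} {N} {i₀} {n₀} c i₀<D n₀<N = ≡.trans
  (∑ℤ.∑-single D i₀ i₀<D (λ i _ i≢ → ∑ℤ.∑-0 N (λ n _ → row i n i≢)))
  (≡.trans (∑ℤ.∑-single N n₀ n₀<N (λ n _ n≢ → column n n≢)) centre)
  where
  row : ∀ i n → i ≢ i₀ → cells i₀ n₀ c i n ≡ + 0
  row i n i≢ with i ℕP.≟ i₀ | n ℕP.≟ n₀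
  ... | yes eq | _     = contradiction eq i≢
  ... | no  _  | yes _ = ≡.refl
  ... | no  _  | no  _ = ≡.refl
  column : ∀ n → n ≢ n₀ → cells i₀ n₀ c i₀ n ≡ + 0
  column n n≢ with i₀ ℕP.≟ i₀ | n ℕP.≟ n₀
  ... | yes _ | yes eq = contradiction eq n≢
  ... | yes _ | no  _  = ≡.refl
  ... | no  _ | yes _  = ≡.refl
  ... | no  _ | no  _  = ≡.refl
  centre : cells i₀ n₀ c i₀ n₀ ≡ c
  centre with i₀ ℕP.≟ i₀ | n₀ ℕP.≟ n₀
  ... | yes _ | yes _ = ≡.refl
  ... | yes _ | no ne = contradiction ≡.refl ne
  ... | no ne | _     = contradiction ≡.refl ne

-- If every other term has a smaller pole order or coefficient zero, then ε i₀ n₀ is itself the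
-- leading coefficient of the sum at order w i₀ n₀, which is known to be zero.
isolate : ∀ D N ε x y (w : ℕ → ℕ → ℕ) → (∀ i n → Lead (w i n) (+ 1) (monomial i n x y)) →
  ∀ i₀ n₀ → i₀ < D → n₀ < N →
  (∀ i n → i < D → n < N → (i ≢ i₀) ⊎ (n ≢ n₀) → (w i n < w i₀ n₀) ⊎ (ε i n ≡ + 0)) →
  Lead (w i₀ n₀) (+ 0) (polynomial D N ε x y) → ε i₀ n₀ ≡ + 0
isolate D N ε x y w lw i₀ n₀ i₀<D n₀<N others l₀ = ≡.trans (≡.sym (cells-sum (ε i₀ n₀) i₀<D n₀<N)) (Lead-unique
  (Lead-∑ p D (λ i → ∑ℤ N (cells i₀ n₀ (ε i₀ n₀) i)) _ (λ i i<D → Lead-∑ p N (cells i₀ n₀ (ε i₀ n₀) i) _ (λ n n<N → term i n i<D n<N))) l₀)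
  where
  p = w i₀ n₀
  scaled : ∀ c i n → Lead (w i n) (c ℤ.* + 1) (conᴸ c 𝕃.* monomial i n x y)
  scaled c i n = Lead-* (Lead-con c) (lw i n)
  small : ∀ i n → (w i n < p) ⊎ (ε i n ≡ + 0) → Lead p (+ 0) (conᴸ (ε i n) 𝕃.* monomial i n x y)
  small i n (inj₁ lt) = Lead-weaken p lt (scaled (ε i n) i n)
  small i n (inj₂ eq) = Lead-0 p (𝕃.trans (𝕃.*-congʳ (𝕃.reflexive (≡.cong conᴸ eq))) (𝕃.zeroˡ _))
  term : ∀ i n → i < D → n < N → Lead p (cells i₀ n₀ (ε i₀ n₀) i n) (conᴸ (ε i n) 𝕃.* monomial i n x y)
  term i n i<D n<N with i ℕP.≟ i₀ | n ℕP.≟ n₀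
  ... | yes ≡.refl | yes ≡.refl = ≡.subst (λ a → Lead p a (conᴸ (ε i n) 𝕃.* monomial i n x y)) (ℤP.*-identityʳ (ε i n)) (scaled (ε i n) i n)
  ... | yes ≡.refl | no n≢      = small i n (others i n i<D n<N (inj₂ n≢))
  ... | no i≢      | yes _      = small i n (others i n i<D n<N (inj₁ i≢))
  ... | no i≢      | no _       = small i n (others i n i<D n<N (inj₁ i≢))

module Vanishing (ℓ : ℕ) (2≤ℓ : 2 ≤ ℓ) (a : ℕ → ℕ → ℤ) (x₁ y₁ x₂ y₂ : Laurent)
  (lx₁ : Lead ℓ (+ 1) x₁) (ly₁ : Lead 1 (+ 1) y₁) (lx₂ : Lead 1 (+ 1) x₂) (ly₂ : Lead ℓ (+ 1) y₂) where
  private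
    -- Pole orders of X^i Y^n at the two places. For n ≤ ℓ, the only coincidences of `w₁` are those
    -- of (i, ℓ) with (i + 1, 0).
    w₁ w₂ : ℕ → ℕ → ℕ
    w₁ i n = i ℕ.* ℓ ℕ.+ n
    w₂ i n = i ℕ.+ n ℕ.* ℓ

    lw₁ : ∀ i n → Lead (w₁ i n) (+ 1) (monomial i n x₁ y₁)
    lw₁ i n = ≡.subst (λ p → Lead p (+ 1) (monomial i n x₁ y₁)) (≡.cong (i ℕ.* ℓ ℕ.+_) (ℕP.*-identityʳ n)) (Lead-* (Lead-^ i lx₁) (Lead-^ n ly₁))

    lw₂ : ∀ i n → Lead (w₂ i n) (+ 1) (monomial i n x₂ y₂)
    lw₂ i n = ≡.subst (λ p → Lead p (+ 1) (monomial i n x₂ y₂)) (≡.cong (ℕ._+ n ℕ.* ℓ) (ℕP.*-identityʳ i)) (Lead-* (Lead-^ i lx₂) (Lead-^ n ly₂))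

    row-below : ∀ {i d} n → i < d → n ≤ ℓ → w₁ i n ≤ d ℕ.* ℓ
    row-below {i} n i<d n≤ℓ = ℕP.≤-trans (ℕP.+-monoʳ-≤ (i ℕ.* ℓ) n≤ℓ) (ℕP.≤-trans (ℕP.≤-reflexive (ℕP.+-comm (i ℕ.* ℓ) ℓ)) (ℕP.*-monoˡ-≤ ℓ i<d))

    0<ℓ : 0 < ℓ
    0<ℓ = ℕP.≤-trans (s≤s z≤n) 2≤ℓ

    -- In the highest row, an entry with n > 0 dominates all lower rows at the first place; the
    -- entries to its right have been eliminated before it. `k` counts the columns still to the
    -- right of `j`.
    top : ∀ d ε → polynomial (suc d) (suc ℓ) ε x₁ y₁ ≅ conᴸ (+ 0) → ∀ k j → k ℕ.+ j ≡ ℓ → ∀ n → n ≤ ℓ → j < n → ε d n ≡ + 0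
    top d ε z zero    j ≡.refl n n≤ℓ j<n = contradiction n≤ℓ (ℕP.<⇒≱ j<n)
    top d ε z (suc k) j eq     n n≤ℓ j<n with ℕP.m≤n⇒m<n∨m≡n j<n
    ... | inj₁ 1+j<n  = top d ε z k (suc j) (≡.trans (ℕP.+-suc k j) eq) n n≤ℓ 1+j<n
    ... | inj₂ ≡.refl = isolate (suc d) (suc ℓ) ε x₁ y₁ w₁ lw₁ d (suc j) ℕP.≤-refl (s≤s n≤ℓ) others (Lead-0 _ z)
      where
      others : ∀ i m → i < suc d → m < suc ℓ → (i ≢ d) ⊎ (m ≢ suc j) → (w₁ i m < w₁ d (suc j)) ⊎ (ε i m ≡ + 0)
      others i m (s≤s i≤d) (s≤s m≤ℓ) ne with ℕP.m≤n⇒m<n∨m≡n i≤d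
      ... | inj₁ i<d = inj₁ (ℕP.≤-<-trans (row-below m i<d m≤ℓ) (ℕP.m<m+n (d ℕ.* ℓ) (s≤s z≤n)))
      others i m (s≤s i≤d) (s≤s m≤ℓ) (inj₁ i≢d) | inj₂ i≡d = contradiction i≡d i≢d
      others i m (s≤s i≤d) (s≤s m≤ℓ) (inj₂ m≢) | inj₂ ≡.refl with ℕP.<-cmp m (suc j)
      ... | tri< m<  _ _ = inj₁ (ℕP.+-monoʳ-< (d ℕ.* ℓ) m<)
      ... | tri≈ _ eq′ _ = contradiction eq′ m≢
      ... | tri> _ _ m>  = inj₂ (top d ε z k (suc j) (≡.trans (ℕP.+-suc k j) eq) m m≤ℓ m>)

    -- After `top` only (d, 0) is left, and at the first place it competes with (d - 1, ℓ). The
    -- absence of a pole at the second place eliminates that competitor first.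
    last-row : ∀ d ε b → polynomial (suc d) (suc ℓ) ε x₁ y₁ ≅ conᴸ (+ 0) → Lead 0 b (polynomial (suc d) (suc ℓ) ε x₂ y₂) →
      ∀ n → n ≤ ℓ → ε d n ≡ + 0
    last-row d ε b z l = last
      where
      positive : ∀ n → n ≤ ℓ → 0 < n → ε d n ≡ + 0
      positive n n≤ℓ 0<n = top d ε z ℓ 0 (ℕP.+-identityʳ ℓ) n n≤ℓ 0<n
      -- At the second place (e, ℓ) has order e + ℓ², greater than that of every other surviving
      -- entry: one step down in n costs ℓ ≥ 2, and i can exceed e by at most 1.
      corner : ∀ e → d ≡ suc e → ε e ℓ ≡ + 0
      corner e ≡.refl = isolate (suc d) (suc ℓ) ε x₂ y₂ w₂ lw₂ e ℓ (ℕP.n≤1+n (suc e)) ℕP.≤-refl others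
        (Lead-weaken (w₂ e ℓ) (ℕP.<-≤-trans (ℕP.*-mono-< 0<ℓ 0<ℓ) (ℕP.m≤n+m (ℓ ℕ.* ℓ) e)) l)
        where
        others : ∀ i m → i < suc d → m < suc ℓ → (i ≢ e) ⊎ (m ≢ ℓ) → (w₂ i m < w₂ e ℓ) ⊎ (ε i m ≡ + 0)
        others i m (s≤s i≤d) (s≤s m≤ℓ) ne with ℕP.m≤n⇒m<n∨m≡n m≤ℓ
        ... | inj₁ m<ℓ = inj₁ (ℕP.+-cancelʳ-< 1 (w₂ i m) (w₂ e ℓ) (begin-strict
          w₂ i m ℕ.+ 1              <⟨ ℕP.+-monoʳ-< (w₂ i m) 2≤ℓ ⟩
          i ℕ.+ m ℕ.* ℓ ℕ.+ ℓ       ≡⟨ ≡.trans (ℕP.+-assoc i (m ℕ.* ℓ) ℓ) (≡.cong (i ℕ.+_) (ℕP.+-comm (m ℕ.* ℓ) ℓ)) ⟩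
          i ℕ.+ suc m ℕ.* ℓ         ≤⟨ ℕP.+-mono-≤ i≤d (ℕP.*-monoˡ-≤ ℓ m<ℓ) ⟩
          suc e ℕ.+ ℓ ℕ.* ℓ         ≡⟨ ℕP.+-comm 1 (w₂ e ℓ) ⟩
          w₂ e ℓ ℕ.+ 1              ∎))
          where open ℕP.≤-Reasoning
        others i m (s≤s i≤d) (s≤s m≤ℓ) (inj₂ m≢) | inj₂ m≡ = contradiction m≡ m≢
        others i m (s≤s i≤d) (s≤s m≤ℓ) (inj₁ i≢) | inj₂ ≡.refl with ℕP.m≤n⇒m<n∨m≡n i≤d
        ... | inj₁ (s≤s i≤e) = inj₁ (ℕP.+-monoˡ-< (m ℕ.* ℓ) (ℕP.≤∧≢⇒< i≤e i≢))
        ... | inj₂ ≡.refl    = inj₂ (positive m ℕP.≤-refl 0<ℓ)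
      last : ∀ n → n ≤ ℓ → ε d n ≡ + 0
      last (suc n) n≤ℓ = positive (suc n) n≤ℓ (s≤s z≤n)
      last zero    _   = isolate (suc d) (suc ℓ) ε x₁ y₁ w₁ lw₁ d 0 ℕP.≤-refl (s≤s z≤n) others (Lead-0 _ z)
        where
        others : ∀ i m → i < suc d → m < suc ℓ → (i ≢ d) ⊎ (m ≢ 0) → (w₁ i m < w₁ d 0) ⊎ (ε i m ≡ + 0)
        others i m (s≤s i≤d) (s≤s m≤ℓ) ne with ℕP.m≤n⇒m<n∨m≡n i≤d
        others i zero    _ _ (inj₁ i≢) | inj₂ eq = contradiction eq i≢
        others i zero    _ _ (inj₂ m≢) | inj₂ eq = contradiction ≡.refl m≢
        others i (suc m) _ (s≤s m≤ℓ) ne | inj₂ ≡.refl = inj₂ (positive (suc m) m≤ℓ (s≤s z≤n))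
        others i m _ (s≤s m≤ℓ) ne | inj₁ i<d with ℕP.m≤n⇒m<n∨m≡n m≤ℓ
        ... | inj₁ m<ℓ = inj₁ (ℕP.<-≤-trans (ℕP.+-monoʳ-< (i ℕ.* ℓ) m<ℓ) (ℕP.≤-trans (row-below ℓ i<d ℕP.≤-refl) (ℕP.m≤m+n (d ℕ.* ℓ) 0)))
        ... | inj₂ ≡.refl with ℕP.m≤n⇒m<n∨m≡n i<d
        ...   | inj₁ 1+i<d = inj₁ (ℕP.≤-<-trans (ℕP.≤-reflexive (ℕP.+-comm (i ℕ.* ℓ) ℓ)) (ℕP.<-≤-trans (ℕP.*-monoˡ-< ℓ {{ℕ.>-nonZero 0<ℓ}} 1+i<d) (ℕP.m≤m+n (d ℕ.* ℓ) 0)))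
        ...   | inj₂ eq    = inj₂ (corner i (≡.sym eq))

    descent : ∀ D ε b → polynomial D (suc ℓ) ε x₁ y₁ ≅ conᴸ (+ 0) → Lead 0 b (polynomial D (suc ℓ) ε x₂ y₂) →
      ∀ i n → i < D → n ≤ ℓ → ε i n ≡ + 0
    descent (suc d) ε b z l i n (s≤s i≤d) n≤ℓ with ℕP.m≤n⇒m<n∨m≡n i≤d
    ... | inj₂ ≡.refl = last-row d ε b z l n n≤ℓ
    ... | inj₁ i<d    = descent d ε b (𝕃.trans (𝕃.sym (restrict x₁ y₁)) z) (Lead-cong (restrict x₂ y₂) l) i n i<d n≤ℓ
      where
      restrict : ∀ x y → polynomial (suc d) (suc ℓ) ε x y ≅ polynomial d (suc ℓ) ε x y
      restrict x y = 𝕃.trans (𝕃.+-congˡ (∑𝕃.∑-0 (suc ℓ) (λ { n (s≤s n≤ℓ) →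
        𝕃.trans (𝕃.*-congʳ (𝕃.reflexive (≡.cong conᴸ (last-row d ε b z l n n≤ℓ)))) (𝕃.zeroˡ _) }))) (𝕃.+-identityʳ _)

  -- By descent on the rows all coefficients of the reduced form vanish, so the function vanishes at
  -- every point of the curve, in particular at the second place.
  vanish : OnCurve ℓ a x₁ y₁ → OnCurve ℓ a x₂ y₂ → ∀ {v} → Reduction.Reducible ℓ a v →
    v x₁ y₁ ≅ conᴸ (+ 0) → ∀ {b} → Lead 0 b (v x₂ y₂) → v x₂ y₂ ≅ conᴸ (+ 0)
  vanish c₁ c₂ (d , ε , h) z {b} l = 𝕃.trans (h d ℕP.≤-refl x₂ y₂ c₂) (∑𝕃.∑-0 d (λ i i<d → ∑𝕃.∑-0 (suc ℓ) (λ { n (s≤s n≤ℓ) →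
    𝕃.trans (𝕃.*-congʳ (𝕃.reflexive (≡.cong conᴸ (zeros i n i<d n≤ℓ)))) (𝕃.zeroˡ _) })))
    where
    zeros : ∀ i n → i < d → n ≤ ℓ → ε i n ≡ + 0
    zeros = descent d ε b (𝕃.trans (𝕃.sym (h d ℕP.≤-refl x₁ y₁ c₁)) z) (Lead-cong (h d ℕP.≤-refl x₂ y₂ c₂) l)

-- Zero divisors, expansions, fixpoints and inverses.

dropPS : ℕ → PS → PS
dropPS j f k = f (j ℕ.+ k)

shift-drop : ∀ j g → (∀ i → i < j → g i ≡ + 0) → g ≋ q 𝕊.^ j ⊠ dropPS j g
shift-drop j g low = mk≋ λ k → case k ℕP.<? j of λ
  { (yes k<j) → ≡.trans (low k k<j) (≡.sym (q^⊠-low j (dropPS j g) k k<j))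
  ; (no k≮j)  → ≡.subst (λ k → g k ≡ (q 𝕊.^ j ⊠ dropPS j g) k) (ℕP.m+[n∸m]≡n (ℕP.≮⇒≥ k≮j)) (≡.sym (q^⊠-high j (dropPS j g) (k ∸ j))) }

-- The negation of g = 0 supplies no index of a nonzero coefficient. So the argument is turned
-- round: f(k) ≠ 0 forces all coefficients of g to vanish one after another, and decidable equality
-- in ℤ removes the double negations.
no-zero-divisors : ∀ {f g} → f ⊠ g ≋ 0PS → ¬ (g ≋ 0PS) → f ≋ 0PS
no-zero-divisors {f} {g} fg≋0 g≢0 = mk≋ λ k → ≡.trans (decidable-stable (f k ℤP.≟ + 0) (λ fk≢0 →
  g≢0 (mk≋ λ j → ≡.trans (zeros k fk≢0 (suc j) j ℕP.≤-refl) (≡.sym (0PS-coefficient j))))) (≡.sym (0PS-coefficient k))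
  where
  reduced : ∀ h → (h 0 ≢ + 0) → f ⊠ h ≋ 0PS → ∀ n k → k < n → f k ≡ + 0
  reduced h h0≢0 fh≋0 (suc n) k (s≤s k≤n) = case ℤP.i*j≡0⇒i≡0∨j≡0 (f k) product of λ
    { (inj₁ fk≡0) → fk≡0 ; (inj₂ h0≡0) → contradiction h0≡0 h0≢0 }
    where
    product : f k ℤ.* h 0 ≡ + 0
    product = begin
      f k ℤ.* h 0                                        ≡⟨ ≡.cong (λ i → f i ℤ.* h 0) (≡.sym (ℕP.+-identityʳ k)) ⟩
      dropPS k f 0 ℤ.* h 0                               ≡⟨ ⊠-0 (dropPS k f) h ⟨
      (dropPS k f ⊠ h) 0                                 ≡⟨ q^⊠-high k (dropPS k f ⊠ h) 0 ⟨
      (q 𝕊.^ k ⊠ (dropPS k f ⊠ h)) (k ℕ.+ 0)             ≡⟨ at (𝕊.trans (𝕊.sym (𝕊.*-assoc _ _ _)) (𝕊.*-congʳ (𝕊.sym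
                                                              (shift-drop k f (λ i i<k → reduced h h0≢0 fh≋0 n i (ℕP.<-≤-trans i<k k≤n)))))) (k ℕ.+ 0) ⟩
      (f ⊠ h) (k ℕ.+ 0)                                  ≡⟨ ≡.trans (at fh≋0 (k ℕ.+ 0)) (0PS-coefficient _) ⟩
      + 0                                                ∎
      where open ≡.≡-Reasoning
  zeros : ∀ k → f k ≢ + 0 → ∀ n j → j < n → g j ≡ + 0
  zeros k fk≢0 (suc n) j (s≤s j≤n) = decidable-stable (g j ℤP.≟ + 0) λ gj≢0 →
    fk≢0 (reduced (dropPS j g) (gj≢0 ∘ ≡.trans (≡.cong g (≡.sym (ℕP.+-identityʳ j))))
      (q^-cancel j (𝕊.trans (𝕊.trans (𝕊.Solver.solve 3 (λ x f g → x 𝕊.Solver.:* (f 𝕊.Solver.:* g) 𝕊.Solver.:= f 𝕊.Solver.:* (x 𝕊.Solver.:* g)) 𝕊.refl (q 𝕊.^ j) f (dropPS j g))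
        (𝕊.*-congˡ (𝕊.sym (shift-drop j g (λ i i<j → zeros k fk≢0 n i (ℕP.<-≤-trans i<j j≤n)))))) (𝕊.trans fg≋0 (𝕊.sym (𝕊.zeroʳ _))))) (suc k) k ℕP.≤-refl)

record Expansion (p : ℕ) (x : Laurent) (f : PS) : Set where
  constructor expansion
  field expands : qᴸ p 𝕃.* x ≅ ι f
open Expansion

module _ where
  open LaurentRing using (ι-cong; ι-*; ι-+; ι-con; ι-injective; clear)
  open 𝕃.Solver using (solve; _:=_; _:*_)

  Expansion-zero : ∀ {p x f} → Expansion p x f → f ≋ 0PS → x ≅ conᴸ (+ 0)
  Expansion-zero {p} e f≋0 = qᴸ-cancel p (𝕃.trans (expands e) (𝕃.trans (ι-cong (𝕊.trans f≋0 (𝕊.sym 𝕊.con-0))) (𝕃.trans (ι-con (+ 0)) (𝕃.sym (𝕃.zeroʳ _)))))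

  zero-Expansion : ∀ {p x f} → Expansion p x f → x ≅ conᴸ (+ 0) → f ≋ 0PS
  zero-Expansion {p} e x≅0 = 𝕊.trans (ι-injective (𝕃.trans (𝕃.sym (expands e)) (𝕃.trans (𝕃.*-congˡ x≅0) (𝕃.trans (𝕃.zeroʳ _) (𝕃.sym (ι-con (+ 0))))))) 𝕊.con-0

  Laurent-no-zero-divisors : ∀ {x y} → x 𝕃.* y ≅ conᴸ (+ 0) → ¬ (y ≅ conᴸ (+ 0)) → x ≅ conᴸ (+ 0)
  Laurent-no-zero-divisors {x} {y} xy≅0 y≢0 = Expansion-zero ex (no-zero-divisors (zero-Expansion exy xy≅0) (y≢0 ∘ Expansion-zero ey))
    where
    ex : Expansion (pole x) x (num x)
    ex = expansion (clear x)
    ey : Expansion (pole y) y (num y)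
    ey = expansion (clear y)
    exy : Expansion (pole x ℕ.+ pole y) (x 𝕃.* y) (num x ⊠ num y)
    exy = expansion (𝕃.trans (𝕃.*-congʳ (qᴸ-+ (pole x) (pole y))) (𝕃.trans (solve 4 (λ u v x y → u :* v :* (x :* y) := u :* x :* (v :* y)) 𝕃.refl (qᴸ (pole x)) (qᴸ (pole y)) x y)
      (𝕃.trans (𝕃.*-cong (clear x) (clear y)) (𝕃.sym (ι-* (num x) (num y))))))

  Laurent-no-nilpotents : ∀ {x y} n → x 𝕃.* y 𝕃.^ n ≅ conᴸ (+ 0) → ¬ (y ≅ conᴸ (+ 0)) → x ≅ conᴸ (+ 0)
  Laurent-no-nilpotents zero    eq y≢0 = 𝕃.trans (𝕃.sym (𝕃.*-identityʳ _)) eq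
  Laurent-no-nilpotents {x} {y} (suc n) eq y≢0 = Laurent-no-zero-divisors (Laurent-no-nilpotents n
    (𝕃.trans (solve 3 (λ x y z → x :* y :* z := x :* (y :* z)) 𝕃.refl x y (y 𝕃.^ n)) eq) y≢0) y≢0

  Expansion-* : ∀ {p r x y f g} → Expansion p x f → Expansion r y g → Expansion (p ℕ.+ r) (x 𝕃.* y) (f ⊠ g)
  Expansion-* {p} {r} {x} {y} {f} {g} e e′ = expansion (𝕃.trans (𝕃.*-congʳ (qᴸ-+ p r))
    (𝕃.trans (solve 4 (λ u v x y → u :* v :* (x :* y) := u :* x :* (v :* y)) 𝕃.refl (qᴸ p) (qᴸ r) x y)
      (𝕃.trans (𝕃.*-cong (expands e) (expands e′)) (𝕃.sym (ι-* f g)))))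

  Expansion-^ : ∀ {p x f} n → Expansion p x f → Expansion (n ℕ.* p) (x 𝕃.^ n) (f 𝕊.^ n)
  Expansion-^ zero    e = expansion (𝕃.trans (𝕃.*-congʳ ι-1) (𝕃.trans (𝕃.*-identityˡ _) (𝕃.sym ι-1)))
  Expansion-^ (suc n) e = Expansion-* e (Expansion-^ n e)

  Expansion-+ : ∀ {p x y f g} → Expansion p x f → Expansion p y g → Expansion p (x 𝕃.+ y) (f ⊞ g)
  Expansion-+ e e′ = expansion (𝕃.trans (𝕃.distribˡ _ _ _) (𝕃.trans (𝕃.+-cong (expands e) (expands e′)) (𝕃.sym (ι-+ _ _))))

  Expansion-con* : ∀ c {p x f} → Expansion p x f → Expansion p (conᴸ c 𝕃.* x) (conPS c ⊠ f)
  Expansion-con* c {p} {x} {f} e = expansion (𝕃.trans (solve 3 (λ k c x → k :* (c :* x) := c :* (k :* x)) 𝕃.refl (qᴸ p) (conᴸ c) x)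
    (𝕃.trans (𝕃.*-cong (𝕃.sym (ι-con c)) (expands e)) (𝕃.sym (ι-* (conPS c) f))))

  Expansion-weaken : ∀ {p x f} r → p ≤ r → Expansion p x f → Expansion r x (q 𝕊.^ (r ∸ p) ⊠ f)
  Expansion-weaken {p} {x} {f} r p≤r e = expansion (𝕃.trans (𝕃.*-congʳ (𝕃.trans (𝕃.reflexive (≡.cong qᴸ (≡.sym (ℕP.m∸n+n≡m p≤r)))) (qᴸ-+ (r ∸ p) p)))
    (𝕃.trans (𝕃.*-assoc _ _ _) (𝕃.trans (𝕃.*-congˡ (expands e)) (𝕃.sym (ι-* (q 𝕊.^ (r ∸ p)) f)))))

  Expansion-∑ : ∀ p n v F → (∀ i → i < n → Expansion p (v i) (F i)) → Expansion p (∑𝕃.∑ n v) (∑𝕊.∑ n F)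
  Expansion-∑ p zero    v F e = expansion (𝕃.trans (𝕃.zeroʳ _) (𝕃.trans (𝕃.sym (ι-con (+ 0))) (ι-cong 𝕊.con-0)))
  Expansion-∑ p (suc n) v F e = Expansion-+ (Expansion-∑ p n v F (λ i i<n → e i (ℕP.m<n⇒m<1+n i<n))) (e n ℕP.≤-refl)

  Expansion-Lead : ∀ {p x f} → Expansion p x f → ∀ {a} → f 0 ≡ a → Lead p a x
  Expansion-Lead {f = f} e h = lead f (expands e) h

  curve-expansion : ∀ ℓ a r {s t x y f g} → Expansion s x f → Expansion t y g → suc ℓ ℕ.* s ≤ r → suc ℓ ℕ.* t ≤ r →
    (∀ m n → m ≤ ℓ → n ≤ ℓ → m ℕ.* s ℕ.+ n ℕ.* t ≤ r) →
    Expansion r (x 𝕃.^ suc ℓ 𝕃.+ y 𝕃.^ suc ℓ 𝕃.+ polynomial (suc ℓ) (suc ℓ) a x y)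
      (q 𝕊.^ (r ∸ suc ℓ ℕ.* s) ⊠ f 𝕊.^ suc ℓ ⊞ q 𝕊.^ (r ∸ suc ℓ ℕ.* t) ⊠ g 𝕊.^ suc ℓ
        ⊞ ∑𝕊.∑ (suc ℓ) (λ m → ∑𝕊.∑ (suc ℓ) (λ n → conPS (a m n) ⊠ (q 𝕊.^ (r ∸ (m ℕ.* s ℕ.+ n ℕ.* t)) ⊠ (f 𝕊.^ m ⊠ g 𝕊.^ n)))))
  curve-expansion ℓ a r {s} {t} ex ey s≤ t≤ st≤ = Expansion-+ (Expansion-+
    (Expansion-weaken r s≤ (Expansion-^ (suc ℓ) ex)) (Expansion-weaken r t≤ (Expansion-^ (suc ℓ) ey)))
    (Expansion-∑ r (suc ℓ) _ _ (λ { m (s≤s m≤ℓ) → Expansion-∑ r (suc ℓ) _ _ (λ { n (s≤s n≤ℓ) →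
      Expansion-con* (a m n) (Expansion-weaken r (st≤ m n m≤ℓ n≤ℓ) (Expansion-* (Expansion-^ m ex) (Expansion-^ n ey))) }) }))

Agree : ℕ → PS → PS → Set
Agree k f g = ∀ i → i < k → f i ≡ g i

-- One more correct coefficient per application: the iterates stabilise in each degree, and the
-- diagonal of the iteration is a fixpoint. This is the q-adic contraction principle.
Contractive : (PS → PS) → Set
Contractive T = ∀ k f g → Agree k f g → Agree (suc k) (T f) (T g)

module Fixpoint (T : PS → PS) (contractive : Contractive T) where
  iterate : ℕ → PS
  iterate zero    = 0PS
  iterate (suc n) = T (iterate n)

  fix : PS
  fix k = iterate (suc k) k

  private
    stable : ∀ n → Agree n (iterate n) (iterate (suc n))
    stable zero    i ()
    stable (suc n) = contractive n (iterate n) (iterate (suc n)) (stable n)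

    fix-iterate : ∀ n → Agree n fix (iterate n)
    fix-iterate (suc n) i (s≤s i≤n) with ℕP.m≤n⇒m<n∨m≡n i≤n
    ... | inj₁ i<n    = ≡.trans (fix-iterate n i i<n) (stable n i i<n)
    ... | inj₂ ≡.refl = ≡.refl

  fix≋ : T fix ≋ fix
  fix≋ = mk≋ λ k → contractive k fix (iterate k) (fix-iterate k) k ℕP.≤-refl

agree-⊠ : ∀ k {f f′ g g′} → Agree k f f′ → Agree k g g′ → Agree k (f ⊠ g) (f′ ⊠ g′)
agree-⊠ k {f} {f′} {g} {g′} p r i i<k = ≡.trans (⊠-congʳ-below i {f} {f′} {g} (λ j j≤i → p j (ℕP.≤-<-trans j≤i i<k)))
  (⊠-congˡ-below i {f′} {g} {g′} (λ j j≤i → r j (ℕP.≤-<-trans j≤i i<k)))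

agree-^ : ∀ k n {f g} → Agree k f g → Agree k (f 𝕊.^ n) (g 𝕊.^ n)
agree-^ k zero    p i i<k = ≡.refl
agree-^ k (suc n) {f} {g} p = agree-⊠ k {f} {g} {f 𝕊.^ n} {g 𝕊.^ n} p (agree-^ k n p)

agree-⊞ : ∀ k {f f′ g g′} → Agree k f f′ → Agree k g g′ → Agree k (f ⊞ g) (f′ ⊞ g′)
agree-⊞ k {f} {f′} {g} {g′} p r i i<k = ≡.trans (⊞-at (p i i<k) (r i i<k)) (≡.sym (⊞-coefficient f′ g′ i))

agree-∑ : ∀ k n F G → (∀ i → i < n → Agree k (F i) (G i)) → Agree k (∑𝕊.∑ n F) (∑𝕊.∑ n G)
agree-∑ k zero    F G p i _ = ≡.refl
agree-∑ k (suc n) F G p = agree-⊞ k {∑𝕊.∑ n F} {∑𝕊.∑ n G} {F n} {G n} (agree-∑ k n F G (λ i i<n → p i (ℕP.m<n⇒m<1+n i<n))) (p n ℕP.≤-refl)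

agree-∑-0 : ∀ k n F → (∀ i → i < n → Agree k (F i) 0PS) → Agree k (∑𝕊.∑ n F) 0PS
agree-∑-0 k n F p i lt = ≡.trans (agree-∑ k n F (λ _ → 0PS) p i lt) (at (∑𝕊.∑-0 n (λ _ _ → 𝕊.refl)) i)

agree-⊞-0ʳ : ∀ k {f g f′} → Agree k f f′ → Agree k g 0PS → Agree k (f ⊞ g) f′
agree-⊞-0ʳ k {f} {g} {f′} p z i lt = ≡.trans (⊞-at (p i lt) (≡.trans (z i lt) (0PS-coefficient i))) (ℤP.+-identityʳ (f′ i))

agree-⊞-0ˡ : ∀ k {f g g′} → Agree k f 0PS → Agree k g g′ → Agree k (f ⊞ g) g′
agree-⊞-0ˡ k {f} {g} {g′} z p i lt = ≡.trans (⊞-at (≡.trans (z i lt) (0PS-coefficient i)) (p i lt)) (ℤP.+-identityˡ (g′ i))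

agree-shift : ∀ k e {f g} → 0 < e → Agree k f g → Agree (suc k) (q 𝕊.^ e ⊠ f) (q 𝕊.^ e ⊠ g)
agree-shift k e {f} {g} 0<e p i (s≤s i≤k) = case i ℕP.<? e of λ
  { (yes i<e) → ≡.trans (q^⊠-low e f i i<e) (≡.sym (q^⊠-low e g i i<e))
  ; (no i≮e) → let i≡ = ℕP.m+[n∸m]≡n (ℕP.≮⇒≥ i≮e) in
      ≡.subst (λ i → (q 𝕊.^ e ⊠ f) i ≡ (q 𝕊.^ e ⊠ g) i) i≡ (≡.trans (q^⊠-high e f (i ∸ e))
        (≡.trans (p (i ∸ e) (ℕP.<-≤-trans (≡.subst (i ∸ e <_) i≡ (ℕP.m<n+m (i ∸ e) 0<e)) i≤k)) (≡.sym (q^⊠-high e g (i ∸ e))))) }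

-- The inverse is the fixpoint of g ↦ 1 + (1 - f)g, contractive because 1 - f has no constant term.
module Inverse (f : PS) (f0≡1 : f 0 ≡ + 1) where
  private
    d : PS
    d = onePS 𝕊.- f

    T : PS → PS
    T g = onePS ⊞ d ⊠ g

    d≋ : d ≋ q 𝕊.^ 1 ⊠ dropPS 1 d
    d≋ = shift-drop 1 d (λ { zero _ → ≡.trans (⊞-at {onePS} {⊟ f} ≡.refl (≡.trans (⊟-coefficient f 0) (≡.cong ℤ.-_ f0≡1))) ≡.refl ; (suc _) (s≤s ()) })

    T≋ : ∀ g → T g ≋ onePS ⊞ q 𝕊.^ 1 ⊠ (dropPS 1 d ⊠ g)
    T≋ g = 𝕊.+-congˡ (𝕊.trans (𝕊.*-congʳ d≋) (𝕊.*-assoc _ _ _))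

    contractive : Contractive T
    contractive k g h p i i≤k = ≡.trans (at (T≋ g) i) (≡.trans (agree-⊞ (suc k) {onePS} {onePS} {q 𝕊.^ 1 ⊠ (dropPS 1 d ⊠ g)} {q 𝕊.^ 1 ⊠ (dropPS 1 d ⊠ h)} (λ _ _ → ≡.refl)
      (agree-shift k 1 {dropPS 1 d ⊠ g} {dropPS 1 d ⊠ h} (s≤s z≤n) (agree-⊠ k {dropPS 1 d} {dropPS 1 d} {g} {h} (λ _ _ → ≡.refl) p)) i i≤k) (≡.sym (at (T≋ h) i)))

  inverse : PS
  inverse = Fixpoint.fix T contractive

  inverse-⊠ : inverse ⊠ f ≋ onePS
  inverse-⊠ = LinearCombination.modulo₁ PS-algebra (⊟ onePS) (Fixpoint.fix≋ T contractive)
    (solve 2 (λ g f → let o = g :^ 0 in g :* f := o :+ (:- o) :* (o :+ (o :- f) :* g :- g)) 𝕊.refl inverse f)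
    where open 𝕊.Solver using (solve; _:=_; _:+_; _:*_; _:-_; :-_; _:^_)

distribute-double-sum : ∀ N (E s t : PS) (F : ℕ → ℕ → PS) → E ⊠ (s ⊞ t ⊞ ∑𝕊.∑ N (λ m → ∑𝕊.∑ N (F m))) ≋ E ⊠ s ⊞ E ⊠ t ⊞ ∑𝕊.∑ N (λ m → ∑𝕊.∑ N (λ n → E ⊠ F m n))
distribute-double-sum N E s t F = 𝕊.trans (𝕊.distribˡ E (s ⊞ t) (∑𝕊.∑ N (λ m → ∑𝕊.∑ N (F m)))) (𝕊.+-cong (𝕊.distribˡ E s t)
  (𝕊.trans (∑𝕊.*-∑ N E (λ m → ∑𝕊.∑ N (F m))) (∑𝕊.∑-cong N (λ m _ → ∑𝕊.*-∑ N E (F m)))))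

shift-agree : ∀ n f g → f 0 ≡ g 0 → Agree (suc n) (q 𝕊.^ n ⊠ f) (q 𝕊.^ n ⊠ g)
shift-agree n f g eq i (s≤s i≤n) = case ℕP.m≤n⇒m<n∨m≡n i≤n of λ
  { (inj₁ i<n) → ≡.trans (q^⊠-low n f i i<n) (≡.sym (q^⊠-low n g i i<n))
  ; (inj₂ i≡n) → ≡.subst (λ j → (q 𝕊.^ n ⊠ f) j ≡ (q 𝕊.^ n ⊠ g) j) (≡.trans (ℕP.+-identityʳ n) (≡.sym i≡n))
      (≡.trans (q^⊠-high n f 0) (≡.trans eq (≡.sym (q^⊠-high n g 0)))) }

double-sum-coefficient : ∀ N (c : ℕ → ℕ → ℤ) (G F : ℕ → ℕ → PS) → (∀ m n → G m n ≋ F m n) → ∀ i →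
  ∑𝕊.∑ N (λ m → ∑𝕊.∑ N (λ n → conPS (c m n) ⊠ F m n)) i ≡ sumBelow N (λ m → sumBelow N (λ n → c m n ℤ.* G m n i))
double-sum-coefficient N c G F eq i = ≡.trans (∑𝕊-coefficient N (λ m → ∑𝕊.∑ N (λ n → conPS (c m n) ⊠ F m n)) i) (≡.trans
  (∑ℤ.∑-cong N (λ m _ → ≡.trans (∑𝕊-coefficient N (λ n → conPS (c m n) ⊠ F m n) i) (≡.trans
    (∑ℤ.∑-cong N (λ n _ → ≡.trans (con-⊠ (c m n) (F m n) i) (≡.cong (c m n ℤ.*_) (≡.sym (at (eq m n) i)))))
    (≡.sym (sumBelow≡∑ N (λ n → c m n ℤ.* G m n i))))))
  (≡.sym (sumBelow≡∑ N (λ m → sumBelow N (λ n → c m n ℤ.* G m n i)))))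

-- The modular equation modulo q^(ℓ+1).

module ClearedEquation (ℓ : ℕ) (a : ℕ → ℕ → ℤ) where
  h k : PS
  h = Jq
  k = dilPS ℓ Jq

  r : ℕ
  r = ℓ ℕ.* suc ℓ

  term : ℕ → ℕ → PS
  term m n = q 𝕊.^ (r ∸ (ℓ ℕ.* m ℕ.+ n)) ⊠ (k 𝕊.^ m ⊠ h 𝕊.^ n)

  mono≋term : ∀ m n → monoPS ℓ m n ≋ term m n
  mono≋term m n = 𝕊.trans (shift≋ (r ∸ (ℓ ℕ.* m ℕ.+ n)) (mulPS (powPS k m) (powPS h n))) (𝕊.*-congˡ (mulPS≋⊠ (powPS≋^ k m) (powPS≋^ h n)))

  equation : PS
  equation = term (suc ℓ) 0 ⊞ term 0 (suc ℓ) ⊞ ∑𝕊.∑ (suc ℓ) (λ m → ∑𝕊.∑ (suc ℓ) (λ n → conPS (a m n) ⊠ term m n))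

  equation-coefficient : ∀ i → equation i ≡ evalΦ ℓ a i
  equation-coefficient i = ⊞-at {term (suc ℓ) 0 ⊞ term 0 (suc ℓ)} {∑𝕊.∑ (suc ℓ) (λ m → ∑𝕊.∑ (suc ℓ) (λ n → conPS (a m n) ⊠ term m n))} {i}
    (⊞-at {term (suc ℓ) 0} {term 0 (suc ℓ)} {i} (≡.sym (at (mono≋term (suc ℓ) 0) i)) (≡.sym (at (mono≋term 0 (suc ℓ)) i)))
    (double-sum-coefficient (suc ℓ) a (monoPS ℓ) term mono≋term i)

module ModularEquation (ℓ′ : ℕ) (2≤ℓ′ : 2 ≤ ℓ′) (a : ℕ → ℕ → ℤ) (modular : IsModularPolynomial (suc ℓ′) a) where
  open Dilation ℓ′ public using (ℓ; δ; δ-unfold)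
  open ClearedEquation (suc ℓ′) a public

  equation≋0 : equation ≋ 0PS
  equation≋0 = mk≋ λ i → ≡.trans (equation-coefficient i) (≡.trans (modular i) (≡.sym (0PS-coefficient i)))

  bound : ∀ m n → m ≤ ℓ → n ≤ ℓ → m ℕ.* ℓ ℕ.+ n ℕ.* 1 ≤ r
  bound m n m≤ℓ n≤ℓ = ℕP.≤-trans (ℕP.+-mono-≤ (ℕP.*-monoˡ-≤ ℓ m≤ℓ) (ℕP.≤-trans (ℕP.≤-reflexive (ℕP.*-identityʳ n)) n≤ℓ))
    (ℕP.≤-reflexive (≡.trans (ℕP.+-comm (ℓ ℕ.* ℓ) ℓ) (≡.sym (ℕP.*-suc ℓ ℓ))))

  onCurve : OnCurve ℓ a (K ℓ′) J
  onCurve = Expansion-zero (curve-expansion ℓ a r {ℓ} {1} {K ℓ′} {J} {k} {h} (expansion (LaurentRing.clear-/ k ℓ)) (expansion (LaurentRing.clear-/ h 1))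
      (ℕP.≤-reflexive (ℕP.*-comm (suc ℓ) ℓ)) (ℕP.≤-trans (ℕP.≤-reflexive (ℕP.*-identityʳ (suc ℓ))) (ℕP.m≤n*m (suc ℓ) ℓ)) bound)
    (𝕊.trans (𝕊.+-cong (𝕊.+-cong
      (𝕊.*-cong (exponent (≡.trans (ℕP.*-comm (suc ℓ) ℓ) (≡.sym (ℕP.+-identityʳ r)))) (𝕊.sym (𝕊.*-identityʳ _)))
      (𝕊.*-cong (exponent (≡.trans (ℕP.*-identityʳ (suc ℓ)) (≡.cong (ℕ._+ suc ℓ) (≡.sym (ℕP.*-zeroʳ ℓ))))) (𝕊.sym (𝕊.*-identityˡ _))))
      (∑𝕊.∑-cong (suc ℓ) (λ m _ → ∑𝕊.∑-cong (suc ℓ) (λ n _ → 𝕊.*-congˡ {conPS (a m n)} (𝕊.*-congʳ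
        (exponent (≡.cong₂ ℕ._+_ (ℕP.*-comm m ℓ) (ℕP.*-identityʳ n))))))))
    equation≋0)
    where
    exponent : ∀ {i j} → i ≡ j → q 𝕊.^ (r ∸ i) ≋ q 𝕊.^ (r ∸ j)
    exponent ≡.refl = 𝕊.refl

  Jq-0 : Jq 0 ≡ + 1
  Jq-0 = ≡.refl

  k-0 : k 0 ≡ + 1
  k-0 = ≡.refl

  k-low : ∀ i → 0 < i → i < ℓ → k i ≡ + 0
  k-low (suc i) _ i<ℓ = ≡.trans (at (δ-unfold Jq) (suc i)) (≡.trans (⊞-at {conPS (Jq 0)} ≡.refl (q^⊠-low ℓ (δ (tail Jq)) (suc i) i<ℓ)) ≡.refl)

  k-ℓ : k ℓ ≡ c′ 1
  k-ℓ = ≡.trans (at (δ-unfold Jq) ℓ) (≡.trans (⊞-at {conPS (Jq 0)} ≡.refl (≡.trans (≡.cong (q 𝕊.^ ℓ ⊠ δ (tail Jq)) (≡.sym (ℕP.+-identityʳ ℓ))) (q^⊠-high ℓ (δ (tail Jq)) 0)))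
    (≡.trans (ℤP.+-identityˡ _) (≡.trans (at (δ-unfold (tail Jq)) 0) (≡.trans (⊞-at {conPS (tail Jq 0)} ≡.refl (q^⊠-low ℓ (δ (tail (tail Jq))) 0 (s≤s z≤n))) (ℤP.+-identityʳ _)))))

  open Inverse h Jq-0 public renaming (inverse to h⁻¹; inverse-⊠ to h⁻¹⊠h)
  open Inverse k k-0 public renaming (inverse to k⁻¹; inverse-⊠ to k⁻¹⊠k)

  h⁻¹-0 : h⁻¹ 0 ≡ + 1
  h⁻¹-0 = ≡.trans (≡.sym (ℤP.*-identityʳ (h⁻¹ 0))) (≡.trans (≡.sym (⊠-0 h⁻¹ h)) (at h⁻¹⊠h 0))

  k⁻¹-0 : k⁻¹ 0 ≡ + 1
  k⁻¹-0 = ≡.trans (≡.sym (ℤP.*-identityʳ (k⁻¹ 0))) (≡.trans (≡.sym (⊠-0 k⁻¹ k)) (at k⁻¹⊠k 0))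

  inverse-^ : ∀ {f g} n → f ⊠ g ≋ onePS → f 𝕊.^ n ⊠ g 𝕊.^ n ≋ onePS
  inverse-^ {f} {g} n eq = 𝕊.trans (𝕊.sym (𝕊.^-distrib-* f g n)) (𝕊.trans (𝕊.^-congˡ n eq) (one^ n))
    where
    one^ : ∀ n → onePS 𝕊.^ n ≋ onePS
    one^ zero    = 𝕊.refl
    one^ (suc n) = 𝕊.trans (𝕊.*-identityˡ _) (one^ n)

  -- The coefficient of X^ℓ in the modular equation, divided by K^ℓ: everything else is O(q^{ℓ+1}).
  A : ℤ
  A = a ℓ′ ℓ

  leading : PS
  leading = k ⊞ ∑𝕊.∑ (suc ℓ) (λ n → conPS (a ℓ n) ⊠ (q 𝕊.^ (ℓ ∸ n) ⊠ h 𝕊.^ n)) ⊞ conPS A ⊠ q 𝕊.^ ℓ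

  private
    E : PS
    E = k⁻¹ 𝕊.^ ℓ

    E⊠k^ : ∀ n → E ⊠ k 𝕊.^ (ℓ ℕ.+ n) ≋ k 𝕊.^ n
    E⊠k^ n = 𝕊.trans (𝕊.*-congˡ (𝕊.^-homo-* k ℓ n)) (𝕊.trans (𝕊.sym (𝕊.*-assoc _ _ _)) (𝕊.trans (𝕊.*-congʳ (inverse-^ ℓ k⁻¹⊠k)) (𝕊.*-identityˡ _)))

    high : ∀ m n → ℓ < r ∸ (ℓ ℕ.* m ℕ.+ n) → Agree (suc ℓ) (E ⊠ term m n) 0PS
    high m n lt i (s≤s i≤ℓ) = ≡.trans (at (solve 3 (λ e q x → e :* (q :* x) := q :* (e :* x)) 𝕊.refl E (q 𝕊.^ (r ∸ (ℓ ℕ.* m ℕ.+ n))) (k 𝕊.^ m ⊠ h 𝕊.^ n)) i)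
      (≡.trans (q^⊠-low _ _ i (ℕP.≤-<-trans i≤ℓ lt)) (≡.sym (0PS-coefficient i)))
      where open 𝕊.Solver using (solve; _:=_; _:*_)

    con-agree : ∀ c f → Agree (suc ℓ) f 0PS → Agree (suc ℓ) (conPS c ⊠ f) 0PS
    con-agree c f p i lt = ≡.trans (con-at c (≡.trans (p i lt) (0PS-coefficient i))) (≡.trans (ℤP.*-zeroʳ c) (≡.sym (0PS-coefficient i)))

    exponent-gap : ∀ m n → ℓ ℕ.* m ℕ.+ n ℕ.+ suc ℓ ≤ r → ℓ < r ∸ (ℓ ℕ.* m ℕ.+ n)
    exponent-gap m n le = ℕP.≤-trans (ℕP.≤-reflexive (≡.sym (ℕP.m+n∸m≡n (ℓ ℕ.* m ℕ.+ n) (suc ℓ)))) (ℕP.∸-monoˡ-≤ (ℓ ℕ.* m ℕ.+ n) le)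

    -- Below row ℓ the exponent r - ℓm - n exceeds ℓ with one exception: at (ℓ - 1, ℓ) it equals ℓ.
    -- The disjunction excludes precisely this cell.
    ℓ<r : ∀ m n → m < ℓ → n ≤ ℓ → (m < ℓ′) ⊎ (n < ℓ) → ℓ < r ∸ (ℓ ℕ.* m ℕ.+ n)
    ℓ<r m n m<ℓ n≤ℓ (inj₁ m<ℓ′) = exponent-gap m n (begin
      ℓ ℕ.* m ℕ.+ n ℕ.+ suc ℓ        ≤⟨ ℕP.+-mono-≤ (ℕP.+-monoʳ-≤ (ℓ ℕ.* m) n≤ℓ) (s≤s (ℕP.m≤m+n ℓ ℓ′)) ⟩
      ℓ ℕ.* m ℕ.+ ℓ ℕ.+ suc (ℓ ℕ.+ ℓ′) ≡⟨ ≡.cong₂ ℕ._+_ (≡.trans (ℕP.+-comm (ℓ ℕ.* m) ℓ) (≡.sym (ℕP.*-suc ℓ m))) (≡.sym (ℕP.+-suc ℓ ℓ′)) ⟩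
      ℓ ℕ.* suc m ℕ.+ (ℓ ℕ.+ ℓ)      ≤⟨ ℕP.+-monoˡ-≤ (ℓ ℕ.+ ℓ) (ℕP.*-monoʳ-≤ ℓ m<ℓ′) ⟩
      ℓ ℕ.* ℓ′ ℕ.+ (ℓ ℕ.+ ℓ)         ≡⟨ ≡.sym (≡.trans (ℕP.*-suc ℓ ℓ) (≡.trans (≡.cong (ℓ ℕ.+_) (ℕP.*-suc ℓ ℓ′)) (≡.trans (≡.sym (ℕP.+-assoc ℓ ℓ (ℓ ℕ.* ℓ′))) (ℕP.+-comm (ℓ ℕ.+ ℓ) (ℓ ℕ.* ℓ′))))) ⟩
      r                              ∎)
      where open ℕP.≤-Reasoning
    ℓ<r m n (s≤s m≤ℓ′) _ (inj₂ (s≤s n≤ℓ′)) = exponent-gap m n (begin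
      ℓ ℕ.* m ℕ.+ n ℕ.+ suc ℓ        ≤⟨ ℕP.+-monoˡ-≤ (suc ℓ) (ℕP.+-mono-≤ (ℕP.*-monoʳ-≤ ℓ m≤ℓ′) n≤ℓ′) ⟩
      ℓ ℕ.* ℓ′ ℕ.+ ℓ′ ℕ.+ suc ℓ      ≡⟨ ≡.trans (ℕP.+-assoc (ℓ ℕ.* ℓ′) ℓ′ (suc ℓ)) (≡.cong (ℓ ℕ.* ℓ′ ℕ.+_) (ℕP.+-suc ℓ′ ℓ)) ⟩
      ℓ ℕ.* ℓ′ ℕ.+ (ℓ ℕ.+ ℓ)         ≡⟨ ≡.sym (≡.trans (ℕP.*-suc ℓ ℓ) (≡.trans (≡.cong (ℓ ℕ.+_) (ℕP.*-suc ℓ ℓ′)) (≡.trans (≡.sym (ℕP.+-assoc ℓ ℓ (ℓ ℕ.* ℓ′))) (ℕP.+-comm (ℓ ℕ.+ ℓ) (ℓ ℕ.* ℓ′))))) ⟩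
      r                              ∎)
      where open ℕP.≤-Reasoning

    cell : ℕ → ℕ → PS
    cell m n = E ⊠ (conPS (a m n) ⊠ term m n)

    cell-high : ∀ m n → ℓ < r ∸ (ℓ ℕ.* m ℕ.+ n) → Agree (suc ℓ) (cell m n) 0PS
    cell-high m n lt i i≤ = ≡.trans (at (solve 3 (λ e c t → e :* (c :* t) := c :* (e :* t)) 𝕊.refl E (conPS (a m n)) (term m n)) i)
      (con-agree (a m n) (E ⊠ term m n) (high m n lt) i i≤)
      where open 𝕊.Solver using (solve; _:=_; _:*_)

    first : Agree (suc ℓ) (E ⊠ term (suc ℓ) 0) k
    first i _ = at (𝕊.trans (𝕊.*-congˡ (𝕊.trans (𝕊.*-cong (𝕊.reflexive (≡.cong (q 𝕊.^_) (≡.trans (≡.cong (r ∸_) (ℕP.+-identityʳ r)) (ℕP.n∸n≡0 r)))) (𝕊.*-identityʳ _)) (𝕊.*-identityˡ _)))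
      (𝕊.trans (𝕊.*-congˡ (𝕊.reflexive (≡.cong (k 𝕊.^_) (≡.sym (ℕP.+-comm ℓ 1))))) (𝕊.trans (E⊠k^ 1) (𝕊.*-identityʳ k)))) i

    ℓ+ : ∀ n → n ≤ ℓ → r ∸ (ℓ ℕ.* ℓ ℕ.+ n) ≡ ℓ ∸ n
    ℓ+ n n≤ℓ = ≡.trans (≡.cong (_∸ (ℓ ℕ.* ℓ ℕ.+ n)) (≡.trans (ℕP.*-suc ℓ ℓ) (ℕP.+-comm ℓ (ℓ ℕ.* ℓ)))) (ℕP.[m+n]∸[m+o]≡n∸o (ℓ ℕ.* ℓ) ℓ n)

    top-row : ∀ n → n ≤ ℓ → cell ℓ n ≋ conPS (a ℓ n) ⊠ (q 𝕊.^ (ℓ ∸ n) ⊠ h 𝕊.^ n)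
    top-row n n≤ℓ = 𝕊.trans (solve 5 (λ e c q x y → e :* (c :* (q :* (x :* y))) := c :* (q :* (e :* x :* y))) 𝕊.refl E (conPS (a ℓ n)) (q 𝕊.^ (r ∸ (ℓ ℕ.* ℓ ℕ.+ n))) (k 𝕊.^ ℓ) (h 𝕊.^ n))
      (𝕊.*-congˡ (𝕊.*-cong (𝕊.reflexive (≡.cong (q 𝕊.^_) (ℓ+ n n≤ℓ))) (𝕊.trans (𝕊.*-congʳ (inverse-^ ℓ k⁻¹⊠k)) (𝕊.*-identityˡ _))))
      where open 𝕊.Solver using (solve; _:=_; _:*_)

    -- The exponent is exactly ℓ, so modulo q^(ℓ+1) only the constant term 1 of the cofactor counts.
    corner : Agree (suc ℓ) (cell ℓ′ ℓ) (conPS A ⊠ q 𝕊.^ ℓ)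
    corner i (s≤s i≤ℓ) = ≡.trans (at (𝕊.trans
        (solve 5 (λ e c q x y → e :* (c :* (q :* (x :* y))) := c :* (q :* (e :* x :* y))) 𝕊.refl E (conPS A) (q 𝕊.^ (r ∸ (ℓ ℕ.* ℓ′ ℕ.+ ℓ))) (k 𝕊.^ ℓ′) (h 𝕊.^ ℓ))
        (𝕊.*-congˡ (𝕊.*-congʳ (𝕊.reflexive (≡.cong (q 𝕊.^_) exponent))))) i)
      (≡.trans (con-at A (≡.trans (value i i≤ℓ) (at (𝕊.*-identityʳ (q 𝕊.^ ℓ)) i))) (≡.sym (con-⊠ A (q 𝕊.^ ℓ) i)))
      where
      open 𝕊.Solver using (solve; _:=_; _:*_)
      exponent : r ∸ (ℓ ℕ.* ℓ′ ℕ.+ ℓ) ≡ ℓ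
      exponent = ≡.trans (≡.cong₂ _∸_ (≡.trans (ℕP.*-suc ℓ ℓ) (ℕP.+-comm ℓ (ℓ ℕ.* ℓ))) (≡.trans (ℕP.+-comm (ℓ ℕ.* ℓ′) ℓ) (≡.sym (ℕP.*-suc ℓ ℓ′)))) (ℕP.m+n∸m≡n (ℓ ℕ.* ℓ) ℓ)
      unit : (E ⊠ k 𝕊.^ ℓ′ ⊠ h 𝕊.^ ℓ) 0 ≡ + 1
      unit = ≡.trans (⊠-0 (E ⊠ k 𝕊.^ ℓ′) (h 𝕊.^ ℓ)) (≡.cong₂ ℤ._*_ (≡.trans (⊠-0 E (k 𝕊.^ ℓ′)) (≡.cong₂ ℤ._*_ (^-at-0 k⁻¹ ℓ k⁻¹-0) (^-at-0 k ℓ′ k-0))) (^-at-0 h ℓ Jq-0))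
      value : ∀ i → i ≤ ℓ → (q 𝕊.^ ℓ ⊠ (E ⊠ k 𝕊.^ ℓ′ ⊠ h 𝕊.^ ℓ)) i ≡ (q 𝕊.^ ℓ ⊠ onePS) i
      value i i≤ℓ = shift-agree ℓ (E ⊠ k 𝕊.^ ℓ′ ⊠ h 𝕊.^ ℓ) onePS unit i (s≤s i≤ℓ)

    second-exponent : ℓ < r ∸ (ℓ ℕ.* 0 ℕ.+ suc ℓ)
    second-exponent = exponent-gap 0 (suc ℓ) (begin
      ℓ ℕ.* 0 ℕ.+ suc ℓ ℕ.+ suc ℓ ≡⟨ ≡.cong (λ z → z ℕ.+ suc ℓ ℕ.+ suc ℓ) (ℕP.*-zeroʳ ℓ) ⟩
      suc ℓ ℕ.+ suc ℓ             ≡⟨ ≡.cong (suc ℓ ℕ.+_) (ℕP.+-identityʳ (suc ℓ)) ⟨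
      2 ℕ.* suc ℓ                 ≤⟨ ℕP.*-monoˡ-≤ (suc ℓ) (ℕP.m≤n⇒m≤1+n 2≤ℓ′) ⟩
      r                           ∎)
      where open ℕP.≤-Reasoning

    row-low : ∀ m → m < ℓ′ → Agree (suc ℓ) (∑𝕊.∑ (suc ℓ) (cell m)) 0PS
    row-low m m<ℓ′ = agree-∑-0 (suc ℓ) (suc ℓ) (cell m) (λ { n (s≤s n≤ℓ) → cell-high m n (ℓ<r m n (ℕP.m<n⇒m<1+n m<ℓ′) n≤ℓ (inj₁ m<ℓ′)) })

    row-ℓ′ : Agree (suc ℓ) (∑𝕊.∑ (suc ℓ) (cell ℓ′)) (conPS A ⊠ q 𝕊.^ ℓ)
    row-ℓ′ = agree-⊞-0ˡ (suc ℓ) {∑𝕊.∑ ℓ (cell ℓ′)} {cell ℓ′ ℓ} (agree-∑-0 (suc ℓ) ℓ (cell ℓ′) (λ n n<ℓ → cell-high ℓ′ n (ℓ<r ℓ′ n ℕP.≤-refl (ℕP.<⇒≤ n<ℓ) (inj₂ n<ℓ)))) corner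

    expanded : E ⊠ equation ≋ E ⊠ term (suc ℓ) 0 ⊞ E ⊠ term 0 (suc ℓ) ⊞ ∑𝕊.∑ (suc ℓ) (λ m → ∑𝕊.∑ (suc ℓ) (cell m))
    expanded = distribute-double-sum (suc ℓ) E (term (suc ℓ) 0) (term 0 (suc ℓ)) (λ m n → conPS (a m n) ⊠ term m n)

  leading≡0 : ∀ i → i ≤ ℓ → leading i ≡ + 0
  leading≡0 i i≤ℓ = ≡.trans (≡.sym (approx i (s≤s i≤ℓ))) (≡.trans (≡.sym (at expanded i))
      (≡.trans (at (𝕊.trans (𝕊.*-congˡ equation≋0) (𝕊.zeroʳ E)) i) (0PS-coefficient i)))
    where
    top : PS
    top = ∑𝕊.∑ (suc ℓ) (λ n → conPS (a ℓ n) ⊠ (q 𝕊.^ (ℓ ∸ n) ⊠ h 𝕊.^ n))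
    approx : Agree (suc ℓ) (E ⊠ term (suc ℓ) 0 ⊞ E ⊠ term 0 (suc ℓ) ⊞ ∑𝕊.∑ (suc ℓ) (λ m → ∑𝕊.∑ (suc ℓ) (cell m))) leading
    approx i lt = ≡.trans (agree-⊞ (suc ℓ) {E ⊠ term (suc ℓ) 0 ⊞ E ⊠ term 0 (suc ℓ)} {k} {∑𝕊.∑ (suc ℓ) (λ m → ∑𝕊.∑ (suc ℓ) (cell m))} {conPS A ⊠ q 𝕊.^ ℓ ⊞ top}
        (agree-⊞-0ʳ (suc ℓ) {E ⊠ term (suc ℓ) 0} first (high 0 (suc ℓ) second-exponent))
        (agree-⊞ (suc ℓ) {∑𝕊.∑ ℓ (λ m → ∑𝕊.∑ (suc ℓ) (cell m))} {conPS A ⊠ q 𝕊.^ ℓ} {∑𝕊.∑ (suc ℓ) (cell ℓ)} {top}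
          (agree-⊞-0ˡ (suc ℓ) {∑𝕊.∑ ℓ′ (λ m → ∑𝕊.∑ (suc ℓ) (cell m))} {∑𝕊.∑ (suc ℓ) (cell ℓ′)} (agree-∑-0 (suc ℓ) ℓ′ _ row-low) row-ℓ′)
          (λ i _ → at (∑𝕊.∑-cong (suc ℓ) (λ { n (s≤s n≤ℓ) → top-row n n≤ℓ })) i)) i lt)
      (at (solve 3 (λ k x y → k :+ (x :+ y) := k :+ y :+ x) 𝕊.refl k (conPS A ⊠ q 𝕊.^ ℓ) top) i)
      where open 𝕊.Solver using (solve; _:=_; _:+_)

-- Lagrange inversion for the coefficients of row ℓ.

module Lagrange (ℓ′ : ℕ) (2≤ℓ′ : 2 ≤ ℓ′) (a : ℕ → ℕ → ℤ) (modular : IsModularPolynomial (suc ℓ′) a) where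
  open ModularEquation ℓ′ 2≤ℓ′ a modular

  -- Since J = h/q, the series 1 - θh/h is -θJ/J.
  log′ u′ : PS
  log′ = θ h ⊠ h⁻¹
  u′ = onePS 𝕊.- log′

  -- Up to the factor q^(-N) this is J^(-N) times -θJ/J, the differential that extracts the
  -- coefficient of J^N.
  w : ℕ → PS
  w N = h⁻¹ 𝕊.^ N ⊠ u′

  private
    log′-0 : log′ 0 ≡ + 0
    log′-0 = ≡.trans (⊠-0 (θ h) h⁻¹) (≡.cong (ℤ._* h⁻¹ 0) (≡.trans (θ-coefficient h 0) (ℤP.*-zeroˡ (h 0))))

    u′-0 : u′ 0 ≡ + 1
    u′-0 = ⊞-at {onePS} {⊟ log′} ≡.refl (≡.trans (⊟-coefficient log′ 0) (≡.cong ℤ.-_ log′-0))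

    w-0 : ∀ N → w N 0 ≡ + 1
    w-0 N = ≡.trans (⊠-0 (h⁻¹ 𝕊.^ N) u′) (≡.cong₂ ℤ._*_ (^-at-0 h⁻¹ N h⁻¹-0) u′-0)

    h⊠h⁻¹ : h ⊠ h⁻¹ ≋ onePS
    h⊠h⁻¹ = 𝕊.trans (𝕊.*-comm h h⁻¹) h⁻¹⊠h

    open 𝕊.Solver using (solve; _:=_; _:+_; _:*_; _:-_; :-_; _:^_)

    -- j hʲ(1 - θh/h) = j hʲ - θ(hʲ) has no term of degree j
    power-residue : ∀ j → 0 < j → (h 𝕊.^ j ⊠ u′) j ≡ + 0
    power-residue (suc j) _ = ℤP.*-cancelˡ-≡ (+ suc j) ((h 𝕊.^ suc j ⊠ u′) (suc j)) (+ 0) (begin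
      + suc j ℤ.* (h 𝕊.^ suc j ⊠ u′) (suc j)                       ≡⟨ con-⊠ (+ suc j) (h 𝕊.^ suc j ⊠ u′) (suc j) ⟨
      (conPS (+ suc j) ⊠ (h 𝕊.^ suc j ⊠ u′)) (suc j)               ≡⟨ at expand (suc j) ⟩
      (conPS (+ suc j) ⊠ h 𝕊.^ suc j 𝕊.- θ (h 𝕊.^ suc j)) (suc j)  ≡⟨ ⊞-at (con-⊠ (+ suc j) (h 𝕊.^ suc j) (suc j))
                                                                        (≡.trans (⊟-coefficient (θ (h 𝕊.^ suc j)) (suc j)) (≡.cong ℤ.-_ (θ-coefficient (h 𝕊.^ suc j) (suc j)))) ⟩
      + suc j ℤ.* c ℤ.- + suc j ℤ.* c                              ≡⟨ ℤP.+-inverseʳ (+ suc j ℤ.* c) ⟩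
      + 0                                                          ≡⟨ ℤP.*-zeroʳ (+ suc j) ⟨
      + suc j ℤ.* + 0                                              ∎)
      where
      open ≡.≡-Reasoning
      c : ℤ
      c = (h 𝕊.^ suc j) (suc j)
      expand : conPS (+ suc j) ⊠ (h 𝕊.^ suc j ⊠ u′) ≋ conPS (+ suc j) ⊠ h 𝕊.^ suc j 𝕊.- θ (h 𝕊.^ suc j)
      expand = LinearCombination.modulo₂ PS-algebra onePS (⊟ (conPS (+ suc j) ⊠ (h 𝕊.^ j ⊠ θ h))) (Powers.∂-^ PS-differential h j) h⊠h⁻¹
        (solve 6 (λ c x h h′ g y → c :* (h :* x :* (c :^ 0 :- h′ :* g)) := c :* (h :* x) :- y
          :+ c :^ 0 :* (y :- c :* (x :* h′)) :+ (:- (c :* (x :* h′))) :* (h :* g :- c :^ 0)) 𝕊.refl (conPS (+ suc j)) (h 𝕊.^ j) h (θ h) h⁻¹ (θ (h 𝕊.^ suc j)))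

    h^w : ∀ N j → h 𝕊.^ (N ℕ.+ j) ⊠ w N ≋ h 𝕊.^ j ⊠ u′
    h^w N j = 𝕊.trans (𝕊.*-congʳ (𝕊.^-homo-* h N j)) (𝕊.trans
      (solve 4 (λ x y z v → x :* y :* (z :* v) := x :* z :* (y :* v)) 𝕊.refl (h 𝕊.^ N) (h 𝕊.^ j) (h⁻¹ 𝕊.^ N) u′)
      (𝕊.trans (𝕊.*-congʳ (inverse-^ N h⊠h⁻¹)) (𝕊.*-identityˡ _)))

    basis : ℕ → PS
    basis n = q 𝕊.^ (ℓ ∸ n) ⊠ h 𝕊.^ n

    -- `basis n` is q^ℓ J^n, so the coefficient taken is the residue of -J^(n-N) dJ/J. For n > N the
    -- differential is exact, for n < N it has no pole.
    pairing : ∀ N n → N ≤ ℓ → n ≤ ℓ → n ≢ N → (basis n ⊠ w N) (ℓ ∸ N) ≡ + 0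
    pairing N n N≤ℓ n≤ℓ n≢N = ≡.trans (at (𝕊.*-assoc (q 𝕊.^ (ℓ ∸ n)) (h 𝕊.^ n) (w N)) (ℓ ∸ N)) (case ℕP.<-cmp n N of λ
      { (tri< n<N _ _) → q^⊠-low (ℓ ∸ n) _ (ℓ ∸ N) (ℕP.∸-monoʳ-< n<N N≤ℓ)
      ; (tri≈ _ n≡N _) → contradiction n≡N n≢N
      ; (tri> _ _ N<n) → ≡.trans (≡.cong (q 𝕊.^ (ℓ ∸ n) ⊠ (h 𝕊.^ n ⊠ w N)) (gap N<n)) (≡.trans (q^⊠-high (ℓ ∸ n) (h 𝕊.^ n ⊠ w N) (n ∸ N))
          (≡.trans (at (𝕊.trans (𝕊.*-congʳ (𝕊.reflexive (≡.cong (h 𝕊.^_) (≡.sym (ℕP.m+[n∸m]≡n (ℕP.<⇒≤ N<n)))))) (h^w N (n ∸ N))) (n ∸ N))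
            (power-residue (n ∸ N) (ℕP.m<n⇒0<n∸m N<n)))) })
      where
      gap : N < n → ℓ ∸ N ≡ (ℓ ∸ n) ℕ.+ (n ∸ N)
      gap N<n = ≡.trans (≡.cong (_∸ N) (≡.sym (ℕP.m∸n+n≡m n≤ℓ))) (ℕP.+-∸-assoc (ℓ ∸ n) (ℕP.<⇒≤ N<n))

    pairing-refl : ∀ N → (basis N ⊠ w N) (ℓ ∸ N) ≡ + 1
    pairing-refl N = ≡.trans (at (𝕊.trans (𝕊.*-assoc (q 𝕊.^ (ℓ ∸ N)) (h 𝕊.^ N) (w N)) (𝕊.*-congˡ (𝕊.trans (𝕊.*-congʳ (𝕊.reflexive (≡.cong (h 𝕊.^_) (≡.sym (ℕP.+-identityʳ N)))))
      (𝕊.trans (h^w N 0) (𝕊.*-identityˡ u′))))) (ℓ ∸ N)) (≡.trans (≡.cong (q 𝕊.^ (ℓ ∸ N) ⊠ u′) (≡.sym (ℕP.+-identityʳ (ℓ ∸ N)))) (≡.trans (q^⊠-high (ℓ ∸ N) u′ 0) u′-0))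

    row : PS
    row = ∑𝕊.∑ (suc ℓ) (λ n → conPS (a ℓ n) ⊠ basis n)

    row-pairing : ∀ N → N ≤ ℓ → (row ⊠ w N) (ℓ ∸ N) ≡ a ℓ N
    row-pairing N N≤ℓ = extract (suc ℓ) (a ℓ) basis (w N) (ℓ ∸ N) N (s≤s N≤ℓ) (λ { n (s≤s n≤ℓ) n≢N → pairing N n N≤ℓ n≤ℓ n≢N }) (pairing-refl N)
      where
      extract : ∀ M (c : ℕ → ℤ) (b : ℕ → PS) v i N → N < M → (∀ n → n < M → n ≢ N → (b n ⊠ v) i ≡ + 0) → (b N ⊠ v) i ≡ + 1 →
        (∑𝕊.∑ M (λ n → conPS (c n) ⊠ b n) ⊠ v) i ≡ c N
      extract M c b v i N N<M others one = ≡.trans (at (∑𝕊.∑-* M v (λ n → conPS (c n) ⊠ b n)) i) (≡.trans (∑𝕊-coefficient M (λ n → conPS (c n) ⊠ b n ⊠ v) i)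
        (≡.trans (∑ℤ.∑-single M N N<M (λ n n<M n≢N → ≡.trans (value n) (≡.trans (≡.cong (c n ℤ.*_) (others n n<M n≢N)) (ℤP.*-zeroʳ (c n)))))
          (≡.trans (value N) (≡.trans (≡.cong (c N ℤ.*_) one) (ℤP.*-identityʳ (c N))))))
        where
        value : ∀ n → (conPS (c n) ⊠ b n ⊠ v) i ≡ c n ℤ.* (b n ⊠ v) i
        value n = ≡.trans (at (𝕊.*-assoc (conPS (c n)) (b n) v) i) (con-⊠ (c n) (b n ⊠ v) i)

    sum≡0 : ∀ N → N ≤ ℓ → (k ⊠ w N) (ℓ ∸ N) ℤ.+ a ℓ N ℤ.+ (conPS A ⊠ q 𝕊.^ ℓ ⊠ w N) (ℓ ∸ N) ≡ + 0
    sum≡0 N N≤ℓ = ≡.trans (≡.sym (⊞-at (⊞-at ≡.refl (row-pairing N N≤ℓ)) ≡.refl)) (≡.trans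
      (≡.sym (at (solve 4 (λ x y z v → (x :+ y :+ z) :* v := x :* v :+ y :* v :+ z :* v) 𝕊.refl k row (conPS A ⊠ q 𝕊.^ ℓ) (w N)) (ℓ ∸ N)))
      (≡.trans (agree-⊠ (suc ℓ) {leading} {0PS} {w N} {w N} (λ { i (s≤s i≤ℓ) → ≡.trans (leading≡0 i i≤ℓ) (≡.sym (0PS-coefficient i)) }) (λ _ _ → ≡.refl) (ℓ ∸ N) (s≤s (ℕP.m∸n≤m ℓ N)))
        (≡.trans (at (𝕊.zeroˡ (w N)) (ℓ ∸ N)) (0PS-coefficient (ℓ ∸ N)))))

    -- The series of j(q^ℓ) contributes its constant term c₀ at order q^ℓ. Like A, it is felt only
    -- by N = 0, since the pairing for N > 0 stops at order ℓ - N.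
    k≈ : Agree (suc ℓ) k (onePS ⊞ conPS (c′ 1) ⊠ q 𝕊.^ ℓ)
    k≈ zero    _ = ≡.trans k-0 (≡.sym (⊞-at {onePS} ≡.refl (con-at (c′ 1) (≡.trans (≡.sym (at (𝕊.*-identityʳ (q 𝕊.^ ℓ)) 0)) (q^⊠-low ℓ onePS 0 (s≤s z≤n))))
      ⟨ ≡.trans ⟩ ≡.cong (λ z → + 1 ℤ.+ z) (ℤP.*-zeroʳ (c′ 1))))
    k≈ (suc i) (s≤s i<ℓ) = case ℕP.m≤n⇒m<n∨m≡n i<ℓ of λ
      { (inj₁ 1+i<ℓ) → ≡.trans (k-low (suc i) (s≤s z≤n) 1+i<ℓ) (≡.sym (⊞-at {onePS} ≡.refl (con-at (c′ 1) (≡.trans (≡.sym (at (𝕊.*-identityʳ (q 𝕊.^ ℓ)) (suc i))) (q^⊠-low ℓ onePS (suc i) 1+i<ℓ)))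
          ⟨ ≡.trans ⟩ ≡.cong (λ z → + 0 ℤ.+ z) (ℤP.*-zeroʳ (c′ 1))))
      ; (inj₂ 1+i≡ℓ) → ≡.subst (λ j → k j ≡ (onePS ⊞ conPS (c′ 1) ⊠ q 𝕊.^ ℓ) j) (≡.sym 1+i≡ℓ) (≡.trans k-ℓ (≡.sym (⊞-at {onePS} ≡.refl (con-at (c′ 1)
          (≡.trans (≡.sym (at (𝕊.*-identityʳ (q 𝕊.^ ℓ)) ℓ)) (≡.trans (≡.cong (q 𝕊.^ ℓ ⊠ onePS) (≡.sym (ℕP.+-identityʳ ℓ))) (q^⊠-high ℓ onePS 0))))
          ⟨ ≡.trans ⟩ ≡.trans (ℤP.+-identityˡ (c′ 1 ℤ.* + 1)) (ℤP.*-identityʳ (c′ 1))))) }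

    k⊠w : ∀ N → (k ⊠ w N) (ℓ ∸ N) ≡ w N (ℓ ∸ N) ℤ.+ (conPS (c′ 1) ⊠ q 𝕊.^ ℓ ⊠ w N) (ℓ ∸ N)
    k⊠w N = ≡.trans (agree-⊠ (suc ℓ) {k} {onePS ⊞ conPS (c′ 1) ⊠ q 𝕊.^ ℓ} {w N} {w N} k≈ (λ _ _ → ≡.refl) (ℓ ∸ N) (s≤s (ℕP.m∸n≤m ℓ N)))
      (≡.trans (at (solve 2 (λ x v → (v :^ 0 :+ x) :* v := v :+ x :* v) 𝕊.refl (conPS (c′ 1) ⊠ q 𝕊.^ ℓ) (w N)) (ℓ ∸ N)) (⊞-coefficient (w N) (conPS (c′ 1) ⊠ q 𝕊.^ ℓ ⊠ w N) (ℓ ∸ N)))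

    shifted-low : ∀ c N → 0 < N → N ≤ ℓ → (conPS c ⊠ q 𝕊.^ ℓ ⊠ w N) (ℓ ∸ N) ≡ + 0
    shifted-low c N 0<N N≤ℓ = ≡.trans (at (𝕊.*-assoc (conPS c) (q 𝕊.^ ℓ) (w N)) (ℓ ∸ N)) (≡.trans (con-at c (q^⊠-low ℓ (w N) (ℓ ∸ N) (ℕP.∸-monoʳ-< 0<N N≤ℓ))) (ℤP.*-zeroʳ c))

    shifted-0 : ∀ c → (conPS c ⊠ q 𝕊.^ ℓ ⊠ w 0) ℓ ≡ c
    shifted-0 c = ≡.trans (at (𝕊.*-assoc (conPS c) (q 𝕊.^ ℓ) (w 0)) ℓ) (≡.trans (con-at c (≡.trans (≡.cong (q 𝕊.^ ℓ ⊠ w 0) (≡.sym (ℕP.+-identityʳ ℓ))) (≡.trans (q^⊠-high ℓ (w 0) 0) (w-0 0)))) (ℤP.*-identityʳ c))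

    a≡-w : ∀ N → 0 < N → N ≤ ℓ → a ℓ N ≡ ℤ.- w N (ℓ ∸ N)
    a≡-w N 0<N N≤ℓ = LinearCombination.modulo₁ ℤ-algebra (+ 1) equation′
      (ℤ-solver.solve 2 (λ x y → y ℤ-solver.:= ℤ-solver.:- x ℤ-solver.:+ ℤ-solver.con (+ 1) ℤ-solver.:* (x ℤ-solver.:+ y ℤ-solver.:- ℤ-solver.con (+ 0))) ≡.refl (w N (ℓ ∸ N)) (a ℓ N))
      where
      equation′ : w N (ℓ ∸ N) ℤ.+ a ℓ N ≡ + 0
      equation′ = ≡.trans (≡.sym (≡.trans (≡.cong₂ ℤ._+_ (≡.cong (ℤ._+ a ℓ N) (≡.trans (k⊠w N) (≡.trans (≡.cong (λ z → w N (ℓ ∸ N) ℤ.+ z) (shifted-low (c′ 1) N 0<N N≤ℓ)) (ℤP.+-identityʳ (w N (ℓ ∸ N)))))) (shifted-low A N 0<N N≤ℓ))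
        (ℤP.+-identityʳ (w N (ℓ ∸ N) ℤ.+ a ℓ N)))) (sum≡0 N N≤ℓ)

    -- N h^(-N)(1 - θh/h) = N h^(-N) + θ(h^(-N)), and θ multiplies degree m by m. For m = ℓ - N the
    -- factor N + m becomes ℓ.
    w-coefficient : ∀ N m → + N ℤ.* w N m ≡ (+ N ℤ.+ + m) ℤ.* (h⁻¹ 𝕊.^ N) m
    w-coefficient N m = ≡.trans (≡.sym (con-⊠ (+ N) (w N) m)) (≡.trans (at expand m) (≡.trans (⊞-at (con-⊠ (+ N) (h⁻¹ 𝕊.^ N) m) (θ-coefficient (h⁻¹ 𝕊.^ N) m))
      (≡.sym (ℤP.*-distribʳ-+ ((h⁻¹ 𝕊.^ N) m) (+ N) (+ m)))))
      where
      θh⁻¹ : θ h⁻¹ ≋ (⊟ log′) ⊠ h⁻¹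
      θh⁻¹ = LinearCombination.modulo₂ PS-algebra h⁻¹ (⊟ (θ h⁻¹)) (𝕊.trans (𝕊.sym (θ-⊠ h h⁻¹)) (𝕊.trans (θ-cong h⊠h⁻¹) (𝕊.trans θ𝕊.∂-1 (𝕊.sym 𝕊.con-0)))) h⊠h⁻¹
        (solve 4 (λ h g h′ g′ → g′ := (:- (h′ :* g)) :* g :+ g :* (h′ :* g :+ h :* g′ :- 𝕊.Solver.con (+ 0)) :+ (:- g′) :* (h :* g :- g :^ 0)) 𝕊.refl h h⁻¹ (θ h) (θ h⁻¹))
      expand : conPS (+ N) ⊠ w N ≋ conPS (+ N) ⊠ h⁻¹ 𝕊.^ N ⊞ θ (h⁻¹ 𝕊.^ N)
      expand = 𝕊.trans (solve 3 (λ c x l → c :* (x :* (c :^ 0 :- l)) := c :* x :+ c :* (:- l) :* x) 𝕊.refl (conPS (+ N)) (h⁻¹ 𝕊.^ N) log′)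
        (𝕊.+-congˡ (𝕊.sym (Powers.∂-^-logarithmic PS-differential h⁻¹ (⊟ log′) N θh⁻¹)))

  a-ℓℓ : a ℓ ℓ ≡ ℤ.- + 1
  a-ℓℓ = ≡.trans (a≡-w ℓ (s≤s z≤n) ℕP.≤-refl) (≡.cong ℤ.-_ (≡.trans (≡.cong (w ℓ) (ℕP.n∸n≡0 ℓ)) (w-0 ℓ)))

  a-coefficient : ∀ N → 0 < N → N ≤ ℓ → + N ℤ.* a ℓ N ≡ ℤ.- (+ ℓ ℤ.* (h⁻¹ 𝕊.^ N) (ℓ ∸ N))
  a-coefficient N 0<N N≤ℓ = begin
    + N ℤ.* a ℓ N                          ≡⟨ ≡.cong (+ N ℤ.*_) (a≡-w N 0<N N≤ℓ) ⟩
    + N ℤ.* (ℤ.- w N (ℓ ∸ N))              ≡⟨ ≡.sym (ℤP.neg-distribʳ-* (+ N) (w N (ℓ ∸ N))) ⟩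
    ℤ.- (+ N ℤ.* w N (ℓ ∸ N))              ≡⟨ ≡.cong ℤ.-_ (w-coefficient N (ℓ ∸ N)) ⟩
    ℤ.- ((+ (N ℕ.+ (ℓ ∸ N))) ℤ.* (h⁻¹ 𝕊.^ N) (ℓ ∸ N))  ≡⟨ ≡.cong (λ m → ℤ.- (+ m ℤ.* (h⁻¹ 𝕊.^ N) (ℓ ∸ N))) (ℕP.m+[n∸m]≡n N≤ℓ) ⟩
    ℤ.- (+ ℓ ℤ.* (h⁻¹ 𝕊.^ N) (ℓ ∸ N))      ∎
    where open ≡.≡-Reasoning

  a-ℓ0 : a ℓ 0 ≡ ℤ.- c′ 1 ℤ.- A ℤ.+ log′ ℓ
  a-ℓ0 = LinearCombination.modulo₁ ℤ-algebra (+ 1) equation′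
    (solve′ 4 (λ c A l x → x :=′ :-′ c :-″ A :+′ l :+′ con′ (+ 1) :*′ (:-′ l :+′ c :+′ x :+′ A :-″ con′ (+ 0))) ≡.refl (c′ 1) A (log′ ℓ) (a ℓ 0))
    where
    open ℤ-solver using () renaming (solve to solve′; _:=_ to _:=′_; :-_ to :-′_; _:-_ to _:-″_; _:+_ to _:+′_; _:*_ to _:*′_; con to con′)
    w0 : w 0 ℓ ≡ ℤ.- log′ ℓ
    w0 = ≡.trans (at (𝕊.*-identityˡ u′) ℓ) (≡.trans (⊞-at {onePS} {⊟ log′} {ℓ} ≡.refl (⊟-coefficient log′ ℓ)) (ℤP.+-identityˡ _))
    equation′ : ℤ.- log′ ℓ ℤ.+ c′ 1 ℤ.+ a ℓ 0 ℤ.+ A ≡ + 0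
    equation′ = ≡.trans (≡.sym (≡.cong₂ ℤ._+_ (≡.cong (ℤ._+ a ℓ 0) (≡.trans (k⊠w 0) (≡.cong₂ ℤ._+_ w0 (shifted-0 (c′ 1))))) (shifted-0 A))) (sum≡0 0 z≤n)

-- The other place of the curve over X = ∞, in the coordinate q = 1/X: there Y = γ/q^ℓ with γ(0) = 1.
module SecondPlace (ℓ′ : ℕ) (1≤ℓ′ : 1 ≤ ℓ′) (a : ℕ → ℕ → ℤ) (a-ℓℓ : a (suc ℓ′) (suc ℓ′) ≡ ℤ.- + 1) where
  ℓ r : ℕ
  ℓ = suc ℓ′
  r = ℓ ℕ.* suc ℓ

  private
    e : ℕ → ℕ → ℕ
    e m n = r ∸ (m ℕ.* 1 ℕ.+ n ℕ.* ℓ)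

    e₀ : ℕ
    e₀ = r ∸ suc ℓ ℕ.* 1

    cell : PS → ℕ → ℕ → PS
    cell v m n = conPS (a m n) ⊠ (q 𝕊.^ e m n ⊠ v 𝕊.^ (suc ℓ ∸ n))

    -- The unknown is τ = 1/γ. After division by γ^(ℓ+1), the term Y^(ℓ+1) becomes 1 and the term
    -- (ℓ, ℓ) becomes -τ, because a_{ℓ,ℓ} = -1. Every remaining term carries a positive power of q,
    -- so the equation has the contractive form τ = `T` τ.
    T : PS → PS
    T v = onePS ⊞ q 𝕊.^ e₀ ⊠ v 𝕊.^ suc ℓ ⊞ ∑𝕊.∑ ℓ (λ m → ∑𝕊.∑ (suc ℓ) (cell v m)) ⊞ ∑𝕊.∑ ℓ (cell v ℓ)

    r≡ : r ≡ ℓ ℕ.+ ℓ ℕ.* ℓ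
    r≡ = ℕP.*-suc ℓ ℓ

    gap : ∀ j i → j ℕ.+ i ≤ r → j ≤ r ∸ i
    gap j i le = ℕP.≤-trans (ℕP.≤-reflexive (≡.sym (ℕP.m+n∸n≡m j i))) (ℕP.∸-monoˡ-≤ i le)

    gap-row : ∀ j m n → j ℕ.+ m ≤ ℓ → n ≤ ℓ → j ≤ e m n
    gap-row j m n j+m≤ℓ n≤ℓ = gap j (m ℕ.* 1 ℕ.+ n ℕ.* ℓ) (ℕP.≤-trans
      (ℕP.≤-reflexive (≡.trans (≡.cong (λ x → j ℕ.+ (x ℕ.+ n ℕ.* ℓ)) (ℕP.*-identityʳ m)) (≡.sym (ℕP.+-assoc j m (n ℕ.* ℓ)))))
      (ℕP.≤-trans (ℕP.+-mono-≤ j+m≤ℓ (ℕP.*-monoˡ-≤ ℓ n≤ℓ)) (ℕP.≤-reflexive (≡.sym r≡))))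

    gap-column : ∀ m n → m ≤ ℓ → n < ℓ → 2 ≤ e m n
    gap-column m n m≤ℓ n<ℓ = gap 2 (m ℕ.* 1 ℕ.+ n ℕ.* ℓ) (begin
      2 ℕ.+ (m ℕ.* 1 ℕ.+ n ℕ.* ℓ)  ≡⟨ ≡.cong (λ x → 2 ℕ.+ (x ℕ.+ n ℕ.* ℓ)) (ℕP.*-identityʳ m) ⟩
      2 ℕ.+ (m ℕ.+ n ℕ.* ℓ)        ≤⟨ ℕP.+-mono-≤ (s≤s 1≤ℓ′) (ℕP.+-monoˡ-≤ (n ℕ.* ℓ) m≤ℓ) ⟩
      ℓ ℕ.+ suc n ℕ.* ℓ            ≤⟨ ℕP.+-monoʳ-≤ ℓ (ℕP.*-monoˡ-≤ ℓ n<ℓ) ⟩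
      ℓ ℕ.+ ℓ ℕ.* ℓ                ≡⟨ r≡ ⟨
      r                            ∎)
      where open ℕP.≤-Reasoning

    gap-₀ : 2 ≤ e₀
    gap-₀ = gap 2 (suc ℓ ℕ.* 1) (ℕP.≤-trans (ℕP.≤-reflexive (≡.trans (≡.cong (2 ℕ.+_) (ℕP.*-identityʳ (suc ℓ))) (ℕP.+-comm 2 (suc ℓ))))
      (ℕP.+-monoʳ-≤ (suc ℓ) (ℕP.*-mono-≤ 1≤ℓ′ (s≤s (s≤s (z≤n {ℓ′}))))))

    cell-agree : ∀ k v v′ m n → 1 ≤ e m n → Agree k v v′ → Agree (suc k) (cell v m n) (cell v′ m n)
    cell-agree k v v′ m n 1≤e p = agree-⊠ (suc k) {conPS (a m n)} {conPS (a m n)} {q 𝕊.^ e m n ⊠ v 𝕊.^ (suc ℓ ∸ n)} {q 𝕊.^ e m n ⊠ v′ 𝕊.^ (suc ℓ ∸ n)} (λ _ _ → ≡.refl)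
      (agree-shift k (e m n) {v 𝕊.^ (suc ℓ ∸ n)} {v′ 𝕊.^ (suc ℓ ∸ n)} 1≤e (agree-^ k (suc ℓ ∸ n) p))

    contractive : Contractive T
    contractive k v v′ p = agree-⊞ (suc k) {onePS ⊞ X₀ v ⊞ U₀ v} {onePS ⊞ X₀ v′ ⊞ U₀ v′} {V₀ v} {V₀ v′}
      (agree-⊞ (suc k) {onePS ⊞ X₀ v} {onePS ⊞ X₀ v′} {U₀ v} {U₀ v′} (agree-⊞ (suc k) {onePS} {onePS} {X₀ v} {X₀ v′} (λ _ _ → ≡.refl)
        (agree-shift k e₀ {v 𝕊.^ suc ℓ} {v′ 𝕊.^ suc ℓ} (ℕP.≤-trans (s≤s z≤n) gap-₀) (agree-^ k (suc ℓ) p)))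
        (agree-∑ (suc k) ℓ (λ m → ∑𝕊.∑ (suc ℓ) (cell v m)) (λ m → ∑𝕊.∑ (suc ℓ) (cell v′ m)) (λ m m<ℓ → agree-∑ (suc k) (suc ℓ) (cell v m) (cell v′ m)
          (λ { n (s≤s n≤ℓ) → cell-agree k v v′ m n (gap-row 1 m n m<ℓ n≤ℓ) p }))))
      (agree-∑ (suc k) ℓ (cell v ℓ) (cell v′ ℓ) (λ n n<ℓ → cell-agree k v v′ ℓ n (ℕP.≤-trans (s≤s z≤n) (gap-column ℓ n ℕP.≤-refl n<ℓ)) p))
      where
      X₀ U₀ V₀ : PS → PS
      X₀ v = q 𝕊.^ e₀ ⊠ v 𝕊.^ suc ℓ
      U₀ v = ∑𝕊.∑ ℓ (λ m → ∑𝕊.∑ (suc ℓ) (cell v m))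
      V₀ v = ∑𝕊.∑ ℓ (cell v ℓ)

  τ : PS
  τ = Fixpoint.fix T contractive

  private
    τ≋ : T τ ≋ τ
    τ≋ = Fixpoint.fix≋ T contractive

    shift-0 : ∀ k d f → k ≤ d → Agree k (q 𝕊.^ d ⊠ f) 0PS
    shift-0 k d f k≤d i i<k = ≡.trans (q^⊠-low d f i (ℕP.<-≤-trans i<k k≤d)) (≡.sym (0PS-coefficient i))

    cell-0 : ∀ k m n → k ≤ e m n → Agree k (cell τ m n) 0PS
    cell-0 k m n k≤e i i<k = ≡.trans (con-at (a m n) (≡.trans (shift-0 k (e m n) (τ 𝕊.^ (suc ℓ ∸ n)) k≤e i i<k) (0PS-coefficient i)))
      (≡.trans (ℤP.*-zeroʳ (a m n)) (≡.sym (0PS-coefficient i)))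

  τ-0 : τ 0 ≡ + 1
  τ-0 = ≡.trans (≡.sym (at τ≋ 0)) (agree-⊞-0ʳ 1 {onePS ⊞ q 𝕊.^ e₀ ⊠ τ 𝕊.^ suc ℓ ⊞ ∑𝕊.∑ ℓ (λ m → ∑𝕊.∑ (suc ℓ) (cell τ m))} {∑𝕊.∑ ℓ (cell τ ℓ)} {onePS}
    (agree-⊞-0ʳ 1 {onePS ⊞ q 𝕊.^ e₀ ⊠ τ 𝕊.^ suc ℓ} {∑𝕊.∑ ℓ (λ m → ∑𝕊.∑ (suc ℓ) (cell τ m))} {onePS}
      (agree-⊞-0ʳ 1 {onePS} {q 𝕊.^ e₀ ⊠ τ 𝕊.^ suc ℓ} {onePS} (λ _ _ → ≡.refl) (shift-0 1 e₀ (τ 𝕊.^ suc ℓ) (ℕP.≤-trans (s≤s z≤n) gap-₀)))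
      (agree-∑-0 1 ℓ (λ m → ∑𝕊.∑ (suc ℓ) (cell τ m)) (λ m m<ℓ → agree-∑-0 1 (suc ℓ) (cell τ m) (λ { n (s≤s n≤ℓ) → cell-0 1 m n (gap-row 1 m n m<ℓ n≤ℓ) }))))
    (agree-∑-0 1 ℓ (cell τ ℓ) (λ n n<ℓ → cell-0 1 ℓ n (ℕP.≤-trans (s≤s z≤n) (gap-column ℓ n ℕP.≤-refl n<ℓ)))) 0 (s≤s z≤n))

  open Inverse τ τ-0 public renaming (inverse to γ; inverse-⊠ to γ⊠τ)

  -- Among the terms of `T` only the cell (ℓ - 1, ℓ) has exponent 1; all others start at q² or
  -- later.
  τ-1 : τ 1 ≡ a ℓ′ ℓ
  τ-1 = ≡.trans (≡.sym (at τ≋ 1)) (≡.trans (agree-⊞-0ʳ 2 {onePS ⊞ q 𝕊.^ e₀ ⊠ τ 𝕊.^ suc ℓ ⊞ U₀} {∑𝕊.∑ ℓ (cell τ ℓ)} {onePS ⊞ cell τ ℓ′ ℓ}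
      (agree-⊞ 2 {onePS ⊞ q 𝕊.^ e₀ ⊠ τ 𝕊.^ suc ℓ} {onePS} {U₀} {cell τ ℓ′ ℓ}
        (agree-⊞-0ʳ 2 {onePS} {q 𝕊.^ e₀ ⊠ τ 𝕊.^ suc ℓ} {onePS} (λ _ _ → ≡.refl) (shift-0 2 e₀ (τ 𝕊.^ suc ℓ) gap-₀))
        (agree-⊞-0ˡ 2 {∑𝕊.∑ ℓ′ (λ m → ∑𝕊.∑ (suc ℓ) (cell τ m))} {∑𝕊.∑ (suc ℓ) (cell τ ℓ′)} {cell τ ℓ′ ℓ}
          (agree-∑-0 2 ℓ′ (λ m → ∑𝕊.∑ (suc ℓ) (cell τ m)) (λ m m<ℓ′ → agree-∑-0 2 (suc ℓ) (cell τ m) (λ { n (s≤s n≤ℓ) → cell-0 2 m n (gap-row 2 m n (s≤s m<ℓ′) n≤ℓ) })))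
          (agree-⊞-0ˡ 2 {∑𝕊.∑ ℓ (cell τ ℓ′)} {cell τ ℓ′ ℓ} {cell τ ℓ′ ℓ} (agree-∑-0 2 ℓ (cell τ ℓ′) (λ n n<ℓ → cell-0 2 ℓ′ n (gap-column ℓ′ n (ℕP.n≤1+n ℓ′) n<ℓ))) (λ _ _ → ≡.refl))))
      (agree-∑-0 2 ℓ (cell τ ℓ) (λ n n<ℓ → cell-0 2 ℓ n (gap-column ℓ n ℕP.≤-refl n<ℓ))) 1 (s≤s (s≤s z≤n)))
    (≡.trans (⊞-at {onePS} {cell τ ℓ′ ℓ} ≡.refl (con-at (a ℓ′ ℓ) corner)) (≡.trans (ℤP.+-identityˡ (a ℓ′ ℓ ℤ.* + 1)) (ℤP.*-identityʳ (a ℓ′ ℓ)))))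
    where
    U₀ : PS
    U₀ = ∑𝕊.∑ ℓ (λ m → ∑𝕊.∑ (suc ℓ) (cell τ m))
    exponent : e ℓ′ ℓ ≡ 1
    exponent = ≡.trans (≡.cong₂ _∸_ (≡.trans r≡ (≡.sym (ℕP.+-assoc 1 ℓ′ (ℓ ℕ.* ℓ)))) (≡.cong (ℕ._+ ℓ ℕ.* ℓ) (ℕP.*-identityʳ ℓ′))) (ℕP.m+n∸n≡m 1 (ℓ′ ℕ.+ ℓ ℕ.* ℓ))
    corner : (q 𝕊.^ e ℓ′ ℓ ⊠ τ 𝕊.^ (suc ℓ ∸ ℓ)) 1 ≡ + 1
    corner = ≡.trans (≡.cong (λ d → (q 𝕊.^ d ⊠ τ 𝕊.^ (suc ℓ ∸ ℓ)) 1) exponent) (≡.trans (q^⊠-high 1 (τ 𝕊.^ (suc ℓ ∸ ℓ)) 0) (^-at-0 τ (suc ℓ ∸ ℓ) τ-0))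

  γ-0 : γ 0 ≡ + 1
  γ-0 = ≡.trans (≡.sym (ℤP.*-identityʳ (γ 0))) (≡.trans (≡.cong (γ 0 ℤ.*_) (≡.sym τ-0)) (≡.trans (≡.sym (⊠-0 γ τ)) (at γ⊠τ 0)))

  γ-1 : γ 1 ≡ ℤ.- a ℓ′ ℓ
  γ-1 = LinearCombination.modulo₁ ℤ-algebra (+ 1) (≡.trans (≡.sym (≡.trans (⊠-1 γ τ) (≡.cong₂ ℤ._+_ (≡.cong₂ ℤ._*_ γ-0 τ-1) (≡.cong (γ 1 ℤ.*_) τ-0)))) (at γ⊠τ 1))
    (ℤ-solver.solve 2 (λ a g → g ℤ-solver.:= ℤ-solver.:- a ℤ-solver.:+ ℤ-solver.con (+ 1) ℤ-solver.:* (ℤ-solver.con (+ 1) ℤ-solver.:* a ℤ-solver.:+ g ℤ-solver.:* ℤ-solver.con (+ 1) ℤ-solver.:- ℤ-solver.con (+ 0))) ≡.refl (a ℓ′ ℓ) (γ 1))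

  x y : Laurent
  x = onePS /q^ 1
  y = γ /q^ ℓ

  private
    one^ : ∀ n → onePS 𝕊.^ n ≋ onePS
    one^ zero    = 𝕊.refl
    one^ (suc n) = 𝕊.trans (𝕊.*-identityˡ _) (one^ n)

    γτ^ : ∀ n → γ 𝕊.^ n ⊠ τ 𝕊.^ n ≋ onePS
    γτ^ n = 𝕊.trans (𝕊.sym (𝕊.^-distrib-* γ τ n)) (𝕊.trans (𝕊.^-congˡ n γ⊠τ) (one^ n))

    G : PS
    G = γ 𝕊.^ suc ℓ

    cleared : ∀ n → n ≤ suc ℓ → γ 𝕊.^ n ≋ G ⊠ τ 𝕊.^ (suc ℓ ∸ n)
    cleared n n≤ = 𝕊.sym (𝕊.trans (𝕊.*-congʳ (𝕊.trans (𝕊.reflexive (≡.cong (γ 𝕊.^_) (≡.sym (ℕP.m+[n∸m]≡n n≤)))) (𝕊.^-homo-* γ n (suc ℓ ∸ n))))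
      (𝕊.trans (𝕊.*-assoc _ _ _) (𝕊.trans (𝕊.*-congˡ (γτ^ (suc ℓ ∸ n))) (𝕊.*-identityʳ _))))

    term : ℕ → ℕ → PS
    term m n = conPS (a m n) ⊠ (q 𝕊.^ e m n ⊠ (onePS 𝕊.^ m ⊠ γ 𝕊.^ n))

    term≋ : ∀ m n → n ≤ ℓ → term m n ≋ G ⊠ cell τ m n
    term≋ m n n≤ℓ = 𝕊.trans (𝕊.*-congˡ (𝕊.*-congˡ (𝕊.trans (𝕊.*-congʳ (one^ m)) (𝕊.trans (𝕊.*-identityˡ _) (cleared n (ℕP.m≤n⇒m≤1+n n≤ℓ))))))
      (solve 4 (λ c q g t → c :* (q :* (g :* t)) := g :* (c :* (q :* t))) 𝕊.refl (conPS (a m n)) (q 𝕊.^ e m n) G (τ 𝕊.^ (suc ℓ ∸ n)))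
      where open 𝕊.Solver using (solve; _:=_; _:*_)

    last-cell : cell τ ℓ ℓ ≋ ⊟ τ
    last-cell = 𝕊.trans (𝕊.*-cong (𝕊.reflexive (≡.cong conPS a-ℓℓ)) (𝕊.*-cong
        (𝕊.reflexive (≡.cong (q 𝕊.^_) (≡.trans (≡.cong₂ _∸_ r≡ (≡.cong (ℕ._+ ℓ ℕ.* ℓ) (ℕP.*-identityʳ ℓ))) (ℕP.n∸n≡0 (ℓ ℕ.+ ℓ ℕ.* ℓ)))))
        (𝕊.reflexive (≡.cong (τ 𝕊.^_) (≡.trans (ℕP.+-∸-assoc 1 (ℕP.≤-refl {ℓ})) (≡.cong suc (ℕP.n∸n≡0 ℓ)))))))
      (solve 1 (λ t → con (ℤ.- + 1) :* (t :^ 0 :* (t :* t :^ 0)) := :- t) 𝕊.refl τ)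
      where open 𝕊.Solver using (solve; _:=_; _:*_; :-_; _:^_; con)

    double-sum : ∀ N (t c : ℕ → ℕ → PS) → (∀ m n → n ≤ N → t m n ≋ G ⊠ c m n) →
      ∑𝕊.∑ (suc N) (λ m → ∑𝕊.∑ (suc N) (t m)) ≋ G ⊠ (∑𝕊.∑ N (λ m → ∑𝕊.∑ (suc N) (c m)) ⊞ (∑𝕊.∑ N (c N) ⊞ c N N))
    double-sum N t c eq = 𝕊.trans (∑𝕊.∑-cong (suc N) (λ m _ → ∑𝕊.∑-cong (suc N) (λ { n (s≤s n≤N) → eq m n n≤N })))
      (𝕊.trans (∑𝕊.∑-cong (suc N) (λ m _ → 𝕊.sym (∑𝕊.*-∑ (suc N) G (c m)))) (𝕊.sym (∑𝕊.*-∑ (suc N) G (λ m → ∑𝕊.∑ (suc N) (c m)))))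

    equation : q 𝕊.^ e₀ ⊠ onePS 𝕊.^ suc ℓ ⊞ q 𝕊.^ (r ∸ suc ℓ ℕ.* ℓ) ⊠ γ 𝕊.^ suc ℓ ⊞ ∑𝕊.∑ (suc ℓ) (λ m → ∑𝕊.∑ (suc ℓ) (term m)) ≋ 0PS
    equation = 𝕊.trans (𝕊.+-cong (𝕊.+-cong
        (𝕊.*-congˡ (𝕊.trans (one^ (suc ℓ)) (𝕊.sym (γτ^ (suc ℓ)))))
        (𝕊.trans (𝕊.*-congʳ (𝕊.reflexive (≡.cong (q 𝕊.^_) (≡.trans (≡.cong (_∸ suc ℓ ℕ.* ℓ) (ℕP.*-comm ℓ (suc ℓ))) (ℕP.n∸n≡0 (suc ℓ ℕ.* ℓ)))))) (𝕊.*-identityˡ G)))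
        (double-sum ℓ term (cell τ) term≋))
      (𝕊.trans (𝕊.+-congˡ (𝕊.*-congˡ (𝕊.+-congˡ (𝕊.+-congˡ last-cell))))
        (𝕊.trans (solve 6 (λ x g t s u v → x :* (g :* s) :+ g :+ g :* (u :+ (v :+ (:- t))) := g :* (g :^ 0 :+ x :* s :+ u :+ v :- t)) 𝕊.refl
          (q 𝕊.^ e₀) G τ (τ 𝕊.^ suc ℓ) (∑𝕊.∑ ℓ (λ m → ∑𝕊.∑ (suc ℓ) (cell τ m))) (∑𝕊.∑ ℓ (cell τ ℓ)))
          (LinearCombination.vanish PS-algebra G τ≋)))
      where open 𝕊.Solver using (solve; _:=_; _:+_; _:*_; :-_; _:-_; _:^_)

  onCurve : OnCurve ℓ a x y
  onCurve = Expansion-zero (curve-expansion ℓ a r {1} {ℓ} {x} {y} {onePS} {γ} (expansion (LaurentRing.clear-/ onePS 1)) (expansion (LaurentRing.clear-/ γ ℓ))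
    (ℕP.≤-trans (ℕP.≤-reflexive (ℕP.*-identityʳ (suc ℓ))) (ℕP.m≤n*m (suc ℓ) ℓ)) (ℕP.≤-reflexive (ℕP.*-comm (suc ℓ) ℓ))
    (λ m n m≤ℓ n≤ℓ → ℕP.≤-trans (ℕP.+-mono-≤ (ℕP.≤-trans (ℕP.≤-reflexive (ℕP.*-identityʳ m)) m≤ℓ) (ℕP.*-monoˡ-≤ ℓ n≤ℓ)) (ℕP.≤-reflexive (≡.sym r≡))))
    equation

-- Polar parts, positivity and residues.

module _ where
  open LaurentRing using (ι-cong; ι-*)

  Lead-lower : ∀ {p x} → Lead (suc p) (+ 0) x → ∃ λ c → Lead p c x
  Lead-lower {p} {x} (lead f e h) = dropPS 1 f 0 , lead (dropPS 1 f) (qᴸ-cancel 1 (𝕃.trans (𝕃.sym (𝕃.*-assoc _ _ _))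
    (𝕃.trans (𝕃.*-congʳ (𝕃.sym (qᴸ-+ 1 p))) (𝕃.trans e (𝕃.trans (ι-cong (shift-drop 1 f (λ { zero _ → h ; (suc _) (s≤s ()) }))) (ι-* (q 𝕊.^ 1) (dropPS 1 f))))))) ≡.refl

  -- s is divisible by q, so each factor s lowers the order of the pole by at least one.
  Lead-^-zero : ∀ {p c z s} → Lead p c z → Lead 0 (+ 0) s → ∃ λ b → Lead 0 b (z 𝕃.* s 𝕃.^ p)
  Lead-^-zero {zero}  {c} {z} l _ = c , Lead-cong (𝕃.sym (𝕃.*-identityʳ z)) l
  Lead-^-zero {suc p} {c} {z} {s} l m =
    let (_ , l′) = Lead-lower {p} {z 𝕃.* s} (≡.subst₂ (λ r b → Lead r b (z 𝕃.* s)) (ℕP.+-identityʳ (suc p)) (ℤP.*-zeroʳ c) (Lead-* l m))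
        (b , l″) = Lead-^-zero {p} l′ m
    in b , Lead-cong (𝕃.*-assoc z s (s 𝕃.^ p)) l″

polynomialT : ℕ → (ℕ → ℤ) → Term → Term
polynomialT p η e = ∑T (suc p) (λ i → κ (η i) ⊗ powT e i)

univariate : ℕ → (ℕ → ℤ) → Laurent → Laurent
univariate p η t = ∑𝕃.∑ (suc p) (λ i → conᴸ (η i) 𝕃.* t 𝕃.^ i)

eval-polynomialT : ∀ x y p η e → eval x y (polynomialT p η e) ≅ univariate p η (eval x y e)
eval-polynomialT x y p η e = 𝕃.trans (𝕃.reflexive (eval-∑ x y (suc p) (λ i → κ (η i) ⊗ powT e i)))
  (∑𝕃.∑-cong (suc p) {λ i → conᴸ (η i) 𝕃.* eval x y (powT e i)} {λ i → conᴸ (η i) 𝕃.* eval x y e 𝕃.^ i} (λ i _ → 𝕃.*-congˡ {conᴸ (η i)} (𝕃.reflexive (eval-pow x y e i))))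

Lead-monomial : ∀ c p {t r} → Lead r (+ 1) t → Lead (p ℕ.* r) c (conᴸ c 𝕃.* t 𝕃.^ p)
Lead-monomial c p {t} {r} lt = ≡.subst (λ a → Lead (p ℕ.* r) a (conᴸ c 𝕃.* t 𝕃.^ p)) (ℤP.*-identityʳ c) (Lead-* (Lead-con c) (Lead-^ p lt))

private
  subtract-top : ∀ c p {t z} → Lead 1 (+ 1) t → Lead p c z → Lead p (+ 0) (z 𝕃.- conᴸ c 𝕃.* t 𝕃.^ p)
  subtract-top c p {t} {z} lt l = ≡.subst (λ b → Lead p b (z 𝕃.- conᴸ c 𝕃.* t 𝕃.^ p)) (ℤP.+-inverseʳ c)
    (Lead-+ l (Lead-neg (≡.subst (λ r → Lead r c (conᴸ c 𝕃.* t 𝕃.^ p)) (ℕP.*-identityʳ p) (Lead-monomial c p lt))))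

  update : (ℕ → ℤ) → ℕ → ℤ → ℕ → ℤ
  update η p c i = if does (i ℕP.≟ p) then c else η i

  update-top : ∀ η p c → update η p c p ≡ c
  update-top η p c = ≡.cong (λ b → if b then c else η p) (dec-true (p ℕP.≟ p) ≡.refl)

  update-low : ∀ η p c i → i < p → update η p c i ≡ η i
  update-low η p c i i<p = ≡.cong (λ b → if b then c else η i) (dec-false (i ℕP.≟ p) (ℕP.<⇒≢ i<p))

  univariate-update : ∀ η p c t z → z 𝕃.- conᴸ c 𝕃.* t 𝕃.^ suc p 𝕃.- univariate p η t ≅ z 𝕃.- univariate (suc p) (update η (suc p) c) t
  univariate-update η p c t z = 𝕃.trans
    (solve 3 (λ z s t → z :- s :- t := z :- (t :+ s)) 𝕃.refl z (conᴸ c 𝕃.* t 𝕃.^ suc p) (univariate p η t))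
    (𝕃.+-congˡ {z} (𝕃.-‿cong (𝕃.+-cong
      (∑𝕃.∑-cong (suc p) {λ i → conᴸ (η i) 𝕃.* t 𝕃.^ i} {λ i → conᴸ (update η (suc p) c i) 𝕃.* t 𝕃.^ i}
        (λ i i<p → 𝕃.*-congʳ {t 𝕃.^ i} (𝕃.reflexive (≡.cong conᴸ (≡.sym (update-low η (suc p) c i i<p))))))
      (𝕃.*-congʳ {t 𝕃.^ suc p} (𝕃.reflexive (≡.cong conᴸ (≡.sym (update-top η (suc p) c))))))))
    where open 𝕃.Solver using (solve; _:=_; _:+_; _:-_)

-- A function with a simple pole has powers of every pole order. Subtracting c tᵖ from the top
-- downwards removes the polar part of z and then its constant term, so that the difference is
-- divisible by q.
polar-part : ∀ {t} → Lead 1 (+ 1) t → ∀ p c z → Lead p c z → ∃ λ η → η p ≡ c × Lead 0 (+ 0) (z 𝕃.- univariate p η t)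
polar-part {t} lt zero c z l = (λ _ → c) , ≡.refl , Lead-cong {y = z 𝕃.- univariate 0 (λ _ → c) t}
  (𝕃.+-congˡ {z} (𝕃.-‿cong (𝕃.sym (𝕃.+-identityˡ (conᴸ c 𝕃.* 𝕃.1#))))) (subtract-top c 0 lt l)
polar-part {t} lt (suc p) c z l = extend (Lead-lower {p} {z 𝕃.- conᴸ c 𝕃.* t 𝕃.^ suc p} (subtract-top c (suc p) lt l))
  where
  extend : ∃ (λ b → Lead p b (z 𝕃.- conᴸ c 𝕃.* t 𝕃.^ suc p)) → ∃ λ η → η (suc p) ≡ c × Lead 0 (+ 0) (z 𝕃.- univariate (suc p) η t)
  extend (b , l′) = let (η , _ , l″) = polar-part lt p b (z 𝕃.- conᴸ c 𝕃.* t 𝕃.^ suc p) l′ in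
    update η (suc p) c , update-top η (suc p) c , Lead-cong (univariate-update η p c t z) l″

Lead-univariate : ∀ p η {s r} → Lead (suc r) (+ 1) s → Lead (p ℕ.* suc r) (η p) (univariate p η s)
Lead-univariate p η {s} {r} ls = ≡.subst (λ c → Lead (p ℕ.* suc r) c (univariate p η s)) (ℤP.+-identityˡ (η p))
  (Lead-+ (≡.subst (λ c → Lead (p ℕ.* suc r) c (∑𝕃.∑ p (λ i → conᴸ (η i) 𝕃.* s 𝕃.^ i))) (∑ℤ.∑-0 p {λ _ → + 0} (λ _ _ → ≡.refl))
      (Lead-∑ (p ℕ.* suc r) p (λ _ → + 0) (λ i → conᴸ (η i) 𝕃.* s 𝕃.^ i) (λ i i<p → Lead-weaken (p ℕ.* suc r) (ℕP.*-monoˡ-< (suc r) i<p) (Lead-monomial (η i) i ls))))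
    (Lead-monomial (η p) p ls))

NonNegative Positive : PS → Set
NonNegative f = ∀ i → + 0 ℤ.≤ f i
Positive f = ∀ i → + 0 ℤ.< f i

∑-nonNegative : ∀ n f → (∀ i → i < n → + 0 ℤ.≤ f i) → + 0 ℤ.≤ ∑ℤ n f
∑-nonNegative zero    f p = ℤP.≤-refl
∑-nonNegative (suc n) f p = ℤP.+-mono-≤ (∑-nonNegative n f (λ i i<n → p i (ℕP.m<n⇒m<1+n i<n))) (p n ℕP.≤-refl)

*-nonNegative : ∀ {i j} → + 0 ℤ.≤ i → + 0 ℤ.≤ j → + 0 ℤ.≤ i ℤ.* j
*-nonNegative {i} {j} p r = ≡.subst (ℤ._≤ i ℤ.* j) (ℤP.*-zeroʳ i) (ℤP.*-monoˡ-≤-nonNeg i {{ℤ.nonNegative p}} r)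

*-positive : ∀ {i j} → + 0 ℤ.< i → + 0 ℤ.< j → + 0 ℤ.< i ℤ.* j
*-positive {i} {j} p r = ≡.subst (ℤ._< i ℤ.* j) (ℤP.*-zeroʳ i) (ℤP.*-monoˡ-<-pos i {{ℤ.positive p}} r)

⊠-nonNegative : ∀ {f g} → NonNegative f → NonNegative g → NonNegative (f ⊠ g)
⊠-nonNegative {f} {g} p r k = ≡.subst (+ 0 ℤ.≤_) (≡.sym (⊠-coefficient f g k)) (∑-nonNegative (suc k) _ (λ i _ → *-nonNegative (p i) (r (k ∸ i))))

⊠-positive : ∀ {f g} → NonNegative f → + 0 ℤ.< f 0 → Positive g → Positive (f ⊠ g)
⊠-positive {f} {g} p p₀ r k = ≡.subst (+ 0 ℤ.<_) (≡.sym (≡.trans (⊠-coefficient f g k) (∑ℤ.∑-head k (λ i → f i ℤ.* g (k ∸ i)))))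
  (ℤP.+-mono-<-≤ (*-positive p₀ (r k)) (∑-nonNegative k _ (λ i _ → *-nonNegative (p (suc i)) (ℤP.<⇒≤ (r (k ∸ suc i))))))

-- E₄³ has nonnegative coefficients and constant term 1, and the 24th power of the partition series
-- has positive ones. What is wanted of this is c_ℓ > 0.
Jq-positive : Positive Jq
Jq-positive = λ k → ≡.subst (+ 0 ℤ.<_) (≡.sym (at (mulPS≋⊠ (powPS≋^ E₄ 3) (powPS≋^ partPS 24)) k))
  (⊠-positive (E₄^ 3) (≡.subst (+ 0 ℤ.<_) (≡.sym (^-at-0 E₄ 3 ≡.refl)) 0<1) (partPS^ 23) k)
  where
  0<1 : + 0 ℤ.< + 1
  0<1 = ℤ.+<+ (s≤s z≤n)
  geom-nonNegative : ∀ n → NonNegative (geomPS n)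
  geom-nonNegative n k with does (n ∣? k)
  ... | true  = ℤ.+≤+ z≤n
  ... | false = ℤ.+≤+ z≤n
  one-nonNegative : NonNegative onePS
  one-nonNegative zero    = ℤ.+≤+ z≤n
  one-nonNegative (suc _) = ℤ.+≤+ z≤n
  geom₁-positive : Positive (geomPS 1)
  geom₁-positive k = ≡.subst (λ b → + 0 ℤ.< (if b then + 1 else + 0)) (≡.sym (dec-true (1 ∣? k) (divides k (≡.sym (ℕP.*-identityʳ k))))) 0<1
  finPartProd-positive : ∀ N → Positive (finPartProd (suc N))
  finPartProd-positive zero    k = ≡.subst (+ 0 ℤ.<_) (≡.sym (at (𝕊.trans (mulPS≋⊠ 𝕊.refl 𝕊.refl) (𝕊.*-identityʳ (geomPS 1))) k)) (geom₁-positive k)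
  finPartProd-positive (suc N) k = ≡.subst (+ 0 ℤ.<_) (≡.sym (mulPS≡⊠ (geomPS (suc (suc N))) (finPartProd (suc N)) k))
    (⊠-positive (geom-nonNegative (suc (suc N))) (≡.subst (λ b → + 0 ℤ.< (if b then + 1 else + 0)) (≡.sym (dec-true (suc (suc N) ∣? 0) (suc (suc N) ∣0))) 0<1) (finPartProd-positive N) k)
  partPS-positive : Positive partPS
  partPS-positive zero    = 0<1
  partPS-positive (suc k) = finPartProd-positive k (suc k)
  partPS^ : ∀ n → Positive (partPS 𝕊.^ suc n)
  partPS^ zero    k = ≡.subst (+ 0 ℤ.<_) (≡.sym (at (𝕊.*-identityʳ partPS) k)) (partPS-positive k)
  partPS^ (suc n) = ⊠-positive (ℤP.<⇒≤ ∘ partPS-positive) (partPS-positive 0) (partPS^ n)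
  σ-nonNegative : ∀ n → + 0 ℤ.≤ σ₃ n
  σ-nonNegative n = ≡.subst (+ 0 ℤ.≤_) (≡.sym (sumBelow≡∑ (suc n) (λ d → summand d (does (d ∣? n) ∧ (0 ℕ.<ᵇ d))))) (∑-nonNegative (suc n) _ (λ d _ → nonNegative d (does (d ∣? n) ∧ (0 ℕ.<ᵇ d))))
    where
    summand : ℕ → Bool → ℤ
    summand d b = if b then + (d ℕ.* d ℕ.* d) else + 0
    nonNegative : ∀ d b → + 0 ℤ.≤ summand d b
    nonNegative d true  = ℤ.+≤+ z≤n
    nonNegative d false = ℤ.+≤+ z≤n
  E₄-nonNegative : NonNegative E₄
  E₄-nonNegative zero    = ℤ.+≤+ z≤n
  E₄-nonNegative (suc k) = *-nonNegative {+ 240} (ℤ.+≤+ z≤n) (σ-nonNegative (suc k))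
  E₄^ : ∀ n → NonNegative (E₄ 𝕊.^ n)
  E₄^ zero    = one-nonNegative
  E₄^ (suc n) = ⊠-nonNegative E₄-nonNegative (E₄^ n)

CT-∑ : ∀ n v → (∀ i → i < n → CT (v i) ≡ + 0) → CT (∑𝕃.∑ n v) ≡ + 0
CT-∑ zero    v z = ≡.trans (≡.sym (LaurentRing.CT-cong (𝕃.zeroˡ 𝕃.0#))) (≡.trans (LaurentRing.CT-con* (+ 0) 𝕃.0#) (ℤP.*-zeroˡ (CT 𝕃.0#)))
CT-∑ (suc n) v z = ≡.trans (LaurentRing.CT-+ (∑𝕃.∑ n v) (v n)) (≡.cong₂ ℤ._+_ (CT-∑ n v (λ i i<n → z i (ℕP.m<n⇒m<1+n i<n))) (z n ℕP.≤-refl))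

-- tⁱ dt is exact
CT-univariate : ∀ p η t → CT (univariate p η t 𝕃.* θᴸ t) ≡ + 0
CT-univariate p η t = ≡.trans (LaurentRing.CT-cong (∑𝕃.∑-* (suc p) (θᴸ t) (λ i → conᴸ (η i) 𝕃.* t 𝕃.^ i)))
  (CT-∑ (suc p) (λ i → conᴸ (η i) 𝕃.* t 𝕃.^ i 𝕃.* θᴸ t) (λ i _ → ≡.trans (LaurentRing.CT-cong (𝕃.*-assoc (conᴸ (η i)) (t 𝕃.^ i) (θᴸ t)))
    (≡.trans (LaurentRing.CT-con* (η i) (t 𝕃.^ i 𝕃.* θᴸ t)) (≡.trans (≡.cong (η i ℤ.*_) (power i)) (ℤP.*-zeroʳ (η i))))))
  where
  power : ∀ i → CT (t 𝕃.^ i 𝕃.* θᴸ t) ≡ + 0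
  power i = ℤP.*-cancelˡ-≡ (+ suc i) (CT (t 𝕃.^ i 𝕃.* θᴸ t)) (+ 0) (≡.trans (≡.sym (LaurentRing.CT-con* (+ suc i) (t 𝕃.^ i 𝕃.* θᴸ t)))
    (≡.trans (LaurentRing.CT-cong (𝕃.sym (Powers.∂-^ Laurent-differential t i))) (≡.trans (LaurentRing.CT-θ (t 𝕃.^ suc i)) (≡.sym (ℤP.*-zeroʳ (+ suc i))))))

CT-expansion : ∀ {p x f} → Expansion p x f → CT x ≡ f p
CT-expansion {p} {x} {f} e = ≡.trans (LaurentRing.CT-cong (qᴸ-cancel p {x} {f /q^ p} (𝕃.trans (Expansion.expands e) (𝕃.sym (LaurentRing.clear-/ f p))))) (LaurentRing.CT-/ f p)

OnCurve-swap : ∀ ℓ a x y → OnCurve ℓ a x y → OnCurve ℓ (λ m n → a n m) y x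
OnCurve-swap ℓ a x y c = 𝕃.trans (𝕃.+-cong (𝕃.+-comm (y 𝕃.^ suc ℓ) (x 𝕃.^ suc ℓ)) (𝕃.trans
  (∑𝕃.∑-swap (suc ℓ) (suc ℓ) (λ i n → conᴸ (a n i) 𝕃.* monomial i n y x))
  (∑𝕃.∑-cong (suc ℓ) {λ n → ∑𝕃.∑ (suc ℓ) (λ i → conᴸ (a n i) 𝕃.* monomial i n y x)} {λ n → ∑𝕃.∑ (suc ℓ) (λ i → conᴸ (a n i) 𝕃.* monomial n i x y)}
    (λ n _ → ∑𝕃.∑-cong (suc ℓ) (λ i _ → 𝕃.*-congˡ {conᴸ (a n i)} (𝕃.*-comm (y 𝕃.^ i) (x 𝕃.^ n))))))) c

-- Transfer of vanishing from one place to the other.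

subT : Term → Term → Term
subT e f = e ⊕ κ (ℤ.- + 1) ⊗ f

eval-subT : ∀ x y e f → eval x y (subT e f) ≅ eval x y e 𝕃.- eval x y f
eval-subT x y e f = solve 2 (λ a b → a :+ con (ℤ.- + 1) :* b := a :- b) 𝕃.refl (eval x y e) (eval x y f)
  where open 𝕃.Solver using (solve; _:=_; _:+_; _:*_; _:-_; con)

-- The two places P₁ = (K, J) and P₂ = (x, y) of the curve: a polynomial that vanishes at P₁ vanishes at P₂.
module Places (ℓ′ : ℕ) (2≤ℓ′ : 2 ≤ ℓ′) (a : ℕ → ℕ → ℤ) (modular : IsModularPolynomial (suc ℓ′) a) where
  open ModularEquation ℓ′ 2≤ℓ′ a modular using (h; k; ℓ; Jq-0; k-0; δ-unfold; δ) renaming (onCurve to onCurve₁) public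
  open SecondPlace ℓ′ (ℕP.≤-trans (s≤s z≤n) 2≤ℓ′) a (Lagrange.a-ℓℓ ℓ′ 2≤ℓ′ a modular) using (γ; γ-0; γ-1; x; y) renaming (onCurve to onCurve₂) public
  open LaurentRing using (clear-/; ι-cong; θᴸ-ι)

  K₁ : Laurent
  K₁ = K ℓ′

  expansion-J : Expansion 1 J h
  expansion-J = expansion (clear-/ h 1)

  expansion-K : Expansion ℓ K₁ k
  expansion-K = expansion (clear-/ k ℓ)

  lead-J : Lead 1 (+ 1) J
  lead-J = Expansion-Lead expansion-J Jq-0

  lead-K : Lead ℓ (+ 1) K₁
  lead-K = Expansion-Lead expansion-K k-0

  lead-x : Lead 1 (+ 1) x
  lead-x = lead onePS (clear-/ onePS 1) ≡.refl

  lead-y : Lead ℓ (+ 1) y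
  lead-y = lead γ (clear-/ γ ℓ) γ-0

  2≤ℓ : 2 ≤ ℓ
  2≤ℓ = ℕP.m≤n⇒m≤1+n 2≤ℓ′

  v : PS
  v = θ h 𝕊.- h

  expansion-θJ : Expansion 1 (θᴸ J) v
  expansion-θJ = expansion (LinearCombination.modulo₂ Laurent-algebra (conᴸ (+ 1)) (𝕃.- conᴸ (+ 1)) derivative (clear-/ h 1)
      (solve 5 (λ k z z′ H H′ → k :* z′ := H′ :- H :+ con (+ 1) :* (k :* z :+ k :* z′ :- H′) :+ (:- con (+ 1)) :* (k :* z :- H)) 𝕃.refl (qᴸ 1) J (θᴸ J) (ι h) (ι (θ h)))
      ⟨ 𝕃.trans ⟩ 𝕃.sym (ι-sub (θ h) h))
    where
    open 𝕃.Solver using (solve; _:=_; _:+_; _:*_; _:-_; :-_; con)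
    derivative : qᴸ 1 𝕃.* J 𝕃.+ qᴸ 1 𝕃.* θᴸ J ≅ ι (θ h)
    derivative = 𝕃.trans (𝕃.+-congʳ (𝕃.*-congʳ {J} (𝕃.sym (𝕃.trans (θᴸ-ι (q 𝕊.^ 1)) (ι-cong (𝕊.trans (θ-q^ 1) (𝕊.trans (𝕊.*-congʳ 𝕊.con-1) (𝕊.*-identityˡ _))))))))
      (𝕃.trans (𝕃.sym (θ𝕃.∂-* (qᴸ 1) J)) (𝕃.trans (θ𝕃.∂-cong (clear-/ h 1)) (θᴸ-ι h)))

  v-coefficient : ∀ i → v (suc i) ≡ + i ℤ.* h (suc i)
  v-coefficient i = ≡.trans (⊞-at (θ-coefficient h (suc i)) (⊟-coefficient h (suc i)))
    (ℤ-solver.solve 2 (λ i x → (ℤ-solver.con (+ 1) ℤ-solver.:+ i) ℤ-solver.:* x ℤ-solver.:- x ℤ-solver.:= i ℤ-solver.:* x) ≡.refl (+ i) (h (suc i)))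

  -- K = q^(-ℓ) + c₀ + O(q^ℓ). Against θJ the first term picks ℓ c_ℓ, the second picks the vanishing
  -- constant term of θJ, and the rest starts above degree 0 because ℓ ≥ 2.
  residue : CT (K₁ 𝕃.* θᴸ J) ≡ + ℓ ℤ.* h (suc ℓ)
  residue = ≡.trans (CT-expansion (Expansion-* expansion-K expansion-θJ)) (≡.trans (≡.cong (k ⊠ v) (ℕP.+-comm ℓ 1))
    (≡.trans (at expand (suc ℓ)) (≡.trans (⊞-at (⊞-at (≡.trans (con-at (h 0) (v-coefficient ℓ)) (≡.trans (≡.cong (ℤ._* (+ ℓ ℤ.* h (suc ℓ))) Jq-0) (ℤP.*-identityˡ (+ ℓ ℤ.* h (suc ℓ)))))
      (con-at (tail h 0) (≡.trans (≡.cong (q 𝕊.^ ℓ ⊠ v) (ℕP.+-comm 1 ℓ)) (≡.trans (q^⊠-high ℓ v 1) (≡.trans (v-coefficient 0) (ℤP.*-zeroˡ (h 1)))))))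
      (q^⊠-low (ℓ ℕ.+ ℓ) (δ (tail (tail h)) ⊠ v) (suc ℓ) (ℕP.+-monoˡ-≤ ℓ 2≤ℓ)))
      (≡.trans (ℤP.+-identityʳ _) (≡.trans (≡.cong (λ z → + ℓ ℤ.* h (suc ℓ) ℤ.+ z) (ℤP.*-zeroʳ (tail h 0))) (ℤP.+-identityʳ _))))))
    where
    open 𝕊.Solver using (solve; _:=_; _:+_; _:*_)
    expand : k ⊠ v ≋ conPS (h 0) ⊠ v ⊞ conPS (tail h 0) ⊠ (q 𝕊.^ ℓ ⊠ v) ⊞ q 𝕊.^ (ℓ ℕ.+ ℓ) ⊠ (δ (tail (tail h)) ⊠ v)
    expand = 𝕊.trans (𝕊.*-congʳ (𝕊.trans (δ-unfold h) (𝕊.+-congˡ (𝕊.*-congˡ (δ-unfold (tail h))))))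
      (𝕊.trans (solve 5 (λ a b p d v → (a :+ p :* (b :+ p :* d)) :* v := a :* v :+ b :* (p :* v) :+ p :* p :* (d :* v)) 𝕊.refl (conPS (h 0)) (conPS (tail h 0)) (q 𝕊.^ ℓ) (δ (tail (tail h))) v)
        (𝕊.+-congˡ (𝕊.*-congʳ (𝕊.sym (𝕊.^-homo-* q ℓ ℓ)))))

  -- K is not a polynomial in J: the residue of K dJ is ℓ c_ℓ > 0.
  K-not-polynomial : ∀ η → ¬ (K₁ 𝕃.- univariate ℓ η J ≅ conᴸ (+ 0))
  K-not-polynomial η eq = ℤP.<⇒≢ (*-positive {+ ℓ} {Jq (suc ℓ)} (ℤ.+<+ {0} {ℓ} (s≤s z≤n)) (Jq-positive (suc ℓ))) (≡.sym (≡.trans (≡.sym residue)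
    (≡.trans (LaurentRing.CT-cong (𝕃.*-congʳ {θᴸ J} K≅)) (CT-univariate ℓ η J))))
    where
    open 𝕃.Solver using (solve; _:=_; _:+_; _:*_; _:-_; con)
    K≅ : K₁ ≅ univariate ℓ η J
    K≅ = LinearCombination.modulo₁ Laurent-algebra (conᴸ (+ 1)) eq (solve 2 (λ a b → a := b :+ con (+ 1) :* (a :- b :- con (+ 0))) 𝕃.refl K₁ (univariate ℓ η J))

  private
    ζη : (∃ λ ζ → ζ ℓ ≡ + 1 × Lead 0 (+ 0) (y 𝕃.- univariate ℓ ζ x)) × (∃ λ η → η ℓ ≡ + 1 × Lead 0 (+ 0) (K₁ 𝕃.- univariate ℓ η J))
    ζη = polar-part lead-x ℓ (+ 1) y lead-y , polar-part lead-J ℓ (+ 1) K₁ lead-K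

    ζ η : ℕ → ℤ
    ζ = proj₁ (proj₁ ζη)
    η = proj₁ (proj₂ ζη)

    -- Y - ζ(X) takes the values `w₁` at P₁ and `w₂` at P₂; X - η(Y) takes the value `w′` at P₁. The
    -- polynomials ζ and η are chosen so that `w₂` and `w′` are divisible by q, while `w₁` has a
    -- pole of order ℓ².
    w₁ w₂ w′ : Laurent
    w₁ = J 𝕃.- univariate ℓ ζ K₁
    w₂ = y 𝕃.- univariate ℓ ζ x
    w′ = K₁ 𝕃.- univariate ℓ η J

    lead-w₂ : Lead 0 (+ 0) w₂
    lead-w₂ = proj₂ (proj₂ (proj₁ ζη))

    lead-w′ : Lead 0 (+ 0) w′
    lead-w′ = proj₂ (proj₂ (proj₂ ζη))

    lead-w₁ : Lead (ℓ ℕ.* ℓ) (ℤ.- + 1) w₁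
    lead-w₁ = ≡.subst (λ c → Lead (ℓ ℕ.* ℓ) (+ 0 ℤ.- c) w₁) (proj₁ (proj₂ (proj₁ ζη)))
      (Lead-+ (Lead-weaken (ℓ ℕ.* ℓ) (ℕP.*-mono-≤ {2} {ℓ} {1} {ℓ} 2≤ℓ (s≤s z≤n)) lead-J) (Lead-neg (Lead-univariate ℓ ζ lead-K)))

    w₁≢0 : ¬ (w₁ ≅ conᴸ (+ 0))
    w₁≢0 eq = ℤP.<⇒≢ (ℤ.-<+ {0} {0}) (Lead-unique lead-w₁ (Lead-0 (ℓ ℕ.* ℓ) eq))

    eval-difference : ∀ s t e ζ f → eval s t (subT e (polynomialT ℓ ζ f)) ≅ eval s t e 𝕃.- univariate ℓ ζ (eval s t f)
    eval-difference s t e ζ f = 𝕃.trans (eval-subT s t e (polynomialT ℓ ζ f)) (𝕃.+-congˡ {eval s t e} (𝕃.-‿cong (eval-polynomialT s t ℓ ζ f)))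

    eval-power : ∀ s t e g n {z} → eval s t g ≅ z → eval s t (e ⊗ powT g n) ≅ eval s t e 𝕃.* z 𝕃.^ n
    eval-power s t e g n eq = 𝕃.*-congˡ {eval s t e} (𝕃.trans (𝕃.reflexive (eval-pow s t g n)) (𝕃.^-congˡ n eq))

    -- Otherwise the argument, with the two coordinates and the two places exchanged, would make K a polynomial in J.
    w₂≢0 : ¬ (w₂ ≅ conᴸ (+ 0))
    w₂≢0 w₂≅0 = w₁≢0 (Laurent-no-nilpotents (ℓ ℕ.* ℓ) (𝕃.trans (𝕃.sym at₂) zero₂) (K-not-polynomial η))
      where
      E W′ V : Term
      E  = subT X (polynomialT ℓ ζ Y)
      W′ = subT Y (polynomialT ℓ η X)
      -- The exponent is the pole order of `w₁`, so V has no pole at (J, K). It vanishes at (y, x)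
      -- because its factor E takes the value `w₂` there.
      V  = E ⊗ powT W′ (ℓ ℕ.* ℓ)
      at₁ : eval y x V ≅ conᴸ (+ 0)
      at₁ = 𝕃.trans (𝕃.*-congʳ {eval y x (powT W′ (ℓ ℕ.* ℓ))} (𝕃.trans (eval-difference y x X ζ Y) w₂≅0)) (𝕃.zeroˡ (eval y x (powT W′ (ℓ ℕ.* ℓ))))
      at₂ : eval J K₁ V ≅ w₁ 𝕃.* w′ 𝕃.^ (ℓ ℕ.* ℓ)
      at₂ = 𝕃.trans (eval-power J K₁ E W′ (ℓ ℕ.* ℓ) (eval-difference J K₁ Y η X)) (𝕃.*-congʳ {w′ 𝕃.^ (ℓ ℕ.* ℓ)} (eval-difference J K₁ X ζ Y))
      no-pole : ∃ λ b → Lead 0 b (w₁ 𝕃.* w′ 𝕃.^ (ℓ ℕ.* ℓ))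
      no-pole = Lead-^-zero lead-w₁ lead-w′
      zero₂ : eval J K₁ V ≅ conᴸ (+ 0)
      zero₂ = Vanishing.vanish ℓ 2≤ℓ (λ m n → a n m) y x J K₁ lead-y lead-x lead-J lead-K
        (OnCurve-swap ℓ a x y onCurve₂) (OnCurve-swap ℓ a K₁ J onCurve₁) {λ s t → eval s t V} (Reduction.Reducible-eval ℓ (λ m n → a n m) V) at₁
        {proj₁ no-pole} (Lead-cong (𝕃.sym at₂) (proj₂ no-pole))

  -- Multiplication by the p-th power of Y - ζ(X), p being a pole order of e at P₂, keeps the zero
  -- at P₁ and removes the pole at P₂. `Vanishing` then applies to the product, and the factor `w₂`
  -- is cancelled since it is not zero.
  transfer : ∀ e → eval K₁ J e ≅ conᴸ (+ 0) → eval x y e ≅ conᴸ (+ 0)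
  transfer e zero₁ = Laurent-no-nilpotents p (𝕃.trans (𝕃.sym at₂) zero₂) w₂≢0
    where
    p : ℕ
    p = pole (eval x y e)
    W V : Term
    W = subT Y (polynomialT ℓ ζ X)
    V = e ⊗ powT W p
    at₁ : eval K₁ J V ≅ conᴸ (+ 0)
    at₁ = 𝕃.trans (𝕃.*-congʳ {eval K₁ J (powT W p)} zero₁) (𝕃.zeroˡ (eval K₁ J (powT W p)))
    at₂ : eval x y V ≅ eval x y e 𝕃.* w₂ 𝕃.^ p
    at₂ = eval-power x y e W p (eval-difference x y Y ζ X)
    no-pole : ∃ λ b → Lead 0 b (eval x y e 𝕃.* w₂ 𝕃.^ p)
    no-pole = Lead-^-zero (Lead-pole (eval x y e)) lead-w₂
    zero₂ : eval x y V ≅ conᴸ (+ 0)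
    zero₂ = Vanishing.vanish ℓ 2≤ℓ a K₁ J x y lead-K lead-J lead-x lead-y onCurve₁ onCurve₂ {λ s t → eval s t V} (Reduction.Reducible-eval ℓ a V) at₁
      {proj₁ no-pole} (Lead-cong (𝕃.sym at₂) (proj₂ no-pole))

-- Two-term expansions and the coefficient A.

ℤ-dual : Operations (ℤ × ℤ)
ℤ-dual = dual (AlgebraOperations.operations ℤ-algebra)

module 𝔻 = Operations ℤ-dual

-- x = (a + bq + ⋯)/qᵖ
record Lead₂ (p : ℕ) (d : ℤ × ℤ) (x : Laurent) : Set where
  constructor lead₂
  field
    series    : PS
    expands   : Expansion p x series
    constant  : series 0 ≡ proj₁ d
    linear    : series 1 ≡ proj₂ d

module _ where
  open LaurentRing using (ι-cong; ι-*; ι-con; θᴸ-ι)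

  Lead₂-⊕ : ∀ {p d e x y} → Lead₂ p d x → Lead₂ p e y → Lead₂ p (d 𝔻.⊕ e) (x 𝕃.+ y)
  Lead₂-⊕ (lead₂ f e h₀ h₁) (lead₂ g e′ k₀ k₁) = lead₂ (f ⊞ g) (Expansion-+ e e′) (⊞-at h₀ k₀) (⊞-at h₁ k₁)

  Lead₂-⊙ : ∀ {p r d e x y} → Lead₂ p d x → Lead₂ r e y → Lead₂ (p ℕ.+ r) (d 𝔻.⊙ e) (x 𝕃.* y)
  Lead₂-⊙ (lead₂ f e h₀ h₁) (lead₂ g e′ k₀ k₁) = lead₂ (f ⊠ g) (Expansion-* e e′) (≡.trans (⊠-0 f g) (≡.cong₂ ℤ._*_ h₀ k₀))
    (≡.trans (⊠-1 f g) (≡.cong₂ ℤ._+_ (≡.cong₂ ℤ._*_ h₀ k₁) (≡.cong₂ ℤ._*_ h₁ k₀)))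

  Lead₂-κ : ∀ c → Lead₂ 0 (𝔻.κ c) (conᴸ c)
  Lead₂-κ c = lead₂ (conPS c) (expansion (𝕃.trans (𝕃.*-congʳ ι-1) (𝕃.trans (𝕃.*-identityˡ _) (𝕃.sym (ι-con c))))) ≡.refl ≡.refl

  Lead₂-⊖ : ∀ {p d e x y} → Lead₂ p d x → Lead₂ p e y → Lead₂ p (d 𝔻.⊖ e) (x 𝕃.+ conᴸ (ℤ.- + 1) 𝕃.* y)
  Lead₂-⊖ l m = Lead₂-⊕ l (Lead₂-⊙ (Lead₂-κ (ℤ.- + 1)) m)

  Lead₂-shift : ∀ {p a b x} → Lead₂ p (a , b) x → Lead₂ (suc p) (+ 0 , a) x
  Lead₂-shift {p} (lead₂ f (expansion e) h₀ h₁) = lead₂ (q 𝕊.^ 1 ⊠ f)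
    (expansion (𝕃.trans (𝕃.*-congʳ (qᴸ-+ 1 p)) (𝕃.trans (𝕃.*-assoc _ _ _) (𝕃.trans (𝕃.*-congˡ e) (𝕃.sym (ι-* (q 𝕊.^ 1) f))))))
    (q^⊠-low 1 f 0 (s≤s z≤n)) (≡.trans (q^⊠-high 1 f 0) h₀)

  -- θ multiplies q^(-p) by -p and q^(1-p) by 1 - p.
  Lead₂-θ : ∀ {p a b x} → Lead₂ p (a , b) x → Lead₂ p (ℤ.- + 1 ℤ.* (+ p ℤ.* a) , (+ 1 ℤ.+ ℤ.- + 1 ℤ.* + p) ℤ.* b) (θᴸ x)
  Lead₂-θ {p} {a} {b} {x} (lead₂ f (expansion e) h₀ h₁) = lead₂ (θ f 𝕊.- conPS (+ p) ⊠ f)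
    (expansion (LinearCombination.modulo₂ Laurent-algebra (conᴸ (+ 1)) (𝕃.- conᴸ (+ p)) derivative e
      (solve 6 (λ k z z′ F F′ c → k :* z′ := F′ :- c :* F :+ con (+ 1) :* (c :* k :* z :+ k :* z′ :- F′) :+ (:- c) :* (k :* z :- F)) 𝕃.refl (qᴸ p) x (θᴸ x) (ι f) (ι (θ f)) (conᴸ (+ p)))
      ⟨ 𝕃.trans ⟩ 𝕃.sym (𝕃.trans (ι-sub (θ f) (conPS (+ p) ⊠ f)) (𝕃.+-congˡ {ι (θ f)} (𝕃.-‿cong (𝕃.trans (ι-* (conPS (+ p)) f) (𝕃.*-congʳ {ι f} (ι-con (+ p)))))))))
    (≡.trans (coefficient 0) (≡.trans (≡.cong (λ z → + 0 ℤ.* z ℤ.- + p ℤ.* z) h₀) (ℤ-solver.solve 2 (λ p a → ℤ-solver.con (+ 0) ℤ-solver.:* a ℤ-solver.:- p ℤ-solver.:* a ℤ-solver.:= ℤ-solver.con (ℤ.- + 1) ℤ-solver.:* (p ℤ-solver.:* a)) ≡.refl (+ p) a)))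
    (≡.trans (coefficient 1) (≡.trans (≡.cong (λ z → + 1 ℤ.* z ℤ.- + p ℤ.* z) h₁) (ℤ-solver.solve 2 (λ p b → ℤ-solver.con (+ 1) ℤ-solver.:* b ℤ-solver.:- p ℤ-solver.:* b ℤ-solver.:= (ℤ-solver.con (+ 1) ℤ-solver.:+ ℤ-solver.con (ℤ.- + 1) ℤ-solver.:* p) ℤ-solver.:* b) ≡.refl (+ p) b)))
    where
    open 𝕃.Solver using (solve; _:=_; _:+_; _:*_; _:-_; :-_; con)
    coefficient : ∀ i → (θ f 𝕊.- conPS (+ p) ⊠ f) i ≡ + i ℤ.* f i ℤ.- + p ℤ.* f i
    coefficient i = ⊞-at (θ-coefficient f i) (≡.trans (⊟-coefficient (conPS (+ p) ⊠ f) i) (≡.cong ℤ.-_ (con-⊠ (+ p) f i)))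
    derivative : conᴸ (+ p) 𝕃.* qᴸ p 𝕃.* x 𝕃.+ qᴸ p 𝕃.* θᴸ x ≅ ι (θ f)
    derivative = 𝕃.trans (𝕃.+-congʳ {qᴸ p 𝕃.* θᴸ x} (𝕃.*-congʳ {x} (𝕃.sym (𝕃.trans (θᴸ-ι (q 𝕊.^ p)) (𝕃.trans (ι-cong (θ-q^ p)) (𝕃.trans (ι-* (conPS (+ p)) (q 𝕊.^ p)) (𝕃.*-congʳ {qᴸ p} (ι-con (+ p)))))))))
      (𝕃.trans (𝕃.sym (θ𝕃.∂-* (qᴸ p) x)) (𝕃.trans (θ𝕃.∂-cong e) (θᴸ-ι f)))

  Lead₂-zero : ∀ {p d x} → Lead₂ p d x → x ≅ conᴸ (+ 0) → proj₂ d ≡ + 0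
  Lead₂-zero (lead₂ f e h₀ h₁) eq = ≡.trans (≡.sym h₁) (≡.trans (at (zero-Expansion e eq) 1) (0PS-coefficient 1))

  Lead-Lead₂ : ∀ {p d x} → Lead₂ p d x → Lead p (proj₁ d) x
  Lead-Lead₂ (lead₂ f e h₀ h₁) = Expansion-Lead e h₀

module _ where
  private
    module SL = Schwarzian (AlgebraOperations.operations Laurent-algebra)
    module SD = Schwarzian ℤ-dual

  module _ {p : ℕ} {w z z₁ z₂ z₃ : Laurent} {w′ z′ z₁′ z₂′ z₃′ : ℤ × ℤ}
           (lw : Lead₂ p w′ w) (l : Lead₂ p z′ z) (l₁ : Lead₂ p z₁′ z₁) (l₂ : Lead₂ p z₂′ z₂) (l₃ : Lead₂ p z₃′ z₃) where
    private
      scaled : ∀ c {x d} → Lead₂ (p ℕ.+ p ℕ.+ p) d x → Lead₂ (p ℕ.+ p ℕ.+ p) (𝔻.κ c 𝔻.⊙ d) (conᴸ c 𝕃.* x)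
      scaled c = Lead₂-⊙ (Lead₂-κ c)

    Lead₂-N : Lead₂ (p ℕ.+ p ℕ.+ p) (SD.Nʷ w′ z′ z₁′) (SL.Nʷ w z z₁)
    Lead₂-N = Lead₂-⊙ (Lead₂-⊙ l l₁) lw

    Lead₂-F : Lead₂ (p ℕ.+ p ℕ.+ p ℕ.+ (p ℕ.+ p ℕ.+ p)) (SD.Fʷ w′ z′ z₁′ z₂′ z₃′) (SL.Fʷ w z z₁ z₂ z₃)
    Lead₂-F = Lead₂-⊕ (Lead₂-⊖ (Lead₂-⊙ (Lead₂-κ (+ 12)) (Lead₂-⊖ (Lead₂-⊙ M′ Lead₂-N) (Lead₂-⊙ M N′))) (Lead₂-⊙ M M))
      (≡.subst (λ r → Lead₂ r (z₁′ 𝔻.⊙ z₁′ 𝔻.⊙ z₁′ 𝔻.⊙ z₁′ 𝔻.⊙ (z′ 𝔻.⊙ w′)) (z₁ 𝕃.* z₁ 𝕃.* z₁ 𝕃.* z₁ 𝕃.* (z 𝕃.* w)))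
        (≡.trans (ℕP.+-assoc (p ℕ.+ p ℕ.+ p) p (p ℕ.+ p)) (≡.cong (p ℕ.+ p ℕ.+ p ℕ.+_) (≡.sym (ℕP.+-assoc p p p))))
        (Lead₂-⊙ (Lead₂-⊙ (Lead₂-⊙ (Lead₂-⊙ l₁ l₁) l₁) l₁) (Lead₂-⊙ l lw)))
      where
      M : Lead₂ (p ℕ.+ p ℕ.+ p) (SD.Mʷ w′ z′ z₁′ z₂′) (SL.Mʷ w z z₁ z₂)
      M = Lead₂-⊖ (Lead₂-⊖ (scaled (+ 6) (Lead₂-⊙ (Lead₂-⊙ l l₂) lw)) (scaled (+ 4) (Lead₂-⊙ (Lead₂-⊙ l₁ l₁) lw))) (scaled (+ 3) (Lead₂-⊙ (Lead₂-⊙ l₁ l₁) l))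
      N′ : Lead₂ (p ℕ.+ p ℕ.+ p) (SD.N′ʷ w′ z′ z₁′ z₂′) (SL.N′ʷ w z z₁ z₂)
      N′ = Lead₂-⊕ (Lead₂-⊕ (Lead₂-⊙ (Lead₂-⊙ l₁ l₁) lw) (Lead₂-⊙ (Lead₂-⊙ l l₂) lw)) (Lead₂-⊙ (Lead₂-⊙ l l₁) l₁)
      M′ : Lead₂ (p ℕ.+ p ℕ.+ p) (SD.M′ʷ w′ z′ z₁′ z₂′ z₃′) (SL.M′ʷ w z z₁ z₂ z₃)
      M′ = Lead₂-⊖ (Lead₂-⊖ (scaled (+ 6) (Lead₂-⊙ (Lead₂-⊙ l l₃) lw)) (scaled (+ 2) (Lead₂-⊙ (Lead₂-⊙ l₁ l₂) lw))) (scaled (+ 7) (Lead₂-⊙ (Lead₂-⊙ l₁ l₁) l₁))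

  -- Writing the pole order of y as r + 2 builds in ℓ ≥ 2, which makes the constant 1728 invisible
  -- in the two leading coefficients of y - 1728.
  Lead₂-Σ : ∀ {r b x y} → Lead₂ 1 (+ 1 , + 0) x → Lead₂ (suc (suc r)) (+ 1 , b) y →
    ∃ λ p → Lead₂ p (Leading.leadingΣ (AlgebraOperations.operations ℤ-algebra) (+ suc (suc r)) b)
      (SL.Σ₂ x (θᴸ x) (θᴸ (θᴸ x)) (θᴸ (θᴸ (θᴸ x))) y (θᴸ y) (θᴸ (θᴸ y)) (θᴸ (θᴸ (θᴸ y))))
  Lead₂-Σ {r} {b} {x} {y} lx ly = s ℕ.+ t , Lead₂-⊖ (Lead₂-⊙ (Lead₂-F lwx lx lx₁ lx₂ lx₃) (Lead₂-⊙ Ny Ny))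
      (≡.subst (λ p → Lead₂ p (Leading.Fʸ (AlgebraOperations.operations ℤ-algebra) (+ suc (suc r)) b 𝔻.⊙ (Leading.Nˣ (AlgebraOperations.operations ℤ-algebra) (+ suc (suc r)) b 𝔻.⊙ Leading.Nˣ (AlgebraOperations.operations ℤ-algebra) (+ suc (suc r)) b))
          (SL.F y (θᴸ y) (θᴸ (θᴸ y)) (θᴸ (θᴸ (θᴸ y))) 𝕃.* (SL.N x (θᴸ x) 𝕃.* SL.N x (θᴸ x)))) (ℕP.+-comm t s)
        (Lead₂-⊙ (Lead₂-F lwy ly ly₁ ly₂ ly₃) (Lead₂-⊙ Nx Nx)))
    where
    ℓ s t : ℕ
    ℓ = suc (suc r)
    s = 1 ℕ.+ 1 ℕ.+ 1 ℕ.+ (1 ℕ.+ 1 ℕ.+ 1)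
    t = ℓ ℕ.+ ℓ ℕ.+ ℓ ℕ.+ (ℓ ℕ.+ ℓ ℕ.+ ℓ)
    c : Laurent
    c = conᴸ (+ 1728)
    lwx : Lead₂ 1 (+ 1 , ℤ.- + 1728) (x 𝕃.+ conᴸ (ℤ.- + 1) 𝕃.* c)
    lwx = Lead₂-⊖ lx (Lead₂-shift (Lead₂-κ (+ 1728)))
    high : ∀ r → Lead₂ (suc (suc r)) (+ 0 , + 0) c
    high zero    = Lead₂-shift (Lead₂-shift (Lead₂-κ (+ 1728)))
    high (suc r) = Lead₂-shift (high r)
    lwy : Lead₂ ℓ (+ 1 , b) (y 𝕃.+ conᴸ (ℤ.- + 1) 𝕃.* c)
    lwy = ≡.subst (λ b → Lead₂ ℓ (+ 1 , b) (y 𝕃.+ conᴸ (ℤ.- + 1) 𝕃.* c)) (ℤP.+-identityʳ b) (Lead₂-⊖ ly (high r))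
    lx₁ = Lead₂-θ lx
    lx₂ = Lead₂-θ lx₁
    lx₃ = Lead₂-θ lx₂
    ly₁ = Lead₂-θ ly
    ly₂ = Lead₂-θ ly₁
    ly₃ = Lead₂-θ ly₂
    Nx = Lead₂-N lwx lx lx₁ lx₂ lx₃
    Ny = Lead₂-N lwy ly ly₁ ly₂ ly₃

curve : ℕ → (ℕ → ℕ → ℤ) → Term
curve ℓ a = powT X (suc ℓ) ⊕ powT Y (suc ℓ) ⊕ ∑T (suc ℓ) (λ m → ∑T (suc ℓ) (λ n → κ (a m n) ⊗ (powT X m ⊗ powT Y n)))

eval-curve : ∀ ℓ a x y → OnCurve ℓ a x y → eval x y (curve ℓ a) ≅ conᴸ (+ 0)
eval-curve ℓ a x y c = 𝕃.trans (𝕃.+-cong (𝕃.+-cong (𝕃.reflexive (eval-pow x y X (suc ℓ))) (𝕃.reflexive (eval-pow x y Y (suc ℓ)))) double) c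
  where
  cell : ℕ → ℕ → Term
  cell m n = κ (a m n) ⊗ (powT X m ⊗ powT Y n)
  double : eval x y (∑T (suc ℓ) (λ m → ∑T (suc ℓ) (cell m))) ≅ polynomial (suc ℓ) (suc ℓ) a x y
  double = 𝕃.trans (𝕃.reflexive (eval-∑ x y (suc ℓ) (λ m → ∑T (suc ℓ) (cell m)))) (∑𝕃.∑-cong (suc ℓ)
    {λ m → eval x y (∑T (suc ℓ) (cell m))} {λ m → ∑𝕃.∑ (suc ℓ) (λ n → conᴸ (a m n) 𝕃.* monomial m n x y)}
    (λ m _ → 𝕃.trans (𝕃.reflexive (eval-∑ x y (suc ℓ) (cell m))) (∑𝕃.∑-cong (suc ℓ)
      {λ n → eval x y (cell m n)} {λ n → conᴸ (a m n) 𝕃.* monomial m n x y}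
      (λ n _ → 𝕃.*-congˡ {conᴸ (a m n)} (𝕃.*-cong (𝕃.reflexive (eval-pow x y X m)) (𝕃.reflexive (eval-pow x y Y n)))))))

module _ (x y : Laurent) where
  open 𝕃.Solver using (solve; _:=_; _:+_; _:*_; con)

  ∂Y-powX : ∀ n → eval x y (∂Y (powT X n)) ≅ conᴸ (+ 0)
  ∂Y-powX zero    = 𝕃.refl
  ∂Y-powX (suc n) = 𝕃.trans (𝕃.+-congˡ {conᴸ (+ 0) 𝕃.* eval x y (powT X n)} (𝕃.*-congˡ {x} (∂Y-powX n)))
    (solve 2 (λ p x → con (+ 0) :* p :+ x :* con (+ 0) := con (+ 0)) 𝕃.refl (eval x y (powT X n)) x)

  ∂Y-powY : ∀ n → eval x y (∂Y (powT Y (suc n))) ≅ conᴸ (+ suc n) 𝕃.* y 𝕃.^ n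
  ∂Y-powY zero    = solve 1 (λ y → con (+ 1) :* con (+ 1) :+ y :* con (+ 0) := con (+ 1) :* con (+ 1)) 𝕃.refl y
  ∂Y-powY (suc n) = 𝕃.trans (𝕃.+-cong (𝕃.*-congˡ {conᴸ (+ 1)} (𝕃.reflexive (eval-pow x y Y (suc n)))) (𝕃.*-congˡ {y} (∂Y-powY n)))
    (𝕃.trans (solve 3 (λ y p c → con (+ 1) :* (y :* p) :+ y :* (c :* p) := (con (+ 1) :+ c) :* (y :* p)) 𝕃.refl y (y 𝕃.^ n) (conᴸ (+ suc n)))
      (𝕃.*-congʳ {y 𝕃.^ suc n} (𝕃.sym (𝕃.con-+ (+ 1) (+ suc n)))))

  ∂Y-cell : ∀ c m n → eval x y (∂Y (κ c ⊗ (powT X m ⊗ powT Y n))) ≅ conᴸ c 𝕃.* (x 𝕃.^ m 𝕃.* eval x y (∂Y (powT Y n)))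
  ∂Y-cell c m n = 𝕃.trans (𝕃.+-congˡ {conᴸ (+ 0) 𝕃.* eval x y (powT X m ⊗ powT Y n)} (𝕃.*-congˡ {conᴸ c} (𝕃.+-cong
      (𝕃.*-congʳ {eval x y (powT Y n)} (∂Y-powX m)) (𝕃.*-congʳ {eval x y (∂Y (powT Y n))} (𝕃.reflexive (eval-pow x y X m))))))
    (solve 5 (λ u c p m d → con (+ 0) :* u :+ c :* (con (+ 0) :* p :+ m :* d) := c :* (m :* d)) 𝕃.refl
      (eval x y (powT X m ⊗ powT Y n)) (conᴸ c) (eval x y (powT Y n)) (x 𝕃.^ m) (eval x y (∂Y (powT Y n))))

  ∂Y-∑ : ∀ n f → eval x y (∂Y (∑T n f)) ≡ ∑𝕃.∑ n (λ i → eval x y (∂Y (f i)))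
  ∂Y-∑ zero    f = ≡.refl
  ∂Y-∑ (suc n) f = ≡.cong (𝕃._+ eval x y (∂Y (f n))) (∂Y-∑ n f)

-- Φ_Y does not vanish at the second place: its leading coefficient is (ℓ + 1) - ℓ.
module CurveSlope (ℓ′ : ℕ) (a : ℕ → ℕ → ℤ) (a-ℓℓ : a (suc ℓ′) (suc ℓ′) ≡ ℤ.- + 1) (x y : Laurent)
  (lx : Lead 1 (+ 1) x) (ly : Lead (suc ℓ′) (+ 1) y) where
  ℓ : ℕ
  ℓ = suc ℓ′

  private
    p : ℕ
    p = ℓ ℕ.* ℓ

    cellT : ℕ → ℕ → Term
    cellT m n = κ (a m n) ⊗ (powT X m ⊗ powT Y n)

    raw : ∀ m n → Lead (m ℕ.+ n ℕ.* ℓ) (a m (suc n) ℤ.* (+ 1 ℤ.* (+ suc n ℤ.* + 1))) (eval x y (∂Y (cellT m (suc n))))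
    raw m n = Lead-cong (𝕃.sym (𝕃.trans (∂Y-cell x y (a m (suc n)) m (suc n)) (𝕃.*-congˡ {conᴸ (a m (suc n))} (𝕃.*-congˡ {x 𝕃.^ m} (∂Y-powY x y n)))))
      (Lead-* (Lead-con (a m (suc n))) (Lead-* (≡.subst (λ r → Lead r (+ 1) (x 𝕃.^ m)) (ℕP.*-identityʳ m) (Lead-^ m lx)) (Lead-* (Lead-con (+ suc n)) (Lead-^ n ly))))

    cell-lead : ∀ m n → m ≤ ℓ → n ≤ ℓ → Lead p (cells ℓ ℓ (ℤ.- + ℓ) m n) (eval x y (∂Y (cellT m n)))
    cell-lead m n m≤ℓ n≤ℓ = go n n≤ℓ (m ℕP.≟ ℓ) (n ℕP.≟ ℓ)
      where
      off : ∀ n → (m ≢ ℓ) ⊎ (n ≢ ℓ) → cells ℓ ℓ (ℤ.- + ℓ) m n ≡ + 0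
      off n ne with m ℕP.≟ ℓ | n ℕP.≟ ℓ
      off n (inj₁ ne) | yes eq | yes _  = contradiction eq ne
      off n (inj₂ ne) | yes _  | yes eq = contradiction eq ne
      ... | yes _ | no _  = ≡.refl
      ... | no _  | yes _ = ≡.refl
      ... | no _  | no _  = ≡.refl
      on : ∀ m n → m ≡ ℓ → n ≡ ℓ → cells ℓ ℓ (ℤ.- + ℓ) m n ≡ ℤ.- + ℓ
      on m n eq eq′ with m ℕP.≟ ℓ | n ℕP.≟ ℓ
      ... | yes _ | yes _ = ≡.refl
      ... | yes _ | no ne = contradiction eq′ ne
      ... | no ne | _     = contradiction eq ne
      zero-lead : ∀ n → (m ≢ ℓ) ⊎ (n ≢ ℓ) → Lead p (+ 0) (eval x y (∂Y (cellT m n))) → Lead p (cells ℓ ℓ (ℤ.- + ℓ) m n) (eval x y (∂Y (cellT m n)))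
      zero-lead n ne = ≡.subst (λ c → Lead p c (eval x y (∂Y (cellT m n)))) (≡.sym (off n ne))
      go : ∀ n → n ≤ ℓ → Dec (m ≡ ℓ) → Dec (n ≡ ℓ) → Lead p (cells ℓ ℓ (ℤ.- + ℓ) m n) (eval x y (∂Y (cellT m n)))
      go zero    _   _        _        = zero-lead 0 (inj₂ λ ()) (Lead-0 p (𝕃.trans (∂Y-cell x y (a m 0) m 0)
        (𝕃.trans (𝕃.*-congˡ {conᴸ (a m 0)} (𝕃.zeroʳ (x 𝕃.^ m))) (𝕃.zeroʳ (conᴸ (a m 0))))))
      go (suc n) n≤ℓ (yes eq) (yes eq′) = ≡.subst (λ c → Lead p c (eval x y (∂Y (cellT m (suc n))))) value
        (≡.subst (λ r → Lead r (a m (suc n) ℤ.* (+ 1 ℤ.* (+ suc n ℤ.* + 1))) (eval x y (∂Y (cellT m (suc n)))))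
          (≡.cong₂ (λ i j → i ℕ.+ j ℕ.* ℓ) eq (ℕP.suc-injective eq′)) (raw m n))
        where
        value : a m (suc n) ℤ.* (+ 1 ℤ.* (+ suc n ℤ.* + 1)) ≡ cells ℓ ℓ (ℤ.- + ℓ) m (suc n)
        value = ≡.trans (≡.cong₂ ℤ._*_ (≡.trans (≡.cong₂ a eq eq′) a-ℓℓ) (≡.cong (λ j → + 1 ℤ.* (+ j ℤ.* + 1)) eq′))
          (≡.trans (ℤ-solver.solve 1 (λ l → ℤ-solver.con (ℤ.- + 1) ℤ-solver.:* (ℤ-solver.con (+ 1) ℤ-solver.:* (l ℤ-solver.:* ℤ-solver.con (+ 1))) ℤ-solver.:= ℤ-solver.:- l) ≡.refl (+ ℓ)) (≡.sym (on m (suc n) eq eq′)))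
      go (suc n) n≤ℓ (yes eq) (no ne) = zero-lead (suc n) (inj₂ ne) (Lead-weaken p
        (ℕP.<-≤-trans (ℕP.+-monoʳ-< m (ℕP.*-monoˡ-< ℓ {n} {ℓ′} (ℕP.≤-pred (ℕP.≤∧≢⇒< n≤ℓ ne)))) (ℕP.+-monoˡ-≤ (ℓ′ ℕ.* ℓ) m≤ℓ)) (raw m n))
      go (suc n) n≤ℓ (no ne) _ = zero-lead (suc n) (inj₁ ne) (Lead-weaken p
        (ℕP.<-≤-trans (ℕP.+-monoˡ-< (n ℕ.* ℓ) (ℕP.≤∧≢⇒< m≤ℓ ne)) (ℕP.+-monoʳ-≤ ℓ (ℕP.*-monoˡ-≤ ℓ {n} {ℓ′} (ℕP.≤-pred n≤ℓ)))) (raw m n))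

    total : Lead p (ℤ.- + ℓ) (eval x y (∂Y (∑T (suc ℓ) (λ m → ∑T (suc ℓ) (cellT m)))))
    total = Lead-cong (𝕃.sym (𝕃.trans (𝕃.reflexive (∂Y-∑ x y (suc ℓ) (λ m → ∑T (suc ℓ) (cellT m)))) (∑𝕃.∑-cong (suc ℓ)
        {λ m → eval x y (∂Y (∑T (suc ℓ) (cellT m)))} {λ m → ∑𝕃.∑ (suc ℓ) (λ n → eval x y (∂Y (cellT m n)))} (λ m _ → 𝕃.reflexive (∂Y-∑ x y (suc ℓ) (cellT m))))))
      (≡.subst (λ c → Lead p c (∑𝕃.∑ (suc ℓ) (λ m → ∑𝕃.∑ (suc ℓ) (λ n → eval x y (∂Y (cellT m n))))))
        (cells-sum {suc ℓ} {suc ℓ} {ℓ} {ℓ} (ℤ.- + ℓ) ℕP.≤-refl ℕP.≤-refl)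
        (Lead-∑ p (suc ℓ) (λ m → ∑ℤ (suc ℓ) (cells ℓ ℓ (ℤ.- + ℓ) m)) (λ m → ∑𝕃.∑ (suc ℓ) (λ n → eval x y (∂Y (cellT m n))))
          (λ { m (s≤s m≤ℓ) → Lead-∑ p (suc ℓ) (cells ℓ ℓ (ℤ.- + ℓ) m) (λ n → eval x y (∂Y (cellT m n))) (λ { n (s≤s n≤ℓ) → cell-lead m n m≤ℓ n≤ℓ }) })))

  slope : Lead p (+ 0 ℤ.+ + suc ℓ ℤ.* + 1 ℤ.+ ℤ.- + ℓ) (eval x y (∂Y (curve ℓ a)))
  slope = Lead-+ (Lead-+ (Lead-0 p (∂Y-powX x y (suc ℓ))) (Lead-cong (𝕃.sym (∂Y-powY x y ℓ)) (Lead-* (Lead-con (+ suc ℓ)) (Lead-^ ℓ ly)))) total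

  slope≢0 : ¬ (eval x y (∂Y (curve ℓ a)) ≅ conᴸ (+ 0))
  slope≢0 eq = ℤP.<⇒≢ (ℤ.+<+ {0} {1} (s≤s z≤n)) (≡.trans (≡.sym (Lead-unique slope (Lead-0 p eq)))
    (ℤ-solver.solve 1 (λ l → ℤ-solver.con (+ 0) ℤ-solver.:+ (ℤ-solver.con (+ 1) ℤ-solver.:+ l) ℤ-solver.:* ℤ-solver.con (+ 1) ℤ-solver.:+ ℤ-solver.:- l ℤ-solver.:= ℤ-solver.con (+ 1)) ≡.refl (+ ℓ)))

opaque
  -- Opaque, so that the large dual-number expression is compared with its closed form once and
  -- never unfolded afterwards.
  leadingTerm : ℤ → ℤ → ℤ
  leadingTerm l b = proj₂ (Leading.leadingΣ (AlgebraOperations.operations ℤ-algebra) l b)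

  leadingTerm≡ : ∀ l b → leadingTerm l b ≡ + 72 ℤ.* l ℤ.* (+ 744 ℤ.* l ℤ.+ b)
  leadingTerm≡ = LeadingValue.leadingΣ≈ ℤ-algebra

  leadingTerm-zero : ∀ r b x y → Lead₂ 1 (+ 1 , + 0) x → Lead₂ (suc (suc r)) (+ 1 , b) y →
    SchwarzianOf.Σ₂ x (θᴸ x) (θᴸ (θᴸ x)) (θᴸ (θᴸ (θᴸ x))) y (θᴸ y) (θᴸ (θᴸ y)) (θᴸ (θᴸ (θᴸ y))) ≅ conᴸ (+ 0) → leadingTerm (+ suc (suc r)) b ≡ + 0
  leadingTerm-zero r b x y lx ly eq = Lead₂-zero (proj₂ (Lead₂-Σ {r} {b} {x} {y} lx ly)) eq

module NearCorner (ℓ′ : ℕ) (2≤ℓ′ : 2 ≤ ℓ′) (a : ℕ → ℕ → ℤ) (modular : IsModularPolynomial (suc ℓ′) a) where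
  open Places ℓ′ 2≤ℓ′ a modular

  private
    Φ : Term
    Φ = curve ℓ a

    S₁ : Term
    S₁ = invariant Φ

    sixth-power : ∀ {μ z} → ¬ (μ ≅ conᴸ (+ 0)) → μ 𝕃.* μ 𝕃.* μ 𝕃.* μ 𝕃.* μ 𝕃.* μ 𝕃.* z ≅ conᴸ (+ 0) → z ≅ conᴸ (+ 0)
    sixth-power {μ} {z} μ≢0 eq = Laurent-no-nilpotents {z} {μ} 6
      (𝕃.trans (solve 2 (λ m z → z :* (m :* (m :* (m :* (m :* (m :* (m :* con (+ 1))))))) := m :* m :* m :* m :* m :* m :* z) 𝕃.refl μ z) eq) μ≢0
      where open 𝕃.Solver using (solve; _:=_; _:*_; con)

    θK≢0 : ¬ (θᴸ K₁ ≅ conᴸ (+ 0))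
    θK≢0 eq = ℤP.<⇒≢ (ℤ.-<+ {ℓ′} {0}) (≡.trans (ℤ-solver.solve 1 (λ l → ℤ-solver.:- l ℤ-solver.:= ℤ-solver.con (ℤ.- + 1) ℤ-solver.:* (l ℤ-solver.:* ℤ-solver.con (+ 1))) ≡.refl (+ ℓ))
      (Lead-unique (Lead-Lead₂ (Lead₂-θ (lead₂ k expansion-K k-0 ≡.refl))) (Lead-0 ℓ eq)))

    Σ-at-P₁ : SchwarzianOf.Σ₂ K₁ (θᴸ K₁) (θᴸ (θᴸ K₁)) (θᴸ (θᴸ (θᴸ K₁))) J (θᴸ J) (θᴸ (θᴸ J)) (θᴸ (θᴸ (θᴸ J))) ≅ conᴸ (+ 0)
    Σ-at-P₁ = 𝕃.trans (𝕃.+-cong (𝕃.*-congʳ {n₁ 𝕃.* n₁} (K-equation ℓ′)) (𝕃.*-congˡ {conᴸ (ℤ.- + 1)} (𝕃.*-congʳ {n₂ 𝕃.* n₂} J-equation)))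
      (solve 2 (λ a b → con (+ 0) :* a :+ con (ℤ.- + 1) :* (con (+ 0) :* b) := con (+ 0)) 𝕃.refl (n₁ 𝕃.* n₁) (n₂ 𝕃.* n₂))
      where
      open 𝕃.Solver using (solve; _:=_; _:+_; _:*_; con)
      n₁ n₂ : Laurent
      n₁ = SchwarzianOf.N J (θᴸ J)
      n₂ = SchwarzianOf.N K₁ (θᴸ K₁)

    -- At (K, J) both third-order equations hold, so Σ for θ is zero. In `Σ₂-tangent` the factor to
    -- be cancelled is the sixth power of θK.
    S₁-at-P₁ : eval K₁ J S₁ ≅ conᴸ (+ 0)
    S₁-at-P₁ = sixth-power θK≢0 (𝕃.trans (𝕃.sym (CurveDerivation.Σ₂-tangent Laurent-differential K₁ J Φ (eval-curve ℓ a K₁ J onCurve₁)))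
      (𝕃.trans (𝕃.*-congˡ {μ 𝕃.* μ 𝕃.* μ 𝕃.* μ 𝕃.* μ 𝕃.* μ} Σ-at-P₁) (𝕃.zeroʳ (μ 𝕃.* μ 𝕃.* μ 𝕃.* μ 𝕃.* μ 𝕃.* μ))))
      where
      μ : Laurent
      μ = eval K₁ J (∂Y Φ)

    -- The same relation is now read in the other direction, from the polynomial back to Σ for θ.
    -- Here the factor to be cancelled is the sixth power of Φ_Y, hence the computation of its
    -- leading coefficient.
    Σ-at-P₂ : SchwarzianOf.Σ₂ x (θᴸ x) (θᴸ (θᴸ x)) (θᴸ (θᴸ (θᴸ x))) y (θᴸ y) (θᴸ (θᴸ y)) (θᴸ (θᴸ (θᴸ y))) ≅ conᴸ (+ 0)
    Σ-at-P₂ = sixth-power (CurveSlope.slope≢0 ℓ′ a (Lagrange.a-ℓℓ ℓ′ 2≤ℓ′ a modular) x y lead-x lead-y)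
      (𝕃.trans (CurveDerivation.Σ₂-tangent Laurent-differential x y Φ (eval-curve ℓ a x y onCurve₂))
        (𝕃.trans (𝕃.*-congˡ {ν 𝕃.* ν 𝕃.* ν 𝕃.* ν 𝕃.* ν 𝕃.* ν} (transfer S₁ S₁-at-P₁)) (𝕃.zeroʳ (ν 𝕃.* ν 𝕃.* ν 𝕃.* ν 𝕃.* ν 𝕃.* ν))))
      where
      ν : Laurent
      ν = θᴸ x

  near-corner : a ℓ′ ℓ ≡ + 744 ℤ.* + ℓ
  near-corner = finish (≡.trans (≡.sym (leadingTerm≡ (+ ℓ) b)) (leading ℓ′ ≡.refl))
    where
    b : ℤ
    b = ℤ.- a ℓ′ ℓ
    -- The predecessor ℓ′ is replaced by a variable so that matching can exhibit ℓ as r + 2.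
    leading : ∀ m → ℓ′ ≡ m → leadingTerm (+ ℓ) b ≡ + 0
    leading zero    eq = contradiction (≡.subst (2 ≤_) eq 2≤ℓ′) λ ()
    leading (suc r) eq = ≡.trans (≡.cong (λ l → leadingTerm (+ suc l) b) eq)
      (leadingTerm-zero r b x y (lead₂ onePS (expansion (LaurentRing.clear-/ onePS 1)) ≡.refl ≡.refl)
        (≡.subst (λ l → Lead₂ (suc l) (+ 1 , b) y) eq (lead₂ γ (expansion (LaurentRing.clear-/ γ ℓ)) γ-0 γ-1)) Σ-at-P₂)
    finish : + 72 ℤ.* + ℓ ℤ.* (+ 744 ℤ.* + ℓ ℤ.+ b) ≡ + 0 → a ℓ′ ℓ ≡ + 744 ℤ.* + ℓ
    finish eq = case ℤP.i*j≡0⇒i≡0∨j≡0 (+ 72 ℤ.* + ℓ) eq of λ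
      { (inj₁ ℓ≡0) → contradiction ℓ≡0 (λ eq′ → ℤP.<⇒≢ (*-positive {+ 72} {+ ℓ} (ℤ.+<+ (s≤s z≤n)) (ℤ.+<+ (s≤s z≤n))) (≡.sym eq′))
      ; (inj₂ sum≡0) → ≡.sym (ℤP.i-j≡0⇒i≡j (+ 744 ℤ.* + ℓ) (a ℓ′ ℓ) sum≡0) }

-- Binomial and multinomial expansions.

module _ where
  open 𝕊
  open 𝕊.Solver using (solve; _:=_; _:+_; _:*_)

  binomialSum : PS → PS → ℕ → ℕ → PS
  binomialSum x y s N = ∑𝕊.∑ N (λ k → conPS (+ (s C k)) * (x ^ k * y ^ (s ∸ k)))

  private
    con-zero : ∀ {c} f → c ≡ 0 → conPS (+ c) * f ≈ 0#
    con-zero f ≡.refl = trans (*-congʳ con-0) (zeroˡ f)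

  -- Any N above s may bound the sum, because the further binomial coefficients vanish. In the
  -- Pascal step the bounds for the x-part and the y-part differ by one, which this freedom absorbs.
  binomial : ∀ x y s N → s < N → (x ⊞ y) ^ s ≈ binomialSum x y s N
  binomial x y zero (suc N) _ = sym (trans (∑𝕊.∑-head N (λ k → conPS (+ (0 C k)) * (x ^ k * y ^ (0 ∸ k)))) (trans (+-cong
      (trans (*-congʳ con-1) (trans (*-identityˡ (x ^ 0 * y ^ 0)) (*-identityˡ 1#)))
      (∑𝕊.∑-0 N (λ k _ → con-zero (x ^ suc k * y ^ 0) (k>n⇒nCk≡0 {0} {suc k} (s≤s z≤n))))) (+-identityʳ 1#)))
  binomial x y (suc s) (suc N) (s≤s s<N) = sym (begin
    binomialSum x y (suc s) (suc N)
      ≈⟨ ∑𝕊.∑-head N (λ k → conPS (+ (suc s C k)) * (x ^ k * y ^ (suc s ∸ k))) ⟩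
    conPS (+ 1) * (x ^ 0 * y ^ suc s) + ∑𝕊.∑ N (λ k → conPS (+ (suc s C suc k)) * (x ^ suc k * y ^ (s ∸ k)))
      ≈⟨ +-congˡ (trans (∑𝕊.∑-cong N (λ k _ → pascal k)) (∑𝕊.∑-+ N (λ k → x * term k) (λ k → y * term (suc k)))) ⟩
    conPS (+ 1) * (x ^ 0 * y ^ suc s) + (∑𝕊.∑ N (λ k → x * term k) + ∑𝕊.∑ N (λ k → y * term (suc k)))
      ≈⟨ solve 6 (λ c o y z a b → c :* (o :* (y :* z)) :+ (a :+ b) := a :+ (y :* (c :* (o :* z)) :+ b)) refl
          (conPS (+ 1)) (x ^ 0) y (y ^ s) (∑𝕊.∑ N (λ k → x * term k)) (∑𝕊.∑ N (λ k → y * term (suc k))) ⟩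
    ∑𝕊.∑ N (λ k → x * term k) + (y * term 0 + ∑𝕊.∑ N (λ k → y * term (suc k)))
      ≈⟨ +-congˡ (sym (∑𝕊.∑-head N (λ k → y * term k))) ⟩
    ∑𝕊.∑ N (λ k → x * term k) + ∑𝕊.∑ (suc N) (λ k → y * term k)
      ≈⟨ +-cong (sym (∑𝕊.*-∑ N x term)) (sym (∑𝕊.*-∑ (suc N) y term)) ⟩
    x * binomialSum x y s N + y * binomialSum x y s (suc N)
      ≈⟨ +-cong (*-congˡ (sym (binomial x y s N s<N))) (*-congˡ (sym (binomial x y s (suc N) (ℕP.m<n⇒m<1+n s<N)))) ⟩
    x * (x ⊞ y) ^ s + y * (x ⊞ y) ^ s
      ≈⟨ distribʳ ((x ⊞ y) ^ s) x y ⟨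
    (x ⊞ y) ^ suc s ∎)
    where
    open 𝕊.≈-Reasoning
    term : ℕ → PS
    term k = conPS (+ (s C k)) * (x ^ k * y ^ (s ∸ k))
    second : ∀ k → conPS (+ (s C suc k)) * (x ^ suc k * y ^ (s ∸ k)) ≈ y * term (suc k)
    second k = case k ℕP.<? s of λ
      { (yes k<s) → trans (*-congˡ (*-congˡ (reflexive (≡.cong (y ^_) (≡.trans (≡.sym (≡.cong (_∸ k) (ℕP.m∸n+n≡m {s} {1} (ℕP.≤-trans (s≤s z≤n) k<s)))) (lemma k s k<s))))))
          (solve 4 (λ c x y z → c :* (x :* (y :* z)) := y :* (c :* (x :* z))) refl (conPS (+ (s C suc k))) (x ^ suc k) y (y ^ (s ∸ suc k)))
      ; (no k≮s) → trans (con-zero (x ^ suc k * y ^ (s ∸ k)) (k>n⇒nCk≡0 (s≤s (ℕP.≮⇒≥ k≮s))))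
          (sym (trans (*-congˡ (con-zero (x ^ suc k * y ^ (s ∸ suc k)) (k>n⇒nCk≡0 (s≤s (ℕP.≮⇒≥ k≮s))))) (zeroʳ y))) }
      where
      lemma : ∀ k s → k < s → (s ∸ 1 ℕ.+ 1) ∸ k ≡ suc (s ∸ suc k)
      lemma k (suc s) (s≤s k≤s) = ≡.trans (≡.cong (_∸ k) (ℕP.+-comm s 1)) (ℕP.+-∸-assoc 1 k≤s)
    pascal : ∀ k → conPS (+ (suc s C suc k)) * (x ^ suc k * y ^ (s ∸ k)) ≈ x * term k + y * term (suc k)
    pascal k = trans (*-congʳ (trans (reflexive (≡.cong (λ c → conPS (+ c)) (≡.sym (nCk+nC[k+1]≡[n+1]C[k+1] s k)))) (con-+ (+ (s C k)) (+ (s C suc k)))))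
      (trans (distribʳ (x ^ suc k * y ^ (s ∸ k)) (conPS (+ (s C k))) (conPS (+ (s C suc k))))
        (+-cong (solve 4 (λ c x p z → c :* (x :* p :* z) := x :* (c :* (p :* z))) refl (conPS (+ (s C k))) x (x ^ k) (y ^ (s ∸ k))) (second k)))

-- The tuples with n parts, all exceeding b - j, weighted by multinomial coefficients; s is the total multiplicity.
module Compositions (γ : ℕ → ℤ) (b : ℕ) where
  β : ℕ → PS
  β x = conPS (γ x) ⊠ q 𝕊.^ x

  start : ℕ → PS
  start zero    = onePS
  start (suc _) = 0PS

  parts : ℕ → ℕ → ℕ → PS
  -- The smallest part is b - i, with multiplicity k + 1; the other n parts exceed b - i. The
  -- binomial coefficient is the first factor of the multinomial one.
  partsWith : ℕ → ℕ → ℕ → PS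
  parts zero    j s = start s
  parts (suc n) j s = ∑𝕊.∑ j (λ i → partsWith n i s)
  partsWith n i s = ∑𝕊.∑ b (λ k → conPS (+ (s C suc k)) ⊠ (β (b ∸ i) 𝕊.^ suc k ⊠ parts n i (s ∸ suc k)))

  -- the sum of β x over b - j < x ≤ b
  tailSum : ℕ → PS
  tailSum j = ∑𝕊.∑ j (λ i → β (b ∸ i))

  total : ℕ → ℕ → ℕ → PS
  total N j s = ∑𝕊.∑ (suc N) (λ n → parts n j s)

  private
    agree-trans : ∀ {k f g h} → Agree k f g → Agree k g h → Agree k f h
    agree-trans p r i lt = ≡.trans (p i lt) (r i lt)

    agree-≋ : ∀ {k f g} → f ≋ g → Agree k f g
    agree-≋ eq i _ = at eq i

    β-power-high : ∀ x k f → suc b ≤ suc k → 0 < x → Agree (suc b) (β x 𝕊.^ suc k ⊠ f) 0PS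
    β-power-high x k f b≤k 0<x i i<b = ≡.trans (at (𝕊.trans (𝕊.*-congʳ (𝕊.trans (𝕊.^-distrib-* (conPS (γ x)) (q 𝕊.^ x) (suc k)) (𝕊.*-congˡ (𝕊.^-assocʳ q x (suc k)))))
        (solve 3 (λ c p f → c :* p :* f := p :* (c :* f)) 𝕊.refl (conPS (γ x) 𝕊.^ suc k) (q 𝕊.^ (x ℕ.* suc k)) f)) i)
      (≡.trans (q^⊠-low (x ℕ.* suc k) (conPS (γ x) 𝕊.^ suc k ⊠ f) i (ℕP.<-≤-trans i<b (ℕP.≤-trans b≤k (ℕP.m≤n*m (suc k) x {{ℕ.>-nonZero 0<x}})))) (≡.sym (0PS-coefficient i)))
      where open 𝕊.Solver using (solve; _:=_; _:*_)

  -- The multinomial theorem modulo q^(b+1), by induction on the number j of admissible parts: the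
  -- new summand β(b - j) is split off binomially. With j admissible parts no tuple has more than N
  -- ≥ j distinct ones.
  total-agree : ∀ j N s → j ≤ b → j ≤ N → Agree (suc b) (total N j s) (tailSum j 𝕊.^ s)
  total-agree zero    N       s _   _         = agree-≋ (𝕊.trans (∑𝕊.∑-head N (λ n → parts n 0 s)) (𝕊.trans (𝕊.+-congˡ (∑𝕊.∑-0 N (λ n _ → 𝕊.refl)))
    (𝕊.trans (𝕊.+-identityʳ (start s)) (power s))))
    where
    power : ∀ s → start s ≋ tailSum 0 𝕊.^ s
    power zero    = 𝕊.refl
    power (suc s) = 𝕊.sym (𝕊.zeroˡ (tailSum 0 𝕊.^ s))
  total-agree (suc j) (suc N) s j<b (s≤s j≤N) = agree-trans (agree-≋ unfold) (agree-trans
      (agree-⊞ (suc b) {total (suc N) j s} {tailSum j 𝕊.^ s} {∑𝕊.∑ b step} {∑𝕊.∑ b binom} (total-agree j (suc N) s (ℕP.<⇒≤ j<b) (ℕP.m≤n⇒m≤1+n j≤N))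
        (agree-∑ (suc b) b step binom (λ k _ → agree-⊠ (suc b) {conPS (+ (s C suc k))} {conPS (+ (s C suc k))} {x 𝕊.^ suc k ⊠ total N j (s ∸ suc k)} {x 𝕊.^ suc k ⊠ Pⱼ 𝕊.^ (s ∸ suc k)} (λ _ _ → ≡.refl)
          (agree-⊠ (suc b) {x 𝕊.^ suc k} {x 𝕊.^ suc k} {total N j (s ∸ suc k)} {Pⱼ 𝕊.^ (s ∸ suc k)} (λ _ _ → ≡.refl) (total-agree j N (s ∸ suc k) (ℕP.<⇒≤ j<b) j≤N)))))
      (agree-trans (agree-⊞ (suc b) {Pⱼ 𝕊.^ s} {Pⱼ 𝕊.^ s} {∑𝕊.∑ b binom} {∑𝕊.∑ (b ℕ.+ s) binom} (λ _ _ → ≡.refl) (λ i lt → ≡.sym (extend s i lt)))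
        (agree-≋ (𝕊.sym close))))
    where
    x Pⱼ : PS
    x = β (b ∸ j)
    Pⱼ = tailSum j
    step binom : ℕ → PS
    step k = conPS (+ (s C suc k)) ⊠ (x 𝕊.^ suc k ⊠ total N j (s ∸ suc k))
    binom k = conPS (+ (s C suc k)) ⊠ (x 𝕊.^ suc k ⊠ Pⱼ 𝕊.^ (s ∸ suc k))
    unfold : total (suc N) (suc j) s ≋ total (suc N) j s ⊞ ∑𝕊.∑ b step
    unfold = 𝕊.trans (∑𝕊.∑-head (suc N) (λ n → parts n (suc j) s)) (𝕊.trans (𝕊.+-congˡ (∑𝕊.∑-+ (suc N) (λ n → parts (suc n) j s) (λ n → partsWith n j s)))
      (𝕊.trans (𝕊.sym (𝕊.+-assoc (start s) (∑𝕊.∑ (suc N) (λ n → parts (suc n) j s)) (∑𝕊.∑ (suc N) (λ n → partsWith n j s))))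
        (𝕊.+-cong (𝕊.sym (∑𝕊.∑-head (suc N) (λ n → parts n j s)))
          (𝕊.trans (∑𝕊.∑-swap (suc N) b (λ n k → conPS (+ (s C suc k)) ⊠ (x 𝕊.^ suc k ⊠ parts n j (s ∸ suc k))))
            (∑𝕊.∑-cong b (λ k _ → 𝕊.trans (𝕊.sym (∑𝕊.*-∑ (suc N) (conPS (+ (s C suc k))) (λ n → x 𝕊.^ suc k ⊠ parts n j (s ∸ suc k))))
              (𝕊.*-congˡ {conPS (+ (s C suc k))} (𝕊.sym (∑𝕊.*-∑ (suc N) (x 𝕊.^ suc k) (λ n → parts n j (s ∸ suc k)))))))))))
    -- Multiplicities above b may be dropped: such a power of a part that is at least 1 is divisible
    -- by q^(b+1).
    extend : ∀ d → Agree (suc b) (∑𝕊.∑ (b ℕ.+ d) binom) (∑𝕊.∑ b binom)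
    extend zero    i lt = ≡.cong (λ n → ∑𝕊.∑ n binom i) (ℕP.+-identityʳ b)
    extend (suc d) i lt = ≡.trans (≡.cong (λ n → ∑𝕊.∑ n binom i) (ℕP.+-suc b d)) (agree-⊞-0ʳ (suc b) {∑𝕊.∑ (b ℕ.+ d) binom} {binom (b ℕ.+ d)} {∑𝕊.∑ b binom} (extend d)
      (λ i lt → ≡.trans (con-at (+ (s C suc (b ℕ.+ d))) (≡.trans (β-power-high (b ∸ j) (b ℕ.+ d) (Pⱼ 𝕊.^ (s ∸ suc (b ℕ.+ d))) (s≤s (ℕP.m≤m+n b d)) (ℕP.m<n⇒0<n∸m j<b) i lt) (0PS-coefficient i)))
        (≡.trans (ℤP.*-zeroʳ (+ (s C suc (b ℕ.+ d)))) (≡.sym (0PS-coefficient i)))) i lt)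
    close : tailSum (suc j) 𝕊.^ s ≋ Pⱼ 𝕊.^ s ⊞ ∑𝕊.∑ (b ℕ.+ s) binom
    close = 𝕊.trans (𝕊.^-congˡ s (𝕊.+-comm Pⱼ x)) (𝕊.trans (binomial x Pⱼ s (suc (b ℕ.+ s)) (s≤s (ℕP.m≤n+m s b)))
      (𝕊.trans (∑𝕊.∑-head (b ℕ.+ s) (λ k → conPS (+ (s C k)) ⊠ (x 𝕊.^ k ⊠ Pⱼ 𝕊.^ (s ∸ k))))
        (𝕊.+-congʳ (𝕊.trans (𝕊.*-congʳ 𝕊.con-1) (𝕊.trans (𝕊.*-identityˡ (onePS ⊠ Pⱼ 𝕊.^ s)) (𝕊.*-identityˡ (Pⱼ 𝕊.^ s)))))))

-- Enumeration of tuples.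

sumL : {A : Set} → List A → (A → ℤ) → ℤ
sumL xs f = foldr (λ x acc → f x ℤ.+ acc) (+ 0) xs

module _ {A : Set} where
  sumL-cong : ∀ (xs : List A) {f g} → (∀ x → f x ≡ g x) → sumL xs f ≡ sumL xs g
  sumL-cong []       eq = ≡.refl
  sumL-cong (x ∷ xs) eq = ≡.cong₂ ℤ._+_ (eq x) (sumL-cong xs eq)

  sumL-0 : ∀ (xs : List A) {f} → (∀ x → f x ≡ + 0) → sumL xs f ≡ + 0
  sumL-0 []       eq = ≡.refl
  sumL-0 (x ∷ xs) eq = ≡.cong₂ ℤ._+_ (eq x) (sumL-0 xs eq)

  sumL-++ : ∀ (xs ys : List A) f → sumL (xs ++ ys) f ≡ sumL xs f ℤ.+ sumL ys f
  sumL-++ []       ys f = ≡.sym (ℤP.+-identityˡ (sumL ys f))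
  sumL-++ (x ∷ xs) ys f = ≡.trans (≡.cong (λ z → f x ℤ.+ z) (sumL-++ xs ys f)) (≡.sym (ℤP.+-assoc (f x) (sumL xs f) (sumL ys f)))

  *-sumL : ∀ (xs : List A) c f → c ℤ.* sumL xs f ≡ sumL xs (λ x → c ℤ.* f x)
  *-sumL []       c f = ℤP.*-zeroʳ c
  *-sumL (x ∷ xs) c f = ≡.trans (ℤP.*-distribˡ-+ c (f x) (sumL xs f)) (≡.cong (λ z → c ℤ.* f x ℤ.+ z) (*-sumL xs c f))

  sumL-∑ : ∀ (xs : List A) n (f : A → ℕ → ℤ) → sumL xs (λ x → ∑ℤ n (f x)) ≡ ∑ℤ n (λ i → sumL xs (λ x → f x i))
  sumL-∑ []       n f = ≡.sym (∑ℤ.∑-0 n {λ _ → + 0} (λ _ _ → ≡.refl))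
  sumL-∑ (x ∷ xs) n f = ≡.trans (≡.cong (λ z → ∑ℤ n (f x) ℤ.+ z) (sumL-∑ xs n f)) (≡.sym (∑ℤ.∑-+ n (f x) (λ i → sumL xs (λ x → f x i))))

  sumL-map : ∀ {B : Set} (xs : List B) (g : B → A) f → sumL (map g xs) f ≡ sumL xs (f ∘ g)
  sumL-map []       g f = ≡.refl
  sumL-map (x ∷ xs) g f = ≡.cong (λ z → f (g x) ℤ.+ z) (sumL-map xs g f)

  sumL-concatMap : ∀ {B : Set} (xs : List B) (g : B → List A) f → sumL (concatMap g xs) f ≡ sumL xs (λ x → sumL (g x) f)
  sumL-concatMap []       g f = ≡.refl
  sumL-concatMap (x ∷ xs) g f = ≡.trans (sumL-++ (g x) (concatMap g xs) f) (≡.cong (λ z → sumL (g x) f ℤ.+ z) (sumL-concatMap xs g f))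

sumL-applyUpTo : ∀ n (g : ℕ → ℕ) f → sumL (applyUpTo g n) f ≡ ∑ℤ n (f ∘ g)
sumL-applyUpTo zero    g f = ≡.refl
sumL-applyUpTo (suc n) g f = ≡.trans (≡.cong (λ z → f (g 0) ℤ.+ z) (sumL-applyUpTo n (g ∘ suc) f)) (≡.sym (∑ℤ.∑-head n (f ∘ g)))

sumL-range : ∀ n f → sumL (map suc (upTo n)) f ≡ ∑ℤ n (f ∘ suc)
sumL-range n f = ≡.trans (sumL-map (upTo n) suc f) (sumL-applyUpTo n id (f ∘ suc))

⟪_⟫_ : Bool → ℤ → ℤ
⟪ b ⟫ z = if b then z else + 0

≡ᵇ-shift : ∀ i x m → i ≤ m → (i ℕ.+ x ℕ.≡ᵇ m) ≡ (x ℕ.≡ᵇ m ∸ i)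
≡ᵇ-shift zero    x m       _         = ≡.refl
≡ᵇ-shift (suc i) x (suc m) (s≤s i≤m) = ≡ᵇ-shift i x m i≤m

≡ᵇ-small : ∀ i x m → m < i → (i ℕ.+ x ℕ.≡ᵇ m) ≡ false
≡ᵇ-small (suc i) x zero    _         = ≡.refl
≡ᵇ-small (suc i) x (suc m) (s≤s m<i) = ≡ᵇ-small i x m m<i

multinomial : ∀ {n} → Vec ℕ n → ℕ
multinomial []      = 1
multinomial (k ∷ t) = ((k ℕ.+ Vec.sum t) C k) ℕ.* multinomial t

powerProduct : (ℕ → ℤ) → ∀ {n} → Vec ℕ n → Vec ℕ n → ℤ
powerProduct γ r t = Vec.foldr _ ℤ._*_ (+ 1) (Vec.zipWith (λ x k → γ x ℤ.^ k) r t)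

module Enumeration (γ : ℕ → ℤ) (b : ℕ) where
  open Compositions γ b

  box : (n : ℕ) → List (Vec ℕ n)
  box n = boxVecs n b

  sum-box : ∀ n f → sumL (box (suc n)) f ≡ ∑ℤ b (λ x → sumL (box n) (λ v → f (suc x ∷ v)))
  sum-box n f = ≡.trans (sumL-concatMap (map suc (upTo b)) (λ x → map (x ∷_) (box n)) f) (≡.trans
    (sumL-range b (λ x → sumL (map (x ∷_) (box n)) f)) (∑ℤ.∑-cong b (λ x _ → sumL-map (box n) (suc x ∷_) f)))

  selected : ∀ {n} → ℕ → ℕ → ℕ → Vec ℕ n → Vec ℕ n → Bool
  selected p m s r t = incFrom p r ∧ allPos t ∧ (weight r t ℕ.≡ᵇ m) ∧ (Vec.sum t ℕ.≡ᵇ s)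

  contribution : ∀ {n} → ℕ → ℕ → ℕ → Vec ℕ n → Vec ℕ n → ℤ
  contribution {n} p m s r t = ⟪ selected p m s r t ⟫ (+ multinomial t ℤ.* powerProduct γ r t)

  count : (n p m s : ℕ) → ℤ
  count n p m s = sumL (box n) (λ r → sumL (box n) (contribution p m s r))

  private
    reverse : ∀ n (f : ℕ → ℤ) → ∑ℤ n f ≡ ∑ℤ n (λ i → f (n ∸ suc i))
    reverse zero    f = ≡.refl
    reverse (suc n) f = ≡.trans (ℤP.+-comm (∑ℤ n f) (f n)) (≡.trans (≡.cong (λ z → f n ℤ.+ z) (reverse n f)) (≡.sym (∑ℤ.∑-head n (λ i → f (n ∸ i)))))

    <ᵇ-true : ∀ {m n} → m < n → (m ℕ.<ᵇ n) ≡ true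
    <ᵇ-true {zero}  {suc n} _         = ≡.refl
    <ᵇ-true {suc m} {suc n} (s≤s m<n) = <ᵇ-true m<n

    <ᵇ-false : ∀ {m n} → n ≤ m → (m ℕ.<ᵇ n) ≡ false
    <ᵇ-false {m}     {zero}  _         = ≡.refl
    <ᵇ-false {suc m} {suc n} (s≤s n≤m) = <ᵇ-false n≤m

    -- Lists enumerate parts upwards from 1, the series `parts` downwards from b; the condition x >
    -- p becomes i < b - p for x = b - i.
    reindex : ∀ p (g : ℕ → ℤ) → ∑ℤ b (λ x → ⟪ p ℕ.<ᵇ suc x ⟫ g (suc x)) ≡ ∑ℤ (b ∸ p) (λ i → g (b ∸ i))
    reindex p g = ≡.trans (reverse b (λ x → ⟪ p ℕ.<ᵇ suc x ⟫ g (suc x))) (≡.trans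
      (∑ℤ.∑-cong b {g = λ i → ⟪ p ℕ.<ᵇ b ∸ i ⟫ g (b ∸ i)} (λ i i<b → ≡.cong (λ y → ⟪ p ℕ.<ᵇ y ⟫ g y) (≡.sym (ℕP.+-∸-assoc 1 i<b))))
      (≡.trans (≡.cong (λ n → ∑ℤ n (λ i → ⟪ p ℕ.<ᵇ b ∸ i ⟫ g (b ∸ i))) (≡.sym (ℕP.m+[n∸m]≡n (ℕP.m∸n≤m b p))))
      (≡.trans (∑ℤ.∑-extend (b ∸ p) (b ∸ (b ∸ p)) (λ i le → ≡.cong (λ c → ⟪ c ⟫ g (b ∸ i)) (<ᵇ-false (ℕP.m≤n+o⇒m∸n≤o b i (ℕP.≤-trans (ℕP.m≤n+m∸n b p) (ℕP.≤-trans (ℕP.+-monoʳ-≤ p le) (ℕP.≤-reflexive (ℕP.+-comm p i))))))))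
        (∑ℤ.∑-cong (b ∸ p) (λ i lt → ≡.cong (λ c → ⟪ c ⟫ g (b ∸ i)) (<ᵇ-true (flip-gap i lt)))))))
      where
      flip-gap : ∀ i → i < b ∸ p → p < b ∸ i
      flip-gap i lt = ℕP.m+n≤o⇒m≤o∸n (suc p) (≡.subst (_≤ b) (≡.trans (ℕP.+-comm (suc i) p) (ℕP.+-suc p i)) (ℕP.m≤o∸n⇒m+n≤o (suc i) (ℕP.<⇒≤ (ℕP.m∸n≢0⇒n<m (λ eq → ℕP.<⇒≱ lt (≡.subst (_≤ i) (≡.sym eq) z≤n)))) lt))

    -- Fixing the smallest part x and its multiplicity k lowers the weight by kx and the total
    -- multiplicity by k, and leaves x as the bound for the remaining parts.
    cell : ∀ n p m s x₀ k₀ → let x = suc x₀ ; k = suc k₀ in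
      sumL (box n) (λ r → sumL (box n) (λ t → contribution p m s (x ∷ r) (k ∷ t)))
      ≡ ⟪ p ℕ.<ᵇ x ⟫ (+ (s C k) ℤ.* (γ x ℤ.^ k ℤ.* (if does (k ℕ.* x ℕP.≤? m) then count n x (m ∸ k ℕ.* x) (s ∸ k) else + 0)))
    cell n p m s x₀ k₀ = split (p ℕ.<ᵇ x) ≡.refl (k ℕ.* x ℕP.≤? m) (k ℕP.≤? s)
      where
      x k : ℕ
      x = suc x₀
      k = suc k₀
      summand : Bool → Bool → ℤ
      summand c d = ⟪ c ⟫ (+ (s C k) ℤ.* (γ x ℤ.^ k ℤ.* (if d then count n x (m ∸ k ℕ.* x) (s ∸ k) else + 0)))
      all-false : ∀ z → (∀ r t → selected p m s (x ∷ r) (k ∷ t) ≡ false) → z ≡ + 0 →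
        sumL (box n) (λ r → sumL (box n) (λ t → contribution p m s (x ∷ r) (k ∷ t))) ≡ z
      all-false z eq z≡0 = ≡.trans (sumL-0 (box n) (λ r → sumL-0 (box n) (λ t → ≡.cong (λ c → ⟪ c ⟫ (+ multinomial (k ∷ t) ℤ.* powerProduct γ (x ∷ r) (k ∷ t))) (eq r t)))) (≡.sym z≡0)
      ∧-false₃ : ∀ a c d {e} → e ≡ false → a ∧ c ∧ e ∧ d ≡ false
      ∧-false₃ true  true  d ≡.refl = ≡.refl
      ∧-false₃ true  false d ≡.refl = ≡.refl
      ∧-false₃ false c     d ≡.refl = ≡.refl
      ∧-false₄ : ∀ a c d {e} → e ≡ false → a ∧ c ∧ d ∧ e ≡ false
      ∧-false₄ true  true  true  ≡.refl = ≡.refl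
      ∧-false₄ true  true  false ≡.refl = ≡.refl
      ∧-false₄ true  false d     ≡.refl = ≡.refl
      ∧-false₄ false c     d     ≡.refl = ≡.refl
      inner : ∀ (A B W Z : Bool) σ μ π → (Z ≡ true → k ℕ.+ σ ≡ s) → ⟪ A ∧ B ∧ W ∧ Z ⟫ (+ (((k ℕ.+ σ) C k) ℕ.* μ) ℤ.* (γ x ℤ.^ k ℤ.* π))
        ≡ + (s C k) ℤ.* (γ x ℤ.^ k ℤ.* ⟪ A ∧ B ∧ W ∧ Z ⟫ (+ μ ℤ.* π))
      inner true true true true σ μ π eq = ≡.trans (≡.cong (λ y → + ((y C k) ℕ.* μ) ℤ.* (γ x ℤ.^ k ℤ.* π)) (eq ≡.refl)) (≡.trans (≡.cong (ℤ._* (γ x ℤ.^ k ℤ.* π)) (ℤP.pos-* (s C k) μ))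
        (ℤ-solver.solve 4 (λ c μ g π → c ℤ-solver.:* μ ℤ-solver.:* (g ℤ-solver.:* π) ℤ-solver.:= c ℤ-solver.:* (g ℤ-solver.:* (μ ℤ-solver.:* π))) ≡.refl (+ (s C k)) (+ μ) (γ x ℤ.^ k) π))
      inner true true true false σ μ π _ = zeros
        where zeros = ≡.sym (≡.trans (≡.cong (+ (s C k) ℤ.*_) (ℤP.*-zeroʳ (γ x ℤ.^ k))) (ℤP.*-zeroʳ (+ (s C k))))
      inner true true false Z σ μ π _ = ≡.sym (≡.trans (≡.cong (+ (s C k) ℤ.*_) (ℤP.*-zeroʳ (γ x ℤ.^ k))) (ℤP.*-zeroʳ (+ (s C k))))
      inner true false W Z σ μ π _ = ≡.sym (≡.trans (≡.cong (+ (s C k) ℤ.*_) (ℤP.*-zeroʳ (γ x ℤ.^ k))) (ℤP.*-zeroʳ (+ (s C k))))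
      inner false B W Z σ μ π _ = ≡.sym (≡.trans (≡.cong (+ (s C k) ℤ.*_) (ℤP.*-zeroʳ (γ x ℤ.^ k))) (ℤP.*-zeroʳ (+ (s C k))))
      both : (p ℕ.<ᵇ x) ≡ true → k ℕ.* x ≤ m → k ≤ s → ∀ r t → contribution p m s (x ∷ r) (k ∷ t) ≡ + (s C k) ℤ.* (γ x ℤ.^ k ℤ.* contribution x (m ∸ k ℕ.* x) (s ∸ k) r t)
      both c kx≤m k≤s r t = ≡.trans (≡.cong (λ e → ⟪ e ⟫ (+ multinomial (k ∷ t) ℤ.* powerProduct γ (x ∷ r) (k ∷ t)))
          (≡.cong₂ _∧_ (≡.cong (_∧ incFrom x r) c) (≡.cong (allPos t ∧_) (≡.cong₂ _∧_ (≡ᵇ-shift (k ℕ.* x) (weight r t) m kx≤m) (≡ᵇ-shift k (Vec.sum t) s k≤s)))))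
        (inner (incFrom x r) (allPos t) (weight r t ℕ.≡ᵇ m ∸ k ℕ.* x) (Vec.sum t ℕ.≡ᵇ s ∸ k) (Vec.sum t) (multinomial t) (powerProduct γ r t)
          (λ eq → ≡.trans (≡.cong (k ℕ.+_) (ℕP.≡ᵇ⇒≡ (Vec.sum t) (s ∸ k) (≡.subst IsTrue (≡.sym eq) tt))) (ℕP.m+[n∸m]≡n k≤s)))
      split : ∀ c → (p ℕ.<ᵇ x) ≡ c → (d : Dec (k ℕ.* x ≤ m)) → Dec (k ≤ s) → sumL (box n) (λ r → sumL (box n) (λ t → contribution p m s (x ∷ r) (k ∷ t))) ≡ summand c (does d)
      split false c d        _         = all-false (+ 0) (λ r t → ≡.cong (λ e → (e ∧ incFrom x r) ∧ allPos t ∧ (k ℕ.* x ℕ.+ weight r t ℕ.≡ᵇ m) ∧ (k ℕ.+ Vec.sum t ℕ.≡ᵇ s)) c) ≡.refl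
      split true  c (no kx≰m) _        = all-false _ (λ r t → ∧-false₃ (incFrom p (x ∷ r)) (allPos (k ∷ t)) _ (≡ᵇ-small (k ℕ.* x) (weight r t) m (ℕP.≰⇒> kx≰m)))
        (≡.trans (≡.cong (+ (s C k) ℤ.*_) (ℤP.*-zeroʳ (γ x ℤ.^ k))) (ℤP.*-zeroʳ (+ (s C k))))
      split true  c (yes _) (no k≰s)   = all-false _ (λ r t → ∧-false₄ (incFrom p (x ∷ r)) (allPos (k ∷ t)) _ (≡ᵇ-small k (Vec.sum t) s (ℕP.≰⇒> k≰s)))
        (≡.cong (λ y → + y ℤ.* (γ x ℤ.^ k ℤ.* count n x (m ∸ k ℕ.* x) (s ∸ k))) (k>n⇒nCk≡0 (ℕP.≰⇒> k≰s)))
      split true  c (yes kx≤m) (yes k≤s) = ≡.trans (sumL-cong (box n) (λ r → ≡.trans (sumL-cong (box n) (both c kx≤m k≤s r))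
          (≡.trans (≡.sym (*-sumL (box n) (+ (s C k)) (λ t → γ x ℤ.^ k ℤ.* contribution x (m ∸ k ℕ.* x) (s ∸ k) r t)))
            (≡.cong (+ (s C k) ℤ.*_) (≡.sym (*-sumL (box n) (γ x ℤ.^ k) (contribution x (m ∸ k ℕ.* x) (s ∸ k) r)))))))
        (≡.trans (≡.sym (*-sumL (box n) (+ (s C k)) (λ r → γ x ℤ.^ k ℤ.* sumL (box n) (contribution x (m ∸ k ℕ.* x) (s ∸ k) r))))
          (≡.cong (+ (s C k) ℤ.*_) (≡.sym (*-sumL (box n) (γ x ℤ.^ k) (λ r → sumL (box n) (contribution x (m ∸ k ℕ.* x) (s ∸ k) r))))))

    conPS-^ : ∀ c k → conPS c 𝕊.^ k ≋ conPS (c ℤ.^ k)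
    conPS-^ c zero    = 𝕊.sym 𝕊.con-1
    conPS-^ c (suc k) = 𝕊.trans (𝕊.*-congˡ {conPS c} (conPS-^ c k)) (𝕊.sym (𝕊.con-* c (c ℤ.^ k)))

    series-cell : ∀ x k f c m → (conPS c ⊠ (β x 𝕊.^ k ⊠ f)) m ≡ c ℤ.* (γ x ℤ.^ k ℤ.* (if does (k ℕ.* x ℕP.≤? m) then f (m ∸ k ℕ.* x) else + 0))
    series-cell x k f c m = con-at c (≡.trans (at (𝕊.trans (𝕊.*-congʳ {f} (𝕊.trans (𝕊.^-distrib-* (conPS (γ x)) (q 𝕊.^ x) k)
        (𝕊.*-cong (conPS-^ (γ x) k) (𝕊.trans (𝕊.^-assocʳ q x k) (𝕊.reflexive (≡.cong (q 𝕊.^_) (ℕP.*-comm x k))))))) (𝕊.*-assoc (conPS (γ x ℤ.^ k)) (q 𝕊.^ (k ℕ.* x)) f)) m)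
      (con-at (γ x ℤ.^ k) (shifted (k ℕ.* x ℕP.≤? m))))
      where
      shifted : (d : Dec (k ℕ.* x ≤ m)) → (q 𝕊.^ (k ℕ.* x) ⊠ f) m ≡ (if does d then f (m ∸ k ℕ.* x) else + 0)
      shifted (yes kx≤m) = ≡.trans (≡.cong (q 𝕊.^ (k ℕ.* x) ⊠ f) (≡.sym (ℕP.m+[n∸m]≡n kx≤m))) (q^⊠-high (k ℕ.* x) f (m ∸ k ℕ.* x))
      shifted (no kx≰m)  = q^⊠-low (k ℕ.* x) f m (ℕP.≰⇒> kx≰m)

  -- Both sides satisfy the recursion on the smallest part and its multiplicity; a lower bound p
  -- corresponds to the b - p parts that exceed it.
  count≡parts : ∀ n p m s → count n p m s ≡ parts n (b ∸ p) s m
  count≡parts zero p zero    zero    = ≡.refl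
  count≡parts zero p (suc m) zero    = ≡.refl
  count≡parts zero p zero    (suc s) = ≡.sym (0PS-coefficient 0)
  count≡parts zero p (suc m) (suc s) = ≡.sym (0PS-coefficient (suc m))
  count≡parts (suc n) p m s = begin
    count (suc n) p m s
      ≡⟨ sum-box n (λ r → sumL (box (suc n)) (contribution p m s r)) ⟩
    ∑ℤ b (λ x → sumL (box n) (λ r → sumL (box (suc n)) (contribution p m s (suc x ∷ r))))
      ≡⟨ ∑ℤ.∑-cong b (λ x _ → ≡.trans (sumL-cong (box n) (λ r → sum-box n (contribution p m s (suc x ∷ r))))
          (≡.trans (sumL-∑ (box n) b (λ r k → sumL (box n) (λ t → contribution p m s (suc x ∷ r) (suc k ∷ t))))
            (∑ℤ.∑-cong b (λ k _ → cell n p m s x k)))) ⟩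
    ∑ℤ b (λ x → ∑ℤ b (λ k → ⟪ p ℕ.<ᵇ suc x ⟫ (+ (s C suc k) ℤ.* (γ (suc x) ℤ.^ suc k ℤ.* (if does (suc k ℕ.* suc x ℕP.≤? m) then count n (suc x) (m ∸ suc k ℕ.* suc x) (s ∸ suc k) else + 0)))))
      ≡⟨ ∑ℤ.∑-cong b (λ x _ → pull (p ℕ.<ᵇ suc x) b _) ⟩
    ∑ℤ b (λ x → ⟪ p ℕ.<ᵇ suc x ⟫ g (suc x))
      ≡⟨ reindex p g ⟩
    ∑ℤ (b ∸ p) (λ i → g (b ∸ i))
      ≡⟨ ∑ℤ.∑-cong (b ∸ p) (λ i i<b-p → ≡.trans (∑ℤ.∑-cong b (λ k _ → term i k (ℕP.≤-trans (ℕP.<⇒≤ i<b-p) (ℕP.m∸n≤m b p)))) (≡.sym (∑𝕊-coefficient b _ m))) ⟩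
    ∑ℤ (b ∸ p) (λ i → partsWith n i s m)
      ≡⟨ ∑𝕊-coefficient (b ∸ p) (λ i → partsWith n i s) m ⟨
    parts (suc n) (b ∸ p) s m ∎
    where
    open ≡.≡-Reasoning
    g : ℕ → ℤ
    g x = ∑ℤ b (λ k → + (s C suc k) ℤ.* (γ x ℤ.^ suc k ℤ.* (if does (suc k ℕ.* x ℕP.≤? m) then count n x (m ∸ suc k ℕ.* x) (s ∸ suc k) else + 0)))
    pull : ∀ c N (f : ℕ → ℤ) → ∑ℤ N (λ k → ⟪ c ⟫ f k) ≡ ⟪ c ⟫ ∑ℤ N f
    pull true  N f = ≡.refl
    pull false N f = ∑ℤ.∑-0 N {λ _ → + 0} (λ _ _ → ≡.refl)
    term : ∀ i k → i ≤ b → + (s C suc k) ℤ.* (γ (b ∸ i) ℤ.^ suc k ℤ.* (if does (suc k ℕ.* (b ∸ i) ℕP.≤? m) then count n (b ∸ i) (m ∸ suc k ℕ.* (b ∸ i)) (s ∸ suc k) else + 0))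
      ≡ (conPS (+ (s C suc k)) ⊠ (β (b ∸ i) 𝕊.^ suc k ⊠ parts n i (s ∸ suc k))) m
    term i k i≤b = ≡.trans (≡.cong (λ z → + (s C suc k) ℤ.* (γ (b ∸ i) ℤ.^ suc k ℤ.* (if does (suc k ℕ.* (b ∸ i) ℕP.≤? m) then z else + 0)))
        (≡.trans (count≡parts n (b ∸ i) (m ∸ suc k ℕ.* (b ∸ i)) (s ∸ suc k)) (≡.cong (λ j → parts n j (s ∸ suc k) (m ∸ suc k ℕ.* (b ∸ i))) (ℕP.m∸[m∸n]≡n i≤b))))
      (≡.sym (series-cell (b ∸ i) (suc k) (parts n i (s ∸ suc k)) (+ (s C suc k)) m))

-- Integrality of the weights.

-- N! ∏tᵢ! divides (N+u)! N and (N+u)! tᵢ, hence (N+u)! (N + Σ tᵢrᵢ) = (N+u)! ℓ.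

m!n!∣[m+n]! : ∀ m n → m ! ℕ.* n ! ∣ (m ℕ.+ n) !
m!n!∣[m+n]! m n = ≡.subst (λ k → m ! ℕ.* k ! ∣ (m ℕ.+ n) !) (ℕP.m+n∸m≡n m n) (k![n∸k]!∣n! (ℕP.m≤m+n m n))

factProd-∣ : ∀ {n} M (t : Vec ℕ n) → M ! ℕ.* factProd t ∣ (M ℕ.+ Vec.sum t) !
factProd-∣ M []      = ∣-reflexive (≡.trans (ℕP.*-identityʳ (M !)) (≡.cong _! (≡.sym (ℕP.+-identityʳ M))))
factProd-∣ M (k ∷ t) = ∣-trans (∣-reflexive (≡.sym (ℕP.*-assoc (M !) (k !) (factProd t))))
  (∣-trans (*-monoˡ-∣ (factProd t) (m!n!∣[m+n]! M k)) (∣-trans (factProd-∣ (M ℕ.+ k) t) (∣-reflexive (≡.cong _! (ℕP.+-assoc M k (Vec.sum t))))))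

base-∣ : ∀ {n} M (t : Vec ℕ n) U → M ℕ.+ Vec.sum t ≡ suc U → M ! ℕ.* factProd t ∣ U ! ℕ.* M
base-∣ zero    t U eq = ∣-trans (_ ∣0) (∣-reflexive (≡.sym (ℕP.*-zeroʳ (U !))))
base-∣ (suc M) t U eq = ∣-trans (∣-reflexive (≡.trans (≡.cong (ℕ._* factProd t) (ℕP.*-comm (suc M) (M !)))
    (≡.trans (ℕP.*-assoc (M !) (suc M) (factProd t)) (≡.trans (≡.cong (M ! ℕ.*_) (ℕP.*-comm (suc M) (factProd t))) (≡.sym (ℕP.*-assoc (M !) (factProd t) (suc M)))))))
  (*-monoˡ-∣ (suc M) (∣-trans (factProd-∣ M t) (∣-reflexive (≡.cong _! (ℕP.suc-injective eq)))))

-- Summand by summand: for the first part, k and M exchange roles in `base-∣`, which yields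
-- divisibility of U! k. For the remaining parts k is merged into M, since M! k! divides (M + k)!.
weight-∣ : ∀ {n} M (r t : Vec ℕ n) U → M ℕ.+ Vec.sum t ≡ suc U → M ! ℕ.* factProd t ∣ U ! ℕ.* weight r t
weight-∣ M []      []      U eq = ∣-trans (_ ∣0) (∣-reflexive (≡.sym (ℕP.*-zeroʳ (U !))))
weight-∣ M (x ∷ r) (k ∷ t) U eq = ∣-trans (∣m∣n⇒∣m+n first second) (∣-reflexive (≡.sym (ℕP.*-distribˡ-+ (U !) (k ℕ.* x) (weight r t))))
  where
  open ≡.≡-Reasoning
  rearrange : ∀ k → M ! ℕ.* (k ! ℕ.* factProd t) ≡ k ! ℕ.* (M ! ℕ.* factProd t)
  rearrange k = ≡.trans (≡.sym (ℕP.*-assoc (M !) (k !) (factProd t))) (≡.trans (≡.cong (ℕ._* factProd t) (ℕP.*-comm (M !) (k !))) (ℕP.*-assoc (k !) (M !) (factProd t)))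
  first : M ! ℕ.* (k ! ℕ.* factProd t) ∣ U ! ℕ.* (k ℕ.* x)
  first = ∣-trans (∣-reflexive (rearrange k)) (∣-trans (swapped k eq) (∣-reflexive (ℕP.*-assoc (U !) k x)))
    where
    swapped : ∀ k → M ℕ.+ (k ℕ.+ Vec.sum t) ≡ suc U → k ! ℕ.* (M ! ℕ.* factProd t) ∣ U ! ℕ.* k ℕ.* x
    swapped k eq = ∣m⇒∣m*n x (∣-trans (∣-reflexive (≡.sym (rearrange′ k))) (base-∣ k (M ∷ t) U (≡.trans (≡.trans (≡.sym (ℕP.+-assoc k M (Vec.sum t))) (≡.trans (≡.cong (ℕ._+ Vec.sum t) (ℕP.+-comm k M)) (ℕP.+-assoc M k (Vec.sum t)))) eq)))
      where
      rearrange′ : ∀ k → k ! ℕ.* factProd (M ∷ t) ≡ k ! ℕ.* (M ! ℕ.* factProd t)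
      rearrange′ k = ≡.refl
  second : M ! ℕ.* (k ! ℕ.* factProd t) ∣ U ! ℕ.* weight r t
  second = ∣-trans (∣-reflexive (≡.sym (ℕP.*-assoc (M !) (k !) (factProd t)))) (∣-trans (*-monoˡ-∣ (factProd t) (m!n!∣[m+n]! M k))
    (weight-∣ (M ℕ.+ k) r t U (≡.trans (ℕP.+-assoc M k (Vec.sum t)) eq)))

C-factorial : ∀ N u → (N ℕ.+ u) ! ≡ N ! ℕ.* (u ! ℕ.* ((N ℕ.+ u) C u))
C-factorial N u = begin
  (N ℕ.+ u) !                                        ≡⟨ m∣n⇒n≡quotient*m d ⟩
  quotient d ℕ.* (u ! ℕ.* (N ℕ.+ u ∸ u) !)  ≡⟨ ≡.cong (ℕ._* (u ! ℕ.* (N ℕ.+ u ∸ u) !)) quotient≡ ⟩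
  ((N ℕ.+ u) C u) ℕ.* (u ! ℕ.* (N ℕ.+ u ∸ u) !)      ≡⟨ ≡.cong (λ k → ((N ℕ.+ u) C u) ℕ.* (u ! ℕ.* k !)) (ℕP.m+n∸n≡m N u) ⟩
  ((N ℕ.+ u) C u) ℕ.* (u ! ℕ.* N !)                  ≡⟨ ℕP.*-assoc ((N ℕ.+ u) C u) (u !) (N !) ⟨
  ((N ℕ.+ u) C u) ℕ.* u ! ℕ.* N !                    ≡⟨ ℕP.*-comm (((N ℕ.+ u) C u) ℕ.* u !) (N !) ⟩
  N ! ℕ.* (((N ℕ.+ u) C u) ℕ.* u !)                  ≡⟨ ≡.cong (N ! ℕ.*_) (ℕP.*-comm ((N ℕ.+ u) C u) (u !)) ⟩
  N ! ℕ.* (u ! ℕ.* ((N ℕ.+ u) C u))                  ∎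
  where
  open ≡.≡-Reasoning
  u≤ : u ≤ N ℕ.+ u
  u≤ = ℕP.m≤n+m u N
  d : u ! ℕ.* (N ℕ.+ u ∸ u) ! ∣ (N ℕ.+ u) !
  d = k![n∸k]!∣n! u≤
  instance
    nz : ℕ.NonZero (u ! ℕ.* (N ℕ.+ u ∸ u) !)
    nz = ℕP.m*n≢0 (u !) ((N ℕ.+ u ∸ u) !) {{u !≢0}} {{(N ℕ.+ u ∸ u) !≢0}}
  quotient≡ : quotient d ≡ (N ℕ.+ u) C u
  quotient≡ = ≡.trans (≡.sym (n/m≡quotient d)) (≡.sym (nCk≡n!/k![n-k]! u≤))

weight-zero : ∀ {n} (r t : Vec ℕ n) → Vec.sum t ≡ 0 → weight r t ≡ 0
weight-zero []      []         eq = ≡.refl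
weight-zero (x ∷ r) (zero ∷ t) eq = weight-zero r t eq

-- (N + u)! ℓ = N! · u! ℓ C(N + u, u), and N! is cancelled from the divisibility by N! ∏tᵢ!.
factProd-∣-coefficient : ∀ {n} N ℓ u (r t : Vec ℕ n) → N ℕ.+ weight r t ≡ ℓ → Vec.sum t ≡ suc u →
  factProd t ∣ u ! ℕ.* ℓ ℕ.* ((N ℕ.+ u) C u)
factProd-∣-coefficient N ℓ u r t N+w≡ℓ sum≡ = *-cancelˡ-∣ (N !) {{N !≢0}} (∣-trans
  (∣m∣n⇒∣m+n (base-∣ N t (N ℕ.+ u) eq) (weight-∣ N r t (N ℕ.+ u) eq))
  (∣-reflexive (begin
    (N ℕ.+ u) ! ℕ.* N ℕ.+ (N ℕ.+ u) ! ℕ.* weight r t  ≡⟨ ℕP.*-distribˡ-+ ((N ℕ.+ u) !) N (weight r t) ⟨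
    (N ℕ.+ u) ! ℕ.* (N ℕ.+ weight r t)                ≡⟨ ≡.cong₂ ℕ._*_ (C-factorial N u) N+w≡ℓ ⟩
    N ! ℕ.* (u ! ℕ.* c) ℕ.* ℓ                         ≡⟨ ℕP.*-assoc (N !) (u ! ℕ.* c) ℓ ⟩
    N ! ℕ.* (u ! ℕ.* c ℕ.* ℓ)                         ≡⟨ ≡.cong (N ! ℕ.*_) (≡.trans (ℕP.*-assoc (u !) c ℓ) (≡.trans (≡.cong (u ! ℕ.*_) (ℕP.*-comm c ℓ)) (≡.sym (ℕP.*-assoc (u !) ℓ c)))) ⟩
    N ! ℕ.* (u ! ℕ.* ℓ ℕ.* c)                         ∎)))
  where
  open ≡.≡-Reasoning
  c : ℕ
  c = (N ℕ.+ u) C u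
  eq : N ℕ.+ Vec.sum t ≡ suc (N ℕ.+ u)
  eq = ≡.trans (≡.cong (N ℕ.+_) sum≡) (ℕP.+-suc N u)

∧-elim : ∀ a b → IsTrue (a ∧ b) → IsTrue a × IsTrue b
∧-elim true true _ = tt , tt

𝒫-member : ∀ m (τ : Tuple) → τ ∈ 𝒫 m → IsTrue (inP m τ)
𝒫-member m τ τ∈ = proj₂ (∈-filter⁻ (T? ∘ inP m) {xs = concatMap (λ n → concatMap (λ r → map (λ t → (n , r , t)) (boxVecs n m)) (boxVecs n m)) (map suc (upTo m))} τ∈)

inP-weight : ∀ m n (r t : Vec ℕ n) → IsTrue (inP m (n , r , t)) → weight r t ≡ m
inP-weight m n r t p = ℕP.≡ᵇ⇒≡ (weight r t) m (proj₂ (∧-elim (allPos t) (weight r t ℕ.≡ᵇ m) (proj₂ (∧-elim (incFrom 0 r) _ (proj₂ (∧-elim (0 ℕ.<ᵇ n) _ p))))))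

inP-sum : ∀ m n (r t : Vec ℕ n) → 0 < m → IsTrue (inP m (n , r , t)) → Vec.sum t ≡ suc (Vec.sum t ∸ 1)
inP-sum m n r t 0<m p = case Vec.sum t ℕP.≟ 0 of λ
  { (yes eq) → contradiction (≡.trans (≡.sym (weight-zero r t eq)) (inP-weight m n r t p)) (ℕP.<⇒≢ 0<m)
  ; (no ne) → ≡.sym (ℕP.suc-pred (Vec.sum t) {{ℕ.≢-nonZero ne}}) }

/-cross : ∀ x d y e .{{_ : ℕ.NonZero d}} .{{_ : ℕ.NonZero e}} → x ℤ.* + e ≡ y ℤ.* + d → x ℚ./ d ≡ y ℚ./ e
/-cross x (suc d) y (suc e) eq = ℚP.fromℚᵘ-cong {ℚᵘ.mkℚᵘ x d} {ℚᵘ.mkℚᵘ y e} (ℚᵘ.*≡* eq)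

integrality : ∀ ℓ m → 0 < m → m ≤ ℓ → (τ : Tuple) → τ ∈ 𝒫 m →
  ∃ λ (z : ℤ) → (+ (uOf τ ! ℕ.* ℓ ℕ.* ((ℓ ∸ m ℕ.+ uOf τ) C uOf τ))) /tFact τ ≡ z ℚ./ 1
integrality ℓ m 0<m m≤ℓ τ@(n , r , t) τ∈ = quotientℤ d , (≡.trans (ℚP./-cong {q₁ = factProd t} {q₂ = factProd t} {{factProd≢0 t}} {{factProd≢0 t}} (≡.cong +_ (m∣n⇒n≡quotient*m d)) ≡.refl) (/-cross (+ (quotient d ℕ.* factProd t)) (factProd t) (+ quotient d) 1 {{factProd≢0 t}} (≡.trans (ℤP.*-identityʳ (+ (quotient d ℕ.* factProd t))) (ℤP.pos-* (quotient d) (factProd t)))))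
  where
  p : IsTrue (inP m τ)
  p = 𝒫-member m τ τ∈
  d : factProd t ∣ uOf τ ! ℕ.* ℓ ℕ.* ((ℓ ∸ m ℕ.+ uOf τ) C uOf τ)
  d = factProd-∣-coefficient (ℓ ∸ m) ℓ (uOf τ) r t (≡.trans (≡.cong (ℓ ∸ m ℕ.+_) (inP-weight m n r t p)) (ℕP.m∸n+n≡m m≤ℓ)) (inP-sum m n r t 0<m p)
  quotientℤ : ∀ {a b} → a ∣ b → ℤ
  quotientℤ d = + quotient d

-- Negative binomial and logarithmic series.

negBinom : ℕ → ℕ → ℤ
negBinom zero    zero    = + 1
negBinom zero    (suc _) = + 0
negBinom (suc N) s       = sgn s ℤ.* + ((N ℕ.+ s) C s)

negBinom-0 : ∀ N → negBinom N 0 ≡ + 1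
negBinom-0 zero    = ≡.refl
negBinom-0 (suc N) = ≡.cong (λ c → + 1 ℤ.* + c) (≡.trans (nCk≡nC[n∸k] {0} {N ℕ.+ 0} z≤n) (nCn≡1 (N ℕ.+ 0)))

negBinom-1 : ∀ s → negBinom 1 s ≡ sgn s
negBinom-1 s = ≡.trans (≡.cong (λ c → sgn s ℤ.* + c) (nCn≡1 s)) (ℤP.*-identityʳ (sgn s))

-- `negBinom` N s is the coefficient of yˢ in (1 + y)^(-N), and this is (1 + y) · (1 + y)^(-N-1) =
-- (1 + y)^(-N). The sign turns Pascal's rule into a cancellation.
negBinom-step : ∀ N s → negBinom (suc N) (suc s) ℤ.+ negBinom (suc N) s ≡ negBinom N (suc s)
negBinom-step zero    s = ≡.trans (≡.cong₂ (λ c d → ℤ.-1ℤ ℤ.* sgn s ℤ.* + c ℤ.+ sgn s ℤ.* + d) (nCn≡1 (suc s)) (nCn≡1 s))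
  (ℤ-solver.solve 1 (λ σ → ℤ-solver.con ℤ.-1ℤ ℤ-solver.:* σ ℤ-solver.:* ℤ-solver.con (+ 1) ℤ-solver.:+ σ ℤ-solver.:* ℤ-solver.con (+ 1) ℤ-solver.:= ℤ-solver.con (+ 0)) ≡.refl (sgn s))
negBinom-step (suc N) s = ≡.trans
  (≡.cong₂ (λ c n → ℤ.-1ℤ ℤ.* sgn s ℤ.* + c ℤ.+ sgn s ℤ.* + (n C s)) (≡.sym (nCk+nC[k+1]≡[n+1]C[k+1] (N ℕ.+ suc s) s)) (≡.sym (ℕP.+-suc N s)))
  (ℤ-solver.solve 3 (λ σ c d → ℤ-solver.con ℤ.-1ℤ ℤ-solver.:* σ ℤ-solver.:* (c ℤ-solver.:+ d) ℤ-solver.:+ σ ℤ-solver.:* c ℤ-solver.:= ℤ-solver.con ℤ.-1ℤ ℤ-solver.:* σ ℤ-solver.:* d)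
    ≡.refl (sgn s) (+ ((N ℕ.+ suc s) C s)) (+ ((N ℕ.+ suc s) C suc s)))

power-low : ∀ n y → y 0 ≡ + 0 → Agree n (y 𝕊.^ n) 0PS
power-low (suc n) y y-0 zero    _         = ≡.trans (⊠-0 y (y 𝕊.^ n)) (≡.trans (≡.cong (ℤ._* (y 𝕊.^ n) 0) y-0) (≡.sym (0PS-coefficient 0)))
power-low (suc n) y y-0 (suc i) (s≤s i<n) = ≡.trans (⊠-suc y (y 𝕊.^ n) i) (≡.trans (≡.cong₂ ℤ._+_ (≡.cong (ℤ._* (y 𝕊.^ n) (suc i)) y-0)
    (≡.trans (agree-⊠ n {tail y} {tail y} {y 𝕊.^ n} {0PS} (λ _ _ → ≡.refl) (power-low n y y-0) i i<n) (≡.trans (at (𝕊.zeroʳ (tail y)) i) (0PS-coefficient i))))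
  (≡.sym (0PS-coefficient (suc i))))

module NegativeBinomial (y g : PS) (y-0 : y 0 ≡ + 0) (inverse : (onePS ⊞ y) ⊠ g ≋ onePS) (M : ℕ) where
  private
    truncated : ℕ → PS
    truncated N = ∑𝕊.∑ (suc M) (λ s → conPS (negBinom N s) ⊠ y 𝕊.^ s)

    head : ∀ N → truncated N ≋ onePS ⊞ ∑𝕊.∑ M (λ s → conPS (negBinom N (suc s)) ⊠ y 𝕊.^ suc s)
    head N = 𝕊.trans (∑𝕊.∑-head M (λ s → conPS (negBinom N s) ⊠ y 𝕊.^ s)) (𝕊.+-congʳ (𝕊.trans (𝕊.*-identityʳ (conPS (negBinom N 0)))
      (𝕊.trans (𝕊.reflexive (≡.cong conPS (negBinom-0 N))) 𝕊.con-1)))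

    multiply : ∀ N → (onePS ⊞ y) ⊠ truncated (suc N) ≋ truncated N ⊞ conPS (negBinom (suc N) M) ⊠ y 𝕊.^ suc M
    multiply N = begin
      (onePS ⊞ y) ⊠ truncated (suc N)                                  ≈⟨ 𝕊.distribʳ (truncated (suc N)) onePS y ⟩
      onePS ⊠ truncated (suc N) ⊞ y ⊠ truncated (suc N)                ≈⟨ 𝕊.+-cong (𝕊.trans (𝕊.*-identityˡ (truncated (suc N))) (head (suc N))) shifted ⟩
      onePS ⊞ ∑𝕊.∑ M (upper (suc N)) ⊞ (∑𝕊.∑ M lower ⊞ lower M)          ≈⟨ solve 4 (λ a x y z → a :+ x :+ (y :+ z) := a :+ (x :+ y) :+ z) 𝕊.refl onePS (∑𝕊.∑ M (upper (suc N))) (∑𝕊.∑ M lower) (lower M) ⟩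
      onePS ⊞ (∑𝕊.∑ M (upper (suc N)) ⊞ ∑𝕊.∑ M lower) ⊞ lower M          ≈⟨ 𝕊.+-congʳ (𝕊.+-congˡ (𝕊.sym (∑𝕊.∑-+ M (upper (suc N)) lower))) ⟩
      onePS ⊞ ∑𝕊.∑ M (λ s → upper (suc N) s ⊞ lower s) ⊞ lower M         ≈⟨ 𝕊.+-congʳ (𝕊.+-congˡ (∑𝕊.∑-cong M (λ s _ → 𝕊.trans (𝕊.sym (𝕊.distribʳ (y 𝕊.^ suc s) (conPS (negBinom (suc N) (suc s))) (conPS (negBinom (suc N) s))))
                                                                            (𝕊.*-congʳ (𝕊.trans (𝕊.sym (𝕊.con-+ (negBinom (suc N) (suc s)) (negBinom (suc N) s))) (𝕊.reflexive (≡.cong conPS (negBinom-step N s)))))))) ⟩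
      onePS ⊞ ∑𝕊.∑ M (upper N) ⊞ lower M                                ≈⟨ 𝕊.+-congʳ (𝕊.sym (head N)) ⟩
      truncated N ⊞ lower M                                           ∎
      where
      open 𝕊.≈-Reasoning
      open 𝕊.Solver using (solve; _:=_; _:+_; _:*_)
      upper : ℕ → ℕ → PS
      upper N s = conPS (negBinom N (suc s)) ⊠ y 𝕊.^ suc s
      lower : ℕ → PS
      lower s = conPS (negBinom (suc N) s) ⊠ y 𝕊.^ suc s
      shifted : y ⊠ truncated (suc N) ≋ ∑𝕊.∑ (suc M) lower
      shifted = 𝕊.trans (∑𝕊.*-∑ (suc M) y (λ s → conPS (negBinom (suc N) s) ⊠ y 𝕊.^ s)) (∑𝕊.∑-cong (suc M) (λ s _ →
        solve 3 (λ y c p → y :* (c :* p) := c :* (y :* p)) 𝕊.refl y (conPS (negBinom (suc N) s)) (y 𝕊.^ s)))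

    step : ∀ N → Agree (suc M) ((onePS ⊞ y) ⊠ truncated (suc N)) (truncated N)
    step N i lt = ≡.trans (at (multiply N) i) (agree-⊞-0ʳ (suc M) {truncated N} {conPS (negBinom (suc N) M) ⊠ y 𝕊.^ suc M} {truncated N} (λ _ _ → ≡.refl)
      (λ i lt → ≡.trans (con-at (negBinom (suc N) M) (≡.trans (power-low (suc M) y y-0 i lt) (0PS-coefficient i))) (≡.trans (ℤP.*-zeroʳ (negBinom (suc N) M)) (≡.sym (0PS-coefficient i)))) i lt)

    -- Each multiplication by g undoes one factor 1 + y. The truncation after y^M is harmless below
    -- degree M + 1, because y has no constant term.
    agree : ∀ N → Agree (suc M) (g 𝕊.^ N) (truncated N)
    agree zero    i lt = at (𝕊.sym (𝕊.trans (head 0) (𝕊.trans (𝕊.+-congˡ (∑𝕊.∑-0 M (λ s _ → 𝕊.trans (𝕊.*-congʳ 𝕊.con-0) (𝕊.zeroˡ (y 𝕊.^ suc s))))) (𝕊.+-identityʳ onePS)))) i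
    agree (suc N) i lt = ≡.trans (agree-⊠ (suc M) {g} {g} {g 𝕊.^ N} {truncated N} (λ _ _ → ≡.refl) (agree N) i lt)
      (≡.trans (agree-⊠ (suc M) {g} {g} {truncated N} {(onePS ⊞ y) ⊠ truncated (suc N)} (λ _ _ → ≡.refl) (λ i lt → ≡.sym (step N i lt)) i lt)
        (at (𝕊.trans (𝕊.sym (𝕊.*-assoc g (onePS ⊞ y) (truncated (suc N)))) (𝕊.trans (𝕊.*-congʳ (𝕊.trans (𝕊.*-comm g (onePS ⊞ y)) inverse)) (𝕊.*-identityˡ (truncated (suc N))))) i))

  inverse-power : ∀ N → (g 𝕊.^ N) M ≡ ∑ℤ (suc M) (λ s → negBinom N s ℤ.* (y 𝕊.^ s) M)
  inverse-power N = ≡.trans (agree N M ℕP.≤-refl) (≡.trans (∑𝕊-coefficient (suc M) (λ s → conPS (negBinom N s) ⊠ y 𝕊.^ s) M)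
    (∑ℤ.∑-cong (suc M) (λ s _ → con-⊠ (negBinom N s) (y 𝕊.^ s) M)))

  θ-power : ∀ s → + suc s ℤ.* (y 𝕊.^ s ⊠ θ y) M ≡ + M ℤ.* (y 𝕊.^ suc s) M
  θ-power s = ≡.trans (≡.sym (con-⊠ (+ suc s) (y 𝕊.^ s ⊠ θ y) M)) (≡.trans (at (𝕊.sym (Powers.∂-^ PS-differential y s)) M) (θ-coefficient (y 𝕊.^ suc s) M))

  -- The geometric series for 1/(1 + y). Its term u = M drops out: M + 1 times its coefficient is M
  -- times that of y^(M+1) in degree M, which is zero.
  logarithmic-derivative : (θ y ⊠ g) M ≡ ∑ℤ M (λ u → sgn u ℤ.* (y 𝕊.^ u ⊠ θ y) M)
  logarithmic-derivative = begin
    (θ y ⊠ g) M                                       ≡⟨ agree-⊠ (suc M) {θ y} {θ y} {g} {truncated 1} (λ _ _ → ≡.refl) (λ i lt → ≡.trans (≡.sym (at (𝕊.*-identityʳ g) i)) (agree 1 i lt)) M ℕP.≤-refl ⟩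
    (θ y ⊠ truncated 1) M                             ≡⟨ at (∑𝕊.*-∑ (suc M) (θ y) (λ s → conPS (negBinom 1 s) ⊠ y 𝕊.^ s)) M ⟩
    ∑𝕊.∑ (suc M) (λ s → θ y ⊠ (conPS (negBinom 1 s) ⊠ y 𝕊.^ s)) M  ≡⟨ ∑𝕊-coefficient (suc M) (λ s → θ y ⊠ (conPS (negBinom 1 s) ⊠ y 𝕊.^ s)) M ⟩
    ∑ℤ (suc M) (λ s → (θ y ⊠ (conPS (negBinom 1 s) ⊠ y 𝕊.^ s)) M)   ≡⟨ ∑ℤ.∑-cong (suc M) (λ s _ → ≡.trans (at (solve 3 (λ z c p → z :* (c :* p) := c :* (p :* z)) 𝕊.refl (θ y) (conPS (negBinom 1 s)) (y 𝕊.^ s)) M)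
                                                            (≡.trans (con-⊠ (negBinom 1 s) (y 𝕊.^ s ⊠ θ y) M) (≡.cong (ℤ._* (y 𝕊.^ s ⊠ θ y) M) (negBinom-1 s)))) ⟩
    ∑ℤ (suc M) (λ s → sgn s ℤ.* (y 𝕊.^ s ⊠ θ y) M)    ≡⟨ ≡.trans (≡.cong (λ z → ∑ℤ M (λ s → sgn s ℤ.* (y 𝕊.^ s ⊠ θ y) M) ℤ.+ z) (≡.trans (≡.cong (sgn M ℤ.*_) last) (ℤP.*-zeroʳ (sgn M)))) (ℤP.+-identityʳ (∑ℤ M (λ s → sgn s ℤ.* (y 𝕊.^ s ⊠ θ y) M))) ⟩
    ∑ℤ M (λ u → sgn u ℤ.* (y 𝕊.^ u ⊠ θ y) M)          ∎
    where
    open ≡.≡-Reasoning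
    open 𝕊.Solver using (solve; _:=_; _:+_; _:*_)
    last : (y 𝕊.^ M ⊠ θ y) M ≡ + 0
    last = ℤP.*-cancelˡ-≡ (+ suc M) ((y 𝕊.^ M ⊠ θ y) M) (+ 0) (≡.trans (θ-power M) (≡.trans (≡.cong (+ M ℤ.*_) (≡.trans (power-low (suc M) y y-0 M ℕP.≤-refl) (0PS-coefficient M)))
      (≡.trans (ℤP.*-zeroʳ (+ M)) (≡.sym (ℤP.*-zeroʳ (+ suc M))))))

-- The sum over tuples as a sum over total multiplicities.

module ℕ-solver = Data.Nat.Solver.+-*-Solver

sumL-filter : ∀ {A : Set} (p : A → Bool) xs f → sumL (filterᵇ p xs) f ≡ sumL xs (λ x → ⟪ p x ⟫ f x)
sumL-filter p []       f = ≡.refl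
sumL-filter p (x ∷ xs) f with p x
... | true  = ≡.cong (λ z → f x ℤ.+ z) (sumL-filter p xs f)
... | false = ≡.trans (sumL-filter p xs f) (≡.sym (ℤP.+-identityˡ (sumL xs (λ x → ⟪ p x ⟫ f x))))

multinomial-factProd : ∀ {n} (t : Vec ℕ n) → multinomial t ℕ.* factProd t ≡ Vec.sum t !
multinomial-factProd []      = ≡.refl
multinomial-factProd (k ∷ t) = begin
  ((k ℕ.+ σ) C k) ℕ.* multinomial t ℕ.* (k ! ℕ.* factProd t)    ≡⟨ swap ((k ℕ.+ σ) C k) (multinomial t) (k !) (factProd t) ⟩
  multinomial t ℕ.* factProd t ℕ.* (k ! ℕ.* ((k ℕ.+ σ) C k))    ≡⟨ ≡.cong₂ (λ p n → p ℕ.* (k ! ℕ.* (n C k))) (multinomial-factProd t) (ℕP.+-comm k σ) ⟩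
  σ ! ℕ.* (k ! ℕ.* ((σ ℕ.+ k) C k))                             ≡⟨ C-factorial σ k ⟨
  (σ ℕ.+ k) !                                                   ≡⟨ ≡.cong _! (ℕP.+-comm σ k) ⟩
  (k ℕ.+ σ) !                                                   ∎
  where
  open ≡.≡-Reasoning
  σ : ℕ
  σ = Vec.sum t
  swap : ∀ a b c d → a ℕ.* b ℕ.* (c ℕ.* d) ≡ b ℕ.* d ℕ.* (c ℕ.* a)
  swap = ℕ-solver.solve 4 (λ a b c d → a ℕ-solver.:* b ℕ-solver.:* (c ℕ-solver.:* d) ℕ-solver.:= b ℕ-solver.:* d ℕ-solver.:* (c ℕ-solver.:* a)) ≡.refl

-- All parts are at least 1. The consequence u < m is what makes u + 1 a divisor of m!.
sum≤weight : ∀ {n} p (r t : Vec ℕ n) → IsTrue (incFrom p r) → Vec.sum t ≤ weight r t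
sum≤weight p []      []      _ = z≤n
sum≤weight p (x ∷ r) (k ∷ t) i = ℕP.+-mono-≤ (ℕP.m≤m*n k x {{ℕ.>-nonZero (ℕP.≤-<-trans z≤n (ℕP.<ᵇ⇒< p x (proj₁ both)))}}) (sum≤weight x r t (proj₂ both))
  where
  both = ∧-elim (p ℕ.<ᵇ x) (incFrom x r) i

/-+ : ∀ a b D .{{_ : ℕ.NonZero D}} → a ℚ./ D ℚ.+ b ℚ./ D ≡ (a ℤ.+ b) ℚ./ D
/-+ a b (suc D) = ℚP.toℚᵘ-injective (ℚᵘP.≃-trans (ℚP.toℚᵘ-homo-+ (a ℚ./ suc D) (b ℚ./ suc D)) (ℚᵘP.≃-trans
  (ℚᵘP.+-cong (ℚP.toℚᵘ-fromℚᵘ (ℚᵘ.mkℚᵘ a D)) (ℚP.toℚᵘ-fromℚᵘ (ℚᵘ.mkℚᵘ b D)))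
  (ℚᵘP.≃-trans (ℚᵘ.*≡* (≡.trans (distribute a b (+ suc D)) (≡.cong ((a ℤ.+ b) ℤ.*_) (≡.sym (ℤP.pos-* (suc D) (suc D)))))) (ℚᵘP.≃-sym (ℚP.toℚᵘ-fromℚᵘ (ℚᵘ.mkℚᵘ (a ℤ.+ b) D))))))
  where
  distribute : ∀ a b d → (a ℤ.* d ℤ.+ b ℤ.* d) ℤ.* d ≡ (a ℤ.+ b) ℤ.* (d ℤ.* d)
  distribute = ℤ-solver.solve 3 (λ a b d → (a ℤ-solver.:* d ℤ-solver.:+ b ℤ-solver.:* d) ℤ-solver.:* d ℤ-solver.:= (a ℤ-solver.:+ b) ℤ-solver.:* (d ℤ-solver.:* d)) ≡.refl

sumℚ-/ : ∀ {A : Set} (xs : List A) (x y : A → ℤ) (d : A → ℕ) (d≢0 : ∀ τ → ℕ.NonZero (d τ)) D .{{_ : ℕ.NonZero D}} →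
  (∀ τ → τ ∈ xs → x τ ℤ.* + D ≡ y τ ℤ.* + d τ) → sumℚ xs (λ τ → ℚ._/_ (x τ) (d τ) {{d≢0 τ}}) ≡ sumL xs y ℚ./ D
sumℚ-/ []       x y d d≢0 D eq = /-cross (+ 0) 1 (+ 0) D ≡.refl
sumℚ-/ (τ ∷ τs) x y d d≢0 D eq = ≡.trans (≡.cong₂ ℚ._+_ (/-cross (x τ) (d τ) (y τ) D {{d≢0 τ}} (eq τ (here ≡.refl))) (sumℚ-/ τs x y d d≢0 D (λ τ τ∈ → eq τ (there τ∈))))
  (/-+ (y τ) (sumL τs y) D)

module PowerCount (γ : ℕ → ℤ) (m : ℕ) (x : PS) (x-0 : x 0 ≡ + 0) (x≡γ : ∀ i → 0 < i → x i ≡ γ i) where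
  open Compositions γ m
  open Enumeration γ m

  private
    β-at : ∀ j i → β j i ≡ γ j ℤ.* (q 𝕊.^ j) i
    β-at j i = con-⊠ (γ j) (q 𝕊.^ j) i

    q^-same : ∀ j → (q 𝕊.^ j) j ≡ + 1
    q^-same j = ≡.trans (≡.sym (at (𝕊.*-identityʳ (q 𝕊.^ j)) j)) (≡.trans (≡.cong (q 𝕊.^ j ⊠ onePS) (≡.sym (ℕP.+-identityʳ j))) (q^⊠-high j onePS 0))

    q^-other : ∀ j i → i ≢ j → (q 𝕊.^ j) i ≡ + 0
    q^-other j i i≢j = ≡.trans (≡.sym (at (𝕊.*-identityʳ (q 𝕊.^ j)) i)) (case i ℕP.<? j of λ
      { (yes i<j) → q^⊠-low j onePS i i<j
      ; (no i≮j) → positive (i ∸ j) (ℕP.m+[n∸m]≡n (ℕP.≮⇒≥ i≮j)) })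
      where
      positive : ∀ d → j ℕ.+ d ≡ i → (q 𝕊.^ j ⊠ onePS) i ≡ + 0
      positive zero    eq = contradiction (≡.trans (≡.sym eq) (ℕP.+-identityʳ j)) i≢j
      positive (suc d) eq = ≡.trans (≡.cong (q 𝕊.^ j ⊠ onePS) (≡.sym eq)) (q^⊠-high j onePS (suc d))

    tailSum≡ : Agree (suc m) (tailSum m) x
    tailSum≡ i (s≤s i≤m) = ≡.trans (∑𝕊-coefficient m (λ j → β (m ∸ j)) i) (value i i≤m)
      where
      value : ∀ i → i ≤ m → ∑ℤ m (λ j → β (m ∸ j) i) ≡ x i
      value zero    _   = ≡.trans (∑ℤ.∑-0 m (λ j j<m → ≡.trans (β-at (m ∸ j) 0) (≡.trans (≡.cong (γ (m ∸ j) ℤ.*_) (q^-other (m ∸ j) 0 (ℕP.<⇒≢ (ℕP.m<n⇒0<n∸m j<m)))) (ℤP.*-zeroʳ (γ (m ∸ j)))))) (≡.sym x-0)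
      value (suc i) i<m = ≡.trans (∑ℤ.∑-single m (m ∸ suc i) (ℕP.∸-monoʳ-< (s≤s z≤n) i<m)
          (λ j j<m j≢ → ≡.trans (β-at (m ∸ j) (suc i)) (≡.trans (≡.cong (γ (m ∸ j) ℤ.*_) (q^-other (m ∸ j) (suc i) (λ eq → j≢ (≡.trans (≡.sym (ℕP.m∸[m∸n]≡n (ℕP.<⇒≤ j<m))) (≡.cong (m ∸_) (≡.sym eq)))))) (ℤP.*-zeroʳ (γ (m ∸ j))))))
        (≡.trans (≡.cong (λ j → β j (suc i)) (ℕP.m∸[m∸n]≡n i<m)) (≡.trans (β-at (suc i) (suc i)) (≡.trans (≡.cong (γ (suc i) ℤ.*_) (q^-same (suc i))) (≡.trans (ℤP.*-identityʳ (γ (suc i))) (≡.sym (x≡γ (suc i) (s≤s z≤n)))))))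

  -- Parts above m cannot occur in degree m, so x may replace the sum of its terms of degree 1 to m.
  -- The total is taken from one part on, since no empty tuple has positive multiplicity.
  count-total : ∀ u → ∑ℤ m (λ n → count (suc n) 0 m (suc u)) ≡ (x 𝕊.^ suc u) m
  count-total u = begin
    ∑ℤ m (λ n → count (suc n) 0 m (suc u))     ≡⟨ ∑ℤ.∑-cong m (λ n _ → count≡parts (suc n) 0 m (suc u)) ⟩
    ∑ℤ m (λ n → parts (suc n) m (suc u) m)     ≡⟨ ∑𝕊-coefficient m (λ n → parts (suc n) m (suc u)) m ⟨
    ∑𝕊.∑ m (λ n → parts (suc n) m (suc u)) m   ≡⟨ at (𝕊.trans (∑𝕊.∑-head m (λ n → parts n m (suc u))) (𝕊.+-identityˡ (∑𝕊.∑ m (λ n → parts (suc n) m (suc u))))) m ⟨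
    total m m (suc u) m                        ≡⟨ total-agree m m (suc u) ℕP.≤-refl ℕP.≤-refl m ℕP.≤-refl ⟩
    (tailSum m 𝕊.^ suc u) m                    ≡⟨ agree-^ (suc m) (suc u) {tailSum m} {x} tailSum≡ m ℕP.≤-refl ⟩
    (x 𝕊.^ suc u) m                            ∎
    where open ≡.≡-Reasoning

-- The numerator over the common denominator m! that corresponds to 1/(u + 1).
E! : ℕ → ℕ → ℕ
E! m u = m ! ℕ./ suc u

E!-suc : ∀ m u → u < m → E! m u ℕ.* suc u ≡ m !
E!-suc m u u<m = m/n*n≡m (∣-trans (m∣m*n (u !)) (m≤n⇒m!∣n! u<m))

-- With y τ the term of τ scaled by m!, the fibre over Σ tᵢ = u + 1 is summed by the multinomial theorem.
module TupleSum (m : ℕ) (0<m : 0 < m) (κ : ℕ → ℕ) where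
  private
    ψ : ℕ → ℤ
    ψ u = sgn u ℤ.* + (E! m u ℕ.* κ u)

  y : Tuple → ℤ
  y τ@(n , r , t) = ψ (uOf τ) ℤ.* (+ multinomial t ℤ.* cProd τ)

  -- u!/∏tᵢ! is the multinomial coefficient divided by u + 1, and 1/(u + 1) is `E!` over m!.
  cleared : (f : ℕ → ℕ) → (∀ u → f u ≡ u ! ℕ.* κ u) → ∀ τ → τ ∈ 𝒫 m → (sgn (uOf τ) ℤ.* + f (uOf τ) ℤ.* cProd τ) ℤ.* + (m !) ≡ y τ ℤ.* + tFact τ
  cleared f f≡ τ@(n , r , t) τ∈ = cross-multiply (sgn (uOf τ)) (cProd τ) (f (uOf τ)) (m !) (E! m (uOf τ) ℕ.* κ (uOf τ)) (multinomial t) (factProd t) (begin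
    f v ℕ.* m !                                                 ≡⟨ ≡.cong₂ ℕ._*_ (f≡ v) (≡.sym (E!-suc m v v<m)) ⟩
    v ! ℕ.* κ v ℕ.* (E! m v ℕ.* suc v)                          ≡⟨ rearrange (v !) (κ v) (E! m v) (suc v) ⟩
    E! m v ℕ.* κ v ℕ.* (suc v ℕ.* v !)                          ≡⟨ ≡.cong (λ n → E! m v ℕ.* κ v ℕ.* n !) (≡.sym sum≡) ⟩
    E! m v ℕ.* κ v ℕ.* Vec.sum t !                              ≡⟨ ≡.cong (E! m v ℕ.* κ v ℕ.*_) (multinomial-factProd t) ⟨
    E! m v ℕ.* κ v ℕ.* (multinomial t ℕ.* factProd t)           ∎)
    where
    open ≡.≡-Reasoning
    v : ℕ
    v = uOf τ
    p : IsTrue (inP m τ)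
    p = 𝒫-member m τ τ∈
    sum≡ : Vec.sum t ≡ suc v
    sum≡ = inP-sum m n r t 0<m p
    v<m : v < m
    v<m = ≡.subst (_≤ m) sum≡ (≡.subst (Vec.sum t ≤_) (inP-weight m n r t p) (sum≤weight 0 r t (proj₁ (∧-elim (incFrom 0 r) _ (proj₂ (∧-elim (0 ℕ.<ᵇ n) _ p))))))
    rearrange : ∀ a k e s → a ℕ.* k ℕ.* (e ℕ.* s) ≡ e ℕ.* k ℕ.* (s ℕ.* a)
    rearrange = ℕ-solver.solve 4 (λ a k e s → a ℕ-solver.:* k ℕ-solver.:* (e ℕ-solver.:* s) ℕ-solver.:= e ℕ-solver.:* k ℕ-solver.:* (s ℕ-solver.:* a)) ≡.refl
    cross-multiply : ∀ σ c f d e μ φ → f ℕ.* d ≡ e ℕ.* (μ ℕ.* φ) → (σ ℤ.* + f ℤ.* c) ℤ.* + d ≡ σ ℤ.* + e ℤ.* (+ μ ℤ.* c) ℤ.* + φ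
    cross-multiply σ c f d e μ φ eq = ≡.trans (ℤ-solver.solve 4 (λ σ f c d → σ ℤ-solver.:* f ℤ-solver.:* c ℤ-solver.:* d ℤ-solver.:= σ ℤ-solver.:* c ℤ-solver.:* (f ℤ-solver.:* d)) ≡.refl σ (+ f) c (+ d))
      (≡.trans (≡.cong (λ z → σ ℤ.* c ℤ.* z) (≡.trans (≡.sym (ℤP.pos-* f d)) (≡.trans (≡.cong +_ eq) (≡.trans (ℤP.pos-* e (μ ℕ.* φ)) (≡.cong (+ e ℤ.*_) (ℤP.pos-* μ φ))))))
        (ℤ-solver.solve 5 (λ σ c e μ φ → σ ℤ-solver.:* c ℤ-solver.:* (e ℤ-solver.:* (μ ℤ-solver.:* φ)) ℤ-solver.:= σ ℤ-solver.:* e ℤ-solver.:* (μ ℤ-solver.:* c) ℤ-solver.:* φ) ≡.refl σ c (+ e) (+ μ) (+ φ)))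

  open Enumeration c′ m

  sumL-𝒫 : ∀ (f : Tuple → ℤ) → sumL (𝒫 m) f ≡ ∑ℤ m (λ n → sumL (box (suc n)) (λ r → sumL (box (suc n)) (λ t → ⟪ inP m (suc n , r , t) ⟫ f (suc n , r , t))))
  sumL-𝒫 f = ≡.trans (sumL-filter (inP m) (concatMap tuples (map suc (upTo m))) f) (≡.trans
    (sumL-concatMap (map suc (upTo m)) tuples g) (≡.trans
    (sumL-range m (λ n → sumL (tuples n) g))
    (∑ℤ.∑-cong m (λ n _ → ≡.trans (sumL-concatMap (box (suc n)) (λ r → map (λ t → (suc n , r , t)) (box (suc n))) g)
      (sumL-cong (box (suc n)) (λ r → sumL-map (box (suc n)) (λ t → (suc n , r , t)) g))))))
    where
    tuples : ℕ → List Tuple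
    tuples n = concatMap (λ r → map (λ t → (n , r , t)) (box n)) (box n)
    g : Tuple → ℤ
    g τ = ⟪ inP m τ ⟫ f τ

  private
    -- A tuple meets the sum over u exactly once, at u = σ - 1; the bound σ ≤ m places this value
    -- inside the range.
    fibres : ∀ A B W σ (φ : ℕ → ℤ) z → (IsTrue (A ∧ B ∧ W) → σ ≡ suc (σ ∸ 1) × σ ≤ m) →
      ⟪ A ∧ B ∧ W ⟫ (φ (σ ∸ 1) ℤ.* z) ≡ ∑ℤ m (λ u → φ u ℤ.* ⟪ A ∧ B ∧ W ∧ (σ ℕ.≡ᵇ suc u) ⟫ z)
    fibres true true true σ φ z p = ≡.sym (≡.trans (∑ℤ.∑-single m (σ ∸ 1) (≡.subst (_≤ m) (proj₁ (p tt)) (proj₂ (p tt)))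
        (λ u _ u≢ → ≡.trans (≡.cong (λ b → φ u ℤ.* ⟪ b ⟫ z) (≡ᵇ-false σ (suc u) (λ eq → u≢ (≡.sym (≡.cong (_∸ 1) eq))))) (ℤP.*-zeroʳ (φ u))))
      (≡.cong (λ b → φ (σ ∸ 1) ℤ.* ⟪ b ⟫ z) (≡ᵇ-true σ (suc (σ ∸ 1)) (proj₁ (p tt)))))
      where
      ≡ᵇ-true : ∀ a b → a ≡ b → (a ℕ.≡ᵇ b) ≡ true
      ≡ᵇ-true zero    zero    _  = ≡.refl
      ≡ᵇ-true (suc a) (suc b) eq = ≡ᵇ-true a b (ℕP.suc-injective eq)
      ≡ᵇ-false : ∀ a b → a ≢ b → (a ℕ.≡ᵇ b) ≡ false
      ≡ᵇ-false zero    zero    ne = contradiction ≡.refl ne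
      ≡ᵇ-false zero    (suc b) _  = ≡.refl
      ≡ᵇ-false (suc a) zero    _  = ≡.refl
      ≡ᵇ-false (suc a) (suc b) ne = ≡ᵇ-false a b (ne ∘ ≡.cong suc)
    fibres true true false σ φ z p = ≡.sym (∑ℤ.∑-0 m (λ u _ → ℤP.*-zeroʳ (φ u)))
    fibres true false W σ φ z p = ≡.sym (∑ℤ.∑-0 m (λ u _ → ℤP.*-zeroʳ (φ u)))
    fibres false B W σ φ z p = ≡.sym (∑ℤ.∑-0 m (λ u _ → ℤP.*-zeroʳ (φ u)))

  sum-by-multiplicity : sumL (𝒫 m) y ≡ ∑ℤ m (λ u → ψ u ℤ.* ∑ℤ m (λ n → count (suc n) 0 m (suc u)))
  sum-by-multiplicity = begin
    sumL (𝒫 m) y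
      ≡⟨ sumL-𝒫 y ⟩
    ∑ℤ m (λ n → sumL (box (suc n)) (λ r → sumL (box (suc n)) (λ t → ⟪ inP m (suc n , r , t) ⟫ y (suc n , r , t))))
      ≡⟨ ∑ℤ.∑-cong m (λ n _ → ≡.trans (sumL-cong (box (suc n)) (λ r → ≡.trans (sumL-cong (box (suc n)) (λ t →
           fibres (incFrom 0 r) (allPos t) (weight r t ℕ.≡ᵇ m) (Vec.sum t) ψ (+ multinomial t ℤ.* cProd (suc n , r , t))
             (λ p → inP-sum m (suc n) r t 0<m p , ≡.subst (Vec.sum t ≤_) (inP-weight m (suc n) r t p) (sum≤weight 0 r t (proj₁ (∧-elim (incFrom 0 r) _ p))))))
           (≡.trans (sumL-∑ (box (suc n)) m (λ t u → ψ u ℤ.* contribution 0 m (suc u) r t)) (∑ℤ.∑-cong m (λ u _ → ≡.sym (*-sumL (box (suc n)) (ψ u) (contribution 0 m (suc u) r)))))))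
         (≡.trans (sumL-∑ (box (suc n)) m (λ r u → ψ u ℤ.* sumL (box (suc n)) (contribution 0 m (suc u) r)))
           (∑ℤ.∑-cong m (λ u _ → ≡.sym (*-sumL (box (suc n)) (ψ u) (λ r → sumL (box (suc n)) (contribution 0 m (suc u) r))))))) ⟩
    ∑ℤ m (λ n → ∑ℤ m (λ u → ψ u ℤ.* count (suc n) 0 m (suc u)))
      ≡⟨ ∑ℤ.∑-swap m m (λ n u → ψ u ℤ.* count (suc n) 0 m (suc u)) ⟩
    ∑ℤ m (λ u → ∑ℤ m (λ n → ψ u ℤ.* count (suc n) 0 m (suc u)))
      ≡⟨ ∑ℤ.∑-cong m (λ u _ → ≡.sym (∑ℤ.*-∑ m (ψ u) (λ n → count (suc n) 0 m (suc u)))) ⟩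
    ∑ℤ m (λ u → ψ u ℤ.* ∑ℤ m (λ n → count (suc n) 0 m (suc u))) ∎
    where open ≡.≡-Reasoning

  module _ (x : PS) (x-0 : x 0 ≡ + 0) (x≡c′ : ∀ i → 0 < i → x i ≡ c′ i) where
    tuple-sum : (f : ℕ → ℕ) → (∀ u → f u ≡ u ! ℕ.* κ u) → ∀ v → ∑ℤ m (λ u → ψ u ℤ.* (x 𝕊.^ suc u) m) ≡ v ℤ.* + (m !) →
      v ℚ./ 1 ≡ sumℚ (𝒫 m) (λ τ → (sgn (uOf τ) ℤ.* + f (uOf τ) ℤ.* cProd τ) /tFact τ)
    tuple-sum f f≡ v eq = ≡.sym (≡.trans (sumℚ-/ (𝒫 m) (λ τ → sgn (uOf τ) ℤ.* + f (uOf τ) ℤ.* cProd τ) y tFact tFact≢0 (m !) {{m !≢0}} (cleared f f≡))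
      (/-cross (sumL (𝒫 m) y) (m !) v 1 {{m !≢0}} (≡.trans (ℤP.*-identityʳ (sumL (𝒫 m) y)) (≡.trans sum-by-multiplicity (≡.trans
        (∑ℤ.∑-cong m (λ u _ → ≡.cong (ψ u ℤ.*_) (PowerCount.count-total c′ m x x-0 x≡c′ u))) eq)))))

-- Both sides, multiplied by N! u!, are (N + 1 + u)!. This exchanges the binomial coefficient of the
-- stated formula for the one of the negative binomial series.
C-absorb : ∀ N u → suc N ℕ.* ((suc N ℕ.+ u) C u) ≡ suc u ℕ.* ((N ℕ.+ suc u) C suc u)
C-absorb N u = ℕP.*-cancelˡ-≡ (suc N ℕ.* c₁) (suc u ℕ.* c₂) (N ! ℕ.* u !) {{ℕP.m*n≢0 (N !) (u !) {{N !≢0}} {{u !≢0}}}} (begin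
  N ! ℕ.* u ! ℕ.* (suc N ℕ.* c₁)      ≡⟨ left (N !) (u !) (suc N) c₁ ⟩
  suc N ! ℕ.* (u ! ℕ.* c₁)            ≡⟨ C-factorial (suc N) u ⟨
  (suc N ℕ.+ u) !                     ≡⟨ ≡.cong _! (ℕP.+-suc N u) ⟨
  (N ℕ.+ suc u) !                     ≡⟨ C-factorial N (suc u) ⟩
  N ! ℕ.* (suc u ! ℕ.* c₂)            ≡⟨ right (N !) (u !) (suc u) c₂ ⟩
  N ! ℕ.* u ! ℕ.* (suc u ℕ.* c₂)      ∎)
  where
  open ≡.≡-Reasoning
  open ℕ-solver using (solve; _:=_; _:*_)
  c₁ c₂ : ℕ
  c₁ = (suc N ℕ.+ u) C u
  c₂ = (N ℕ.+ suc u) C suc u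
  left : ∀ a b n c → a ℕ.* b ℕ.* (n ℕ.* c) ≡ n ℕ.* a ℕ.* (b ℕ.* c)
  left = solve 4 (λ a b n c → a :* b :* (n :* c) := n :* a :* (b :* c)) ≡.refl
  right : ∀ a b n c → a ℕ.* (n ℕ.* b ℕ.* c) ≡ a ℕ.* b ℕ.* (n ℕ.* c)
  right = solve 4 (λ a b n c → a :* (n :* b :* c) := a :* b :* (n :* c)) ≡.refl

module Unipotent (f g : PS) (f-0 : f 0 ≡ + 1) (g⊠f : g ⊠ f ≋ onePS) where
  y : PS
  y = f 𝕊.- onePS

  y-0 : y 0 ≡ + 0
  y-0 = ⊞-at {f} {⊟ onePS} f-0 (⊟-coefficient onePS 0)

  y-suc : ∀ i → 0 < i → y i ≡ f i
  y-suc (suc i) _ = ≡.trans (⊞-at {f} {⊟ onePS} {suc i} ≡.refl (⊟-coefficient onePS (suc i))) (ℤP.+-identityʳ (f (suc i)))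

  1+y : onePS ⊞ y ≋ f
  1+y = solve 2 (λ a f → a :+ (f :- a) := f) 𝕊.refl onePS f
    where open 𝕊.Solver using (solve; _:=_; _:+_; _:-_)

  θy : θ y ≋ θ f
  θy = 𝕊.trans (𝕊.trans (𝕊.sym (𝕊.+-identityˡ (θ y))) (𝕊.+-congʳ (𝕊.sym ∂-1))) (𝕊.trans (𝕊.sym (∂-+ onePS y)) (θ-cong 1+y))
    where open DifferentialAlgebra PS-differential using (∂-1; ∂-+)

  inverse : (onePS ⊞ y) ⊠ g ≋ onePS
  inverse = 𝕊.trans (𝕊.*-congʳ 1+y) (𝕊.trans (𝕊.*-comm f g) g⊠f)

  module _ (M : ℕ) where
    open NegativeBinomial y g y-0 inverse M

    -- Everything is multiplied by N + 1, so that no division occurs. `C-absorb` turns this factor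
    -- into u + 1, which completes `E!` to M!, and the shift from s = u + 1 to u supplies the sign;
    -- the term s = 0 vanishes because M > 0.
    power-sum : ∀ N ℓ v → 0 < M → + suc N ℤ.* v ≡ ℤ.- (+ ℓ ℤ.* (g 𝕊.^ suc N) M) →
      ∑ℤ M (λ u → sgn u ℤ.* + (E! M u ℕ.* (ℓ ℕ.* ((suc N ℕ.+ u) C u))) ℤ.* (y 𝕊.^ suc u) M) ≡ v ℤ.* + (M !)
    power-sum N ℓ v 0<M eq = ℤP.*-cancelˡ-≡ (+ suc N) _ (v ℤ.* + (M !)) (begin
      + suc N ℤ.* ∑ℤ M (λ u → sgn u ℤ.* + (E! M u ℕ.* (ℓ ℕ.* ((suc N ℕ.+ u) C u))) ℤ.* (y 𝕊.^ suc u) M)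
        ≡⟨ ∑ℤ.*-∑ M (+ suc N) (λ u → sgn u ℤ.* + (E! M u ℕ.* (ℓ ℕ.* ((suc N ℕ.+ u) C u))) ℤ.* (y 𝕊.^ suc u) M) ⟩
      ∑ℤ M (λ u → + suc N ℤ.* (sgn u ℤ.* + (E! M u ℕ.* (ℓ ℕ.* ((suc N ℕ.+ u) C u))) ℤ.* (y 𝕊.^ suc u) M))
        ≡⟨ ∑ℤ.∑-cong M (λ u u<M → regroup (sgn u) ((y 𝕊.^ suc u) M) (suc N) (E! M u) ((suc N ℕ.+ u) C u) (suc u) ((N ℕ.+ suc u) C suc u) (C-absorb N u) (E!-suc M u u<M)) ⟩
      ∑ℤ M (λ u → ℤ.- (+ ℓ ℤ.* + (M !)) ℤ.* (negBinom (suc N) (suc u) ℤ.* (y 𝕊.^ suc u) M))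
        ≡⟨ ∑ℤ.*-∑ M (ℤ.- (+ ℓ ℤ.* + (M !))) (λ u → negBinom (suc N) (suc u) ℤ.* (y 𝕊.^ suc u) M) ⟨
      ℤ.- (+ ℓ ℤ.* + (M !)) ℤ.* ∑ℤ M (λ u → negBinom (suc N) (suc u) ℤ.* (y 𝕊.^ suc u) M)
        ≡⟨ ≡.cong (ℤ.- (+ ℓ ℤ.* + (M !)) ℤ.*_) (≡.trans (inverse-power (suc N)) (without-constant M 0<M (negBinom (suc N)))) ⟨
      ℤ.- (+ ℓ ℤ.* + (M !)) ℤ.* (g 𝕊.^ suc N) M
        ≡⟨ solve 3 (λ l d p → :- (l :* d) :* p := :- (l :* p) :* d) ≡.refl (+ ℓ) (+ (M !)) ((g 𝕊.^ suc N) M) ⟩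
      ℤ.- (+ ℓ ℤ.* (g 𝕊.^ suc N) M) ℤ.* + (M !)
        ≡⟨ ≡.cong (ℤ._* + (M !)) eq ⟨
      + suc N ℤ.* v ℤ.* + (M !)
        ≡⟨ ℤP.*-assoc (+ suc N) v (+ (M !)) ⟩
      + suc N ℤ.* (v ℤ.* + (M !)) ∎)
      where
      open ≡.≡-Reasoning
      open ℤ-solver using (solve; _:=_; _:*_; :-_; con)
      without-constant : ∀ M → 0 < M → (b : ℕ → ℤ) → ∑ℤ (suc M) (λ s → b s ℤ.* (y 𝕊.^ s) M) ≡ ∑ℤ M (λ u → b (suc u) ℤ.* (y 𝕊.^ suc u) M)
      without-constant (suc M) _ b = ≡.trans (∑ℤ.∑-head (suc M) (λ s → b s ℤ.* (y 𝕊.^ s) (suc M))) (≡.trans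
        (≡.cong (ℤ._+ ∑ℤ (suc M) (λ u → b (suc u) ℤ.* (y 𝕊.^ suc u) (suc M))) (ℤP.*-zeroʳ (b 0))) (ℤP.+-identityˡ (∑ℤ (suc M) (λ u → b (suc u) ℤ.* (y 𝕊.^ suc u) (suc M)))))
      regroup : ∀ σ p n e c₁ s c₂ → n ℕ.* c₁ ≡ s ℕ.* c₂ → e ℕ.* s ≡ M ! →
        + n ℤ.* (σ ℤ.* + (e ℕ.* (ℓ ℕ.* c₁)) ℤ.* p) ≡ ℤ.- (+ ℓ ℤ.* + (M !)) ℤ.* (ℤ.-1ℤ ℤ.* σ ℤ.* + c₂ ℤ.* p)
      regroup σ p n e c₁ s c₂ eq₁ eq₂ = ≡.trans (solve 4 (λ n σ k p → n :* (σ :* k :* p) := σ :* p :* (n :* k)) ≡.refl (+ n) σ (+ (e ℕ.* (ℓ ℕ.* c₁))) p)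
        (≡.trans (≡.cong (σ ℤ.* p ℤ.*_) (≡.trans (≡.sym (ℤP.pos-* n (e ℕ.* (ℓ ℕ.* c₁)))) (≡.trans (≡.cong +_ naturals) (≡.trans (ℤP.pos-* (ℓ ℕ.* M !) c₂) (≡.cong (ℤ._* + c₂) (ℤP.pos-* ℓ (M !)))))))
          (solve 5 (λ σ p l d c → σ :* p :* (l :* d :* c) := :- (l :* d) :* (con ℤ.-1ℤ :* σ :* c :* p)) ≡.refl σ p (+ ℓ) (+ (M !)) (+ c₂)))
        where
        naturals : n ℕ.* (e ℕ.* (ℓ ℕ.* c₁)) ≡ ℓ ℕ.* M ! ℕ.* c₂
        naturals = ≡.trans (first n e ℓ c₁) (≡.trans (≡.cong (ℓ ℕ.* e ℕ.*_) eq₁) (≡.trans (second ℓ e s c₂) (≡.cong (λ d → ℓ ℕ.* d ℕ.* c₂) eq₂)))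
          where
          first : ∀ n e l c → n ℕ.* (e ℕ.* (l ℕ.* c)) ≡ l ℕ.* e ℕ.* (n ℕ.* c)
          first = ℕ-solver.solve 4 (λ n e l c → n ℕ-solver.:* (e ℕ-solver.:* (l ℕ-solver.:* c)) ℕ-solver.:= l ℕ-solver.:* e ℕ-solver.:* (n ℕ-solver.:* c)) ≡.refl
          second : ∀ l e s c → l ℕ.* e ℕ.* (s ℕ.* c) ≡ l ℕ.* (e ℕ.* s) ℕ.* c
          second = ℕ-solver.solve 4 (λ l e s c → l ℕ-solver.:* e ℕ-solver.:* (s ℕ-solver.:* c) ℕ-solver.:= l ℕ-solver.:* (e ℕ-solver.:* s) ℕ-solver.:* c) ≡.refl

    -- The coefficient of y^u θy is M/(u + 1) times that of y^(u+1) in degree M. With `E!` in place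
    -- of 1/(u + 1), the sum becomes the logarithmic derivative of f times M!.
    logarithm-sum : ∑ℤ M (λ u → sgn u ℤ.* + (E! M u ℕ.* M) ℤ.* (y 𝕊.^ suc u) M) ≡ (θ f ⊠ g) M ℤ.* + (M !)
    logarithm-sum = begin
      ∑ℤ M (λ u → sgn u ℤ.* + (E! M u ℕ.* M) ℤ.* (y 𝕊.^ suc u) M)
        ≡⟨ ∑ℤ.∑-cong M (λ u u<M → regroup (sgn u) ((y 𝕊.^ suc u) M) ((y 𝕊.^ u ⊠ θ y) M) (E! M u) (suc u) (E!-suc M u u<M) (θ-power u)) ⟩
      ∑ℤ M (λ u → (sgn u ℤ.* (y 𝕊.^ u ⊠ θ y) M) ℤ.* + (M !))
        ≡⟨ ∑ℤ.∑-* M (+ (M !)) (λ u → sgn u ℤ.* (y 𝕊.^ u ⊠ θ y) M) ⟨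
      ∑ℤ M (λ u → sgn u ℤ.* (y 𝕊.^ u ⊠ θ y) M) ℤ.* + (M !)
        ≡⟨ ≡.cong (ℤ._* + (M !)) (≡.trans (≡.sym logarithmic-derivative) (at (𝕊.*-congʳ θy) M)) ⟩
      (θ f ⊠ g) M ℤ.* + (M !) ∎
      where
      open ≡.≡-Reasoning
      open ℤ-solver using (solve; _:=_; _:*_)
      regroup : ∀ σ p l e s → e ℕ.* s ≡ M ! → + s ℤ.* l ≡ + M ℤ.* p → σ ℤ.* + (e ℕ.* M) ℤ.* p ≡ σ ℤ.* l ℤ.* + (M !)
      regroup σ p l e s eq₁ eq₂ = begin
        σ ℤ.* + (e ℕ.* M) ℤ.* p         ≡⟨ ≡.cong (λ z → σ ℤ.* z ℤ.* p) (ℤP.pos-* e M) ⟩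
        σ ℤ.* (+ e ℤ.* + M) ℤ.* p       ≡⟨ solve 4 (λ σ e m p → σ :* (e :* m) :* p := σ :* e :* (m :* p)) ≡.refl σ (+ e) (+ M) p ⟩
        σ ℤ.* + e ℤ.* (+ M ℤ.* p)       ≡⟨ ≡.cong (σ ℤ.* + e ℤ.*_) eq₂ ⟨
        σ ℤ.* + e ℤ.* (+ s ℤ.* l)       ≡⟨ solve 4 (λ σ e s l → σ :* e :* (s :* l) := σ :* l :* (e :* s)) ≡.refl σ (+ e) (+ s) l ⟩
        σ ℤ.* l ℤ.* (+ e ℤ.* + s)       ≡⟨ ≡.cong (σ ℤ.* l ℤ.*_) (≡.trans (≡.sym (ℤP.pos-* e s)) (≡.cong +_ eq₁)) ⟩
        σ ℤ.* l ℤ.* + (M !)             ∎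

-- The formulas for the coefficients of row ℓ.

module Coefficients (ℓ′ : ℕ) (2≤ℓ′ : 2 ≤ ℓ′) (a : ℕ → ℕ → ℤ) (modular : IsModularPolynomial (suc ℓ′) a) where
  open ModularEquation ℓ′ 2≤ℓ′ a modular
  open Lagrange ℓ′ 2≤ℓ′ a modular
  open Unipotent h h⁻¹ Jq-0 h⁻¹⊠h

  row-coefficient : ∀ m → 0 < m → m < ℓ → a ℓ (ℓ ∸ m) ℚ./ 1 ≡
    sumℚ (𝒫 m) (λ τ → (sgn (uOf τ) ℤ.* + (uOf τ ! ℕ.* ℓ ℕ.* ((ℓ ∸ m ℕ.+ uOf τ) C uOf τ)) ℤ.* cProd τ) /tFact τ)
  row-coefficient m 0<m m<ℓ = at-gap (ℓ ∸ m) (ℕP.m<n⇒0<n∸m m<ℓ) (ℕP.m∸n≤m ℓ m) (ℕP.m∸[m∸n]≡n (ℕP.<⇒≤ m<ℓ))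
    where
    at-gap : ∀ N → 0 < N → N ≤ ℓ → ℓ ∸ N ≡ m → a ℓ N ℚ./ 1 ≡
      sumℚ (𝒫 m) (λ τ → (sgn (uOf τ) ℤ.* + (uOf τ ! ℕ.* ℓ ℕ.* ((N ℕ.+ uOf τ) C uOf τ)) ℤ.* cProd τ) /tFact τ)
    at-gap (suc N) 0<N N≤ℓ gap = TupleSum.tuple-sum m 0<m (λ u → ℓ ℕ.* ((suc N ℕ.+ u) C u)) y y-0 y-suc
      (λ u → u ! ℕ.* ℓ ℕ.* ((suc N ℕ.+ u) C u)) (λ u → ℕP.*-assoc (u !) ℓ ((suc N ℕ.+ u) C u)) (a ℓ (suc N))
      (power-sum m N ℓ (a ℓ (suc N)) 0<m (≡.trans (a-coefficient (suc N) 0<N N≤ℓ) (≡.cong (λ i → ℤ.- (+ ℓ ℤ.* (h⁻¹ 𝕊.^ suc N) i)) gap)))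

  constant-coefficient : a ℓ 0 ℚ./ 1 ≡ (ℤ.- (+ suc ℓ ℤ.* c′ 1)) ℚ./ 1 ℚ.+
    sumℚ (𝒫 ℓ) (λ τ → (sgn (uOf τ) ℤ.* + (uOf τ ! ℕ.* ℓ) ℤ.* cProd τ) /tFact τ)
  constant-coefficient = ≡.trans (≡.cong (ℚ._/ 1) (≡.trans a-ℓ0 (collect (c′ 1) A (+ ℓ) (log′ ℓ) c′1 (NearCorner.near-corner ℓ′ 2≤ℓ′ a modular))))
    (≡.trans (≡.sym (/-+ (ℤ.- (+ suc ℓ ℤ.* c′ 1)) (log′ ℓ) 1)) (≡.cong ((ℤ.- (+ suc ℓ ℤ.* c′ 1)) ℚ./ 1 ℚ.+_)
      (TupleSum.tuple-sum ℓ (s≤s z≤n) (λ _ → ℓ) y y-0 y-suc (λ u → u ! ℕ.* ℓ) (λ _ → ≡.refl) (log′ ℓ) (logarithm-sum ℓ))))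
    where
    open ℤ-solver using (solve; _:=_; _:+_; _:*_; _:-_; :-_; con)
    c′1 : c′ 1 ≡ + 744
    c′1 = ≡.refl
    -- Because c₀ = 744, the value A = 744ℓ is ℓ c₀, and -c₀ - A becomes -(ℓ + 1)c₀.
    collect : ∀ c A l v → c ≡ + 744 → A ≡ + 744 ℤ.* l → ℤ.- c ℤ.- A ℤ.+ v ≡ ℤ.- ((+ 1 ℤ.+ l) ℤ.* c) ℤ.+ v
    collect c A l v ≡.refl ≡.refl = solve 2 (λ l v → :- con (+ 744) :- con (+ 744) :* l :+ v := :- ((con (+ 1) :+ l) :* con (+ 744)) :+ v) ≡.refl l v

theorem1p1 : (ℓ : ℕ) → Prime ℓ → 3 ≤ ℓ → (a : ℕ → ℕ → ℤ) → IsModularPolynomial ℓ a →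
    ((m : ℕ) → 0 < m → m < ℓ →
    a ℓ (ℓ ∸ m) ℚ./ 1 ≡
    sumℚ (𝒫 m) (λ τ → (sgn (uOf τ) ℤ.* + (uOf τ ! ℕ.* ℓ ℕ.* ((ℓ ∸ m ℕ.+ uOf τ) C uOf τ)) ℤ.* cProd τ) /tFact τ))
    × (a ℓ 0 ℚ./ 1 ≡
    (ℤ.- (+ suc ℓ ℤ.* c′ 1)) ℚ./ 1 ℚ.+
    sumℚ (𝒫 ℓ) (λ τ → (sgn (uOf τ) ℤ.* + (uOf τ ! ℕ.* ℓ) ℤ.* cProd τ) /tFact τ))
    × ((m : ℕ) → 0 < m → m ≤ ℓ → (τ : Tuple) → τ ∈ 𝒫 m →
    ∃ λ (z : ℤ) → (+ (uOf τ ! ℕ.* ℓ ℕ.* ((ℓ ∸ m ℕ.+ uOf τ) C uOf τ))) /tFact τ ≡ z ℚ./ 1)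
theorem1p1 (suc ℓ′) _ (s≤s 2≤ℓ′) a modular = row-coefficient , constant-coefficient , integrality (suc ℓ′)
  where open Coefficients ℓ′ 2≤ℓ′ a modular
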